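{- There is an algorithm which, given a CNF formula $\phi:\mathbb{B}^n\to\mathbb{B}$ with $n$ variables and $m$ clauses, computes the number of satisfying assignments $$\#(\phi)=\#\{\vec x\in\mathbb{B}^n \mid \phi(\vec x)=1\}$$ in time $O^*(1.2377^{\,n+m_{\geq 3}})$, where $m_{\geq 3}$ is the number of clauses of $\phi$ of width at least three. In particular, for clause density $\delta=m/n<2.2503$ this running time is $O^*(c^n)$ for some $c<2$, independently of the maximal clause width $k$.
   Context: A CNF formula is $\phi(x_1,\dots,x_n)=\bigwedge_{i=1}^m (c_{i1}\lor\cdots\lor c_{ik_i})$, where each literal $c_{ij}$ is $x_l$ or $\lnot x_l$ for some $l$; the width of the $i$-th clause is $k_i$, the maximal clause width is $k=\max_i k_i$, and the clause density is $\delta=m/n$. The notation $O^*(\cdot)$ suppresses factors polynomial in the input size. -}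

module Defs where

import Algebra.Definitions.RawSemiring
open import Data.Bool using (Bool; true; false; not)
open import Data.Bool.ListAction using (any; all)
open import Data.Digit using (Bit; fromDigits)
open import Data.Fin using (Fin; zero; suc; toℕ)
open import Data.Integer using (+_)
open import Data.List using (List; []; _∷_; _++_; map; length; filter; filterᵇ)
open import Data.Nat using (ℕ; zero; suc; _+_; _*_; _^_; _≤?_; NonZero)
open import Data.Product using (∃; Σ-syntax; ∃-syntax; _×_; _,_)
open import Data.Rational as ℚ using (ℚ; _/_)
open import Data.Vec using (Vec; []; _∷_; lookup)
open import Relation.Binary.PropositionalEquality using (_≡_)
open import Relation.Unary using (Pred)
open import Level using (0ℓ)

module ℚExp = Algebra.Definitions.RawSemiring ℚ.+-*-rawSemiring

data Literal (n : ℕ) : Set where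
  pos neg : Fin n → Literal n

Clause : ℕ → Set
Clause n = List (Literal n)

CNF : ℕ → Set
CNF n = List (Clause n)

width : ∀ {n} → Clause n → ℕ
width = length

#clauses : ∀ {n} → CNF n → ℕ
#clauses = length

#clauses≥3 : ∀ {n} → CNF n → ℕ
#clauses≥3 φ = length (filter (λ c → 3 ≤? width c) φ)

density : ∀ {n} → .{{NonZero n}} → CNF n → ℚ
density {n} φ = + #clauses φ / n

evalLiteral : ∀ {n} → Literal n → Vec Bool n → Bool
evalLiteral (pos i) x = lookup x i
evalLiteral (neg i) x = not (lookup x i)

evalClause : ∀ {n} → Clause n → Vec Bool n → Bool
evalClause c x = any (λ l → evalLiteral l x) c

⟦_⟧ : ∀ {n} → CNF n → Vec Bool n → Bool
⟦ φ ⟧ x = all (λ c → evalClause c x) φ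

-- Every element of 𝔹ⁿ occurs exactly once.
assignments : ∀ n → List (Vec Bool n)
assignments zero    = [] ∷ []
assignments (suc n) = map (false ∷_) (assignments n) ++ map (true ∷_) (assignments n)

#sat : ∀ {n} → CNF n → ℕ
#sat {n} φ = length (filterᵇ ⟦ φ ⟧ (assignments n))

-- The machine model is a first-order, call-by-value functional language
-- over binary trees, where every evaluation step costs one time unit.
-- This is in essence the language F of N. D. Jones, "Computability and
-- Complexity from a Programming Perspective".  Trees are only built and
-- taken apart one node at a time (never copied or compared as a whole), so
-- with trees as pointers into a shared heap each step takes constant time
-- on a pointer machine or unit-cost RAM; conversely, t steps of a RAM with
-- logarithmic-size words are simulated in time t·polylog(t) by keeping its
-- memory in a balanced tree.  For single-exponential t these overheads are
-- polynomial in the input size, hence absorbed by O*.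

infixr 5 _∙_
data Tree : Set where
  nil : Tree
  _∙_ : Tree → Tree → Tree

treeSize : Tree → ℕ
treeSize nil     = 1
treeSize (a ∙ b) = suc (treeSize a + treeSize b)

-- Expr f v: expressions over f unary functions and v variables (de Bruijn
-- indices, the most recently bound variable being zero).
data Expr (f : ℕ) : ℕ → Set where
  var   : ∀ {v} → Fin v → Expr f v
  nil   : ∀ {v} → Expr f v
  _∙_   : ∀ {v} → Expr f v → Expr f v → Expr f v
  -- case e e₁ e₂: continue with e₁ if e is nil, and with e₂ if e is a ∙ b,
  -- where variable zero is bound to a and variable one to b.
  case  : ∀ {v} → Expr f v → Expr f v → Expr f (suc (suc v)) → Expr f v
  let′  : ∀ {v} → Expr f v → Expr f (suc v) → Expr f v
  call  : ∀ {v} → Fin f → Expr f v → Expr f v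

-- Functions may be mutually recursive; main has the input as its only
-- free variable.
record Program : Set where
  field
    #funs  : ℕ
    bodies : Vec (Expr #funs 1) #funs
    main   : Expr #funs 1

-- fs , ρ ⊢ e ⇓ a [ t ]: under function bodies fs and environment ρ, e
-- evaluates to a in time t.
data _,_⊢_⇓_[_] {f} (fs : Vec (Expr f 1) f) :
     ∀ {v} → Vec Tree v → Expr f v → Tree → ℕ → Set where

  ⇓var : ∀ {v} {ρ : Vec Tree v} {i} →
         fs , ρ ⊢ var i ⇓ lookup ρ i [ 1 ]

  ⇓nil : ∀ {v} {ρ : Vec Tree v} →
         fs , ρ ⊢ nil ⇓ nil [ 1 ]

  ⇓∙ : ∀ {v} {ρ : Vec Tree v} {e₁ e₂ a b s t} →
       fs , ρ ⊢ e₁ ⇓ a [ s ] →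
       fs , ρ ⊢ e₂ ⇓ b [ t ] →
       fs , ρ ⊢ e₁ ∙ e₂ ⇓ a ∙ b [ suc (s + t) ]

  ⇓case-nil : ∀ {v} {ρ : Vec Tree v} {e e₁ e₂ r s t} →
              fs , ρ ⊢ e ⇓ nil [ s ] →
              fs , ρ ⊢ e₁ ⇓ r [ t ] →
              fs , ρ ⊢ case e e₁ e₂ ⇓ r [ suc (s + t) ]

  ⇓case-∙ : ∀ {v} {ρ : Vec Tree v} {e e₁ e₂ a b r s t} →
            fs , ρ ⊢ e ⇓ a ∙ b [ s ] →
            fs , a ∷ b ∷ ρ ⊢ e₂ ⇓ r [ t ] →
            fs , ρ ⊢ case e e₁ e₂ ⇓ r [ suc (s + t) ]

  ⇓let : ∀ {v} {ρ : Vec Tree v} {e₁ e₂ a r s t} →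
         fs , ρ ⊢ e₁ ⇓ a [ s ] →
         fs , a ∷ ρ ⊢ e₂ ⇓ r [ t ] →
         fs , ρ ⊢ let′ e₁ e₂ ⇓ r [ suc (s + t) ]

  ⇓call : ∀ {v} {ρ : Vec Tree v} {g e a r s t} →
          fs , ρ ⊢ e ⇓ a [ s ] →
          fs , a ∷ [] ⊢ lookup fs g ⇓ r [ t ] →
          fs , ρ ⊢ call g e ⇓ r [ suc (s + t) ]

Runs : Program → (input output : Tree) (time : ℕ) → Set
Runs p input output time = bodies , input ∷ [] ⊢ main ⇓ output [ time ]
  where open Program p

encodeList : ∀ {A : Set} → (A → Tree) → List A → Tree
encodeList enc []       = nil
encodeList enc (a ∷ as) = enc a ∙ encodeList enc as

encodeUnary : ℕ → Tree
encodeUnary zero    = nil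
encodeUnary (suc n) = nil ∙ encodeUnary n

encodeLiteral : ∀ {n} → Literal n → Tree
encodeLiteral (pos i) = nil ∙ encodeUnary (toℕ i)
encodeLiteral (neg i) = (nil ∙ nil) ∙ encodeUnary (toℕ i)

encodeCNF : ∀ {n} → CNF n → Tree
encodeCNF {n} φ = encodeUnary n ∙ encodeList (encodeList encodeLiteral) φ

encodeBit : Bit → Tree
encodeBit zero       = nil
encodeBit (suc zero) = nil ∙ nil

-- The tree is a binary numeral for k, least significant bit first.
IsBinary : Tree → ℕ → Set
IsBinary a k = Σ[ bs ∈ List Bit ] (fromDigits bs ≡ k × a ≡ encodeList encodeBit bs)

Instance : Set
Instance = ∃ CNF

inputSize : Instance → ℕ
inputSize (_ , φ) = treeSize (encodeCNF φ)

Computes#SATInTime : Program → (Instance → ℕ) → Set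
Computes#SATInTime p T =
  ∀ {n} (φ : CNF n) →
  ∃[ out ] (Runs p (encodeCNF φ) out (T (n , φ)) × IsBinary out (#sat φ))

fromℕ : ℕ → ℚ
fromℕ k = + k / 1

-- T = O*(g) on the instances in P.  Monomials suffice as polynomials, since
-- input sizes are positive.
O*-on : Pred Instance 0ℓ → (Instance → ℕ) → (Instance → ℚ) → Set
O*-on P T g =
  ∃[ C ] ∃[ d ] (∀ I → P I → fromℕ (T I) ℚ.≤ fromℕ (C * inputSize I ^ d) ℚ.* g I)

-- δ = m/n is only defined for n ≠ 0.
DensityBelow : ℚ → Pred Instance 0ℓ
DensityBelow q (n , φ) = Σ[ n≢0 ∈ NonZero n ] (density {{n≢0}} φ ℚ.< q)

{-# OPTIONS --safe #-}

-- A clause of width at least three is replaced by a new vertex y of weights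
-- 1 and -1 such that y = 1 excludes all its literals: summing over y gives
-- 1 - 1 = 0 if the clause is false, and 1 if it is true.  So #(φ) is the
-- partition function of a binary constraint network with n + m≥3 vertices
-- (up to a constant), computed modulo 2 ^ N for an N > n.  Vertex sets with
-- at most two neighbours are summed out in polynomial time.  Otherwise the
-- algorithm branches on a vertex (the neighbours forced by a constraint with a
-- zero entry vanish as well), or on one or two vertices that separate a small
-- set, which is then summed out.  Progress is
-- measured by the minimum of ten functionals that weigh a vertex by its degree
-- and its soft edges (without zero entries); a finite case distinction over
-- local types shows that some step decreases the minimal one sufficiently.
module Submission where

open import Defs
open import Data.Bool using (T; Bool; true; false; not; _∧_; _∨_; if_then_else_)
import Data.Bool.ListAction as ListB
open import Data.Bool.Properties using (T?; T-≡; ∨-identityʳ; ∨-assoc)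
open import Data.Digit using (Bit; fromDigits)
open import Data.Empty using (⊥; ⊥-elim)
open import Data.Fin using (Fin; zero; suc; toℕ; fromℕ<; inject≤; _↑ˡ_; _↑ʳ_)
open import Data.Fin.Properties using (toℕ-injective; toℕ<n; toℕ-inject≤; toℕ-fromℕ<) renaming (_≟_ to _≟ᶠ_)
import Data.Integer as ℤ
import Data.Integer.Properties as ℤ
open import Data.List using (List; []; _∷_; length; map; foldl; filterᵇ; _++_)
open import Data.List.Membership.Propositional using (_∈_)
open import Data.List.Properties using (length-map; length-++; length-filter)
open import Data.List.Relation.Unary.All as All using (All; []; _∷_)
open import Data.List.Relation.Unary.Any using (here; there)
open import Data.Nat
open import Data.Nat.Binary as Bin using (ℕᵇ; 2[1+_]; 1+[2_])
open import Data.Nat.Binary.Properties using (toℕ-fromℕ)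
open import Data.Nat.DivMod using (%-distribˡ-+; %-distribˡ-*; [m+kn]%n≡m%n; m<n⇒m%n≡m; m≡m%n+[m/n]*n; m%n<n)
open import Data.Nat.Properties
open import Algebra.Properties.CommutativeMonoid.Sum *-1-commutativeMonoid using () renaming (sum to prod; sum-cong-≗ to prod-cong; ∑-distrib-+ to prod-distrib)
open import Algebra.Properties.Semiring.Sum +-*-semiring using (sum; sum-cong-≗; ∑-distrib-+; ∑-comm; *-distribˡ-sum; *-distribʳ-sum)
open import Data.Nat.Tactic.RingSolver using (solve-∀)
open import Data.Product hiding (map)
open import Data.Rational as ℚ using (ℚ)
import Data.Rational.Properties as ℚ
open import Data.Rational.Unnormalised as ℚᵘ using (mkℚᵘ)
import Data.Rational.Unnormalised.Properties as ℚᵘ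
open import Data.Sum using (_⊎_; inj₁; inj₂)
open import Data.Unit using (⊤; tt)
open import Data.Vec as Vec using (Vec; []; _∷_; lookup)
open import Data.Vec.Properties using (lookup-++ˡ; lookup-++ʳ)
open import Function using (_∘_; id)
open import Function.Bundles using (Equivalence)
open import Relation.Binary.PropositionalEquality hiding ([_])
open import Relation.Nullary
open import Relation.Unary using (U)

-- Finite sums and counting

-- The program never performs the case distinction: it tries every candidate step, computes the
-- measures of the children, and takes a step whose decrease suffices. The local types only prove
-- that such a step exists, so bounds for the children are enough, valid whatever numbers the tables
-- contain. One functional would have to be good at every local type at once. With several, each is
-- responsible for a few types: if the minimal functional has no good step, then all vertices of the
-- maximum degree have many soft edges, where the next functional is no larger; hence that one is
-- minimal too, and the argument moves on to it. The last one always has a good step. Soft edges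
-- arise only by summing out, since every edge in the network of a formula has a zero entry. So the
-- initial measure is bounded by the first functional without its soft part, which is 2 * 3076 per
-- vertex. A decrease of 20000 stands for a factor 2, and 2 to the power 0.3076 lies just below
-- 1.2377.

[_] : Bool → ℕ
[ true ] = 1
[ false ] = 0

[]≤1 : ∀ b → [ b ] ≤ 1
[]≤1 true = ≤-refl
[]≤1 false = z≤n

sum-mono : ∀ {n} {f g : Fin n → ℕ} → (∀ i → f i ≤ g i) → sum f ≤ sum g
sum-mono {zero} p = z≤n
sum-mono {suc n} p = +-mono-≤ (p zero) (sum-mono (p ∘ suc))

sum-zero : ∀ {n} {f : Fin n → ℕ} → (∀ i → f i ≡ 0) → sum f ≡ 0
sum-zero {zero} p = refl
sum-zero {suc n} p = cong₂ _+_ (p zero) (sum-zero (p ∘ suc))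

term≤sum : ∀ {n} (f : Fin n → ℕ) i → f i ≤ sum f
term≤sum f zero = m≤m+n _ _
term≤sum f (suc i) = ≤-trans (term≤sum (f ∘ suc) i) (m≤n+m _ _)

_≡ᶠ_ : ∀ {n} → Fin n → Fin n → Bool
zero ≡ᶠ zero = true
zero ≡ᶠ suc j = false
suc i ≡ᶠ zero = false
suc i ≡ᶠ suc j = i ≡ᶠ j

≡ᶠ-refl : ∀ {n} (i : Fin n) → (i ≡ᶠ i) ≡ true
≡ᶠ-refl zero = refl
≡ᶠ-refl (suc i) = ≡ᶠ-refl i

≡ᶠ⇒≡ : ∀ {n} (i j : Fin n) → (i ≡ᶠ j) ≡ true → i ≡ j
≡ᶠ⇒≡ zero zero _ = refl
≡ᶠ⇒≡ (suc i) (suc j) p = cong suc (≡ᶠ⇒≡ i j p)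

≢⇒≡ᶠ : ∀ {n} {i j : Fin n} → i ≢ j → (i ≡ᶠ j) ≡ false
≢⇒≡ᶠ {i = i} {j} i≢j with i ≡ᶠ j in eq
... | true = contradiction (≡ᶠ⇒≡ i j eq) i≢j
... | false = refl

≡ᶠ⇒≢ : ∀ {n} {i j : Fin n} → (i ≡ᶠ j) ≡ false → i ≢ j
≡ᶠ⇒≢ {i = i} p refl with trans (sym p) (≡ᶠ-refl i)
... | ()

≡ᶠ-sym : ∀ {n} (i j : Fin n) → (i ≡ᶠ j) ≡ (j ≡ᶠ i)
≡ᶠ-sym zero zero = refl
≡ᶠ-sym zero (suc j) = refl
≡ᶠ-sym (suc i) zero = refl
≡ᶠ-sym (suc i) (suc j) = ≡ᶠ-sym i j

sum-pick : ∀ {n} (v : Fin n) (f : Fin n → ℕ) → sum (λ i → [ v ≡ᶠ i ] * f i) ≡ f v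
sum-pick {suc n} zero f = trans (cong₂ _+_ (+-identityʳ (f zero)) (sum-zero {n} (λ _ → refl))) (+-identityʳ _)
sum-pick (suc v) f = sum-pick v (f ∘ suc)

count : ∀ {n} → (Fin n → Bool) → ℕ
count P = sum (λ i → [ P i ])

count-cong : ∀ {n} {P Q : Fin n → Bool} → (∀ i → P i ≡ Q i) → count P ≡ count Q
count-cong p = sum-cong-≗ (λ i → cong [_] (p i))

[]-mono : ∀ {a b} → (a ≡ true → b ≡ true) → [ a ] ≤ [ b ]
[]-mono {false} _ = z≤n
[]-mono {true} h rewrite h refl = ≤-refl

count-mono : ∀ {n} {P Q : Fin n → Bool} → (∀ i → P i ≡ true → Q i ≡ true) → count P ≤ count Q
count-mono p = sum-mono (λ i → []-mono (p i))

count⇒∃ : ∀ {n} (P : Fin n → Bool) → 1 ≤ count P → ∃ λ i → P i ≡ true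
count⇒∃ {suc n} P 1≤ with P zero in eq
... | true = zero , eq
... | false = let (i , p) = count⇒∃ (P ∘ suc) 1≤ in suc i , p

∃⇒count : ∀ {n} (P : Fin n → Bool) {i} → P i ≡ true → 1 ≤ count P
∃⇒count P {i} p = ≤-trans (≤-reflexive (cong [_] (sym p))) (term≤sum (λ j → [ P j ]) i)

count≡0 : ∀ {n} (P : Fin n → Bool) → count P ≡ 0 → ∀ i → P i ≡ false
count≡0 P c i with P i in eq
... | false = refl
... | true = contradiction (≤-trans (∃⇒count P eq) (≤-reflexive c)) λ ()

_∖_ : ∀ {n} → (Fin n → Bool) → Fin n → Fin n → Bool
(P ∖ u) i = P i ∧ not (u ≡ᶠ i)

∖-true : ∀ {n} {P : Fin n → Bool} {u i} → (P ∖ u) i ≡ true → P i ≡ true × u ≢ i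
∖-true {P = P} {u} {i} p with P i | u ≡ᶠ i in eq
... | true | false = refl , ≡ᶠ⇒≢ eq

count-∖ : ∀ {n} {P : Fin n → Bool} {u} → P u ≡ true → count P ≡ suc (count (P ∖ u))
count-∖ {P = P} {u} pu = trans (sum-cong-≗ split)
  (trans (∑-distrib-+ (λ i → [ u ≡ᶠ i ] * 1) (λ i → [ (P ∖ u) i ])) (cong (_+ count (P ∖ u)) (sum-pick u (λ _ → 1))))
  where
  split : ∀ i → [ P i ] ≡ [ u ≡ᶠ i ] * 1 + [ (P ∖ u) i ]
  split i with u ≡ᶠ i in eq
  ... | false with P i
  ... | true = refl
  ... | false = refl
  split i | true rewrite sym (≡ᶠ⇒≡ u i eq) | pu = refl

any : ∀ {n} → (Fin n → Bool) → Bool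
any {zero} P = false
any {suc n} P = P zero ∨ any (P ∘ suc)

any⁺ : ∀ {n} (P : Fin n → Bool) i → P i ≡ true → any P ≡ true
any⁺ P zero p rewrite p = refl
any⁺ P (suc i) p with P zero
... | true = refl
... | false = any⁺ (P ∘ suc) i p

any⁻ : ∀ {n} (P : Fin n → Bool) → any P ≡ true → ∃ λ i → P i ≡ true
any⁻ {suc n} P p with P zero in eq
... | true = zero , eq
... | false = let (i , q) = any⁻ (P ∘ suc) p in suc i , q

∧⁻ : ∀ {a b} → a ∧ b ≡ true → a ≡ true × b ≡ true
∧⁻ {true} {true} _ = refl , refl

∧⁺ : ∀ {a b} → a ≡ true → b ≡ true → a ∧ b ≡ true
∧⁺ refl refl = refl

-- Constraint graphs and their measures

-- `kind u v` is seen from `u`: `hard α` means that `u = α` rules out a value of `v`. The argument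
-- of `hard` need not agree at the two ends, so only being an edge and being soft are required to be
-- symmetric. If both values of `u` restrict `v`, `kindOf` records `false`.
data Kind : Set where
  none soft : Kind
  hard : Bool → Kind

isEdge isSoft : Kind → Bool
isEdge none = false
isEdge _ = true
isSoft soft = true
isSoft _ = false

isHard : Bool → Kind → Bool
isHard false (hard false) = true
isHard true (hard true) = true
isHard _ _ = false

record Graph (n : ℕ) : Set where
  field
    kind : Fin n → Fin n → Kind
    irrefl : ∀ v → kind v v ≡ none
    edge-sym : ∀ u v → isEdge (kind u v) ≡ isEdge (kind v u)
    soft-sym : ∀ u v → isSoft (kind u v) ≡ isSoft (kind v u)

  adj : Fin n → Fin n → Bool
  adj u v = isEdge (kind u v)

  deg sdeg : Fin n → ℕ
  deg v = count (adj v)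
  sdeg v = count (λ u → isSoft (kind v u))

  forced : Fin n → Bool → Fin n → Bool
  forced v α u = isHard α (kind v u)

  -- All these vertices leave the graph when `v = α` is chosen, because a forced vertex has at most
  -- one possible value left.
  cluster : Fin n → Bool → Fin n → Bool
  cluster v α u = (v ≡ᶠ u) ∨ forced v α u

  links : (Fin n → Bool) → Fin n → ℕ
  links X y = count (λ x → X x ∧ adj y x)

  exits : (Fin n → Bool) → Fin n → ℕ
  exits X x = count (λ y → not (X y) ∧ adj x y)

  boundary : (Fin n → Bool) → Fin n → Bool
  boundary X y = not (X y) ∧ any (λ x → X x ∧ adj y x)

record Weights : Set where
  constructor weights
  field σ w₃ w₄ w₅ w₆ : ℕ

  w : ℕ → ℕ
  w 0 = 0
  w 1 = 0
  w 2 = σ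
  w 3 = w₃
  w 4 = w₄
  w 5 = w₅
  w _ = w₆

  -- A soft edge is charged `σ` at each end. As `w 2 = σ`, a vertex of degree two is worth at least
  -- the `2 * σ` that a new soft edge between its neighbours may cost, so summing it out does not
  -- increase the measure.
  W : ℕ → ℕ → ℕ
  W d t = 2 * w d + σ * t

  slope : ℕ → ℕ
  slope k = w k ∸ w (pred k)

  Increasing : Set
  Increasing = σ ≤ w₃ × w₃ ≤ w₄ × w₄ ≤ w₅ × w₅ ≤ w₆

  module _ (inc : Increasing) where
    w-step : ∀ d → w d ≤ w (suc d)
    w-step 0 = z≤n
    w-step 1 = z≤n
    w-step 2 = proj₁ inc
    w-step 3 = proj₁ (proj₂ inc)
    w-step 4 = proj₁ (proj₂ (proj₂ inc))
    w-step 5 = proj₂ (proj₂ (proj₂ inc))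
    w-step (suc (suc (suc (suc (suc (suc d)))))) = ≤-refl

    w-mono′ : ∀ {d e} → d ≤′ e → w d ≤ w e
    w-mono′ ≤′-refl = ≤-refl
    w-mono′ {e = suc e} (≤′-step d≤e) = ≤-trans (w-mono′ d≤e) (w-step e)

    w-mono : ∀ {d e} → d ≤ e → w d ≤ w e
    w-mono = w-mono′ ∘ ≤⇒≤′

    W-mono : ∀ {d e t u} → d ≤ e → t ≤ u → W d t ≤ W e u
    W-mono d≤e t≤u = +-mono-≤ (*-monoʳ-≤ 2 (w-mono d≤e)) (*-monoʳ-≤ σ t≤u)

    slope-loss : ∀ {d d′} → suc d′ ≤ d → w d′ + slope d ≤ w d
    slope-loss {suc d} (s≤s d′≤d) = ≤-trans (+-monoˡ-≤ (slope (suc d)) (w-mono d′≤d)) (≤-reflexive (m+[n∸m]≡n (w-step d)))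

  -- m₁ and m₂ bound the loss of w at the first and the second edge that a
  -- vertex of degree 3 ≤ d ≤ D loses.
  Slopes : (D m₁ m₂ : ℕ) → Set
  Slopes D m₁ m₂ = ∀ d → 3 ≤ d → d ≤ D → (w (d ∸ 1) + m₁ ≤ w d) × (w (d ∸ 2) + m₂ ≤ w (d ∸ 1))

  module _ (inc : Increasing) {D m₁ m₂} (sl : Slopes D m₁ m₂) where
    first-loss : ∀ {d d′} → 3 ≤ d → d ≤ D → d′ + 1 ≤ d → w d′ + m₁ ≤ w d
    first-loss {d} {d′} 3≤ ≤D h = ≤-trans (+-monoˡ-≤ m₁ (w-mono inc (m+n≤o⇒m≤o∸n d′ h))) (proj₁ (sl d 3≤ ≤D))

    -- The loss is split at degree `d ∸ 1`: the step down from `d` is kept exact, only the one below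
    -- it is estimated by `m₂`.
    second-loss : ∀ {d d′} → 3 ≤ d → d ≤ D → d′ + 2 ≤ d → w d′ + (slope d + m₂) ≤ w d
    second-loss {suc (suc (suc d))} {d′} 3≤@(s≤s (s≤s (s≤s _))) ≤D h = begin
      w d′ + (slope e + m₂) ≡⟨ comm (w d′) (slope e) m₂ ⟩
      (w d′ + m₂) + slope e ≤⟨ +-monoˡ-≤ (slope e) (≤-trans (+-monoˡ-≤ m₂ (w-mono inc (m+n≤o⇒m≤o∸n d′ h))) (proj₂ (sl e 3≤ ≤D))) ⟩
      w (e ∸ 1) + slope e ≤⟨ slope-loss inc {e} {e ∸ 1} ≤-refl ⟩
      w e ∎
      where
      open ≤-Reasoning
      e = suc (suc (suc d))
      comm : ∀ a b c → a + (b + c) ≡ (a + c) + b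
      comm = solve-∀

    m₁≤slope : ∀ {d} → 3 ≤ d → d ≤ D → m₁ ≤ slope d
    m₁≤slope {suc (suc (suc d))} 3≤@(s≤s (s≤s (s≤s _))) ≤D = m+n≤o⇒m≤o∸n m₁ (≤-trans (≤-reflexive (+-comm m₁ _)) (proj₁ (sl _ 3≤ ≤D)))

measure : ∀ {n} → Weights → Graph n → ℕ
measure F g = sum (λ v → W (deg v) (sdeg v))
  where
  open Weights F
  open Graph g

-- g′ arises from g by deleting the vertices of X and, in case of
-- elimination, by possibly adding an edge between a and b.
record Deletes {n} (X : Fin n → Bool) (New : Fin n → Fin n → Set) (g g′ : Graph n) : Set where
  private
    module G = Graph g
    module G′ = Graph g′
  field
    edge⁻ : ∀ x y → G′.adj x y ≡ true → (G.adj x y ≡ true × X x ≡ false × X y ≡ false) ⊎ New x y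
    soft⁻ : ∀ x y → isSoft (G′.kind x y) ≡ true → (isSoft (G.kind x y) ≡ true × X x ≡ false × X y ≡ false) ⊎ New x y

Removes : ∀ {n} (X : Fin n → Bool) (g g′ : Graph n) → Set
Removes X = Deletes X (λ _ _ → ⊥)

-- Decrease of the measure by assigning a vertex

isHard⇒isEdge : ∀ α k → isHard α k ≡ true → isEdge k ≡ true
isHard⇒isEdge false (hard false) _ = refl
isHard⇒isEdge true (hard true) _ = refl

isHard-none : ∀ α → isHard α none ≡ false
isHard-none true = refl
isHard-none false = refl

isHard-soft : ∀ α → isHard α soft ≡ false
isHard-soft true = refl
isHard-soft false = refl

hard⇒¬soft : ∀ α k → isHard α k ≡ true → isSoft k ≡ false
hard⇒¬soft true (hard _) _ = refl
hard⇒¬soft false (hard _) _ = refl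

isSoft⇒isEdge : ∀ k → isSoft k ≡ true → isEdge k ≡ true
isSoft⇒isEdge soft _ = refl

-- What a neighbour of degree k loses when its neighbour is set to α.
gain : Weights → Bool → Kind → ℕ → ℕ
gain F α none k = 0
gain F α soft k = 2 * Weights.slope F k + Weights.σ F
gain F α (hard β) k = if isHard α (hard β) then 2 * Weights.w F k else 2 * Weights.slope F k

module _ {n} (g : Graph n) where
  open Graph g

  forced-self : ∀ v α → forced v α v ≡ false
  forced-self v false rewrite irrefl v = refl
  forced-self v true rewrite irrefl v = refl

  cluster-self : ∀ v α → cluster v α v ≡ true
  cluster-self v α rewrite ≡ᶠ-refl v = refl

  links-pos : ∀ X y → 1 ≤ links X y → any (λ x → X x ∧ adj y x) ≡ true
  links-pos X y h with count⇒∃ (λ x → X x ∧ adj y x) h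
  ... | x , p = any⁺ (λ x → X x ∧ adj y x) x p

  links-pos⁻ : ∀ X y → any (λ x → X x ∧ adj y x) ≡ true → 1 ≤ links X y
  links-pos⁻ X y h with any⁻ (λ x → X x ∧ adj y x) h
  ... | x , p = ∃⇒count (λ x → X x ∧ adj y x) {x} p

  module _ {X g′} (rem : Removes X g g′) where
    private module G′ = Graph g′
    open Deletes rem

    edge⁻′ : ∀ x y → G′.adj x y ≡ true → adj x y ≡ true × X x ≡ false × X y ≡ false
    edge⁻′ x y p with edge⁻ x y p
    ... | inj₁ q = q

    soft⁻′ : ∀ x y → isSoft (G′.kind x y) ≡ true → isSoft (kind x y) ≡ true × X x ≡ false × X y ≡ false
    soft⁻′ x y p with soft⁻ x y p
    ... | inj₁ q = q

    removed-deg : ∀ {y} → X y ≡ true → G′.deg y ≡ 0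
    removed-deg {y} Xy = sum-zero λ x → cong [_] (h x)
      where
      h : ∀ x → G′.adj y x ≡ false
      h x with G′.adj y x in eq
      ... | false = refl
      ... | true with trans (sym Xy) (proj₁ (proj₂ (edge⁻′ y x eq)))
      ... | ()

    removed-sdeg : ∀ {y} → X y ≡ true → G′.sdeg y ≡ 0
    removed-sdeg {y} Xy = n≤0⇒n≡0 (≤-trans (count-mono (λ x → isSoft⇒isEdge (G′.kind y x))) (≤-reflexive (removed-deg Xy)))

    kept-deg : ∀ y → G′.deg y + links X y ≤ deg y
    kept-deg y = ≤-trans (≤-reflexive (sym (∑-distrib-+ (λ x → [ G′.adj y x ]) _))) (sum-mono h)
      where
      h : ∀ x → [ G′.adj y x ] + [ X x ∧ adj y x ] ≤ [ adj y x ]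
      h x with G′.adj y x in eq
      ... | true rewrite proj₂ (proj₂ (edge⁻′ y x eq)) | proj₁ (edge⁻′ y x eq) = ≤-refl
      ... | false with X x
      ... | true = ≤-refl
      ... | false = z≤n

    kept-sdeg : ∀ y → G′.sdeg y ≤ sdeg y
    kept-sdeg y = count-mono λ x p → proj₁ (soft⁻′ y x p)

    kept-sdeg-soft : ∀ {v y} → X v ≡ true → isSoft (kind y v) ≡ true → G′.sdeg y + 1 ≤ sdeg y
    kept-sdeg-soft {v} {y} Xv sv = begin
      G′.sdeg y + 1 ≡⟨ cong (G′.sdeg y +_) (sym (sum-pick v (λ _ → 1))) ⟩
      G′.sdeg y + sum (λ x → [ v ≡ᶠ x ] * 1) ≡⟨ ∑-distrib-+ (λ x → [ isSoft (G′.kind y x) ]) _ ⟨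
      sum (λ x → [ isSoft (G′.kind y x) ] + [ v ≡ᶠ x ] * 1) ≤⟨ sum-mono h ⟩
      sdeg y ∎
      where
      open ≤-Reasoning
      h : ∀ x → [ isSoft (G′.kind y x) ] + [ v ≡ᶠ x ] * 1 ≤ [ isSoft (kind y x) ]
      h x with isSoft (G′.kind y x) in eq | v ≡ᶠ x in veq
      ... | false | false = z≤n
      ... | false | true rewrite sym (≡ᶠ⇒≡ v x veq) | sv = ≤-refl
      ... | true | false rewrite proj₁ (soft⁻′ y x eq) = ≤-refl
      ... | true | true with trans (sym Xv) (trans (cong X (≡ᶠ⇒≡ v x veq)) (proj₂ (proj₂ (soft⁻′ y x eq))))
      ... | ()

  module _ (v : Fin n) (α : Bool) where
    -- j y is the number of neighbours of y that v = α forces.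
    j : Fin n → ℕ
    j = links (forced v α)

    -- Both concern vertices outside the cluster. An `outer` one is no neighbour of `v` and loses
    -- edges to forced vertices only; a `twice` one loses at least two edges, one of which may go to
    -- `v`. Self test, kind and number of forced neighbours are arguments, so that proofs can split
    -- on them.
    outerOf twiceOf : Bool → Kind → ℕ → Bool
    outerOf self k i = not self ∧ not (isEdge k) ∧ (1 ≤ᵇ i)
    twiceOf self k i = not self ∧ not (isHard α k) ∧ (if isEdge k then 1 ≤ᵇ i else 2 ≤ᵇ i)

    outer twice : Fin n → Bool
    outer y = outerOf (v ≡ᶠ y) (kind v y) (j y)
    twice y = twiceOf (v ≡ᶠ y) (kind v y) (j y)

    private
      X = cluster v α

    links-cluster : ∀ y → links X y ≡ [ adj y v ] + j y
    links-cluster y = trans (sum-cong-≗ h) (trans (∑-distrib-+ (λ x → [ v ≡ᶠ x ] * [ adj y x ]) _) (cong (_+ j y) (sum-pick v (λ x → [ adj y x ]))))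
      where
      h : ∀ x → [ X x ∧ adj y x ] ≡ [ v ≡ᶠ x ] * [ adj y x ] + [ forced v α x ∧ adj y x ]
      h x with v ≡ᶠ x in eq
      ... | false = refl
      ... | true rewrite sym (≡ᶠ⇒≡ v x eq) | forced-self v α = sym (trans (+-identityʳ _) (+-identityʳ _))

    module _ (F : Weights) where
      open Weights F

      module _ (inc : Increasing) {D m₁ m₂} (sl : Slopes D m₁ m₂)
               (reg : ∀ y → deg y ≡ 0 ⊎ (3 ≤ deg y × deg y ≤ D))
               {g′} (rem : Removes X g g′) where
        private module G′ = Graph g′

        regular : ∀ y → 1 ≤ deg y → 3 ≤ deg y × deg y ≤ D
        regular y 1≤ with reg y
        ... | inj₁ eq = contradiction (≤-trans 1≤ (≤-reflexive eq)) λ ()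
        ... | inj₂ p = p

        private
          loss : ∀ d′ d t′ t L S → w d′ + L ≤ w d → t′ + S ≤ t → W d′ t′ + (2 * L + σ * S) ≤ W d t
          loss d′ d t′ t L S p q = begin
            2 * w d′ + σ * t′ + (2 * L + σ * S) ≡⟨ r (w d′) σ t′ L S ⟩
            2 * (w d′ + L) + σ * (t′ + S) ≤⟨ +-mono-≤ (*-monoʳ-≤ 2 p) (*-monoʳ-≤ σ q) ⟩
            2 * w d + σ * t ∎
            where
            open ≤-Reasoning
            r : ∀ a s t L S → 2 * a + s * t + (2 * L + s * S) ≡ 2 * (a + L) + s * (t + S)
            r = solve-∀

          Reg : ℕ → Set
          Reg d = 1 ≤ d → 3 ≤ d × d ≤ D

          positive : ∀ d′ i {d} → d′ + suc i ≤ d → 1 ≤ d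
          positive d′ i h = ≤-trans (≤-trans (s≤s z≤n) (m≤n+m (suc i) d′)) h

          slope+ : ∀ d d′ i → Reg d → d′ + (1 + i) ≤ d → w d′ + (slope d + m₂ * [ 1 ≤ᵇ i ]) ≤ w d
          slope+ d d′ zero rg h rewrite *-zeroʳ m₂ | +-identityʳ (slope d) =
            slope-loss inc (≤-trans (≤-reflexive (+-comm 1 d′)) h)
          slope+ d d′ (suc i) rg h rewrite *-identityʳ m₂ with rg (positive d′ (suc i) h)
          ... | 3≤ , ≤D = second-loss inc sl 3≤ ≤D (≤-trans (+-monoʳ-≤ d′ (s≤s (s≤s z≤n))) h)

          first+ : ∀ d d′ i → Reg d → d′ + i ≤ d → w d′ + (m₁ * [ 1 ≤ᵇ i ] + m₂ * [ 2 ≤ᵇ i ]) ≤ w d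
          first+ d d′ zero _ h rewrite *-zeroʳ m₁ | *-zeroʳ m₂ | +-identityʳ (w d′) = w-mono inc (m+n≤o⇒m≤o d′ h)
          first+ d d′ (suc zero) rg h rewrite *-zeroʳ m₂ | *-identityʳ m₁ | +-identityʳ m₁ with rg (positive d′ 0 h)
          ... | 3≤ , ≤D = first-loss inc sl 3≤ ≤D h
          first+ d d′ (suc (suc i)) rg h rewrite *-identityʳ m₂ | *-identityʳ m₁ with rg (positive d′ (suc i) h)
          ... | 3≤ , ≤D = ≤-trans (+-monoʳ-≤ (w d′) (+-monoˡ-≤ m₂ (m₁≤slope inc sl 3≤ ≤D)))
                                  (second-loss inc sl 3≤ ≤D (≤-trans (+-monoʳ-≤ d′ (s≤s (s≤s z≤n))) h))

          kept : ∀ y {b} → isEdge (kind v y) ≡ b → G′.deg y + ([ b ] + j y) ≤ deg y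
          kept y {b} e = subst (λ b → G′.deg y + ([ b ] + j y) ≤ deg y) (trans (edge-sym y v) e)
                           (subst (λ i → G′.deg y + i ≤ deg y) (links-cluster y) (kept-deg rem y))

          gone : ∀ y {c} → X y ≡ true → c ≤ W (deg y) (sdeg y) → W (G′.deg y) (G′.sdeg y) + c ≤ W (deg y) (sdeg y)
          gone y Xy h rewrite removed-deg rem Xy | removed-sdeg rem Xy | *-zeroʳ σ = h

          kept-sdeg₀ : ∀ y → G′.sdeg y + 0 ≤ sdeg y
          kept-sdeg₀ y = ≤-trans (≤-reflexive (+-identityʳ _)) (kept-sdeg rem y)

        lossAt : Fin n → ℕ
        lossAt y = [ v ≡ᶠ y ] * W (deg v) (sdeg v) + gain F α (kind v y) (deg y) + 2 * m₁ * [ outer y ] + 2 * m₂ * [ twice y ]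

        -- Every vertex pays for itself. `v` and the forced vertices lose everything, another
        -- neighbour loses one slope (and `σ` along a soft edge), and an edge to a forced vertex is
        -- worth `m₁` as the first and `m₂` as the second edge lost.
        vertex-drop′ : ∀ y s k → (v ≡ᶠ y) ≡ s → kind v y ≡ k →
          W (G′.deg y) (G′.sdeg y)
            + ([ s ] * W (deg v) (sdeg v) + gain F α k (deg y) + 2 * m₁ * [ outerOf s k (j y) ] + 2 * m₂ * [ twiceOf s k (j y) ])
            ≤ W (deg y) (sdeg y)
        vertex-drop′ y true k eq ky with ≡ᶠ⇒≡ v y eq
        ... | refl with trans (sym (irrefl v)) ky
        ... | refl = gone y (cluster-self v α) (≤-reflexive (r (W (deg v) (sdeg v)) m₁ m₂))
          where
          r : ∀ a b c → 1 * a + 0 + 2 * b * 0 + 2 * c * 0 ≡ a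
          r = solve-∀
        vertex-drop′ y false none eq ky rewrite isHard-none α =
          ≤-trans (≤-reflexive (cong (W (G′.deg y) (G′.sdeg y) +_) (r m₁ m₂ [ 1 ≤ᵇ j y ] [ 2 ≤ᵇ j y ] σ)))
            (loss (G′.deg y) (deg y) (G′.sdeg y) (sdeg y) (m₁ * [ 1 ≤ᵇ j y ] + m₂ * [ 2 ≤ᵇ j y ]) 0
              (first+ (deg y) (G′.deg y) (j y) (regular y) (kept y (cong isEdge ky))) (kept-sdeg₀ y))
          where
          r : ∀ a b x z s → 0 + 2 * a * x + 2 * b * z ≡ 2 * (a * x + b * z) + s * 0
          r = solve-∀
        vertex-drop′ y false soft eq ky rewrite isHard-soft α =
          ≤-trans (≤-reflexive (cong (W (G′.deg y) (G′.sdeg y) +_) (r m₁ m₂ (slope (deg y)) [ 1 ≤ᵇ j y ] σ)))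
            (loss (G′.deg y) (deg y) (G′.sdeg y) (sdeg y) (slope (deg y) + m₂ * [ 1 ≤ᵇ j y ]) 1
              (slope+ (deg y) (G′.deg y) (j y) (regular y) (kept y (cong isEdge ky)))
              (kept-sdeg-soft rem (cluster-self v α) (trans (soft-sym y v) (cong isSoft ky))))
          where
          r : ∀ a b x z s → 2 * x + s + 2 * a * 0 + 2 * b * z ≡ 2 * (x + b * z) + s * 1
          r = solve-∀
        vertex-drop′ y false (hard β) eq ky with isHard α (hard β) in h
        ... | true = gone y Xy (≤-trans (≤-reflexive (r (w (deg y)) m₁ m₂)) (m≤m+n _ _))
          where
          Xy : X y ≡ true
          Xy rewrite eq | ky = h
          r : ∀ a b c → 2 * a + 2 * b * 0 + 2 * c * 0 ≡ 2 * a
          r = solve-∀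
        ... | false =
          ≤-trans (≤-reflexive (cong (W (G′.deg y) (G′.sdeg y) +_) (r m₁ m₂ (slope (deg y)) [ 1 ≤ᵇ j y ] σ)))
            (loss (G′.deg y) (deg y) (G′.sdeg y) (sdeg y) (slope (deg y) + m₂ * [ 1 ≤ᵇ j y ]) 0
              (slope+ (deg y) (G′.deg y) (j y) (regular y) (kept y (cong isEdge ky))) (kept-sdeg₀ y))
          where
          r : ∀ a b x z s → 2 * x + 2 * a * 0 + 2 * b * z ≡ 2 * (x + b * z) + s * 0
          r = solve-∀

        total-gain : ℕ
        total-gain = sum (λ y → gain F α (kind v y) (deg y))

        branch-drop : measure F g′ + (W (deg v) (sdeg v) + total-gain + 2 * m₁ * count outer + 2 * m₂ * count twice) ≤ measure F g
        branch-drop = ≤-trans (≤-reflexive (sym sums)) (sum-mono (λ y → vertex-drop′ y _ _ refl refl))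
          where
          open ≡-Reasoning
          μ′ = λ y → W (G′.deg y) (G′.sdeg y)
          sums : sum (λ y → μ′ y + lossAt y) ≡ measure F g′ + (W (deg v) (sdeg v) + total-gain + 2 * m₁ * count outer + 2 * m₂ * count twice)
          sums = begin
            sum (λ y → μ′ y + lossAt y) ≡⟨ ∑-distrib-+ μ′ lossAt ⟩
            measure F g′ + sum lossAt ≡⟨ cong (measure F g′ +_) eq₁ ⟩
            _ ∎
            where
            eq₁ : sum lossAt ≡ W (deg v) (sdeg v) + total-gain + 2 * m₁ * count outer + 2 * m₂ * count twice
            eq₁ = trans (∑-distrib-+ (λ y → [ v ≡ᶠ y ] * W (deg v) (sdeg v) + gain F α (kind v y) (deg y) + 2 * m₁ * [ outer y ]) _)
              (cong₂ _+_ (trans (∑-distrib-+ (λ y → [ v ≡ᶠ y ] * W (deg v) (sdeg v) + gain F α (kind v y) (deg y)) _)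
                (cong₂ _+_ (trans (∑-distrib-+ (λ y → [ v ≡ᶠ y ] * W (deg v) (sdeg v)) _) (cong (_+ total-gain) (sum-pick v (λ _ → W (deg v) (sdeg v)))))
                   (sym (*-distribˡ-sum (2 * m₁) (λ y → [ outer y ])))))
                (sym (*-distribˡ-sum (2 * m₂) (λ y → [ twice y ]))))

[∧] : ∀ a b → [ a ∧ b ] ≡ [ a ] * [ b ]
[∧] false b = refl
[∧] true b = sym (+-identityʳ [ b ])

[not] : ∀ b → [ not b ] + [ b ] ≡ 1
[not] true = refl
[not] false = refl

module _ {n} (g : Graph n) (v : Fin n) (α : Bool) where
  open Graph g
  private
    R = forced v α
    X = cluster v α
    r = count R

  exits+links : ∀ X x → exits X x + links X x ≡ deg x
  exits+links X x = trans (sym (∑-distrib-+ (λ y → [ not (X y) ∧ adj x y ]) _)) (sum-cong-≗ h)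
    where
    h : ∀ y → [ not (X y) ∧ adj x y ] + [ X y ∧ adj x y ] ≡ [ adj x y ]
    h y with X y
    ... | true = refl
    ... | false = +-identityʳ _

  -- Double counting of the edges between `P` and the complement of `X`.
  exits-links : ∀ (X P : Fin n → Bool) → sum (λ y → [ not (X y) ] * links P y) ≡ sum (λ x → [ P x ] * exits X x)
  exits-links X P = begin
    sum (λ y → [ not (X y) ] * links P y) ≡⟨ sum-cong-≗ (λ y → *-distribˡ-sum [ not (X y) ] (λ x → [ P x ∧ adj y x ])) ⟩
    sum (λ y → sum (λ x → [ not (X y) ] * [ P x ∧ adj y x ])) ≡⟨ ∑-comm (λ y x → [ not (X y) ] * [ P x ∧ adj y x ]) ⟩
    sum (λ x → sum (λ y → [ not (X y) ] * [ P x ∧ adj y x ])) ≡⟨ sum-cong-≗ (λ x → sum-cong-≗ (λ y → h x y)) ⟩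
    sum (λ x → sum (λ y → [ P x ] * [ not (X y) ∧ adj x y ])) ≡⟨ sum-cong-≗ (λ x → *-distribˡ-sum [ P x ] (λ y → [ not (X y) ∧ adj x y ])) ⟨
    sum (λ x → [ P x ] * exits X x) ∎
    where
    open ≡-Reasoning
    h : ∀ x y → [ not (X y) ] * [ P x ∧ adj y x ] ≡ [ P x ] * [ not (X y) ∧ adj x y ]
    h x y rewrite [∧] (P x) (adj y x) | [∧] (not (X y)) (adj x y) | edge-sym y x = m (P x) [ not (X y) ] [ adj x y ]
      where
      m : ∀ p q a → q * ([ p ] * a) ≡ [ p ] * (q * a)
      m p q a = trans (sym (*-assoc q [ p ] a)) (trans (cong (_* a) (*-comm q [ p ])) (*-assoc [ p ] q a))

  forced⇒adj : ∀ x → R x ≡ true → adj v x ≡ true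
  forced⇒adj x = isHard⇒isEdge α (kind v x)

  forced⇒cluster : ∀ x → R x ≡ true → X x ≡ true
  forced⇒cluster x p rewrite p with v ≡ᶠ x
  ... | true = refl
  ... | false = refl

  cluster-split : ∀ x → [ X x ] ≡ [ v ≡ᶠ x ] * 1 + [ R x ]
  cluster-split x with v ≡ᶠ x in eq
  ... | false = refl
  ... | true rewrite sym (≡ᶠ⇒≡ v x eq) | forced-self g v α = refl

  sum-cluster : ∀ (f : Fin n → ℕ) → sum (λ x → [ X x ] * f x) ≡ f v + sum (λ x → [ R x ] * f x)
  sum-cluster f = trans (sum-cong-≗ h) (trans (∑-distrib-+ (λ x → [ v ≡ᶠ x ] * f x) _) (cong (_+ sum (λ x → [ R x ] * f x)) (sum-pick v f)))
    where
    h : ∀ x → [ X x ] * f x ≡ [ v ≡ᶠ x ] * f x + [ R x ] * f x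
    h x rewrite cluster-split x | *-identityʳ [ v ≡ᶠ x ] = *-distribʳ-+ (f x) [ v ≡ᶠ x ] [ R x ]

  count-cluster : count X ≡ suc r
  count-cluster = trans (sum-cong-≗ (λ x → sym (*-identityʳ [ X x ])))
    (trans (sum-cluster (λ _ → 1)) (cong suc (sum-cong-≗ (λ x → *-identityʳ [ R x ]))))

  -- The boundary consists of the neighbours of `v` that are not forced and of the outer vertices;
  -- `r` is added instead of subtracted.
  boundary-count : count (boundary X) + r ≡ deg v + count (outer g v α)
  boundary-count = trans (sym (∑-distrib-+ (λ y → [ boundary X y ]) _)) (trans (sum-cong-≗ (λ y → h y _ _ refl refl)) (∑-distrib-+ (λ y → [ adj v y ]) _))
    where
    anyX : ∀ y → any (λ x → X x ∧ adj y x) ≡ (1 ≤ᵇ links X y)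
    anyX y with links X y in eq
    ... | zero with any (λ x → X x ∧ adj y x) in e
    ... | false = refl
    ... | true = contradiction (≤-trans (links-pos⁻ g X y e) (≤-reflexive eq)) λ ()
    anyX y | suc k = links-pos g X y (≤-trans (s≤s z≤n) (≤-reflexive (sym eq)))
    h : ∀ y s k → (v ≡ᶠ y) ≡ s → kind v y ≡ k →
        [ not (s ∨ isHard α k) ∧ any (λ x → X x ∧ adj y x) ] + [ isHard α k ] ≡ [ isEdge k ] + [ outerOf g v α s k (j g v α y) ]
    h y s k eq ky rewrite anyX y | links-cluster g v α y | edge-sym y v | ky = c s k eq ky
      where
      c : ∀ s k → (v ≡ᶠ y) ≡ s → kind v y ≡ k →
          [ not (s ∨ isHard α k) ∧ (1 ≤ᵇ [ isEdge k ] + j g v α y) ] + [ isHard α k ] ≡ [ isEdge k ] + [ outerOf g v α s k (j g v α y) ]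
      c true k eq ky with ≡ᶠ⇒≡ v y eq
      ... | refl with trans (sym (irrefl v)) ky
      ... | refl rewrite isHard-none α = refl
      c false none eq ky rewrite isHard-none α = +-identityʳ _
      c false soft eq ky rewrite isHard-soft α = refl
      c false (hard β) eq ky with isHard α (hard β)
      ... | true = refl
      ... | false = refl

  links-in-cluster : ∀ x → X x ≡ true → links X x ≤ r
  links-in-cluster x Xx = ≤-trans (count-mono {Q = X ∖ x} h) (≤-reflexive (suc-injective (trans (sym (count-∖ {P = X} {x} Xx)) count-cluster)))
    where
    h : ∀ y → X y ∧ adj x y ≡ true → (X ∖ x) y ≡ true
    h y p with ∧⁻ {X y} {adj x y} p
    ... | Xy , xy = ∧⁺ Xy (cong not (≢⇒≡ᶠ x≢y))
      where
      x≢y : x ≢ y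
      x≢y refl with trans (sym (cong isEdge (irrefl x))) xy
      ... | ()

  -- If no vertex outside of the cluster loses an edge twice, then the edges
  -- that leave the forced vertices end in pairwise distinct outer vertices.
  exits≤outer : count (twice g v α) ≡ 0 → sum (λ x → [ R x ] * (deg x ∸ r)) ≤ count (outer g v α)
  exits≤outer none₂ = begin
    sum (λ x → [ R x ] * (deg x ∸ r)) ≤⟨ sum-mono exit ⟩
    sum (λ x → [ R x ] * exits X x) ≡⟨ exits-links X R ⟨
    sum (λ y → [ not (X y) ] * links R y) ≤⟨ sum-mono (λ y → once y _ _ refl refl (count≡0 (twice g v α) none₂ y)) ⟩
    count (outer g v α) ∎
    where
    open ≤-Reasoning
    exit : ∀ x → [ R x ] * (deg x ∸ r) ≤ [ R x ] * exits X x
    exit x with R x in eq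
    ... | false = z≤n
    ... | true rewrite +-identityʳ (deg x ∸ r) | +-identityʳ (exits X x) =
      m≤n+o⇒m∸n≤o (deg x) r (≤-trans (≤-reflexive (sym (exits+links X x)))
        (≤-trans (+-monoʳ-≤ (exits X x) (links-in-cluster x (forced⇒cluster x eq))) (≤-reflexive (+-comm (exits X x) r))))
    once : ∀ y s k → (v ≡ᶠ y) ≡ s → kind v y ≡ k → twiceOf g v α s k (links R y) ≡ false →
           [ not (s ∨ isHard α k) ] * links R y ≤ [ outerOf g v α s k (links R y) ]
    once y true k eq ky t = z≤n
    once y false none eq ky t rewrite isHard-none α with links R y
    ... | zero = z≤n
    ... | suc zero = s≤s z≤n
    once y false soft eq ky t rewrite isHard-soft α with links R y
    ... | zero = z≤n
    once y false (hard β) eq ky t with isHard α (hard β) | links R y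
    ... | true | _ = z≤n
    ... | false | zero = z≤n

  -- Double counting of the edges out of the cluster: `v` spends `r` of its edges on forced
  -- vertices, and each forced vertex spends one on `v`.
  boundary-links : sum (λ y → [ boundary X y ] * links X y) + r ≤ deg v + sum (λ x → [ R x ] * (deg x ∸ 1))
  boundary-links = begin
    sum (λ y → [ boundary X y ] * links X y) + r ≤⟨ +-monoˡ-≤ r (sum-mono out) ⟩
    sum (λ y → [ not (X y) ] * links X y) + r ≡⟨ cong (_+ r) (trans (exits-links X X) (sum-cluster (exits X))) ⟩
    exits X v + sum (λ x → [ R x ] * exits X x) + r ≡⟨ comm (exits X v) _ r ⟩
    exits X v + r + sum (λ x → [ R x ] * exits X x) ≤⟨ +-mono-≤ own (sum-mono rest) ⟩
    deg v + sum (λ x → [ R x ] * (deg x ∸ 1)) ∎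
    where
    open ≤-Reasoning
    comm : ∀ a b c → a + b + c ≡ a + c + b
    comm = solve-∀
    out : ∀ y → [ boundary X y ] * links X y ≤ [ not (X y) ] * links X y
    out y = *-monoˡ-≤ (links X y) ([]-mono {boundary X y} {not (X y)} (λ p → proj₁ (∧⁻ {not (X y)} p)))
    own : exits X v + r ≤ deg v
    own = ≤-trans (+-monoʳ-≤ (exits X v) (count-mono (λ x p → ∧⁺ (forced⇒cluster x p) (forced⇒adj x p)))) (≤-reflexive (exits+links X v))
    rest : ∀ x → [ R x ] * exits X x ≤ [ R x ] * (deg x ∸ 1)
    rest x with R x in eq
    ... | false = z≤n
    ... | true rewrite +-identityʳ (deg x ∸ 1) | +-identityʳ (exits X x) =
      m+n≤o⇒m≤o∸n (exits X x) (≤-trans (+-monoʳ-≤ (exits X x) (∃⇒count (λ y → X y ∧ adj x y) {v} (∧⁺ (cluster-self g v α) (trans (edge-sym x v) (forced⇒adj x eq)))))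
        (≤-reflexive (exits+links X x)))

-- Decrease of the measure by eliminating vertices

Joins : ∀ {n} → Fin n → Fin n → Fin n → Fin n → Set
Joins a b x y = (x ≡ a × y ≡ b) ⊎ (x ≡ b × y ≡ a)

-- X is summed out, leaving an edge between a and b.
record Eliminates {n} (X : Fin n → Bool) (a b : Fin n) (g g′ : Graph n) : Set where
  open Graph g
  field
    deletes : Deletes X (Joins a b) g g′
    a∉X : X a ≡ false
    b∉X : X b ≡ false
    attached : a ≡ b ⊎ (1 ≤ links X a × 1 ≤ links X b)

module _ {n} {g g′ : Graph n} {X a b} (el : Eliminates X a b g g′) where
  open Graph g
  open Eliminates el
  open Deletes deletes
  private module G′ = Graph g′

  false≢true : ∀ {b} → b ≡ true → b ≡ false → ⊥
  false≢true refl ()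

  ends : Fin n → ℕ
  ends y = [ a ≡ᶠ y ] + [ b ≡ᶠ y ]

  elim-gone : ∀ {y} → X y ≡ true → G′.deg y ≡ 0
  elim-gone {y} Xy = sum-zero λ x → cong [_] (h x)
    where
    h : ∀ x → G′.adj y x ≡ false
    h x with G′.adj y x in eq
    ... | false = refl
    ... | true with edge⁻ y x eq
    ... | inj₁ (_ , p , _) = ⊥-elim (false≢true Xy p)
    ... | inj₂ (inj₁ (refl , _)) = ⊥-elim (false≢true Xy a∉X)
    ... | inj₂ (inj₂ (refl , _)) = ⊥-elim (false≢true Xy b∉X)

  elim-sgone : ∀ {y} → X y ≡ true → G′.sdeg y ≡ 0
  elim-sgone {y} Xy = n≤0⇒n≡0 (≤-trans (count-mono (λ x → isSoft⇒isEdge (G′.kind y x))) (≤-reflexive (elim-gone Xy)))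

  private
    pick-both : ∀ y → sum (λ x → [ a ≡ᶠ y ] * ([ b ≡ᶠ x ] * 1) + [ b ≡ᶠ y ] * ([ a ≡ᶠ x ] * 1)) ≡ ends y
    pick-both y = trans (∑-distrib-+ (λ x → [ a ≡ᶠ y ] * ([ b ≡ᶠ x ] * 1)) _)
      (cong₂ _+_ (one b [ a ≡ᶠ y ]) (one a [ b ≡ᶠ y ]))
      where
      one : ∀ b c → sum (λ x → c * ([ b ≡ᶠ x ] * 1)) ≡ c
      one b c = trans (sym (*-distribˡ-sum c (λ x → [ b ≡ᶠ x ] * 1))) (trans (cong (c *_) (sum-pick b (λ _ → 1))) (*-identityʳ c))

    joined : ∀ {x y} → Joins a b y x → 1 ≤ [ a ≡ᶠ y ] * ([ b ≡ᶠ x ] * 1) + [ b ≡ᶠ y ] * ([ a ≡ᶠ x ] * 1)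
    joined (inj₁ (refl , refl)) rewrite ≡ᶠ-refl a | ≡ᶠ-refl b = s≤s z≤n
    joined (inj₂ (refl , refl)) rewrite ≡ᶠ-refl a | ≡ᶠ-refl b = m≤n+m 1 _

  -- The new edge costs a and b one degree at most, which the edges into X
  -- pay for.
  elim-links : ∀ y → G′.deg y + links X y ≤ deg y + ends y
  elim-links y = begin
    G′.deg y + links X y ≡⟨ ∑-distrib-+ (λ x → [ G′.adj y x ]) _ ⟨
    sum (λ x → [ G′.adj y x ] + [ X x ∧ adj y x ]) ≤⟨ sum-mono h ⟩
    sum (λ x → [ adj y x ] + ([ a ≡ᶠ y ] * ([ b ≡ᶠ x ] * 1) + [ b ≡ᶠ y ] * ([ a ≡ᶠ x ] * 1))) ≡⟨ ∑-distrib-+ (λ x → [ adj y x ]) _ ⟩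
    deg y + sum (λ x → [ a ≡ᶠ y ] * ([ b ≡ᶠ x ] * 1) + [ b ≡ᶠ y ] * ([ a ≡ᶠ x ] * 1)) ≡⟨ cong (deg y +_) (pick-both y) ⟩
    deg y + ends y ∎
    where
    open ≤-Reasoning
    not∈ : ∀ {x} → Joins a b y x → X x ≡ false
    not∈ (inj₁ (_ , refl)) = b∉X
    not∈ (inj₂ (_ , refl)) = a∉X
    h : ∀ x → [ G′.adj y x ] + [ X x ∧ adj y x ] ≤ [ adj y x ] + ([ a ≡ᶠ y ] * ([ b ≡ᶠ x ] * 1) + [ b ≡ᶠ y ] * ([ a ≡ᶠ x ] * 1))
    h x with G′.adj y x in eq
    ... | false = ≤-trans ([]-mono {X x ∧ adj y x} {adj y x} (λ p → proj₂ (∧⁻ {X x} p))) (m≤m+n _ _)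
    ... | true with edge⁻ y x eq
    ... | inj₁ (p , _ , q) rewrite p | q = s≤s z≤n
    ... | inj₂ new rewrite not∈ new = ≤-trans (joined new) (m≤n+m _ [ adj y x ])

  -- `a` and `b` need not have soft edges into `X`, so in contrast to the degrees their soft degrees
  -- can really grow. This is the `2 * σ` that a new edge costs.
  elim-sdeg : ∀ y → G′.sdeg y + count (λ x → X x ∧ isSoft (kind y x)) ≤ sdeg y + ends y
  elim-sdeg y = begin
    G′.sdeg y + count (λ x → X x ∧ isSoft (kind y x)) ≡⟨ ∑-distrib-+ (λ x → [ isSoft (G′.kind y x) ]) _ ⟨
    sum (λ x → [ isSoft (G′.kind y x) ] + [ X x ∧ isSoft (kind y x) ]) ≤⟨ sum-mono h ⟩
    sum (λ x → [ isSoft (kind y x) ] + ([ a ≡ᶠ y ] * ([ b ≡ᶠ x ] * 1) + [ b ≡ᶠ y ] * ([ a ≡ᶠ x ] * 1))) ≡⟨ ∑-distrib-+ (λ x → [ isSoft (kind y x) ]) _ ⟩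
    sdeg y + sum (λ x → [ a ≡ᶠ y ] * ([ b ≡ᶠ x ] * 1) + [ b ≡ᶠ y ] * ([ a ≡ᶠ x ] * 1)) ≡⟨ cong (sdeg y +_) (pick-both y) ⟩
    sdeg y + ends y ∎
    where
    open ≤-Reasoning
    not∈ : ∀ {x} → Joins a b y x → X x ≡ false
    not∈ (inj₁ (_ , refl)) = b∉X
    not∈ (inj₂ (_ , refl)) = a∉X
    h : ∀ x → [ isSoft (G′.kind y x) ] + [ X x ∧ isSoft (kind y x) ] ≤ [ isSoft (kind y x) ] + ([ a ≡ᶠ y ] * ([ b ≡ᶠ x ] * 1) + [ b ≡ᶠ y ] * ([ a ≡ᶠ x ] * 1))
    h x with isSoft (G′.kind y x) in eq
    ... | false = ≤-trans ([]-mono {X x ∧ isSoft (kind y x)} {isSoft (kind y x)} (λ p → proj₂ (∧⁻ {X x} p))) (m≤m+n _ _)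
    ... | true with soft⁻ y x eq
    ... | inj₁ (p , _ , q) rewrite p | q = s≤s z≤n
    ... | inj₂ new rewrite not∈ new = ≤-trans (joined new) (m≤n+m _ [ isSoft (kind y x) ])

  -- For `a ≡ b` the new edge would be a loop, which `irrefl` forbids.
  elim-same : a ≡ b → ∀ y → G′.deg y ≤ deg y × G′.sdeg y ≤ sdeg y
  elim-same refl y = count-mono h , count-mono hs
    where
    not-join : ∀ {x} → Joins a b y x → G′.adj y x ≡ true → ⊥
    not-join (inj₁ (refl , refl)) p = false≢true p (cong isEdge (G′.irrefl y))
    not-join (inj₂ (refl , refl)) p = false≢true p (cong isEdge (G′.irrefl y))
    h : ∀ x → G′.adj y x ≡ true → adj y x ≡ true
    h x p with edge⁻ y x p
    ... | inj₁ q = proj₁ q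
    ... | inj₂ new = ⊥-elim (not-join new p)
    hs : ∀ x → isSoft (G′.kind y x) ≡ true → isSoft (kind y x) ≡ true
    hs x p with soft⁻ y x p
    ... | inj₁ q = proj₁ q
    ... | inj₂ new = ⊥-elim (not-join new (isSoft⇒isEdge _ p))

  -- Each of `a` and `b` exchanges an edge into `X` for the new one, so no degree grows. `e` marks
  -- vertices that are to lose one edge more, and `paid` provides the edges into `X` that this
  -- takes.
  elim-kept : ∀ (e : Fin n → Bool) → (a ≡ b → ∀ y → e y ≡ false) → (∀ y → e y ≡ true → X y ≡ false → [ e y ] + ends y ≤ links X y) →
              ∀ y → X y ≡ false → G′.deg y + [ e y ] ≤ deg y
  elim-kept e e≡ paid y y∉X with attached
  ... | inj₁ a≡b rewrite e≡ a≡b y = ≤-trans (≤-reflexive (+-identityʳ _)) (proj₁ (elim-same a≡b y))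
  ... | inj₂ (pa , pb) with e y in eq
  ... | true = +-cancelʳ-≤ (ends y) _ _ (≤-trans (≤-reflexive (+-assoc (G′.deg y) 1 (ends y)))
                   (≤-trans (+-monoʳ-≤ (G′.deg y) (subst (λ c → [ c ] + ends y ≤ links X y) eq (paid y eq y∉X))) (elim-links y)))
  ... | false with a ≡ᶠ b in ab
  ... | true = ≤-trans (≤-reflexive (+-identityʳ _)) (proj₁ (elim-same (≡ᶠ⇒≡ a b ab) y))
  ... | false = +-cancelʳ-≤ (ends y) _ _ (≤-trans (≤-reflexive (cong (_+ ends y) (+-identityʳ (G′.deg y))))
                   (≤-trans (+-monoʳ-≤ (G′.deg y) (ends≤ (≡ᶠ⇒≢ ab))) (elim-links y)))
    where
    ends≤ : a ≢ b → ends y ≤ links X y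
    ends≤ a≢b with a ≡ᶠ y in ay | b ≡ᶠ y in by
    ... | true | true = ⊥-elim (a≢b (trans (≡ᶠ⇒≡ a y ay) (sym (≡ᶠ⇒≡ b y by))))
    ... | true | false rewrite sym (≡ᶠ⇒≡ a y ay) = pa
    ... | false | true rewrite sym (≡ᶠ⇒≡ b y by) = pb
    ... | false | false = z≤n

  module _ (F : Weights) (inc : Weights.Increasing F) where
    open Weights F

    -- Vertices of `X` save their full weight, the others what a lost edge (`e`) and a lost soft
    -- edge (`s`) are worth. The price of the new edge stays on the right-hand side, which avoids
    -- truncated subtraction.
    elim-drop : ∀ m₁ (e s : Fin n → Bool) →
      (∀ y → X y ≡ false → G′.deg y + [ e y ] ≤ deg y) →
      (∀ y → X y ≡ false → G′.sdeg y + [ s y ] ≤ sdeg y + ends y) →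
      (∀ y → e y ≡ true → ∀ d → d + 1 ≤ deg y → w d + m₁ ≤ w (deg y)) →
      measure F g′ + sum (λ y → [ X y ] * W (deg y) (sdeg y) + [ not (X y) ] * (2 * m₁ * [ e y ] + σ * [ s y ])) ≤ measure F g + 2 * σ
    elim-drop m₁ e s kept skept first = begin
      measure F g′ + sum f ≡⟨ ∑-distrib-+ (λ y → W (G′.deg y) (G′.sdeg y)) f ⟨
      sum (λ y → W (G′.deg y) (G′.sdeg y) + f y) ≤⟨ sum-mono h ⟩
      sum (λ y → W (deg y) (sdeg y) + ([ a ≡ᶠ y ] * σ + [ b ≡ᶠ y ] * σ)) ≡⟨ ∑-distrib-+ (λ y → W (deg y) (sdeg y)) _ ⟩
      measure F g + sum (λ y → [ a ≡ᶠ y ] * σ + [ b ≡ᶠ y ] * σ) ≡⟨ cong (measure F g +_) (trans (∑-distrib-+ (λ y → [ a ≡ᶠ y ] * σ) _) (cong₂ _+_ (sum-pick a (λ _ → σ)) (trans (sum-pick b (λ _ → σ)) (sym (+-identityʳ σ))))) ⟩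
      measure F g + 2 * σ ∎
      where
      open ≤-Reasoning
      f : Fin n → ℕ
      f y = [ X y ] * W (deg y) (sdeg y) + [ not (X y) ] * (2 * m₁ * [ e y ] + σ * [ s y ])
      h : ∀ y → W (G′.deg y) (G′.sdeg y) + f y ≤ W (deg y) (sdeg y) + ([ a ≡ᶠ y ] * σ + [ b ≡ᶠ y ] * σ)
      h y with X y in Xy
      ... | true rewrite elim-gone Xy | elim-sgone Xy | *-zeroʳ σ = ≤-trans (≤-reflexive (r (W (deg y) (sdeg y)))) (m≤m+n _ _)
        where
        r : ∀ a → 0 + (1 * a + 0) ≡ a
        r = solve-∀
      ... | false = begin
        W (G′.deg y) (G′.sdeg y) + (0 + 1 * (2 * m₁ * [ e y ] + σ * [ s y ])) ≡⟨ r (w (G′.deg y)) σ (G′.sdeg y) m₁ [ e y ] [ s y ] ⟩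
        2 * (w (G′.deg y) + m₁ * [ e y ]) + σ * (G′.sdeg y + [ s y ]) ≤⟨ +-mono-≤ (*-monoʳ-≤ 2 lose) (*-monoʳ-≤ σ (skept y Xy)) ⟩
        2 * w (deg y) + σ * (sdeg y + ends y) ≡⟨ r′ (w (deg y)) σ (sdeg y) [ a ≡ᶠ y ] [ b ≡ᶠ y ] ⟩
        W (deg y) (sdeg y) + ([ a ≡ᶠ y ] * σ + [ b ≡ᶠ y ] * σ) ∎
        where
        r : ∀ a s t m e c → 2 * a + s * t + (0 + 1 * (2 * m * e + s * c)) ≡ 2 * (a + m * e) + s * (t + c)
        r = solve-∀
        r′ : ∀ a s t x z → 2 * a + s * (t + (x + z)) ≡ 2 * a + s * t + (x * s + z * s)
        r′ = solve-∀
        lose : w (G′.deg y) + m₁ * [ e y ] ≤ w (deg y)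
        lose with e y in eq
        ... | true rewrite *-identityʳ m₁ = first y eq (G′.deg y) (subst (λ c → G′.deg y + [ c ] ≤ deg y) eq (kept y Xy))
        ... | false rewrite *-zeroʳ m₁ | +-identityʳ (w (G′.deg y)) = w-mono inc {G′.deg y} {deg y} (≤-trans (m≤m+n (G′.deg y) [ e y ]) (kept y Xy))

    -- Every weight function c supported on X that is bounded by the weights
    -- is saved, up to the price of the new edge.
    elim-drop₀ : ∀ (c : Fin n → ℕ) → (∀ y → c y ≤ [ X y ] * W (deg y) (sdeg y)) → measure F g′ + sum c ≤ measure F g + 2 * σ
    elim-drop₀ c c≤ = ≤-trans (+-monoʳ-≤ (measure F g′) (sum-mono (λ y → ≤-trans (c≤ y) (m≤m+n _ _))))
      (elim-drop 0 (λ _ → false) (λ _ → false) (elim-kept (λ _ → false) (λ _ _ → refl) (λ _ ()))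
        (λ y _ → ≤-trans (+-monoʳ-≤ (G′.sdeg y) z≤n) (elim-sdeg y)) (λ _ ()))

    elim-same-drop : a ≡ b → measure F g′ ≤ measure F g
    elim-same-drop a≡b = sum-mono (λ y → W-mono inc (proj₁ (elim-same a≡b y)) (proj₂ (elim-same a≡b y)))

module _ {n} {g g′ : Graph n} (v : Fin n) (α : Bool) (u a b : Fin n) where
  open Graph g
  private
    R = forced v α
    X = cluster v α
    Y : Fin n → Bool
    Y y = X y ∨ (u ≡ᶠ y)

  module _ (el : Eliminates Y a b g g′) (a≢b : a ≢ b) (u∉X : X u ≡ false) (Xa : 1 ≤ links X a) (Xb : 1 ≤ links X b) where
    private module G′ = Graph g′
    open Eliminates el

    links-Y : ∀ y → links X y + [ adj y u ] ≤ links Y y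
    links-Y y = ≤-trans (≤-reflexive (trans (cong (links X y +_) (sym (sum-pick u (λ x → [ adj y x ])))) (sym (∑-distrib-+ (λ x → [ X x ∧ adj y x ]) _)))) (sum-mono h)
      where
      h : ∀ x → [ X x ∧ adj y x ] + [ u ≡ᶠ x ] * [ adj y x ] ≤ [ Y x ∧ adj y x ]
      h x with u ≡ᶠ x in eq
      ... | true rewrite sym (≡ᶠ⇒≡ u x eq) | u∉X = ≤-reflexive (+-identityʳ _)
      ... | false with X x
      ... | true = ≤-reflexive (+-identityʳ _)
      ... | false = z≤n

    module _ (F : Weights) (inc : Weights.Increasing F) {D m₁ m₂} (sl : Weights.Slopes F D m₁ m₂)
             (reg : ∀ y → 1 ≤ deg y → 3 ≤ deg y × deg y ≤ D) where
      open Weights F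

      -- Here `u` is assigned and the cluster is summed out. The soft edges of `v` count twice, at
      -- `v` and at their far ends, and every neighbour of `u` outside the cluster loses an edge
      -- beyond the one that may be exchanged for the new edge.
      separator-drop : measure F g′ + (2 * (w (deg v) + sum (λ x → [ R x ] * w (deg x))) + 2 * (σ * sdeg v)
                                       + 2 * w (deg u) + 2 * m₁ * exits X u) ≤ measure F g + 2 * σ
      separator-drop = ≤-trans (+-monoʳ-≤ (measure F g′) (≤-trans (≤-reflexive total) (sum-mono f≤)))
        (elim-drop el F inc m₁ e s (elim-kept el e (λ a≡b → ⊥-elim (a≢b a≡b)) paid) skept
          (λ y ey d → let (p , q) = reg y (∃⇒count (adj y) ey) in first-loss inc sl p q))
        where
        e s : Fin n → Bool
        e y = adj y u
        s y = isSoft (kind v y)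
        paid : ∀ y → e y ≡ true → Y y ≡ false → [ e y ] + ends el y ≤ links Y y
        paid y ey _ = ≤-trans (≤-trans (≤-reflexive (+-comm [ e y ] (ends el y))) (+-monoˡ-≤ [ e y ] ends≤)) (links-Y y)
          where
          ends≤ : ends el y ≤ links X y
          ends≤ with a ≡ᶠ y in ay | b ≡ᶠ y in by
          ... | true | true = ⊥-elim (a≢b (trans (≡ᶠ⇒≡ a y ay) (sym (≡ᶠ⇒≡ b y by))))
          ... | true | false rewrite sym (≡ᶠ⇒≡ a y ay) = Xa
          ... | false | true rewrite sym (≡ᶠ⇒≡ b y by) = Xb
          ... | false | false = z≤n
        skept : ∀ y → Y y ≡ false → G′.sdeg y + [ s y ] ≤ sdeg y + ends el y
        skept y _ = ≤-trans (+-monoʳ-≤ (G′.sdeg y) ([]≤count (s y) refl)) (elim-sdeg el y)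
          where
          []≤count : ∀ c → s y ≡ c → [ c ] ≤ count (λ x → Y x ∧ isSoft (kind y x))
          []≤count false _ = z≤n
          []≤count true eq = ∃⇒count (λ x → Y x ∧ isSoft (kind y x)) {v} (∧⁺ Yv (trans (soft-sym y v) eq))
            where
            Yv : Y v ≡ true
            Yv rewrite cluster-self g v α = refl
        f : Fin n → ℕ
        f y = [ v ≡ᶠ y ] * W (deg v) (sdeg v) + 2 * ([ R y ] * w (deg y)) + [ u ≡ᶠ y ] * (2 * w (deg u)) + 2 * m₁ * [ not (X y) ∧ adj u y ] + σ * [ s y ]
        total : 2 * (w (deg v) + sum (λ x → [ R x ] * w (deg x))) + 2 * (σ * sdeg v) + 2 * w (deg u) + 2 * m₁ * exits X u ≡ sum f
        total = sym (trans (∑-distrib-+ (λ y → [ v ≡ᶠ y ] * W (deg v) (sdeg v) + 2 * ([ R y ] * w (deg y)) + [ u ≡ᶠ y ] * (2 * w (deg u)) + 2 * m₁ * [ not (X y) ∧ adj u y ]) _)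
          (trans (cong₂ _+_ (trans (∑-distrib-+ (λ y → [ v ≡ᶠ y ] * W (deg v) (sdeg v) + 2 * ([ R y ] * w (deg y)) + [ u ≡ᶠ y ] * (2 * w (deg u))) _)
             (cong₂ _+_ (trans (∑-distrib-+ (λ y → [ v ≡ᶠ y ] * W (deg v) (sdeg v) + 2 * ([ R y ] * w (deg y))) _)
                (cong₂ _+_ (trans (∑-distrib-+ (λ y → [ v ≡ᶠ y ] * W (deg v) (sdeg v)) _)
                   (cong₂ _+_ (sum-pick v (λ _ → W (deg v) (sdeg v))) (sym (*-distribˡ-sum 2 (λ y → [ R y ] * w (deg y))))))
                 (sum-pick u (λ _ → 2 * w (deg u)))))
              (sym (*-distribˡ-sum (2 * m₁) (λ y → [ not (X y) ∧ adj u y ])))))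
            (sym (*-distribˡ-sum σ (λ y → [ s y ]))))
           (r (w (deg v)) σ (sdeg v) (sum (λ y → [ R y ] * w (deg y))) (2 * w (deg u)) (2 * m₁ * exits X u))))
          where
          r : ∀ a s t b c d → 2 * a + s * t + 2 * b + c + d + s * t ≡ 2 * (a + b) + 2 * (s * t) + c + d
          r = solve-∀
        f≤ : ∀ y → f y ≤ [ Y y ] * W (deg y) (sdeg y) + [ not (Y y) ] * (2 * m₁ * [ e y ] + σ * [ s y ])
        f≤ y = c (v ≡ᶠ y) (kind v y) (u ≡ᶠ y) refl refl refl
          where
          c : ∀ p k q → (v ≡ᶠ y) ≡ p → kind v y ≡ k → (u ≡ᶠ y) ≡ q →
              [ p ] * W (deg v) (sdeg v) + 2 * ([ isHard α k ] * w (deg y)) + [ q ] * (2 * w (deg u)) + 2 * m₁ * [ not (p ∨ isHard α k) ∧ adj u y ] + σ * [ isSoft k ]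
              ≤ [ (p ∨ isHard α k) ∨ q ] * W (deg y) (sdeg y) + [ not ((p ∨ isHard α k) ∨ q) ] * (2 * m₁ * [ adj y u ] + σ * [ isSoft k ])
          c true k q eqv ky equ with ≡ᶠ⇒≡ v y eqv
          ... | refl with trans (sym (irrefl v)) ky
          ... | refl with q
          ... | true = ⊥-elim (false≢true el (cluster-self g v α) (subst (λ z → X z ≡ false) (≡ᶠ⇒≡ u v equ) u∉X))
          ... | false rewrite isHard-none α = ≤-reflexive (r (W (deg v) (sdeg v)) m₁ σ)
            where
            r : ∀ a m s → 1 * a + 0 + 0 + 2 * m * 0 + s * 0 ≡ 1 * a + 0
            r = solve-∀
          c false k q eqv ky equ with isHard α k in hk
          c false k true eqv ky equ | true = ⊥-elim (false≢true el Xy (subst (λ z → X z ≡ false) (≡ᶠ⇒≡ u y equ) u∉X))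
            where
            Xy : X y ≡ true
            Xy rewrite eqv | ky = hk
          c false k false eqv ky equ | true rewrite hard⇒¬soft α k hk = ≤-trans (≤-reflexive (r (w (deg y)) m₁ σ))
              (≤-trans (m≤m+n (2 * w (deg y)) (σ * sdeg y)) (≤-reflexive (sym (trans (+-identityʳ _) (+-identityʳ _)))))
            where
            r : ∀ a m s → 0 + 2 * (1 * a) + 0 + 2 * m * 0 + s * 0 ≡ 2 * a
            r = solve-∀
          c false k true eqv ky equ | false with ≡ᶠ⇒≡ u y equ
          ... | refl rewrite irrefl u = ≤-trans (≤-reflexive (r (w (deg u)) m₁ (σ * [ isSoft k ])))
              (≤-trans (+-monoʳ-≤ (2 * w (deg u)) (*-monoʳ-≤ σ (sd k ky))) (≤-reflexive (sym (trans (+-identityʳ _) (+-identityʳ _)))))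
            where
            r : ∀ a m s → 0 + 0 + 1 * (2 * a) + 2 * m * 0 + s ≡ 2 * a + s
            r = solve-∀
            sd : ∀ k → kind v u ≡ k → [ isSoft k ] ≤ sdeg u
            sd none _ = z≤n
            sd (hard _) _ = z≤n
            sd soft eq = ∃⇒count (λ x → isSoft (kind u x)) {v} (trans (soft-sym u v) (cong isSoft eq))
          c false k false eqv ky equ | false rewrite edge-sym u y = ≤-reflexive (r (2 * m₁ * [ adj y u ]) (σ * [ isSoft k ]))
            where
            r : ∀ a b → 0 + 0 + 0 + a + b ≡ 0 + 1 * (a + b)
            r = solve-∀

-- Local types of vertices and the numerical certificate

Key : Set
Key = Kind × ℕ

_≡ᵏ_ : Kind → Kind → Bool
none ≡ᵏ none = true
soft ≡ᵏ soft = true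
hard false ≡ᵏ hard false = true
hard true ≡ᵏ hard true = true
_ ≡ᵏ _ = false

≡ᵏ⇒≡ : ∀ k l → (k ≡ᵏ l) ≡ true → k ≡ l
≡ᵏ⇒≡ none none _ = refl
≡ᵏ⇒≡ soft soft _ = refl
≡ᵏ⇒≡ (hard false) (hard false) _ = refl
≡ᵏ⇒≡ (hard true) (hard true) _ = refl

matches : Key → Key → Bool
matches (k , d) (l , e) = (k ≡ᵏ l) ∧ (d ≡ᵇ e)

≡ᵇ⇒≡′ : ∀ d e → (d ≡ᵇ e) ≡ true → d ≡ e
≡ᵇ⇒≡′ zero zero _ = refl
≡ᵇ⇒≡′ (suc d) (suc e) p = cong suc (≡ᵇ⇒≡′ d e p)

matches⇒≡ : ∀ x y → matches x y ≡ true → x ≡ y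
matches⇒≡ (k , d) (l , e) p with ∧⁻ {k ≡ᵏ l} p
... | q , r = cong₂ _,_ (≡ᵏ⇒≡ k l q) (≡ᵇ⇒≡′ d e r)

dot : (Kind → ℕ → ℕ) → List Key → List ℕ → ℕ
dot φ ((k , d) ∷ bs) (c ∷ cs) = c * φ k d + dot φ bs cs
dot φ _ _ = 0

occurrences : Key → List Key → ℕ
occurrences x [] = 0
occurrences x (b ∷ bs) = [ matches x b ] + occurrences x bs

counts : ∀ {n} → (Fin n → Key) → List Key → List ℕ
counts key = map (λ b → count (λ y → matches (key y) b))

-- Exchanges the order of summation. Once every neighbour has a key that occurs exactly once in the
-- list, sums over the neighbourhood are functions of the multiplicities alone, of which there are
-- finitely many for each degree.
dot-counts : ∀ {n} (key : Fin n → Key) bs (φ : Kind → ℕ → ℕ) →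
             dot φ bs (counts key bs) ≡ sum (λ y → occurrences (key y) bs * uncurry φ (key y))
dot-counts {n} key [] φ = sym (sum-zero {n} (λ _ → refl))
dot-counts key (b ∷ bs) φ = trans (cong₂ _+_ (*-distribʳ-sum (uncurry φ b) (λ y → [ matches (key y) b ])) (dot-counts key bs φ))
  (trans (sym (∑-distrib-+ (λ y → [ matches (key y) b ] * uncurry φ b) _)) (sum-cong-≗ h))
  where
  h : ∀ y → [ matches (key y) b ] * uncurry φ b + occurrences (key y) bs * uncurry φ (key y) ≡ occurrences (key y) (b ∷ bs) * uncurry φ (key y)
  h y with matches (key y) b in eq
  ... | false = refl
  ... | true rewrite matches⇒≡ (key y) b eq = cong (_+ occurrences b bs * uncurry φ b) (+-identityʳ (uncurry φ b))

block : ℕ → List Key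
block k = (soft , k) ∷ (hard false , k) ∷ (hard true , k) ∷ []

-- The keys that neighbours can have when all degrees of non-isolated vertices lie between three and
-- `D`.
buckets : ℕ → List Key
buckets 3 = block 3
buckets 4 = block 4 ++ block 3
buckets 5 = block 5 ++ block 4 ++ block 3
buckets 6 = block 6 ++ block 5 ++ block 4 ++ block 3
buckets _ = []

occurrences-none : ∀ d D → D ≤ 6 → occurrences (none , d) (buckets D) ≡ 0
occurrences-none d 0 _ = refl
occurrences-none d 1 _ = refl
occurrences-none d 2 _ = refl
occurrences-none d 3 _ = refl
occurrences-none d 4 _ = refl
occurrences-none d 5 _ = refl
occurrences-none d 6 _ = refl
occurrences-none d (suc (suc (suc (suc (suc (suc (suc D))))))) (s≤s (s≤s (s≤s (s≤s (s≤s (s≤s ()))))))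

forall-upto : ℕ → (ℕ → Bool) → Bool
forall-upto zero P = P 0
forall-upto (suc d) P = P (suc d) ∧ forall-upto d P

forall-upto⁻ : ∀ d P → forall-upto d P ≡ true → ∀ c → c ≤ d → P c ≡ true
forall-upto⁻ zero P p .zero z≤n = p
forall-upto⁻ (suc d) P p c c≤ with ∧⁻ {P (suc d)} p | m≤n⇒m<n∨m≡n c≤
... | q , r | inj₁ (s≤s c≤d) = forall-upto⁻ d P r c c≤d
... | q , r | inj₂ refl = q

single? : ℕ → ℕ → Kind → Bool
single? D d k = occurrences (k , d) (buckets D) ≡ᵇ 1

singles? : ℕ → ℕ → Bool
singles? D d = if 3 ≤ᵇ d then (if d ≤ᵇ D then single? D d soft ∧ single? D d (hard false) ∧ single? D d (hard true) else true) else true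

all-singles : forall-upto 6 (λ D → forall-upto 6 (singles? D)) ≡ true
all-singles = refl

occurrences-edge : ∀ k d D → isEdge k ≡ true → 3 ≤ d → d ≤ D → D ≤ 6 → occurrences (k , d) (buckets D) ≡ 1
occurrences-edge k d D e 3≤d d≤D D≤6 = ≡ᵇ⇒≡′ (occurrences (k , d) (buckets D)) 1 (pick k e)
  where
  h : single? D d soft ∧ single? D d (hard false) ∧ single? D d (hard true) ≡ true
  h = subst₂ (λ a b → (if a then (if b then single? D d soft ∧ single? D d (hard false) ∧ single? D d (hard true) else true) else true) ≡ true)
    (Equivalence.to T-≡ (≤⇒≤ᵇ 3≤d)) (Equivalence.to T-≡ (≤⇒≤ᵇ d≤D))
    (forall-upto⁻ 6 (singles? D) (forall-upto⁻ 6 (λ D → forall-upto 6 (singles? D)) all-singles D D≤6) d (≤-trans d≤D D≤6))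
  pick : ∀ k → isEdge k ≡ true → single? D d k ≡ true
  pick soft _ = proj₁ (∧⁻ {single? D d soft} h)
  pick (hard false) _ = proj₁ (∧⁻ {single? D d (hard false)} (proj₂ (∧⁻ {single? D d soft} h)))
  pick (hard true) _ = proj₂ (∧⁻ {single? D d (hard false)} (proj₂ (∧⁻ {single? D d soft} h)))

total : List ℕ → ℕ
total [] = 0
total (c ∷ cs) = c + total cs

-- Turns a claim about all neighbourhoods of a vertex of degree `d` into one closed Boolean. Vectors
-- with another total are accepted unseen.
for-counts : (m d : ℕ) → (List ℕ → Bool) → Bool
for-counts zero zero P = P []
for-counts zero (suc _) P = true
for-counts (suc m) d P = forall-upto d (λ c → for-counts m (d ∸ c) (P ∘ (c ∷_)))

for-counts⁻ : ∀ m d P → for-counts m d P ≡ true → ∀ cs → length cs ≡ m → total cs ≡ d → P cs ≡ true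
for-counts⁻ zero zero P p [] _ _ = p
for-counts⁻ (suc m) d P p (c ∷ cs) le te =
  for-counts⁻ m (d ∸ c) (P ∘ (c ∷_)) (forall-upto⁻ d _ p c (≤-trans (m≤m+n c _) (≤-reflexive te))) cs (suc-injective le)
    (trans (sym (m+n∸m≡n c (total cs))) (cong (_∸ c) te))

-- `W` doubles the weights, so a weight of 10000 amounts to one bit: a decrease by `unit` halves the
-- remaining bound on the running time, and an initial vertex of weight 3076 contributes a factor of
-- about 2 to the power 0.3076.
unit : ℕ
unit = 20000

-- Pairs of decreases of the measure whose branching number is at most the
-- base of the running time.
thresholds : List (ℕ × ℕ)
thresholds = map (λ (x , y) → 2 * x , 2 * y)
  ( (3076 , 23800) ∷ (3562 , 21918) ∷ (3758 , 21239) ∷ (4356 , 19394) ∷ (4380 , 19326)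
  ∷ (4664 , 18555) ∷ (4978 , 17763) ∷ (5510 , 16549) ∷ (5570 , 16421) ∷ (5944 , 15658)
  ∷ (6394 , 14814) ∷ (6531 , 14572) ∷ (6712 , 14261) ∷ (6970 , 13836) ∷ (7218 , 13445)
  ∷ (7409 , 13156) ∷ (7848 , 12526) ∷ (8064 , 12233) ∷ (8164 , 12100) ∷ (8487 , 11686)
  ∷ (8583 , 11568) ∷ (8918 , 11166) ∷ (9414 , 10607) ∷ (9670 , 10334) ∷ (10000 , 10000) ∷ [])

exceeds : List (ℕ × ℕ) → ℕ → ℕ → Bool
exceeds [] x y = false
exceeds ((p , q) ∷ ts) x y = ((p ≤ᵇ x) ∧ (q ≤ᵇ y)) ∨ ((q ≤ᵇ x) ∧ (p ≤ᵇ y)) ∨ exceeds ts x y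

onHard : Bool → (ℕ → ℕ) → Kind → ℕ → ℕ
onHard α f k d = [ isHard α k ] * f d

-- Everything here is computed from the multiplicities `cs` of the keys around a vertex of maximum
-- degree `D`. The results are exact or err on the safe side for the actual graph.
module Local-check (unit : ℕ) (thresholds : List (ℕ × ℕ)) (F : Weights) (D m₁ m₂ : ℕ) where
  open Weights F

  module _ (cs : List ℕ) where
    stat : (Kind → ℕ → ℕ) → ℕ
    stat φ = dot φ (buckets D) cs

    #soft : ℕ
    #soft = stat (λ k _ → [ isSoft k ])

    module _ (α : Bool) where
      #forced cluster-weight link-bound spread separable₁ separable₂ : ℕ
      #forced = stat (onHard α (λ _ → 1))
      cluster-weight = w D + stat (onHard α w)
      -- Edges out of the cluster: those of `v` to vertices that are not forced, and for each forced
      -- vertex all but the one to `v`.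
      link-bound = (D ∸ #forced) + stat (onHard α (_∸ 1))
      -- A forced vertex has at most `#forced` neighbours in the cluster, since the cluster has one
      -- vertex more and there are no loops.
      spread = stat (onHard α (_∸ #forced))
      -- One of three boundary vertices receives at most a third of the edges out of the cluster.
      -- Its degree is at least three, so `3 ∸ link-bound / 3` of its edges lead elsewhere.
      separable₁ = 2 * cluster-weight + 2 * (σ * #soft) + 2 * w₃ + 2 * m₁ * (3 ∸ link-bound / 3)
      -- Two separating vertices, each of weight at least `w₃`.
      separable₂ = 2 * cluster-weight + 4 * w₃

      -- If separation pays off for a boundary of three (and also of four) vertices, such boundaries
      -- need no branching on `v`, so the analysis of branching may assume a larger one.
      min-boundary : ℕ
      min-boundary = if unit + 2 * σ ≤ᵇ separable₁ then (if 2 * unit + 2 * σ ≤ᵇ separable₂ then 5 else 4) else 3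

      min-outer : ℕ
      min-outer = min-boundary ∸ (D ∸ #forced)

      -- The last summand: if more edges leave the forced vertices than outer vertices are
      -- guaranteed, then there are further outer vertices or some vertex loses two edges.
      branch-gain : ℕ
      branch-gain = W D #soft + stat (gain F α) + 2 * m₁ * min-outer + 2 * m₂ * [ min-outer <ᵇ spread ]

    good-counts : Bool
    good-counts = exceeds thresholds (branch-gain false) (branch-gain true)

  good-types : (T : ℕ) → Bool
  good-types T = for-counts (length (buckets D)) D (λ cs → (T <ᵇ #soft cs) ∨ good-counts cs)

-- `f₁` deals with degrees from five on, `f₂` to `f₆` with maximum degree four, and `p₀` to `p₃`
-- with maximum degree three. Within each group the number of soft edges grows, which is why `σ`
-- decreases. An entry 10000 makes a vertex of that degree worth a whole `unit`, so that branching
-- on it is good without further analysis.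
f₁ f₂ f₃ f₄ f₅ f₆ p₀ p₁ p₂ p₃ : Weights
f₁ = weights 1130 2005 2718 2995 3076
f₂ = weights 880 2005 2718 10000 10000
f₃ = weights 826 2005 2745 10000 10000
f₄ = weights 710 2005 2861 10000 10000
f₅ = weights 694 2005 2885 10000 10000
f₆ = weights 556 2005 3161 10000 10000
p₀ = weights 436 2005 10000 10000 10000
p₁ = weights 316 2065 10000 10000 10000
p₂ = weights 272 2109 10000 10000 10000
p₃ = weights 10 2502 10000 10000 10000

-- The numbers are the degree `D`, `m₁`, `m₂` and the largest number of soft edges. `m₁` is the
-- least slope at degrees three to `D`, and `m₂` is the smaller one of `m₁` and `σ`.
f₁-6 : Local-check.good-types unit thresholds f₁ 6 81 81 6 ≡ true
f₁-6 = refl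
f₁-5 : Local-check.good-types unit thresholds f₁ 5 277 277 5 ≡ true
f₁-5 = refl
f₂-4 : Local-check.good-types unit thresholds f₂ 4 713 713 0 ≡ true
f₂-4 = refl
f₃-4 : Local-check.good-types unit thresholds f₃ 4 740 740 1 ≡ true
f₃-4 = refl
f₄-4 : Local-check.good-types unit thresholds f₄ 4 856 710 2 ≡ true
f₄-4 = refl
f₅-4 : Local-check.good-types unit thresholds f₅ 4 880 694 3 ≡ true
f₅-4 = refl
f₆-4 : Local-check.good-types unit thresholds f₆ 4 1156 556 4 ≡ true
f₆-4 = refl
p₀-3 : Local-check.good-types unit thresholds p₀ 3 1569 436 0 ≡ true
p₀-3 = refl
p₁-3 : Local-check.good-types unit thresholds p₁ 3 1749 316 1 ≡ true
p₁-3 = refl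
p₂-3 : Local-check.good-types unit thresholds p₂ 3 1837 272 2 ≡ true
p₂-3 = refl
p₃-3 : Local-check.good-types unit thresholds p₃ 3 2492 10 3 ≡ true
p₃-3 = refl

-- A good step exists in every reduced graph

with₁ : ∀ {n} → (Fin n → Bool) → Fin n → Fin n → Bool
with₁ X u y = X y ∨ (u ≡ᶠ y)

record Pair {n} (P : Fin n → Bool) (a b : Fin n) : Set where
  field
    a∈ : P a ≡ true
    b∈ : P b ≡ true
    a≢b : a ≢ b
    only : ∀ y → P y ≡ true → y ≡ a ⊎ y ≡ b

pair : ∀ {n} (P : Fin n → Bool) → count P ≡ 2 → ∃₂ λ a b → Pair P a b
pair P c with count⇒∃ P (≤-trans (s≤s z≤n) (≤-reflexive (sym c)))
... | a , pa with suc-injective (trans (sym (count-∖ {P = P} {a} pa)) c)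
... | c₁ with count⇒∃ (P ∖ a) (≤-reflexive (sym c₁))
... | b , pb = a , b , record { a∈ = pa ; b∈ = proj₁ (∖-true {P = P} {a} {b} pb) ; a≢b = proj₂ (∖-true {P = P} {a} {b} pb) ; only = only }
  where
  c₂ : count ((P ∖ a) ∖ b) ≡ 0
  c₂ = suc-injective (trans (sym (count-∖ {P = P ∖ a} {b} pb)) c₁)
  only : ∀ y → P y ≡ true → y ≡ a ⊎ y ≡ b
  only y py with a ≡ᶠ y in ay | b ≡ᶠ y in by
  ... | true | _ = inj₁ (sym (≡ᶠ⇒≡ a y ay))
  ... | false | true = inj₂ (sym (≡ᶠ⇒≡ b y by))
  ... | false | false with trans (sym (count≡0 ((P ∖ a) ∖ b) c₂ y)) (∧⁺ (∧⁺ py (cong not ay)) (cong not by))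
  ... | ()

module _ (unit : ℕ) (thresholds : List (ℕ × ℕ)) {n} (g : Graph n) (F : Weights) where
  open Graph g

  -- The decrease is required for every graph that a step can lead to: whether a new edge exists and
  -- whether it is soft depends on numbers that the graph does not record. A separation has two or
  -- four branches, so each has to save one or two units. The bound 7 keeps summing out by brute
  -- force within constant effort.
  data Good : Set where
    branch : ∀ v x y → 1 ≤ deg v → exceeds thresholds x y ≡ true →
      (∀ {g′} → Removes (cluster v false) g g′ → measure F g′ + x ≤ measure F g) →
      (∀ {g′} → Removes (cluster v true) g g′ → measure F g′ + y ≤ measure F g) → Good
    separate₁ : ∀ v α u a b → 1 ≤ deg v → count (cluster v α) ≤ 7 →
      boundary (cluster v α) u ≡ true → Pair (boundary (cluster v α) ∖ u) a b →
      (∀ {g′} → Eliminates (with₁ (cluster v α) u) a b g g′ → measure F g′ + unit ≤ measure F g) → Good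
    separate₂ : ∀ v α u₁ u₂ a b → 1 ≤ deg v → count (cluster v α) ≤ 7 →
      boundary (cluster v α) u₁ ≡ true → (boundary (cluster v α) ∖ u₁) u₂ ≡ true → Pair ((boundary (cluster v α) ∖ u₁) ∖ u₂) a b →
      (∀ {g′} → Eliminates (with₁ (with₁ (cluster v α) u₁) u₂) a b g g′ → measure F g′ + 2 * unit ≤ measure F g) → Good

  open Weights F

  module _ (inc : Increasing) {D m₁ m₂} (3≤D : 3 ≤ D) (D≤6 : D ≤ 6) (m₂≤m₁ : m₂ ≤ m₁) (sl : Slopes D m₁ m₂)
           (reg : ∀ y → deg y ≡ 0 ⊎ 3 ≤ deg y) (≤D : ∀ y → deg y ≤ D)
           (wide : ∀ v α → 1 ≤ deg v → deg v ≤ 6 → 3 ≤ count (boundary (cluster v α)))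
           (v : Fin n) (deg-v : deg v ≡ D) where
    open Local-check unit thresholds F D m₁ m₂

    private
      3≤deg : ∀ y → 1 ≤ deg y → 3 ≤ deg y
      3≤deg y 1≤ with reg y
      ... | inj₁ eq = contradiction (≤-trans 1≤ (≤-reflexive eq)) λ ()
      ... | inj₂ p = p

      1≤deg-v : 1 ≤ deg v
      1≤deg-v = ≤-trans (s≤s z≤n) (≤-trans 3≤D (≤-reflexive (sym deg-v)))

      key : Fin n → Key
      key y = kind v y , deg y

      cs : List ℕ
      cs = counts key (buckets D)

      occ : ∀ y → occurrences (key y) (buckets D) ≡ [ adj v y ]
      occ y = c (kind v y) refl
        where
        c : ∀ k → kind v y ≡ k → occurrences (k , deg y) (buckets D) ≡ [ isEdge k ]
        c none _ = occurrences-none (deg y) D D≤6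
        c soft ky = occurrences-edge soft (deg y) D refl (3≤deg y (∃⇒count (adj y) {v} (trans (edge-sym y v) (cong isEdge ky)))) (≤D y) D≤6
        c (hard β) ky = occurrences-edge (hard β) (deg y) D refl (3≤deg y (∃⇒count (adj y) {v} (trans (edge-sym y v) (cong isEdge ky)))) (≤D y) D≤6

      stat-sum : ∀ φ → (∀ d → φ none d ≡ 0) → stat cs φ ≡ sum (λ y → φ (kind v y) (deg y))
      stat-sum φ φ0 = trans (dot-counts key (buckets D) φ) (sum-cong-≗ h)
        where
        h : ∀ y → occurrences (key y) (buckets D) * φ (kind v y) (deg y) ≡ φ (kind v y) (deg y)
        h y rewrite occ y with kind v y
        ... | none = sym (φ0 (deg y))
        ... | soft = +-identityʳ _
        ... | hard _ = +-identityʳ _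

      total-cs : total cs ≡ D
      total-cs = trans (trans (ones (buckets D)) (dot-counts key (buckets D) (λ _ _ → 1)))
        (trans (sum-cong-≗ (λ y → trans (*-identityʳ _) (occ y))) deg-v)
        where
        ones : ∀ bs → total (counts key bs) ≡ dot (λ _ _ → 1) bs (counts key bs)
        ones [] = refl
        ones (b ∷ bs) = cong₂ _+_ (sym (*-identityʳ _)) (ones bs)

      soft-sum : #soft cs ≡ sdeg v
      soft-sum = stat-sum (λ k _ → [ isSoft k ]) (λ _ → refl)

      module Side (α : Bool) where
        R = forced v α
        X = cluster v α
        r = count R
        bd = boundary X

        on-none : ∀ (f : ℕ → ℕ) d → onHard α f none d ≡ 0
        on-none f d rewrite isHard-none α = refl

        r-sum : #forced cs α ≡ r
        r-sum = trans (stat-sum (onHard α (λ _ → 1)) (on-none _)) (sum-cong-≗ (λ y → *-identityʳ [ R y ]))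

        wX-sum : cluster-weight cs α ≡ w (deg v) + sum (λ x → [ R x ] * w (deg x))
        wX-sum = cong₂ _+_ (cong w (sym deg-v)) (stat-sum (onHard α w) (on-none w))

        spread-sum : spread cs α ≡ sum (λ x → [ R x ] * (deg x ∸ r))
        spread-sum = trans (stat-sum (onHard α (_∸ #forced cs α)) (on-none (_∸ #forced cs α)))
                       (sum-cong-≗ (λ x → cong (λ k → [ R x ] * (deg x ∸ k)) r-sum))

        gain-sum : stat cs (gain F α) ≡ sum (λ y → gain F α (kind v y) (deg y))
        gain-sum = stat-sum (gain F α) (λ _ → refl)

        r≤D : r ≤ D
        r≤D = ≤-trans (count-mono (λ x → forced⇒adj g v α x)) (≤-reflexive deg-v)

        small : count X ≤ 7
        small = ≤-trans (≤-reflexive (count-cluster g v α)) (s≤s (≤-trans r≤D D≤6))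

        3≤bd : 3 ≤ count bd
        3≤bd = wide v α 1≤deg-v (≤-trans (≤-reflexive deg-v) D≤6)

        link-sum : sum (λ y → [ bd y ] * links X y) ≤ link-bound cs α
        link-sum = +-cancelʳ-≤ r _ _ (≤-trans (boundary-links g v α) (≤-reflexive (sym eq)))
          where
          eq : link-bound cs α + r ≡ deg v + sum (λ x → [ R x ] * (deg x ∸ 1))
          eq = trans (cong (_+ r) (cong₂ _+_ (cong (D ∸_) r-sum) (stat-sum (onHard α (_∸ 1)) (on-none (_∸ 1)))))
            (trans (comm (D ∸ r) (sum (λ x → [ R x ] * (deg x ∸ 1))) r) (cong (_+ sum (λ x → [ R x ] * (deg x ∸ 1))) (trans (m∸n+n≡m r≤D) (sym deg-v))))
            where
            comm : ∀ a b c → a + b + c ≡ a + c + b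
            comm = solve-∀

        few : ℕ
        few = link-bound cs α / 3

        thin : Fin n → Bool
        thin u = bd u ∧ (links X u ≤ᵇ few)

        -- Pigeonhole: three boundary vertices share link-bound many links.
        thin-exists : count bd ≡ 3 → ∃ λ u → bd u ≡ true × links X u ≤ few
        thin-exists c with any thin in eq
        ... | true with any⁻ thin eq
        ... | u , p = u , proj₁ (∧⁻ {bd u} p) , ≤ᵇ⇒≤ _ _ (subst T (sym (proj₂ (∧⁻ {bd u} p))) _)
        thin-exists c | false = contradiction (≤-trans lower link-sum) (<⇒≱ upper)
          where
          thick : ∀ y → [ bd y ] * suc few ≤ [ bd y ] * links X y
          thick y with bd y in by
          ... | false = z≤n
          ... | true rewrite +-identityʳ few | +-identityʳ (links X y) with suc few ≤? links X y
          ... | yes p = p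
          ... | no ¬p with trans (sym eq) (any⁺ thin y (∧⁺ by (T⇒true (≤⇒≤ᵇ (≤-pred (≰⇒> ¬p))))))
            where
            T⇒true : ∀ {b} → T b → b ≡ true
            T⇒true {true} _ = refl
          ... | ()
          lower : 3 * suc few ≤ sum (λ y → [ bd y ] * links X y)
          lower = ≤-trans (≤-reflexive (trans (cong (_* suc few) (sym c)) (*-distribʳ-sum (suc few) (λ y → [ bd y ])))) (sum-mono thick)
          upper : link-bound cs α < 3 * suc few
          upper = begin-strict
            link-bound cs α ≡⟨ m≡m%n+[m/n]*n (link-bound cs α) 3 ⟩
            link-bound cs α % 3 + few * 3 <⟨ +-monoˡ-< (few * 3) (m%n<n (link-bound cs α) 3) ⟩
            3 + few * 3 ≡⟨ *-comm (suc few) 3 ⟩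
            3 * suc few ∎
            where
            open ≤-Reasoning

        bd∉X : ∀ {y} → bd y ≡ true → X y ≡ false
        bd∉X {y} p with X y
        ... | false = refl

        bd-links : ∀ {y} → bd y ≡ true → 1 ≤ links X y
        bd-links {y} p = links-pos⁻ g X y (proj₂ (∧⁻ {not (X y)} p))

        bd-deg : ∀ {y} → bd y ≡ true → 3 ≤ deg y
        bd-deg {y} p = 3≤deg y (≤-trans (bd-links p) (count-mono (λ x q → proj₂ (∧⁻ {X x} q))))

        -- The boundary vertex with the fewest edges into the cluster is assigned: its other edges
        -- are saved in addition.
        good₁ : count bd ≡ 3 → unit + 2 * σ ≤ separable₁ cs α → Good
        good₁ c ok with thin-exists c
        ... | u , bu , thin-u with pair (bd ∖ u) (suc-injective (trans (sym (count-∖ {P = bd} {u} bu)) c))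
        ... | a , b , pr = separate₁ v α u a b 1≤deg-v small bu pr drop₁
          where
          open Pair pr
          drop₁ : ∀ {g′} → Eliminates (with₁ X u) a b g g′ → measure F g′ + unit ≤ measure F g
          drop₁ {g′} el = +-cancelʳ-≤ (2 * σ) _ _ (begin
            measure F g′ + unit + 2 * σ ≡⟨ +-assoc (measure F g′) unit (2 * σ) ⟩
            measure F g′ + (unit + 2 * σ) ≤⟨ +-monoʳ-≤ (measure F g′) (≤-trans ok enough) ⟩
            measure F g′ + _ ≤⟨ separator-drop v α u a b el a≢b (bd∉X bu) (bd-links (proj₁ (∖-true {P = bd} {u} {a} a∈))) (bd-links (proj₁ (∖-true {P = bd} {u} {b} b∈)))
                                                                 F inc sl (λ y 1≤ → 3≤deg y 1≤ , ≤D y) ⟩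
            measure F g + 2 * σ ∎)
            where
            open ≤-Reasoning
            out : 3 ∸ few ≤ exits X u
            out = ≤-trans (∸-mono (bd-deg bu) thin-u) (≤-reflexive (trans (cong (_∸ links X u) (sym (exits+links g v α X u))) (m+n∸n≡m (exits X u) (links X u))))
            enough : separable₁ cs α ≤ 2 * (w (deg v) + sum (λ x → [ R x ] * w (deg x))) + 2 * (σ * sdeg v) + 2 * w (deg u) + 2 * m₁ * exits X u
            enough = +-mono-≤ (+-mono-≤ (≤-reflexive (cong₂ (λ x y → 2 * x + 2 * (σ * y)) wX-sum soft-sum)) (*-monoʳ-≤ 2 (w-mono inc (bd-deg bu)))) (*-monoʳ-≤ (2 * m₁) out)

        -- Any two boundary vertices serve, because only their own weights are counted.
        good₂ : count bd ≡ 4 → 2 * unit + 2 * σ ≤ separable₂ cs α → Good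
        good₂ c ok with count⇒∃ bd (≤-trans (s≤s z≤n) (≤-reflexive (sym c)))
        ... | u₁ , p₁ with suc-injective (trans (sym (count-∖ {P = bd} {u₁} p₁)) c)
        ... | c₁ with count⇒∃ (bd ∖ u₁) (≤-trans (s≤s z≤n) (≤-reflexive (sym c₁)))
        ... | u₂ , p₂ with pair ((bd ∖ u₁) ∖ u₂) (suc-injective (trans (sym (count-∖ {P = bd ∖ u₁} {u₂} p₂)) c₁))
        ... | a , b , pr = separate₂ v α u₁ u₂ a b 1≤deg-v small p₁ p₂ pr drop₂
          where
          b₂ = proj₁ (∖-true {P = bd} {u₁} {u₂} p₂)
          u₁≢u₂ = proj₂ (∖-true {P = bd} {u₁} {u₂} p₂)
          c′ : Fin n → ℕ
          c′ y = 2 * ([ X y ] * w (deg y)) + ([ u₁ ≡ᶠ y ] * (2 * w₃) + [ u₂ ≡ᶠ y ] * (2 * w₃))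
          sum-c′ : sum c′ ≡ separable₂ cs α
          sum-c′ = trans (∑-distrib-+ (λ y → 2 * ([ X y ] * w (deg y))) _)
            (trans (cong₂ _+_ (trans (sym (*-distribˡ-sum 2 (λ y → [ X y ] * w (deg y)))) (cong (2 *_) (trans (sum-cluster g v α (w ∘ deg)) (sym wX-sum))))
              (trans (∑-distrib-+ (λ y → [ u₁ ≡ᶠ y ] * (2 * w₃)) _) (cong₂ _+_ (sum-pick u₁ (λ _ → 2 * w₃)) (sum-pick u₂ (λ _ → 2 * w₃)))))
             (r′ (2 * cluster-weight cs α) w₃))
            where
            r′ : ∀ a b → a + (2 * b + 2 * b) ≡ a + 4 * b
            r′ = solve-∀
          drop₂ : ∀ {g′} → Eliminates (with₁ (with₁ X u₁) u₂) a b g g′ → measure F g′ + 2 * unit ≤ measure F g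
          drop₂ {g′} el = +-cancelʳ-≤ (2 * σ) _ _ (begin
            measure F g′ + 2 * unit + 2 * σ ≡⟨ +-assoc (measure F g′) (2 * unit) (2 * σ) ⟩
            measure F g′ + (2 * unit + 2 * σ) ≤⟨ +-monoʳ-≤ (measure F g′) (≤-trans ok (≤-reflexive (sym sum-c′))) ⟩
            measure F g′ + sum c′ ≤⟨ elim-drop₀ el F inc c′ c≤ ⟩
            measure F g + 2 * σ ∎)
            where
            open ≤-Reasoning
            w≤W : ∀ y {c} → c ≤ w (deg y) → 2 * c ≤ W (deg y) (sdeg y)
            w≤W y c≤ = ≤-trans (*-monoʳ-≤ 2 c≤) (m≤m+n _ _)
            c≤ : ∀ y → c′ y ≤ [ with₁ (with₁ X u₁) u₂ y ] * W (deg y) (sdeg y)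
            c≤ y with u₁ ≡ᶠ y in e₁ | u₂ ≡ᶠ y in e₂
            ... | true | true = ⊥-elim (u₁≢u₂ (trans (≡ᶠ⇒≡ u₁ y e₁) (sym (≡ᶠ⇒≡ u₂ y e₂))))
            ... | true | false rewrite sym (≡ᶠ⇒≡ u₁ y e₁) | bd∉X p₁ =
              ≤-trans (≤-reflexive (r″ w₃)) (≤-trans (w≤W u₁ (w-mono inc (bd-deg p₁))) (≤-reflexive (sym (+-identityʳ _))))
              where
              r″ : ∀ a → 0 + (1 * (2 * a) + 0) ≡ 2 * a
              r″ = solve-∀
            ... | false | true rewrite sym (≡ᶠ⇒≡ u₂ y e₂) | bd∉X b₂ =
              ≤-trans (≤-reflexive (r″ w₃)) (≤-trans (w≤W u₂ (w-mono inc (bd-deg b₂))) (≤-reflexive (sym (+-identityʳ _))))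
              where
              r″ : ∀ a → 0 + (0 + 1 * (2 * a)) ≡ 2 * a
              r″ = solve-∀
            ... | false | false with X y
            ... | false = z≤n
            ... | true = ≤-trans (≤-reflexive (r″ (w (deg y)))) (≤-trans (w≤W y ≤-refl) (≤-reflexive (sym (+-identityʳ _))))
              where
              r″ : ∀ a → 2 * (1 * a) + 0 ≡ 2 * a
              r″ = solve-∀

        Drops : ℕ → Set
        Drops x = ∀ {g′} → Removes X g g′ → measure F g′ + x ≤ measure F g

        drops : min-boundary cs α ≤ count bd → Drops (branch-gain cs α)
        drops wide-enough {g′} rem = ≤-trans (+-monoʳ-≤ (measure F g′) gain≤)
          (branch-drop g v α F inc sl (λ y → reg′ y) rem)
          where
          reg′ : ∀ y → deg y ≡ 0 ⊎ (3 ≤ deg y × deg y ≤ D)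
          reg′ y with reg y
          ... | inj₁ p = inj₁ p
          ... | inj₂ p = inj₂ (p , ≤D y)
          nout ntw : ℕ
          nout = count (outer g v α)
          ntw = count (twice g v α)
          bd-eq : count bd ≡ (D ∸ r) + nout
          bd-eq = +-cancelʳ-≡ r _ _ (trans (boundary-count g v α) (trans (cong (_+ nout) (trans deg-v (sym (m∸n+n≡m r≤D)))) (comm (D ∸ r) r nout)))
            where
            comm : ∀ a b c → a + b + c ≡ a + c + b
            comm = solve-∀
          mo≤ : min-outer cs α ≤ nout
          mo≤ = m≤n+o⇒m∸n≤o (min-boundary cs α) (D ∸ #forced cs α)
                  (≤-trans wide-enough (≤-reflexive (trans bd-eq (cong (λ k → (D ∸ k) + nout) (sym r-sum)))))
          tail : 2 * m₁ * min-outer cs α + 2 * m₂ * [ min-outer cs α <ᵇ spread cs α ] ≤ 2 * m₁ * nout + 2 * m₂ * ntw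
          tail with min-outer cs α <ᵇ spread cs α in lt
          ... | false = +-mono-≤ (*-monoʳ-≤ (2 * m₁) mo≤) (≤-trans (≤-reflexive (*-zeroʳ (2 * m₂))) z≤n)
          ... | true with m≤n⇒m<n∨m≡n mo≤
          -- A further outer vertex saves `m₁`, which covers `m₂`.
          ... | inj₁ mo<nout = ≤-trans (+-monoʳ-≤ (2 * m₁ * min-outer cs α) (≤-trans (≤-reflexive (*-identityʳ (2 * m₂))) (*-monoʳ-≤ 2 m₂≤m₁)))
                   (≤-trans (≤-reflexive (trans (+-comm _ (2 * m₁)) (sym (*-suc (2 * m₁) (min-outer cs α))))) (≤-trans (*-monoʳ-≤ (2 * m₁) mo<nout) (m≤m+n _ _)))
          ... | inj₂ mo≡nout with ntw in eq
          ... | suc k = +-mono-≤ (*-monoʳ-≤ (2 * m₁) mo≤) (*-monoʳ-≤ (2 * m₂) (s≤s z≤n))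
          -- If no vertex loses two edges, the edges out of the forced vertices end in distinct
          -- outer vertices, and `spread` exceeds their number.
          ... | zero = contradiction (≤-trans (≤-reflexive spread-sum) (exits≤outer g v α eq))
                      (<⇒≱ (subst (_< spread cs α) mo≡nout (<ᵇ⇒< _ _ (subst T (sym lt) _))))
          gain≤ : branch-gain cs α ≤ W (deg v) (sdeg v) + sum (λ y → gain F α (kind v y) (deg y)) + 2 * m₁ * nout + 2 * m₂ * ntw
          gain≤ = ≤-trans (≤-reflexive (+-assoc (W D (#soft cs) + stat cs (gain F α)) (2 * m₁ * min-outer cs α) (2 * m₂ * [ min-outer cs α <ᵇ spread cs α ])))
            (≤-trans (+-mono-≤ (≤-reflexive (cong₂ _+_ (cong₂ W (sym deg-v) soft-sum) gain-sum)) tail)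
              (≤-reflexive (sym (+-assoc (W (deg v) (sdeg v) + sum (λ y → gain F α (kind v y) (deg y))) (2 * m₁ * nout) (2 * m₂ * ntw)))))

        blocked : ∀ b₁ b₂ c → 3 ≤ c → ¬ (if b₁ then (if b₂ then 5 else 4) else 3) ≤ c → (c ≡ 3 × b₁ ≡ true) ⊎ (c ≡ 4 × b₂ ≡ true)
        blocked false _ c 3≤c ¬p = ⊥-elim (¬p 3≤c)
        blocked true b₂ 3 _ _ = inj₁ (refl , refl)
        blocked true true 4 _ _ = inj₂ (refl , refl)
        blocked true false (suc (suc (suc (suc c)))) 3≤c ¬p = ⊥-elim (¬p (s≤s (s≤s (s≤s (s≤s z≤n)))))
        blocked true true (suc (suc (suc (suc (suc c))))) 3≤c ¬p = ⊥-elim (¬p (s≤s (s≤s (s≤s (s≤s (s≤s z≤n))))))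
        blocked true b₂ 1 (s≤s ()) _
        blocked true b₂ 2 (s≤s (s≤s ())) _

        side : Good ⊎ Drops (branch-gain cs α)
        side with min-boundary cs α ≤? count bd
        ... | yes p = inj₂ (drops p)
        ... | no ¬p with blocked (unit + 2 * σ ≤ᵇ separable₁ cs α) (2 * unit + 2 * σ ≤ᵇ separable₂ cs α) (count bd) 3≤bd ¬p
        ... | inj₁ (c , e) = inj₁ (good₁ c (≤ᵇ⇒≤ (unit + 2 * σ) (separable₁ cs α) (subst T (sym e) _)))
        ... | inj₂ (c , e) = inj₁ (good₂ c (≤ᵇ⇒≤ (2 * unit + 2 * σ) (separable₂ cs α) (subst T (sym e) _)))

    -- A separation around either value of `v` settles the claim at once. Otherwise both boundaries
    -- are large, and the certificate applies to the guaranteed decreases of the two branches.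
    vertex-good : ∀ t → good-types t ≡ true → sdeg v ≤ t → Good
    vertex-good t ok t≤ with Side.side false | Side.side true
    ... | inj₁ good | _ = good
    ... | inj₂ _ | inj₁ good = good
    ... | inj₂ d₀ | inj₂ d₁ = branch v _ _ 1≤deg-v exceed d₀ d₁
      where
      either : (t <ᵇ #soft cs) ∨ good-counts cs ≡ true
      either = for-counts⁻ (length (buckets D)) D (λ cs → (t <ᵇ #soft cs) ∨ good-counts cs) ok cs (length-map _ (buckets D)) total-cs
      exceed : good-counts cs ≡ true
      exceed with t <ᵇ #soft cs in lt | either
      ... | false | p = p
      ... | true | _ = contradiction (≤-trans (≤-reflexive soft-sum) t≤) (<⇒≱ (<ᵇ⇒< _ _ (subst T (sym lt) _)))

-- Boolean checks and their meaning

true⇒T : ∀ {b} → b ≡ true → T b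
true⇒T refl = _

T⇒true : ∀ {b} → T b → b ≡ true
T⇒true {true} _ = refl

∨⁻ : ∀ {a b} → a ∨ b ≡ true → a ≡ true ⊎ b ≡ true
∨⁻ {true} _ = inj₁ refl
∨⁻ {false} p = inj₂ p

≤ᵇ-true : ∀ m n → (m ≤ᵇ n) ≡ true → m ≤ n
≤ᵇ-true m n p = ≤ᵇ⇒≤ m n (true⇒T p)

true-≤ᵇ : ∀ {m n} → m ≤ n → (m ≤ᵇ n) ≡ true
true-≤ᵇ p = T⇒true (≤⇒≤ᵇ p)

∨-right : ∀ a {b} → b ≡ true → a ∨ b ≡ true
∨-right true _ = refl
∨-right false p = p

∨-left : ∀ {a} b → a ≡ true → a ∨ b ≡ true
∨-left b refl = refl

exceeds-mono : ∀ ts {x y x′ y′} → x ≤ x′ → y ≤ y′ → exceeds ts x y ≡ true → exceeds ts x′ y′ ≡ true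
exceeds-mono ((p , q) ∷ ts) {x} {y} {x′} {y′} x≤ y≤ e with ∨⁻ {(p ≤ᵇ x) ∧ (q ≤ᵇ y)} e
... | inj₁ h with ∧⁻ {p ≤ᵇ x} h
... | h₁ , h₂ = ∨-left _ (∧⁺ (true-≤ᵇ (≤-trans (≤ᵇ-true p x h₁) x≤)) (true-≤ᵇ (≤-trans (≤ᵇ-true q y h₂) y≤)))
exceeds-mono ((p , q) ∷ ts) {x} {y} {x′} {y′} x≤ y≤ e | inj₂ e′ with ∨⁻ {(q ≤ᵇ x) ∧ (p ≤ᵇ y)} e′
... | inj₂ h = ∨-right ((p ≤ᵇ x′) ∧ (q ≤ᵇ y′)) (∨-right ((q ≤ᵇ x′) ∧ (p ≤ᵇ y′)) (exceeds-mono ts x≤ y≤ h))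
... | inj₁ h with ∧⁻ {q ≤ᵇ x} h
... | h₁ , h₂ = ∨-right ((p ≤ᵇ x′) ∧ (q ≤ᵇ y′)) (∨-left _ (∧⁺ (true-≤ᵇ (≤-trans (≤ᵇ-true q x h₁) x≤)) (true-≤ᵇ (≤-trans (≤ᵇ-true p y h₂) y≤))))

data _≼_ : List ℕ → List ℕ → Set where
  [] : [] ≼ []
  _∷_ : ∀ {c d cs ds} → c ≤ d → cs ≼ ds → (c ∷ cs) ≼ (d ∷ ds)

≼-length : ∀ {cs ds} → cs ≼ ds → length cs ≡ length ds
≼-length [] = refl
≼-length (_ ∷ ps) = cong suc (≼-length ps)

dot-mono : ∀ φ bs {cs ds} → cs ≼ ds → dot φ bs cs ≤ dot φ bs ds
dot-mono φ [] _ = z≤n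
dot-mono φ ((k , d) ∷ bs) [] = z≤n
dot-mono φ ((k , d) ∷ bs) (p ∷ ps) = +-mono-≤ (*-monoˡ-≤ (φ k d) p) (dot-mono φ bs ps)

-- Selects `m` of the counted neighbours, so that a vertex of degree above seven is treated by means
-- of seven of them.
shrink : ∀ ds m → m ≤ total ds → ∃ λ cs → cs ≼ ds × total cs ≡ m
shrink [] .0 z≤n = [] , [] , refl
shrink (d ∷ ds) m m≤ with m ≤? d
... | yes m≤d = let (cs , p , e) = shrink ds 0 z≤n in m ∷ cs , m≤d ∷ p , trans (cong (m +_) e) (+-identityʳ m)
... | no m≰d = let (cs , p , e) = shrink ds (m ∸ d) (m≤n+o⇒m∸n≤o m d m≤) in
  d ∷ cs , ≤-refl ∷ p , trans (cong (d +_) e) (m+[n∸m]≡n (<⇒≤ (≰⇒> m≰d)))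

find : ∀ {n} (P : Fin n → Bool) → (∃ λ v → P v ≡ true) ⊎ (∀ v → P v ≡ false)
find P with any P in eq
... | true = inj₁ (any⁻ P eq)
... | false = inj₂ h
  where
  h : ∀ v → P v ≡ false
  h v with P v in pv
  ... | false = refl
  ... | true with trans (sym eq) (any⁺ P v pv)
  ... | ()

false-≤ᵇ : ∀ {m n} → (m ≤ᵇ n) ≡ false → n < m
false-≤ᵇ {m} {n} p with m ≤? n
... | no m≰n = ≰⇒> m≰n
... | yes m≤n with trans (sym p) (true-≤ᵇ m≤n)
... | ()

increasing? : Weights → Bool
increasing? F = (σ ≤ᵇ w₃) ∧ (w₃ ≤ᵇ w₄) ∧ (w₄ ≤ᵇ w₅) ∧ (w₅ ≤ᵇ w₆)
  where open Weights F

increasing : ∀ F → increasing? F ≡ true → Weights.Increasing F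
increasing F p with ∧⁻ {Weights.σ F ≤ᵇ Weights.w₃ F} p
... | a , p′ with ∧⁻ {Weights.w₃ F ≤ᵇ Weights.w₄ F} p′
... | b , p″ with ∧⁻ {Weights.w₄ F ≤ᵇ Weights.w₅ F} p″
... | c , d = ≤ᵇ-true _ _ a , ≤ᵇ-true _ _ b , ≤ᵇ-true _ _ c , ≤ᵇ-true _ _ d

slopes? : Weights → (D m₁ m₂ : ℕ) → Bool
slopes? F D m₁ m₂ = forall-upto D (λ d → (d <ᵇ 3) ∨ ((w (d ∸ 1) + m₁ ≤ᵇ w d) ∧ (w (d ∸ 2) + m₂ ≤ᵇ w (d ∸ 1))))
  where open Weights F

slopes : ∀ F D m₁ m₂ → slopes? F D m₁ m₂ ≡ true → Weights.Slopes F D m₁ m₂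
slopes F D m₁ m₂ p d 3≤d d≤D with ∨⁻ {d <ᵇ 3} (forall-upto⁻ D _ p d d≤D)
... | inj₁ lt = contradiction 3≤d (<⇒≱ (<ᵇ⇒< _ _ (true⇒T lt)))
... | inj₂ q = let (a , b) = ∧⁻ {Weights.w F (d ∸ 1) + m₁ ≤ᵇ Weights.w F d} q in ≤ᵇ-true _ _ a , ≤ᵇ-true _ _ b

-- On degrees up to D, apart from degree D with at most T soft edges, the
-- weights F′ are at most F.
below? : Weights → Weights → (D T : ℕ) → Bool
below? F F′ D T = forall-upto D (λ d → forall-upto d (λ t →
  ((d ≡ᵇ D) ∧ (t ≤ᵇ T)) ∨ (d ≡ᵇ 1) ∨ (d ≡ᵇ 2) ∨ (Weights.W F′ d t ≤ᵇ Weights.W F d t)))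

record Reduced {n} (g : Graph n) : Set where
  open Graph g
  field
    degrees : ∀ y → deg y ≡ 0 ⊎ 3 ≤ deg y
    wide : ∀ v α → 1 ≤ deg v → deg v ≤ 6 → 3 ≤ count (boundary (cluster v α))

-- Good steps for a single functional

module Main (unit : ℕ) (thresholds : List (ℕ × ℕ)) (balanced : exceeds thresholds unit unit ≡ true) {n} (g : Graph n) where
  open Graph g

  sdeg≤deg : ∀ v → sdeg v ≤ deg v
  sdeg≤deg v = count-mono (λ u → isSoft⇒isEdge (kind v u))

  module _ (F : Weights) (inc : Weights.Increasing F) where
    open Weights F

    flat : ∀ D → Slopes D 0 0
    flat D d 3≤d d≤D = (≤-trans (≤-reflexive (+-identityʳ _)) (w-mono inc (m∸n≤m d 1))) , (≤-trans (≤-reflexive (+-identityʳ _)) (w-mono inc (∸-monoʳ-≤ d (s≤s z≤n))))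

    branch-drop₀ : (∀ y → deg y ≡ 0 ⊎ 3 ≤ deg y) → ∀ v α {g′} → Removes (cluster v α) g g′ →
                   measure F g′ + (W (deg v) (sdeg v) + sum (λ y → gain F α (kind v y) (deg y))) ≤ measure F g
    branch-drop₀ reg v α {g′} rem = ≤-trans (+-monoʳ-≤ (measure F g′) (≤-trans (m≤m+n _ _) (m≤m+n _ _)))
      (branch-drop g v α F inc (flat (sum deg)) reg′ rem)
      where
      reg′ : ∀ y → deg y ≡ 0 ⊎ (3 ≤ deg y × deg y ≤ sum deg)
      reg′ y with reg y
      ... | inj₁ p = inj₁ p
      ... | inj₂ p = inj₂ (p , term≤sum deg y)

    -- The weight of `v` alone is a `unit`, which both branches save.
    heavy-good : (∀ y → deg y ≡ 0 ⊎ 3 ≤ deg y) → ∀ v → 1 ≤ deg v → unit ≤ 2 * w (deg v) → Good unit thresholds g F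
    heavy-good reg v 1≤ heavy = branch v unit unit 1≤ balanced (λ rem → drops false rem) (λ rem → drops true rem)
      where
      drops : ∀ α {g′} → Removes (cluster v α) g g′ → measure F g′ + unit ≤ measure F g
      drops α {g′} rem = ≤-trans (+-monoʳ-≤ (measure F g′) (≤-trans heavy (≤-trans (m≤m+n (2 * w (deg v)) (σ * sdeg v)) (m≤m+n (W (deg v) (sdeg v)) _)))) (branch-drop₀ reg v α rem)

  module _ (red : Reduced g) where
    open Reduced red

    bounded-good : ∀ F D m₁ m₂ t → increasing? F ≡ true → slopes? F D m₁ m₂ ≡ true → (3 ≤ᵇ D) ∧ (D ≤ᵇ 6) ∧ (m₂ ≤ᵇ m₁) ≡ true →
      Local-check.good-types unit thresholds F D m₁ m₂ t ≡ true → (∀ y → deg y ≤ D) → ∀ v → deg v ≡ D → sdeg v ≤ t → Good unit thresholds g F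
    bounded-good F D m₁ m₂ t inc sl rng ok ≤D v dv tv with ∧⁻ {3 ≤ᵇ D} rng
    ... | a , rng′ with ∧⁻ {D ≤ᵇ 6} rng′
    ... | b , c = vertex-good unit thresholds g F (increasing F inc) (≤ᵇ-true 3 D a) (≤ᵇ-true D 6 b) (≤ᵇ-true m₂ m₁ c) (slopes F D m₁ m₂ sl) degrees ≤D wide v dv t ok tv

    below : ∀ F F′ D t → below? F F′ D t ≡ true → (∀ y → deg y ≤ D) → (∀ y → deg y ≡ D → t < sdeg y) → measure F′ g ≤ measure F g
    below F F′ D t ok ≤D soft-many = sum-mono h
      where
      bad : ∀ {y k} → deg y ≡ k → 1 ≤ k → k < 3 → ⊥
      bad {y} refl 1≤ <3 with degrees y
      ... | inj₁ p = contradiction (≤-trans 1≤ (≤-reflexive p)) λ ()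
      ... | inj₂ p = <⇒≱ <3 p
      h : ∀ y → Weights.W F′ (deg y) (sdeg y) ≤ Weights.W F (deg y) (sdeg y)
      h y with ∨⁻ {(deg y ≡ᵇ D) ∧ (sdeg y ≤ᵇ t)} (forall-upto⁻ (deg y) _ (forall-upto⁻ D _ ok (deg y) (≤D y)) (sdeg y) (sdeg≤deg y))
      ... | inj₁ p = let (a , b) = ∧⁻ {deg y ≡ᵇ D} p in contradiction (≤ᵇ-true (sdeg y) t b) (<⇒≱ (soft-many y (≡ᵇ⇒≡′ (deg y) D a)))
      ... | inj₂ p with ∨⁻ {deg y ≡ᵇ 1} p
      ... | inj₁ q = ⊥-elim (bad {y} (≡ᵇ⇒≡′ (deg y) 1 q) (s≤s z≤n) (s≤s (s≤s z≤n)))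
      ... | inj₂ q with ∨⁻ {deg y ≡ᵇ 2} q
      ... | inj₁ e = ⊥-elim (bad {y} (≡ᵇ⇒≡′ (deg y) 2 e) (s≤s z≤n) (s≤s (s≤s (s≤s z≤n))))
      ... | inj₂ e = ≤ᵇ-true (Weights.W F′ (deg y) (sdeg y)) (Weights.W F (deg y) (sdeg y)) e

    Heavy : Weights → ℕ → Set
    Heavy F D = ∀ d → unit ≤ 2 * Weights.w F (suc D + d)

    light : ∀ F D → increasing? F ≡ true → Heavy F D → Good unit thresholds g F ⊎ (∀ y → deg y ≤ D)
    light F D inc heavy with find (λ y → suc D ≤ᵇ deg y)
    ... | inj₂ absent = inj₂ λ y → ≤-pred (false-≤ᵇ {suc D} {deg y} (absent y))
    ... | inj₁ (v , p) = inj₁ (heavy-good F (increasing F inc) degrees v (≤-trans (s≤s z≤n) (≤ᵇ-true (suc D) (deg v) p))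
            (subst (λ d → unit ≤ 2 * Weights.w F d) (m+[n∸m]≡n (≤ᵇ-true (suc D) (deg v) p)) (heavy (deg v ∸ suc D))))

    -- Without a good step every vertex of degree `D` has more than `t` soft edges, and for such
    -- vertices, as for smaller degrees, `F′` charges no more than `F`.
    descend : ∀ F F′ D m₁ m₂ t → increasing? F ≡ true → slopes? F D m₁ m₂ ≡ true → (3 ≤ᵇ D) ∧ (D ≤ᵇ 6) ∧ (m₂ ≤ᵇ m₁) ≡ true →
      Local-check.good-types unit thresholds F D m₁ m₂ t ≡ true → Heavy F D → below? F F′ D t ≡ true → Good unit thresholds g F ⊎ measure F′ g ≤ measure F g
    descend F F′ D m₁ m₂ t inc sl rng ok heavy bel with light F D inc heavy
    ... | inj₁ good = inj₁ good
    ... | inj₂ ≤D with find (λ y → (deg y ≡ᵇ D) ∧ (sdeg y ≤ᵇ t))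
    ... | inj₁ (v , p) = let (a , b) = ∧⁻ {deg v ≡ᵇ D} p in
              inj₁ (bounded-good F D m₁ m₂ t inc sl rng ok ≤D v (≡ᵇ⇒≡′ (deg v) D a) (≤ᵇ-true (sdeg v) t b))
    ... | inj₂ absent = inj₂ (below F F′ D t bel ≤D many)
      where
      many : ∀ y → deg y ≡ D → t < sdeg y
      many y dy with t <? sdeg y
      ... | yes p = p
      ... | no ¬p with trans (sym (absent y)) (∧⁺ (T⇒true (≡⇒≡ᵇ (deg y) D dy)) (true-≤ᵇ (≮⇒≥ ¬p)))
      ... | ()

-- Degree 5 stands for all degrees from 5 on.
cap : ℕ → ℕ
cap d = d ⊓ 5

module Capped (thresholds : List (ℕ × ℕ)) (F : Weights) where
  open Weights F

  -- Beyond degree six the slope vanishes. So a neighbour in the class of degree five guarantees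
  -- only `σ` along a soft edge, its weight `w₅` (doubled) when forced, and nothing along another
  -- hard edge.
  capped-gain : Bool → Kind → ℕ → ℕ
  capped-gain α none d = 0
  capped-gain α soft d = if d ≡ᵇ 5 then σ else gain F α soft d
  capped-gain α (hard β) d = if d ≡ᵇ 5 then (if isHard α (hard β) then 2 * w₅ else 0) else gain F α (hard β) d

  capped-branch-gain : List ℕ → Bool → ℕ
  capped-branch-gain cs α = W 7 (dot (λ k _ → [ isSoft k ]) (buckets 5) cs) + dot (capped-gain α) (buckets 5) cs

  capped-good : List ℕ → Bool
  capped-good cs = exceeds thresholds (capped-branch-gain cs false) (capped-branch-gain cs true)

  module _ (inc : Increasing) where
    capped-gain≤ : ∀ α k d → 3 ≤ d → capped-gain α k (cap d) ≤ gain F α k d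
    capped-gain≤ α none d _ = z≤n
    capped-gain≤ α k 0 ()
    capped-gain≤ α k 1 (s≤s ())
    capped-gain≤ α k 2 (s≤s (s≤s ()))
    capped-gain≤ α soft 3 _ = ≤-refl
    capped-gain≤ α soft 4 _ = ≤-refl
    capped-gain≤ α soft (suc (suc (suc (suc (suc d))))) _ rewrite ⊓-zeroʳ d = m≤n+m _ _
    capped-gain≤ α (hard β) 3 _ = ≤-refl
    capped-gain≤ α (hard β) 4 _ = ≤-refl
    capped-gain≤ α (hard β) (suc (suc (suc (suc (suc d))))) _ rewrite ⊓-zeroʳ d with isHard α (hard β)
    ... | true = *-monoʳ-≤ 2 (w-mono inc {5} {5 + d} (m≤m+n 5 d))
    ... | false = z≤n

    module _ (unit : ℕ) (balanced : exceeds thresholds unit unit ≡ true) (ok-all : for-counts 9 7 capped-good ≡ true) {n} (g : Graph n) (red : Reduced g) where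
      open Graph g
      open Reduced red

      -- Seven neighbours with degrees capped at five already yield enough, which leaves finitely
      -- many local types although the degree is unbounded.
      high-good : ∀ v → 7 ≤ deg v → Good unit thresholds g F
      high-good v 7≤ = branch v (gains false) (gains true) (≤-trans (s≤s z≤n) 7≤) exceed
        (Main.branch-drop₀ unit thresholds balanced g F inc degrees v false) (Main.branch-drop₀ unit thresholds balanced g F inc degrees v true)
        where
        gains : Bool → ℕ
        gains α = W (deg v) (sdeg v) + sum (λ y → gain F α (kind v y) (deg y))
        3≤deg : ∀ y {k} → isEdge k ≡ true → kind v y ≡ k → 3 ≤ deg y
        3≤deg y e ky with degrees y
        ... | inj₂ p = p
        ... | inj₁ p = contradiction (≤-trans (∃⇒count (adj y) {v} (trans (edge-sym y v) (trans (cong isEdge ky) e))) (≤-reflexive p)) λ ()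
        key : Fin n → Key
        key y = kind v y , cap (deg y)
        ds = counts key (buckets 5)
        occ : ∀ y k → kind v y ≡ k → occurrences (k , cap (deg y)) (buckets 5) ≡ [ isEdge k ]
        occ y none _ = occurrences-none (cap (deg y)) 5 (m≤m+n 5 1)
        occ y soft ky = occurrences-edge soft (cap (deg y)) 5 refl (⊓-glb (3≤deg y refl ky) (m≤m+n 3 2)) (m⊓n≤n (deg y) 5) (m≤m+n 5 1)
        occ y (hard β) ky = occurrences-edge (hard β) (cap (deg y)) 5 refl (⊓-glb (3≤deg y refl ky) (m≤m+n 3 2)) (m⊓n≤n (deg y) 5) (m≤m+n 5 1)
        dot-sum : ∀ φ → dot φ (buckets 5) ds ≡ sum (λ y → [ adj v y ] * φ (kind v y) (cap (deg y)))
        dot-sum φ = trans (dot-counts key (buckets 5) φ) (sum-cong-≗ (λ y → cong (_* φ (kind v y) (cap (deg y))) (occ y _ refl)))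
        total-ds : total ds ≡ deg v
        total-ds = trans (trans (ones (buckets 5)) (dot-sum (λ _ _ → 1))) (sum-cong-≗ (λ y → *-identityʳ [ adj v y ]))
          where
          ones : ∀ bs → total (counts key bs) ≡ dot (λ _ _ → 1) bs (counts key bs)
          ones [] = refl
          ones (b ∷ bs) = cong₂ _+_ (sym (*-identityʳ _)) (ones bs)
        chosen = shrink ds 7 (≤-trans 7≤ (≤-reflexive (sym total-ds)))
        cs = proj₁ chosen
        cs≼ = proj₁ (proj₂ chosen)
        ok : capped-good cs ≡ true
        ok = for-counts⁻ 9 7 capped-good ok-all cs (≼-length cs≼) (proj₂ (proj₂ chosen))
        gains≥ : ∀ α → capped-branch-gain cs α ≤ gains α
        gains≥ α = +-mono-≤ (W-mono inc {7} {deg v} 7≤ soft≤) (≤-trans (dot-mono (capped-gain α) (buckets 5) cs≼) (≤-trans (≤-reflexive (dot-sum (capped-gain α))) (sum-mono h)))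
          where
          soft≤ : dot (λ k _ → [ isSoft k ]) (buckets 5) cs ≤ sdeg v
          soft≤ = ≤-trans (dot-mono (λ k _ → [ isSoft k ]) (buckets 5) cs≼) (≤-trans (≤-reflexive (dot-sum (λ k _ → [ isSoft k ]))) (sum-mono s))
            where
            s : ∀ y → [ adj v y ] * [ isSoft (kind v y) ] ≤ [ isSoft (kind v y) ]
            s y with adj v y
            ... | true = ≤-reflexive (+-identityʳ _)
            ... | false = z≤n
          h : ∀ y → [ adj v y ] * capped-gain α (kind v y) (cap (deg y)) ≤ gain F α (kind v y) (deg y)
          h y = c (kind v y) refl
            where
            c : ∀ k → kind v y ≡ k → [ isEdge k ] * capped-gain α k (cap (deg y)) ≤ gain F α k (deg y)
            c none _ = z≤n
            c soft ky = ≤-trans (≤-reflexive (+-identityʳ _)) (capped-gain≤ α soft (deg y) (3≤deg y refl ky))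
            c (hard β) ky = ≤-trans (≤-reflexive (+-identityʳ _)) (capped-gain≤ α (hard β) (deg y) (3≤deg y refl ky))
        exceed : exceeds thresholds (gains false) (gains true) ≡ true
        exceed = exceeds-mono thresholds (gains≥ false) (gains≥ true) ok

-- Passing from one functional to the next

open Capped
open Main unit thresholds refl

all-capped-good : for-counts 9 7 (capped-good thresholds f₁) ≡ true
all-capped-good = refl

all-weights : List Weights
all-weights = f₁ ∷ f₂ ∷ f₃ ∷ f₄ ∷ f₅ ∷ f₆ ∷ p₀ ∷ p₁ ∷ p₂ ∷ p₃ ∷ []

pattern at₁ = here refl
pattern at₂ = there at₁
pattern at₃ = there at₂
pattern at₄ = there at₃
pattern at₅ = there at₄
pattern at₆ = there at₅
pattern at₇ = there at₆
pattern at₈ = there at₇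
pattern at₉ = there at₈
pattern at₁₀ = there at₉

least : ∀ {n} → Graph n → List Weights → ℕ
least g [] = 0
least g (F ∷ []) = measure F g
least g (F ∷ G ∷ Fs) = measure F g ⊓ least g (G ∷ Fs)

min-measure : ∀ {n} → Graph n → ℕ
min-measure g = least g all-weights

least≤ : ∀ {n} (g : Graph n) {Fs F} → F ∈ Fs → least g Fs ≤ measure F g
least≤ g {F ∷ []} (here refl) = ≤-refl
least≤ g {F ∷ G ∷ Fs} (here refl) = m⊓n≤m _ _
least≤ g {F ∷ G ∷ Fs} (there p) = ≤-trans (m⊓n≤n (measure F g) _) (least≤ g p)

least-attained : ∀ {n} (g : Graph n) F Fs → ∃ λ G → G ∈ F ∷ Fs × least g (F ∷ Fs) ≡ measure G g
least-attained g F [] = F , here refl , refl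
least-attained g F (G ∷ Fs) with ⊓-sel (measure F g) (least g (G ∷ Fs)) | least-attained g G Fs
... | inj₁ e | _ = F , here refl , e
... | inj₂ e | H , p , e′ = H , there p , trans e e′

module _ {n} (g : Graph n) (red : Reduced g) where
  open Graph g
  open Reduced red

  -- `f₁` has a good step as soon as some degree is at least five. Without such vertices, `f₂`
  -- differs from `f₁` only in the smaller `σ`.
  first-step : Good unit thresholds g f₁ ⊎ measure f₂ g ≤ measure f₁ g
  first-step with find (λ y → 7 ≤ᵇ deg y)
  ... | inj₁ (v , p) = inj₁ (high-good thresholds f₁ (increasing f₁ refl) unit refl all-capped-good g red v (≤ᵇ-true 7 (deg v) p))
  ... | inj₂ none₇ with find (λ y → deg y ≡ᵇ 6)
  ... | inj₁ (v , p) = inj₁ (bounded-good g red f₁ 6 81 81 6 refl refl refl f₁-6 ≤6 v (≡ᵇ⇒≡′ (deg v) 6 p) (≤-trans (sdeg≤deg g v) (≤6 v)))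
    where
    ≤6 : ∀ y → deg y ≤ 6
    ≤6 y = ≤-pred (false-≤ᵇ {7} {deg y} (none₇ y))
  ... | inj₂ none₆ with find (λ y → deg y ≡ᵇ 5)
  ... | inj₁ (v , p) = inj₁ (bounded-good g red f₁ 5 277 277 5 refl refl refl f₁-5 ≤5 v (≡ᵇ⇒≡′ (deg v) 5 p) (≤-trans (sdeg≤deg g v) (≤5 v)))
    where
    ≤5 : ∀ y → deg y ≤ 5
    ≤5 y with m≤n⇒m<n∨m≡n (≤-pred (false-≤ᵇ {7} {deg y} (none₇ y)))
    ... | inj₁ (s≤s q) = q
    ... | inj₂ e with trans (sym (none₆ y)) (cong (_≡ᵇ 6) e)
    ... | ()
  -- No degree equals five, so the exemption for that degree is void.
  ... | inj₂ none₅ = inj₂ (below g red f₁ f₂ 5 5 refl (λ y → m≤n⇒m≤1+n (≤4 y)) (λ y e → contradiction (≤4 y) (<⇒≱ (≤-reflexive (sym e)))))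
    where
    ≤4 : ∀ y → deg y ≤ 4
    ≤4 y with m≤n⇒m<n∨m≡n (≤-pred (false-≤ᵇ {7} {deg y} (none₇ y)))
    ... | inj₂ e with trans (sym (none₆ y)) (cong (_≡ᵇ 6) e)
    ... | ()
    ≤4 y | inj₁ (s≤s q) with m≤n⇒m<n∨m≡n q
    ... | inj₁ (s≤s q′) = q′
    ... | inj₂ e with trans (sym (none₅ y)) (cong (_≡ᵇ 5) e)
    ... | ()

  heavy₄ : ∀ {a b c} d → unit ≤ 2 * Weights.w (weights a b c 10000 10000) (5 + d)
  heavy₄ zero = ≤ᵇ-true unit _ refl
  heavy₄ (suc d) = ≤ᵇ-true unit _ refl

  heavy₃ : ∀ {a b} d → unit ≤ 2 * Weights.w (weights a b 10000 10000 10000) (4 + d)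
  heavy₃ 0 = ≤ᵇ-true unit _ refl
  heavy₃ 1 = ≤ᵇ-true unit _ refl
  heavy₃ (suc (suc d)) = ≤ᵇ-true unit _ refl

  -- A vertex of degree three has at most three soft edges, so the last certificate leaves no local
  -- type to a further functional.
  last-step : ∀ v → 1 ≤ deg v → Good unit thresholds g p₃
  last-step v 1≤ with light g red p₃ 3 refl heavy₃
  ... | inj₁ good = good
  ... | inj₂ ≤3 with degrees v
  ... | inj₁ e = contradiction (≤-trans 1≤ (≤-reflexive e)) λ ()
  ... | inj₂ 3≤ = bounded-good g red p₃ 3 2492 10 3 refl refl refl p₃-3 ≤3 v (≤-antisym (≤3 v) 3≤) (≤-trans (sdeg≤deg g v) (≤3 v))

  Progress : Set
  Progress = ∃ λ F → F ∈ all-weights × min-measure g ≡ measure F g × Good unit thresholds g F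

  module _ (v : Fin n) (1≤ : 1 ≤ deg v) where
    private
      Minimal : Weights → Set
      Minimal F = min-measure g ≡ measure F g

      -- If the minimal `F` has no good step, the next functional is at most as large, hence minimal
      -- as well, and the search for a step continues there.
      move : ∀ {F F′} → F ∈ all-weights → F′ ∈ all-weights → Good unit thresholds g F ⊎ measure F′ g ≤ measure F g → (Minimal F′ → Progress) → Minimal F → Progress
      move {F} F∈ F′∈ (inj₁ good) _ m = F , F∈ , m , good
      move F∈ F′∈ (inj₂ le) next m = next (≤-antisym (least≤ g F′∈) (≤-trans le (≤-reflexive (sym m))))

      m₁₀ : Minimal p₃ → Progress
      m₁₀ m = p₃ , at₁₀ , m , last-step v 1≤
      m₉ : Minimal p₂ → Progress
      m₉ = move at₉ at₁₀ (descend g red p₂ p₃ 3 1837 272 2 refl refl refl p₂-3 heavy₃ refl) m₁₀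
      m₈ : Minimal p₁ → Progress
      m₈ = move at₈ at₉ (descend g red p₁ p₂ 3 1749 316 1 refl refl refl p₁-3 heavy₃ refl) m₉
      m₇ : Minimal p₀ → Progress
      m₇ = move at₇ at₈ (descend g red p₀ p₁ 3 1569 436 0 refl refl refl p₀-3 heavy₃ refl) m₈
      m₆ : Minimal f₆ → Progress
      m₆ = move at₆ at₇ (descend g red f₆ p₀ 4 1156 556 4 refl refl refl f₆-4 heavy₄ refl) m₇
      m₅ : Minimal f₅ → Progress
      m₅ = move at₅ at₆ (descend g red f₅ f₆ 4 880 694 3 refl refl refl f₅-4 heavy₄ refl) m₆
      m₄ : Minimal f₄ → Progress
      m₄ = move at₄ at₅ (descend g red f₄ f₅ 4 856 710 2 refl refl refl f₄-4 heavy₄ refl) m₅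
      m₃ : Minimal f₃ → Progress
      m₃ = move at₃ at₄ (descend g red f₃ f₄ 4 740 740 1 refl refl refl f₃-4 heavy₄ refl) m₄
      m₂ : Minimal f₂ → Progress
      m₂ = move at₂ at₃ (descend g red f₂ f₃ 4 713 713 0 refl refl refl f₂-4 heavy₄ refl) m₃
      m₁ : Minimal f₁ → Progress
      m₁ = move at₁ at₂ first-step m₂

    progress : Progress
    progress = All.lookup {P = λ F → Minimal F → Progress} (m₁ ∷ m₂ ∷ m₃ ∷ m₄ ∷ m₅ ∷ m₆ ∷ m₇ ∷ m₈ ∷ m₉ ∷ m₁₀ ∷ []) (proj₁ (proj₂ minimal)) (proj₂ (proj₂ minimal))
      where
      minimal : ∃ λ F → F ∈ all-weights × Minimal F
      minimal = least-attained g f₁ (f₂ ∷ f₃ ∷ f₄ ∷ f₅ ∷ f₆ ∷ p₀ ∷ p₁ ∷ p₂ ∷ p₃ ∷ [])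

-- A typed loop language and its compilation

infixr 5 _⊗_
data Ty : Set where
  bool idx : Ty
  _⊗_ : Ty → Ty → Ty
  arr list : Ty → Ty

Ctx : Set
Ctx = List Ty

data Var : Ctx → Ty → Set where
  z : ∀ {Γ τ} → Var (τ ∷ Γ) τ
  s : ∀ {Γ τ σ} → Var Γ τ → Var (σ ∷ Γ) τ

-- Loops run over all indices or over a list of the input, hence every term
-- takes polynomial time.
data Tm (Γ : Ctx) : Ty → Set where
  var : ∀ {τ} → Var Γ τ → Tm Γ τ
  tru fls : Tm Γ bool
  ite : ∀ {τ} → Tm Γ bool → Tm Γ τ → Tm Γ τ → Tm Γ τ
  pr : ∀ {σ τ} → Tm Γ σ → Tm Γ τ → Tm Γ (σ ⊗ τ)
  fst : ∀ {σ τ} → Tm Γ (σ ⊗ τ) → Tm Γ σ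
  snd : ∀ {σ τ} → Tm Γ (σ ⊗ τ) → Tm Γ τ
  at : ∀ {τ} → Tm Γ (arr τ) → Tm Γ idx → Tm Γ τ
  same : Tm Γ idx → Tm Γ idx → Tm Γ bool
  tab : ∀ {τ} → Tm (idx ∷ Γ) τ → Tm Γ (arr τ)
  fold : ∀ {σ} → Tm Γ σ → Tm (idx ∷ σ ∷ Γ) σ → Tm Γ σ
  foldL : ∀ {τ σ} → Tm Γ (list τ) → Tm Γ σ → Tm (τ ∷ σ ∷ Γ) σ → Tm Γ σ
  call : ∀ {Δ τ} → All (Tm Γ) Δ → Tm Δ τ → Tm Γ τ

-- The length bound belongs to the value, so that the cost of a loop over a list is bounded in terms
-- of `B` alone.
record List≤ (B : ℕ) (A : Set) : Set where
  constructor list≤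
  field
    elements : List A
    bounded : length elements ≤ B
open List≤ public

foldFin : ∀ {A : Set} n → (Fin n → A → A) → A → A
foldFin zero f a = a
foldFin (suc n) f a = foldFin n (f ∘ suc) (f zero a)

module Semantics (N B : ℕ) where

  ⟦_⟧ᵗ : Ty → Set
  ⟦ bool ⟧ᵗ = Bool
  ⟦ idx ⟧ᵗ = Fin N
  ⟦ σ ⊗ τ ⟧ᵗ = ⟦ σ ⟧ᵗ × ⟦ τ ⟧ᵗ
  ⟦ arr τ ⟧ᵗ = Fin N → ⟦ τ ⟧ᵗ
  ⟦ list τ ⟧ᵗ = List≤ B ⟦ τ ⟧ᵗ

  ⟦_⟧ᶜ : Ctx → Set
  ⟦ [] ⟧ᶜ = ⊤
  ⟦ τ ∷ Γ ⟧ᶜ = ⟦ τ ⟧ᵗ × ⟦ Γ ⟧ᶜ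

  ⟦_⟧ᵛ : ∀ {Γ τ} → Var Γ τ → ⟦ Γ ⟧ᶜ → ⟦ τ ⟧ᵗ
  ⟦ z ⟧ᵛ (a , γ) = a
  ⟦ s x ⟧ᵛ (a , γ) = ⟦ x ⟧ᵛ γ

  eval : ∀ {Γ τ} → Tm Γ τ → ⟦ Γ ⟧ᶜ → ⟦ τ ⟧ᵗ
  evals : ∀ {Γ Δ} → All (Tm Γ) Δ → ⟦ Γ ⟧ᶜ → ⟦ Δ ⟧ᶜ
  eval (var x) γ = ⟦ x ⟧ᵛ γ
  eval tru γ = true
  eval fls γ = false
  eval (ite c t u) γ = if eval c γ then eval t γ else eval u γ
  eval (pr t u) γ = eval t γ , eval u γ
  eval (fst t) γ = proj₁ (eval t γ)
  eval (snd t) γ = proj₂ (eval t γ)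
  eval (at t u) γ = eval t γ (eval u γ)
  eval (same t u) γ = eval t γ ≡ᶠ eval u γ
  eval (tab t) γ = λ i → eval t (i , γ)
  eval (fold t u) γ = foldFin N (λ i a → eval u (i , a , γ)) (eval t γ)
  eval (foldL l t u) γ = foldl (λ a x → eval u (x , a , γ)) (eval t γ) (elements (eval l γ))
  eval (call ts t) γ = eval t (evals ts γ)
  evals [] γ = tt
  evals (t ∷ ts) γ = eval t γ , evals ts γ

  encodeTable : ∀ n → (Fin n → Tree) → Tree
  encodeTable zero f = nil
  encodeTable (suc n) f = f zero ∙ encodeTable n (f ∘ suc)

  enc : ∀ τ → ⟦ τ ⟧ᵗ → Tree
  enc bool false = nil
  enc bool true = nil ∙ nil
  enc idx i = encodeUnary (toℕ i)
  enc (σ ⊗ τ) (a , b) = enc σ a ∙ enc τ b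
  enc (arr τ) f = encodeTable N (enc τ ∘ f)
  enc (list τ) l = encodeList (enc τ) (elements l)

  -- The unary `N` at the end of every environment tells the loops over indices where to stop.
  encEnv : ∀ Γ → ⟦ Γ ⟧ᶜ → Tree
  encEnv [] _ = encodeUnary N
  encEnv (τ ∷ Γ) (a , γ) = enc τ a ∙ encEnv Γ γ

-- Counts the loops, each of which becomes one recursive function of the program.
size : ∀ {Γ τ} → Tm Γ τ → ℕ
sizes : ∀ {Γ Δ} → All (Tm Γ) Δ → ℕ
size (var x) = 0
size tru = 0
size fls = 0
size (ite c t u) = size c + (size t + size u)
size (pr t u) = size t + size u
size (fst t) = size t
size (snd t) = size t
size (at t u) = size t + size u
size (same t u) = size t + size u
size (tab t) = suc (size t)
size (fold t u) = suc (size t + size u)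
size (foldL l t u) = suc (size l + (size t + size u))
size (call ts t) = sizes ts + size t
sizes [] = 0
sizes (t ∷ ts) = size t + sizes ts

pattern v0 = var zero
pattern v1 = var (suc zero)
pattern v2 = var (suc (suc zero))
pattern v3 = var (suc (suc (suc zero)))

-- Skips the environment to reach the unary `N` behind it.
dropE : ∀ {f v} → Ctx → Expr f v → Expr f v
dropE [] x = x
dropE (_ ∷ Γ) x = case x nil (dropE Γ v1)

nthE : ∀ {f v Γ τ} → Var Γ τ → Expr f v → Expr f v
nthE z x = case x nil v0
nthE (s y) x = case x nil (nthE y v1)

lookupBody sameBody : ∀ {f} → Fin f → Expr f 1
lookupBody self = case v0 nil (case v1 (case v0 nil v0) (case v2 nil (call self (v1 ∙ v3))))
sameBody self = case v0 nil (case v0 (case v1 (nil ∙ nil) nil) (case v3 nil (call self (v3 ∙ v1))))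

module Compile {f} (L E : Fin f) where

  -- `ι` places the functions of the term in the table of the whole program, and `e` is the variable
  -- that holds the environment.
  comp : ∀ {Γ τ v} (t : Tm Γ τ) → (Fin (size t) → Fin f) → Fin v → Expr f v
  comps : ∀ {Γ Δ v} (ts : All (Tm Γ) Δ) → (Fin (sizes ts) → Fin f) → Fin v → Expr f v
  comp (var x) ι e = nthE x (var e)
  comp tru ι e = nil ∙ nil
  comp fls ι e = nil
  comp (ite c t u) ι e = case (comp c (ι ∘ (_↑ˡ _)) e) (comp u (ι ∘ (size c ↑ʳ_) ∘ (size t ↑ʳ_)) e)
                             (comp t (ι ∘ (size c ↑ʳ_) ∘ (_↑ˡ size u)) (suc (suc e)))
  comp (pr t u) ι e = comp t (ι ∘ (_↑ˡ _)) e ∙ comp u (ι ∘ (size t ↑ʳ_)) e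
  comp (fst t) ι e = case (comp t ι e) nil v0
  comp (snd t) ι e = case (comp t ι e) nil v1
  comp (at t u) ι e = call L (comp t (ι ∘ (_↑ˡ _)) e ∙ comp u (ι ∘ (size t ↑ʳ_)) e)
  comp (same t u) ι e = call E (comp t (ι ∘ (_↑ˡ _)) e ∙ comp u (ι ∘ (size t ↑ʳ_)) e)
  comp {Γ} (tab t) ι e = call (ι zero) (dropE Γ (var e) ∙ (nil ∙ var e))
  comp {Γ} (fold t u) ι e = call (ι zero) (dropE Γ (var e) ∙ (nil ∙ (comp t (ι ∘ suc ∘ (_↑ˡ _)) e ∙ var e)))
  comp (foldL l t u) ι e = call (ι zero) (comp l (ι ∘ suc ∘ (_↑ˡ _)) e ∙ (comp t (ι ∘ suc ∘ (size l ↑ʳ_) ∘ (_↑ˡ size u)) e ∙ var e))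
  comp (call ts t) ι e = let′ (comps ts (ι ∘ (_↑ˡ _)) e) (comp t (ι ∘ (sizes ts ↑ʳ_)) zero)
  comps {Γ} [] ι e = dropE Γ (var e)
  comps (t ∷ ts) ι e = comp t (ι ∘ (_↑ˡ _)) e ∙ comps ts (ι ∘ (size t ↑ʳ_)) e

  -- The argument consists of the number of remaining rounds, the current index and the environment.
  -- The last two together already form the environment of the loop body.
  tabBody : ∀ {Γ τ} (t : Tm (idx ∷ Γ) τ) → (Fin (size t) → Fin f) → Fin f → Expr f 1
  tabBody t ι self = case v0 nil (case v0 nil
    (comp t ι (suc (suc (suc zero))) ∙ call self (v1 ∙ case v3 nil ((nil ∙ v0) ∙ v1))))

  foldBody : ∀ {Γ σ} (t : Tm (idx ∷ σ ∷ Γ) σ) → (Fin (size t) → Fin f) → Fin f → Expr f 1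
  foldBody t ι self = case v0 nil (case v0 (case v1 nil (case v1 nil v0))
    (call self (v1 ∙ case v3 nil ((nil ∙ v0) ∙ (comp t ι (suc (suc (suc (suc (suc zero))))) ∙ case v1 nil v1)))))

  foldLBody : ∀ {Γ τ σ} (t : Tm (τ ∷ σ ∷ Γ) σ) → (Fin (size t) → Fin f) → Fin f → Expr f 1
  foldLBody t ι self = case v0 nil (case v0 (case v1 nil v0)
    (call self (v1 ∙ (let′ (v0 ∙ v3) (comp t ι zero) ∙ case v3 nil v1))))

  code : ∀ {Γ τ} (t : Tm Γ τ) → (Fin (size t) → Fin f) → Vec (Expr f 1) (size t)
  codes : ∀ {Γ Δ} (ts : All (Tm Γ) Δ) → (Fin (sizes ts) → Fin f) → Vec (Expr f 1) (sizes ts)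
  code (var x) ι = []
  code tru ι = []
  code fls ι = []
  code (ite c t u) ι = code c (ι ∘ (_↑ˡ _)) Vec.++ (code t (ι ∘ (size c ↑ʳ_) ∘ (_↑ˡ size u)) Vec.++ code u (ι ∘ (size c ↑ʳ_) ∘ (size t ↑ʳ_)))
  code (pr t u) ι = code t (ι ∘ (_↑ˡ _)) Vec.++ code u (ι ∘ (size t ↑ʳ_))
  code (fst t) ι = code t ι
  code (snd t) ι = code t ι
  code (at t u) ι = code t (ι ∘ (_↑ˡ _)) Vec.++ code u (ι ∘ (size t ↑ʳ_))
  code (same t u) ι = code t (ι ∘ (_↑ˡ _)) Vec.++ code u (ι ∘ (size t ↑ʳ_))
  code (tab t) ι = tabBody t (ι ∘ suc) (ι zero) ∷ code t (ι ∘ suc)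
  code (fold t u) ι = foldBody u (ι ∘ suc ∘ (size t ↑ʳ_)) (ι zero) ∷ (code t (ι ∘ suc ∘ (_↑ˡ _)) Vec.++ code u (ι ∘ suc ∘ (size t ↑ʳ_)))
  code (foldL l t u) ι = foldLBody u (ι ∘ suc ∘ (size l ↑ʳ_) ∘ (size t ↑ʳ_)) (ι zero)
    ∷ (code l (ι ∘ suc ∘ (_↑ˡ _)) Vec.++ (code t (ι ∘ suc ∘ (size l ↑ʳ_) ∘ (_↑ˡ size u)) Vec.++ code u (ι ∘ suc ∘ (size l ↑ʳ_) ∘ (size t ↑ʳ_))))
  code (call ts t) ι = codes ts (ι ∘ (_↑ˡ _)) Vec.++ code t (ι ∘ (sizes ts ↑ʳ_))
  codes [] ι = []
  codes (t ∷ ts) ι = code t (ι ∘ (_↑ˡ _)) Vec.++ codes ts (ι ∘ (size t ↑ʳ_))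

costVar : ∀ {Γ τ} → Var Γ τ → ℕ
costVar z = 3
costVar (s x) = 2 + costVar x

costDrop : Ctx → ℕ
costDrop [] = 1
costDrop (_ ∷ Γ) = 2 + costDrop Γ

-- An upper bound that charges both branches of a conditional and full loops. Therefore it depends
-- on the input only through `B`.
cost : ∀ {Γ τ} → Tm Γ τ → ℕ → ℕ
costs : ∀ {Γ Δ} → All (Tm Γ) Δ → ℕ → ℕ
cost (var x) B = costVar x
cost tru B = 3
cost fls B = 1
cost (ite c t u) B = suc (cost c B + (cost t B + cost u B))
cost (pr t u) B = suc (cost t B + cost u B)
cost (fst t) B = suc (cost t B + 1)
cost (snd t) B = suc (cost t B + 1)
cost (at t u) B = suc (suc (cost t B + cost u B) + suc B * 20)
cost (same t u) B = suc (suc (cost t B + cost u B) + suc B * 20)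
cost {Γ} (tab t) B = suc (suc (costDrop Γ + 3) + suc B * (cost t B + 20))
cost {Γ} (fold t u) B = suc (suc (costDrop Γ + suc (1 + suc (cost t B + 1))) + suc B * (cost u B + 20))
cost (foldL l t u) B = suc (suc (cost l B + suc (cost t B + 1)) + suc B * (cost u B + 20))
cost (call ts t) B = suc (costs ts B + cost t B)
costs {Γ} [] B = costDrop Γ
costs (t ∷ ts) B = suc (cost t B + costs ts B)

-- Correctness and cost of compiled code

module Evaluation {f} (fs : Vec (Expr f 1) f) where

  infix 4 _⊢_⇓_≤_
  _⊢_⇓_≤_ : ∀ {v} → Vec Tree v → Expr f v → Tree → ℕ → Set
  ρ ⊢ e ⇓ a ≤ m = ∃ λ t → (fs , ρ ⊢ e ⇓ a [ t ]) × t ≤ m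

  module _ {v} {ρ : Vec Tree v} where
    evVar : ∀ {i a} → lookup ρ i ≡ a → ρ ⊢ var i ⇓ a ≤ 1
    evVar refl = 1 , ⇓var , ≤-refl

    evNil : ρ ⊢ nil ⇓ nil ≤ 1
    evNil = 1 , ⇓nil , ≤-refl

    evCons : ∀ {e₁ e₂ a b m n} → ρ ⊢ e₁ ⇓ a ≤ m → ρ ⊢ e₂ ⇓ b ≤ n → ρ ⊢ e₁ ∙ e₂ ⇓ a ∙ b ≤ suc (m + n)
    evCons (_ , p , p≤) (_ , q , q≤) = _ , ⇓∙ p q , s≤s (+-mono-≤ p≤ q≤)

    evCaseNil : ∀ {e e₁ e₂ r m n} → ρ ⊢ e ⇓ nil ≤ m → ρ ⊢ e₁ ⇓ r ≤ n → ρ ⊢ case e e₁ e₂ ⇓ r ≤ suc (m + n)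
    evCaseNil (_ , p , p≤) (_ , q , q≤) = _ , ⇓case-nil p q , s≤s (+-mono-≤ p≤ q≤)

    evCase : ∀ {e e₁ e₂ a b r m n} → ρ ⊢ e ⇓ a ∙ b ≤ m → a ∷ b ∷ ρ ⊢ e₂ ⇓ r ≤ n → ρ ⊢ case e e₁ e₂ ⇓ r ≤ suc (m + n)
    evCase (_ , p , p≤) (_ , q , q≤) = _ , ⇓case-∙ p q , s≤s (+-mono-≤ p≤ q≤)

    evLet : ∀ {e₁ e₂ a r m n} → ρ ⊢ e₁ ⇓ a ≤ m → a ∷ ρ ⊢ e₂ ⇓ r ≤ n → ρ ⊢ let′ e₁ e₂ ⇓ r ≤ suc (m + n)
    evLet (_ , p , p≤) (_ , q , q≤) = _ , ⇓let p q , s≤s (+-mono-≤ p≤ q≤)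

    evCall : ∀ {g e b a r m n} → lookup fs g ≡ b → ρ ⊢ e ⇓ a ≤ m → a ∷ [] ⊢ b ⇓ r ≤ n → ρ ⊢ call g e ⇓ r ≤ suc (m + n)
    evCall refl (_ , p , p≤) (_ , q , q≤) = _ , ⇓call p q , s≤s (+-mono-≤ p≤ q≤)

    atMost : ∀ {e a m n} → m ≤ n → ρ ⊢ e ⇓ a ≤ m → ρ ⊢ e ⇓ a ≤ n
    atMost m≤n (_ , p , p≤) = _ , p , ≤-trans p≤ m≤n

    round : ∀ {e a k n c} → ρ ⊢ e ⇓ a ≤ k + (c + n * (c + 20)) → k ≤ 20 → ρ ⊢ e ⇓ a ≤ suc n * (c + 20)
    round {k = k} {n} {c} p k≤ = atMost (≤-trans (+-monoˡ-≤ _ k≤) (≤-reflexive (r c (n * (c + 20))))) p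
      where
      r : ∀ c m → 20 + (c + m) ≡ c + 20 + m
      r = solve-∀

module Correct {f} (fs : Vec (Expr f 1) f) (L E : Fin f)
               (linkL : lookup fs L ≡ lookupBody L) (linkE : lookup fs E ≡ sameBody E)
               (N B : ℕ) (N≤B : N ≤ B) where
  open Evaluation fs public
  open Semantics N B
  open Compile L E

  dropE-correct : ∀ {v} {ρ : Vec Tree v} Γ {γ : ⟦ Γ ⟧ᶜ} {x} → ρ ⊢ x ⇓ encEnv Γ γ ≤ 1 → ρ ⊢ dropE Γ x ⇓ encodeUnary N ≤ costDrop Γ
  dropE-correct [] p = p
  dropE-correct (τ ∷ Γ) p = evCase p (dropE-correct Γ (evVar refl))

  nthE-correct : ∀ {v Γ τ} {ρ : Vec Tree v} (y : Var Γ τ) {γ : ⟦ Γ ⟧ᶜ} {x} → ρ ⊢ x ⇓ encEnv Γ γ ≤ 1 → ρ ⊢ nthE y x ⇓ enc τ (⟦ y ⟧ᵛ γ) ≤ costVar y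
  nthE-correct z p = evCase p (evVar refl)
  nthE-correct (s y) p = evCase p (nthE-correct y (evVar refl))

  lookup-correct : ∀ n (g : Fin n → Tree) j → (encodeTable n g ∙ encodeUnary (toℕ j)) ∷ [] ⊢ lookupBody L ⇓ g j ≤ suc (toℕ j) * 20
  lookup-correct (suc n) g zero = atMost (m≤m+n 7 13) (evCase (evVar refl) (evCaseNil (evVar refl) (evCase (evVar refl) (evVar refl))))
  lookup-correct (suc n) g (suc j) = atMost (+-monoˡ-≤ (suc (toℕ j) * 20) (m≤m+n 10 10))
    (evCase (evVar refl) (evCase (evVar refl) (evCase (evVar refl) (evCall linkL (evCons (evVar refl) (evVar refl)) (lookup-correct n (g ∘ suc) j)))))

  same-correct : ∀ {n} (i j : Fin n) → (encodeUnary (toℕ i) ∙ encodeUnary (toℕ j)) ∷ [] ⊢ sameBody E ⇓ enc bool (i ≡ᶠ j) ≤ suc (toℕ i) * 20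
  same-correct zero zero = atMost (m≤m+n 9 11) (evCase (evVar refl) (evCaseNil (evVar refl) (evCaseNil (evVar refl) (evCons evNil evNil))))
  same-correct zero (suc j) = atMost (m≤m+n 7 13) (evCase (evVar refl) (evCaseNil (evVar refl) (evCase (evVar refl) evNil)))
  same-correct (suc i) zero = atMost (≤-trans (m≤m+n 7 13) (m≤m+n 20 _)) (evCase (evVar refl) (evCase (evVar refl) (evCaseNil (evVar refl) evNil)))
  same-correct (suc i) (suc j) = atMost (+-monoˡ-≤ (suc (toℕ i) * 20) (m≤m+n 10 10))
    (evCase (evVar refl) (evCase (evVar refl) (evCase (evVar refl) (evCall linkE (evCons (evVar refl) (evVar refl)) (same-correct i j)))))

  index-bound : ∀ (j : Fin N) → suc (toℕ j) * 20 ≤ suc B * 20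
  index-bound j = *-monoˡ-≤ 20 (s≤s (≤-trans (<⇒≤ (toℕ<n j)) N≤B))

  Linked : ∀ {Γ τ} (t : Tm Γ τ) → (Fin (size t) → Fin f) → Set
  Linked t ι = ∀ j → lookup fs (ι j) ≡ lookup (code t ι) j

  Runs-to : ∀ {Γ τ} (t : Tm Γ τ) → (Fin (size t) → Fin f) → Set
  Runs-to {Γ} {τ} t ι = ∀ γ {v} {ρ : Vec Tree v} e → lookup ρ e ≡ encEnv Γ γ → ρ ⊢ comp t ι e ⇓ enc τ (eval t γ) ≤ cost t B

  left : ∀ {m n} (xs : Vec (Expr f 1) m) (ys : Vec (Expr f 1) n) {ι : Fin (m + n) → Fin f} →
         (∀ j → lookup fs (ι j) ≡ lookup (xs Vec.++ ys) j) → ∀ j → lookup fs (ι (j ↑ˡ n)) ≡ lookup xs j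
  left xs ys h j = trans (h _) (lookup-++ˡ xs ys j)

  right : ∀ {m n} (xs : Vec (Expr f 1) m) (ys : Vec (Expr f 1) n) {ι : Fin (m + n) → Fin f} →
          (∀ j → lookup fs (ι j) ≡ lookup (xs Vec.++ ys) j) → ∀ j → lookup fs (ι (m ↑ʳ j)) ≡ lookup ys j
  right xs ys h j = trans (h _) (lookup-++ʳ xs ys j)

  module _ {Γ τ} (t : Tm (idx ∷ Γ) τ) {ι self} (link : lookup fs self ≡ tabBody t ι self) (run : Runs-to t ι) (γ : ⟦ Γ ⟧ᶜ) where
    -- `g` lists the remaining indices. They are consecutive, so the counter `k` in the argument
    -- encodes the next one.
    tab-correct : ∀ r k (g : Fin r → Fin N) → (∀ j → toℕ (g j) ≡ k + toℕ j) →
      (encodeUnary r ∙ (encodeUnary k ∙ encEnv Γ γ)) ∷ [] ⊢ tabBody t ι self ⇓ encodeTable r (λ j → enc τ (eval t (g j , γ))) ≤ suc r * (cost t B + 20)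
    tab-correct zero k g h = atMost (≤-trans (m≤m+n 5 15) (≤-trans (m≤n+m 20 (cost t B)) (m≤m+n _ _))) (evCase (evVar refl) (evCaseNil (evVar refl) evNil))
    tab-correct (suc r) k g h = round {k = 15} {n = suc r} {c = cost t B} (atMost (≤-reflexive (eq (cost t B) (suc r * (cost t B + 20))))
      (evCase (evVar refl) (evCase (evVar refl) (evCons
        (run (g zero , γ) (suc (suc (suc zero))) (cong (λ i → encodeUnary i ∙ encEnv Γ γ) (sym (trans (h zero) (+-identityʳ k)))))
        (evCall link (evCons (evVar refl) (evCase (evVar refl) (evCons (evCons evNil (evVar refl)) (evVar refl))))
          (tab-correct r (suc k) (g ∘ suc) (λ j → trans (h (suc j)) (+-suc k (toℕ j))))))))) (m≤m+n 15 5)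
      where
      eq : ∀ c n → suc (1 + suc (1 + suc (c + suc (suc (1 + suc (1 + suc (suc (1 + 1) + 1))) + n)))) ≡ 15 + (c + n)
      eq = solve-∀

  module _ {Γ σ} (t : Tm (idx ∷ σ ∷ Γ) σ) {ι self} (link : lookup fs self ≡ foldBody t ι self) (run : Runs-to t ι) (γ : ⟦ Γ ⟧ᶜ) where
    fold-correct : ∀ r k (g : Fin r → Fin N) → (∀ j → toℕ (g j) ≡ k + toℕ j) → ∀ a →
      (encodeUnary r ∙ (encodeUnary k ∙ (enc σ a ∙ encEnv Γ γ))) ∷ [] ⊢ foldBody t ι self ⇓ enc σ (foldFin r (λ j a → eval t (g j , a , γ)) a) ≤ suc r * (cost t B + 20)
    fold-correct zero k g h a = atMost (≤-trans (m≤m+n 9 11) (≤-trans (m≤n+m 20 (cost t B)) (m≤m+n _ _)))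
      (evCase (evVar refl) (evCaseNil (evVar refl) (evCase (evVar refl) (evCase (evVar refl) (evVar refl)))))
    fold-correct (suc r) k g h a = round {k = 17} {n = suc r} {c = cost t B} (atMost (≤-reflexive (eq (cost t B) (suc r * (cost t B + 20))))
      (evCase (evVar refl) (evCase (evVar refl) (evCall link
        (evCons (evVar refl) (evCase (evVar refl) (evCons (evCons evNil (evVar refl))
          (evCons (run (g zero , a , γ) (suc (suc (suc (suc (suc zero))))) (cong (λ i → encodeUnary i ∙ (enc σ a ∙ encEnv Γ γ)) (sym (trans (h zero) (+-identityʳ k)))))
                  (evCase (evVar refl) (evVar refl))))))
        (fold-correct r (suc k) (g ∘ suc) (λ j → trans (h (suc j)) (+-suc k (toℕ j))) (eval t (g zero , a , γ))))))) (m≤m+n 17 3)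
      where
      eq : ∀ c n → suc (1 + suc (1 + suc (suc (1 + suc (1 + suc (suc (1 + 1) + suc (c + suc (1 + 1))))) + n))) ≡ 17 + (c + n)
      eq = solve-∀

  module _ {Γ τ σ} (t : Tm (τ ∷ σ ∷ Γ) σ) {ι self} (link : lookup fs self ≡ foldLBody t ι self) (run : Runs-to t ι) (γ : ⟦ Γ ⟧ᶜ) where
    foldL-correct : ∀ l a → (encodeList (enc τ) l ∙ (enc σ a ∙ encEnv Γ γ)) ∷ [] ⊢ foldLBody t ι self ⇓ enc σ (foldl (λ a x → eval t (x , a , γ)) a l)
                            ≤ suc (length l) * (cost t B + 20)
    foldL-correct [] a = atMost (≤-trans (m≤m+n 7 13) (≤-trans (m≤n+m 20 (cost t B)) (m≤m+n _ _)))
      (evCase (evVar refl) (evCaseNil (evVar refl) (evCase (evVar refl) (evVar refl))))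
    foldL-correct (x ∷ l) a = round {k = 15} {n = suc (length l)} {c = cost t B} (atMost (≤-reflexive (eq (cost t B) (suc (length l) * (cost t B + 20))))
      (evCase (evVar refl) (evCase (evVar refl) (evCall link
        (evCons (evVar refl) (evCons (evLet (evCons (evVar refl) (evVar refl)) (run (x , a , γ) zero refl)) (evCase (evVar refl) (evVar refl))))
        (foldL-correct l (eval t (x , a , γ))))))) (m≤m+n 15 5)
      where
      eq : ∀ c n → suc (1 + suc (1 + suc (suc (1 + suc (suc (suc (1 + 1) + c) + suc (1 + 1))) + n))) ≡ 15 + (c + n)
      eq = solve-∀

  comp-correct : ∀ {Γ τ} (t : Tm Γ τ) ι → Linked t ι → Runs-to t ι
  comps-correct : ∀ {Γ Δ} (ts : All (Tm Γ) Δ) ι → (∀ j → lookup fs (ι j) ≡ lookup (codes ts ι) j) →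
    ∀ γ {v} {ρ : Vec Tree v} e → lookup ρ e ≡ encEnv Γ γ → ρ ⊢ comps ts ι e ⇓ encEnv Δ (evals ts γ) ≤ costs ts B
  comp-correct (var x) ι l γ e p = nthE-correct x (evVar p)
  comp-correct tru ι l γ e p = evCons evNil evNil
  comp-correct fls ι l γ e p = evNil
  comp-correct (ite c t u) ι l γ e p with eval c γ | comp-correct c _ (left (code c _) _ l) γ e p
  ... | true | q = atMost (s≤s (+-monoʳ-≤ (cost c B) (m≤m+n _ _)))
                     (evCase q (comp-correct t _ (left (code t _) (code u _) (right (code c _) _ l)) γ (suc (suc e)) p))
  ... | false | q = atMost (s≤s (+-monoʳ-≤ (cost c B) (m≤n+m _ _)))
                     (evCaseNil q (comp-correct u _ (right (code t _) (code u _) (right (code c _) _ l)) γ e p))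
  comp-correct (pr t u) ι l γ e p = evCons (comp-correct t _ (left (code t _) (code u _) l) γ e p) (comp-correct u _ (right (code t _) (code u _) l) γ e p)
  comp-correct (fst t) ι l γ e p = evCase (comp-correct t ι l γ e p) (evVar refl)
  comp-correct (snd t) ι l γ e p = evCase (comp-correct t ι l γ e p) (evVar refl)
  comp-correct (at t u) ι l γ e p = evCall linkL
    (evCons (comp-correct t _ (left (code t _) (code u _) l) γ e p) (comp-correct u _ (right (code t _) (code u _) l) γ e p))
    (atMost (index-bound (eval u γ)) (lookup-correct N _ (eval u γ)))
  comp-correct (same t u) ι l γ e p = evCall linkE
    (evCons (comp-correct t _ (left (code t _) (code u _) l) γ e p) (comp-correct u _ (right (code t _) (code u _) l) γ e p))
    (atMost (index-bound (eval t γ)) (same-correct (eval t γ) (eval u γ)))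
  comp-correct {Γ} (tab t) ι l γ e p = evCall (l zero) (evCons (dropE-correct Γ (evVar p)) (evCons evNil (evVar p)))
    (atMost (*-monoˡ-≤ (cost t B + 20) (s≤s N≤B)) (tab-correct t (l zero) (comp-correct t (ι ∘ suc) (l ∘ suc)) γ N 0 id (λ _ → refl)))
  comp-correct {Γ} (fold t u) ι l γ e p = evCall (l zero)
    (evCons (dropE-correct Γ (evVar p)) (evCons evNil (evCons (comp-correct t _ (left (code t _) (code u _) (l ∘ suc)) γ e p) (evVar p))))
    (atMost (*-monoˡ-≤ (cost u B + 20) (s≤s N≤B)) (fold-correct u (l zero) (comp-correct u _ (right (code t _) (code u _) (l ∘ suc))) γ N 0 id (λ _ → refl) (eval t γ)))
  comp-correct (foldL x t u) ι l γ e p = evCall (l zero)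
    (evCons (comp-correct x _ (left (code x _) _ (l ∘ suc)) γ e p)
      (evCons (comp-correct t _ (left (code t _) (code u _) (right (code x _) _ (l ∘ suc))) γ e p) (evVar p)))
    (atMost (*-monoˡ-≤ (cost u B + 20) (s≤s (bounded (eval x γ))))
      (foldL-correct u (l zero) (comp-correct u _ (right (code t _) (code u _) (right (code x _) _ (l ∘ suc)))) γ (elements (eval x γ)) (eval t γ)))
  comp-correct (call ts t) ι l γ e p = evLet (comps-correct ts _ (left (codes ts _) (code t _) l) γ e p)
    (comp-correct t _ (right (codes ts _) (code t _) l) (evals ts γ) zero refl)
  comps-correct {Γ} [] ι l γ e p = dropE-correct Γ (evVar p)
  comps-correct (t ∷ ts) ι l γ e p = evCons (comp-correct t _ (left (code t _) (codes ts _) l) γ e p) (comps-correct ts _ (right (code t _) (codes ts _) l) γ e p)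

-- Polynomial cost bounds

Polynomial : (ℕ → ℕ) → Set
Polynomial f = ∃₂ λ C d → ∀ B → f B ≤ C * suc B ^ d

poly-const : ∀ c → Polynomial (λ _ → c)
poly-const c = c , 0 , λ B → ≤-reflexive (sym (*-identityʳ c))

poly-suc : Polynomial suc
poly-suc = 1 , 1 , λ B → ≤-reflexive (sym (trans (+-identityʳ _) (*-identityʳ (suc B))))

poly-+ : ∀ {f g} → Polynomial f → Polynomial g → Polynomial (λ B → f B + g B)
poly-+ {f} {g} (C , d , p) (D , e , q) = C + D , d + e , λ B → begin
  f B + g B ≤⟨ +-mono-≤ (p B) (q B) ⟩
  C * suc B ^ d + D * suc B ^ e ≤⟨ +-mono-≤ (*-monoʳ-≤ C (^-monoʳ-≤ (suc B) (m≤m+n d e))) (*-monoʳ-≤ D (^-monoʳ-≤ (suc B) (m≤n+m e d))) ⟩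
  C * suc B ^ (d + e) + D * suc B ^ (d + e) ≡⟨ *-distribʳ-+ (suc B ^ (d + e)) C D ⟨
  (C + D) * suc B ^ (d + e) ∎
  where open ≤-Reasoning

poly-* : ∀ {f g} → Polynomial f → Polynomial g → Polynomial (λ B → f B * g B)
poly-* {f} {g} (C , d , p) (D , e , q) = C * D , d + e , λ B → begin
  f B * g B ≤⟨ *-mono-≤ (p B) (q B) ⟩
  C * suc B ^ d * (D * suc B ^ e) ≡⟨ r C (suc B ^ d) D (suc B ^ e) ⟩
  C * D * (suc B ^ d * suc B ^ e) ≡⟨ cong (C * D *_) (^-distribˡ-+-* (suc B) d e) ⟨
  C * D * suc B ^ (d + e) ∎
  where
  open ≤-Reasoning
  r : ∀ a b c d → a * b * (c * d) ≡ a * c * (b * d)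
  r = solve-∀

poly-1+ : ∀ {f} → Polynomial f → Polynomial (λ B → suc (f B))
poly-1+ p = poly-+ (poly-const 1) p

cost-poly : ∀ {Γ τ} (t : Tm Γ τ) → Polynomial (cost t)
costs-poly : ∀ {Γ Δ} (ts : All (Tm Γ) Δ) → Polynomial (costs ts)
cost-poly (var x) = poly-const (costVar x)
cost-poly tru = poly-const 3
cost-poly fls = poly-const 1
cost-poly (ite c t u) = poly-1+ (poly-+ (cost-poly c) (poly-+ (cost-poly t) (cost-poly u)))
cost-poly (pr t u) = poly-1+ (poly-+ (cost-poly t) (cost-poly u))
cost-poly (fst t) = poly-1+ (poly-+ (cost-poly t) (poly-const 1))
cost-poly (snd t) = poly-1+ (poly-+ (cost-poly t) (poly-const 1))
cost-poly (at t u) = poly-1+ (poly-+ (poly-1+ (poly-+ (cost-poly t) (cost-poly u))) (poly-* poly-suc (poly-const 20)))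
cost-poly (same t u) = poly-1+ (poly-+ (poly-1+ (poly-+ (cost-poly t) (cost-poly u))) (poly-* poly-suc (poly-const 20)))
cost-poly {Γ} (tab t) = poly-1+ (poly-+ (poly-const (suc (costDrop Γ + 3))) (poly-* poly-suc (poly-+ (cost-poly t) (poly-const 20))))
cost-poly {Γ} (fold t u) = poly-1+ (poly-+ (poly-1+ (poly-+ (poly-const (costDrop Γ)) (poly-1+ (poly-+ (poly-const 1) (poly-1+ (poly-+ (cost-poly t) (poly-const 1)))))))
                                    (poly-* poly-suc (poly-+ (cost-poly u) (poly-const 20))))
cost-poly (foldL l t u) = poly-1+ (poly-+ (poly-1+ (poly-+ (cost-poly l) (poly-1+ (poly-+ (cost-poly t) (poly-const 1))))) (poly-* poly-suc (poly-+ (cost-poly u) (poly-const 20))))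
cost-poly (call ts t) = poly-1+ (poly-+ (costs-poly ts) (cost-poly t))
costs-poly {Γ} [] = poly-const (costDrop Γ)
costs-poly (t ∷ ts) = poly-1+ (poly-+ (cost-poly t) (costs-poly ts))

-- Arithmetic modulo 2 ^ N

module Modular (M : ℕ) .{{_ : NonZero M}} where
  infix 4 _≈_
  _≈_ : ℕ → ℕ → Set
  x ≈ y = x % M ≡ y % M

  +-cong : ∀ {a b c d} → a ≈ b → c ≈ d → a + c ≈ b + d
  +-cong {a} {b} {c} {d} p q = trans (%-distribˡ-+ a c M) (trans (cong₂ (λ x y → (x + y) % M) p q) (sym (%-distribˡ-+ b d M)))

  *-cong : ∀ {a b c d} → a ≈ b → c ≈ d → a * c ≈ b * d
  *-cong {a} {b} {c} {d} p q = trans (%-distribˡ-* a c M) (trans (cong₂ (λ x y → (x * y) % M) p q) (sym (%-distribˡ-* b d M)))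

  sum-cong : ∀ {n} {f g : Fin n → ℕ} → (∀ i → f i ≈ g i) → sum f ≈ sum g
  sum-cong {zero} p = refl
  sum-cong {suc n} {f} {g} p = +-cong {f zero} {g zero} (p zero) (sum-cong (p ∘ suc))

  multiple≈ : ∀ x k → x + M * k ≈ x
  multiple≈ x k = trans (cong (λ m → (x + m) % M) (*-comm M k)) ([m+kn]%n≡m%n x k M)

  ≈⇒≡ : ∀ {x y} → x < M → y < M → x ≈ y → x ≡ y
  ≈⇒≡ x< y< p = trans (sym (m<n⇒m%n≡m x<)) (trans p (m<n⇒m%n≡m y<))

xor³ maj : Bool → Bool → Bool → Bool
xor³ a b c = if a then (if b then c else (if c then false else true)) else (if b then (if c then false else true) else c)
maj a b c = if a then (if b then true else c) else (if b then c else false)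

full-adder : ∀ a b c → [ xor³ a b c ] + 2 * [ maj a b c ] ≡ [ a ] + [ b ] + [ c ]
full-adder true true true = refl
full-adder true true false = refl
full-adder true false true = refl
full-adder true false false = refl
full-adder false true true = refl
full-adder false true false = refl
full-adder false false true = refl
full-adder false false false = refl

val : ∀ {n} → (Fin n → Bool) → ℕ
val {zero} a = 0
val {suc n} a = [ a zero ] + 2 * val (a ∘ suc)

val-cong : ∀ {n} {a b : Fin n → Bool} → (∀ i → a i ≡ b i) → val a ≡ val b
val-cong {zero} p = refl
val-cong {suc n} p = cong₂ (λ x y → [ x ] + 2 * y) (p zero) (val-cong (p ∘ suc))

val< : ∀ {n} (a : Fin n → Bool) → val a < 2 ^ n
val< {zero} a = s≤s z≤n
val< {suc n} a = begin-strict
  [ a zero ] + 2 * val (a ∘ suc) ≤⟨ +-monoˡ-≤ _ ([]≤1 (a zero)) ⟩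
  1 + 2 * val (a ∘ suc) <⟨ n<1+n _ ⟩
  2 + 2 * val (a ∘ suc) ≡⟨ *-suc 2 (val (a ∘ suc)) ⟨
  2 * suc (val (a ∘ suc)) ≤⟨ *-monoʳ-≤ 2 (val< (a ∘ suc)) ⟩
  2 * 2 ^ n ∎
  where open ≤-Reasoning

val≡0 : ∀ {n} (a : Fin n → Bool) → (∀ i → a i ≡ false) → val a ≡ 0
val≡0 {zero} a p = refl
val≡0 {suc n} a p rewrite p zero | val≡0 (a ∘ suc) (p ∘ suc) = refl

carry : ∀ {n} → (a b : Fin n → Bool) → Bool → Fin n → Bool
carry a b c zero = c
carry a b c (suc i) = carry (a ∘ suc) (b ∘ suc) (maj (a zero) (b zero) c) i

carry-out : ∀ {n} → (a b : Fin n → Bool) → Bool → Bool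
carry-out {zero} a b c = c
carry-out {suc n} a b c = carry-out (a ∘ suc) (b ∘ suc) (maj (a zero) (b zero) c)

add-val : ∀ {n} (a b : Fin n → Bool) c → val (λ i → xor³ (a i) (b i) (carry a b c i)) + 2 ^ n * [ carry-out a b c ] ≡ val a + val b + [ c ]
add-val {zero} a b c = +-identityʳ _
add-val {suc n} a b c = begin
  [ x ] + 2 * v + 2 * 2 ^ n * [ o ] ≡⟨ r₁ [ x ] v (2 ^ n) [ o ] ⟩
  [ x ] + 2 * (v + 2 ^ n * [ o ]) ≡⟨ cong (λ k → [ x ] + 2 * k) (add-val (a ∘ suc) (b ∘ suc) m) ⟩
  [ x ] + 2 * (va + vb + [ m ]) ≡⟨ r₂ [ x ] va vb [ m ] ⟩
  [ x ] + 2 * [ m ] + (2 * va + 2 * vb) ≡⟨ cong (_+ (2 * va + 2 * vb)) (full-adder (a zero) (b zero) c) ⟩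
  [ a zero ] + [ b zero ] + [ c ] + (2 * va + 2 * vb) ≡⟨ r₃ [ a zero ] [ b zero ] [ c ] va vb ⟩
  [ a zero ] + 2 * va + ([ b zero ] + 2 * vb) + [ c ] ∎
  where
  open ≡-Reasoning
  m = maj (a zero) (b zero) c
  x = xor³ (a zero) (b zero) c
  v = val (λ i → xor³ (a (suc i)) (b (suc i)) (carry (a ∘ suc) (b ∘ suc) m i))
  o = carry-out (a ∘ suc) (b ∘ suc) m
  va = val (a ∘ suc)
  vb = val (b ∘ suc)
  r₁ : ∀ x v p o → x + 2 * v + 2 * p * o ≡ x + 2 * (v + p * o)
  r₁ = solve-∀
  r₂ : ∀ x a b m → x + 2 * (a + b + m) ≡ x + 2 * m + (2 * a + 2 * b)
  r₂ = solve-∀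
  r₃ : ∀ x y c a b → x + y + c + (2 * a + 2 * b) ≡ x + 2 * a + (y + 2 * b) + c
  r₃ = solve-∀

num : Ty
num = arr bool

pattern x0 = var z
pattern x1 = var (s z)
pattern x2 = var (s (s z))
pattern x3 = var (s (s (s z)))
pattern x4 = var (s (s (s (s z))))
pattern x5 = var (s (s (s (s (s z)))))
pattern x6 = var (s (s (s (s (s (s z))))))
pattern x7 = var (s (s (s (s (s (s (s z)))))))

xorT majT : ∀ {Γ} → Tm Γ bool → Tm Γ bool → Tm Γ bool → Tm Γ bool
xorT a b c = ite a (ite b c (ite c fls tru)) (ite b (ite c fls tru) c)
majT a b c = ite a (ite b tru c) (ite b c fls)

opaque
  -- The entries of a table are computed independently of each other. So each output bit runs over
  -- all positions with the current carry, and stores the carry that arrives at its own position.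
  addcT : Tm (num ∷ num ∷ bool ∷ []) num
  addcT = tab (xorT (at x1 x0) (at x2 x0)
    (snd (fold (pr x3 fls) (pr (majT (at x3 x0) (at x4 x0) (fst x1)) (ite (same x0 x2) (fst x1) (snd x1))))))

zeroT : ∀ {Γ} → Tm Γ num
zeroT = tab fls

add : ∀ {Γ} → Tm Γ num → Tm Γ num → Tm Γ num
add t u = call (t ∷ u ∷ fls ∷ []) addcT

doubleT double+1T incT : Tm (num ∷ []) num
doubleT = call (x0 ∷ x0 ∷ fls ∷ []) addcT
double+1T = call (x0 ∷ x0 ∷ tru ∷ []) addcT
incT = call (x0 ∷ zeroT ∷ tru ∷ []) addcT

opaque
  -- Schoolbook multiplication: the pair holds the partial sum and the first factor, doubled once
  -- per bit of the second. Dropping the overflow is right modulo `2 ^ N`.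
  mulT : Tm (num ∷ num ∷ []) num
  mulT = fst (fold (pr zeroT x0) (pr (ite (at x3 x0) (add (fst x1) (snd x1)) (fst x1)) (call (snd x1 ∷ []) doubleT)))

mul : ∀ {Γ} → Tm Γ num → Tm Γ num → Tm Γ num
mul t u = call (t ∷ u ∷ []) mulT

opaque
  -- Runs from the least significant bit upwards, so that a difference in a higher bit overrides the
  -- verdict so far.
  leT : Tm (num ∷ num ∷ []) bool
  leT = fold tru (ite (at x2 x0) (ite (at x3 x0) x1 fls) (ite (at x3 x0) tru x1))

le : ∀ {Γ} → Tm Γ num → Tm Γ num → Tm Γ bool
le t u = call (t ∷ u ∷ []) leT

constᵇ : ∀ {Γ} → ℕᵇ → Tm Γ num
constᵇ Bin.zero = zeroT
constᵇ 2[1+ x ] = call (call (constᵇ x ∷ []) double+1T ∷ []) incT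
constᵇ 1+[2 x ] = call (constᵇ x ∷ []) double+1T

const : ∀ {Γ} → ℕ → Tm Γ num
const n = constᵇ (Bin.fromℕ n)

isZero : ∀ {Γ} → Tm Γ num → Tm Γ bool
isZero t = le t zeroT

module _ (N B : ℕ) where
  open Semantics N B
  private
    M = 2 ^ N
    instance
      M≢0 : NonZero M
      M≢0 = m^n≢0 2 N
  open Modular M

  Num : Set
  Num = Fin N → Bool

  private
    capture : ∀ {n} (a b g : Fin n → Bool) → Fin n → Bool × Bool → Bool × Bool
    capture a b g j (c , p) = maj (a j) (b j) c , (if g j then c else p)

    capture-never : ∀ {n} (a b : Fin n → Bool) c p → proj₂ (foldFin n (capture a b (λ _ → false)) (c , p)) ≡ p
    capture-never {zero} a b c p = refl
    capture-never {suc n} a b c p = capture-never (a ∘ suc) (b ∘ suc) _ p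

    capture-at : ∀ {n} (a b : Fin n → Bool) i c p → proj₂ (foldFin n (capture a b (_≡ᶠ i)) (c , p)) ≡ carry a b c i
    capture-at {suc n} a b zero c p = capture-never (a ∘ suc) (b ∘ suc) _ c
    capture-at {suc n} a b (suc i) c p = capture-at (a ∘ suc) (b ∘ suc) i _ p

  opaque
    unfolding addcT

    addc-val : ∀ (a b : Num) c → val (eval addcT (a , b , c , tt)) ≈ val a + val b + [ c ]
    addc-val a b c = begin
      val (eval addcT (a , b , c , tt)) % M ≡⟨ cong (_% M) (val-cong (λ i → cong (xor³ (a i) (b i)) (capture-at a b i c false))) ⟩
      val (λ i → xor³ (a i) (b i) (carry a b c i)) % M ≡⟨ multiple≈ _ [ carry-out a b c ] ⟨
      (val (λ i → xor³ (a i) (b i) (carry a b c i)) + M * [ carry-out a b c ]) % M ≡⟨ cong (_% M) (add-val a b c) ⟩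
      (val a + val b + [ c ]) % M ∎
      where open ≡-Reasoning

  module _ {Γ} (γ : ⟦ Γ ⟧ᶜ) where
    zero-val : val (eval {Γ} zeroT γ) ≡ 0
    zero-val = val≡0 {N} _ (λ _ → refl)

    add-term : ∀ t u → val (eval (add t u) γ) ≈ val (eval t γ) + val (eval u γ)
    add-term t u = trans (addc-val (eval t γ) (eval u γ) false) (cong (_% M) (+-identityʳ _))

    opaque
      unfolding mulT

      mul-term : ∀ t u → val (eval (mul t u) γ) ≈ val (eval t γ) * val (eval u γ)
      mul-term t u = trans (step N b (eval {Γ} zeroT γ) a) (cong (_% M) (cong (_+ val a * val b) zero-val))
        where
        a b : Num
        a = eval t γ
        b = eval u γ
        go : ∀ {n} → (Fin n → Bool) → Fin n → Num × Num → Num × Num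
        go b i (acc , sh) = (if b i then eval addcT (acc , sh , false , tt) else acc) , eval addcT (sh , sh , false , tt)
        step : ∀ n (b : Fin n → Bool) acc sh → val (proj₁ (foldFin n (go b) (acc , sh))) ≈ val acc + val sh * val b
        step zero b acc sh = cong (_% M) (sym (trans (cong (val acc +_) (*-zeroʳ (val sh))) (+-identityʳ _)))
        step (suc n) b acc sh with b zero
        ... | true = trans (step n (b ∘ suc) _ _) (trans (+-cong {val (eval addcT (acc , sh , false , tt))} (addc-val acc sh false) (*-cong {val (eval addcT (sh , sh , false , tt))} {_} {val (b ∘ suc)} (addc-val sh sh false) refl))
                        (cong (_% M) (r (val acc) (val sh) (val (b ∘ suc)))))
          where
          r : ∀ a h w → a + h + 0 + (h + h + 0) * w ≡ a + h * (1 + 2 * w)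
          r = solve-∀
        ... | false = trans (step n (b ∘ suc) _ _) (trans (+-cong {val acc} refl (*-cong {val (eval addcT (sh , sh , false , tt))} {_} {val (b ∘ suc)} (addc-val sh sh false) refl))
                        (cong (_% M) (r (val acc) (val sh) (val (b ∘ suc)))))
          where
          r : ∀ a h w → a + (h + h + 0) * w ≡ a + h * (0 + 2 * w)
          r = solve-∀

    constᵇ-val : ∀ x → val (eval (constᵇ x) γ) ≈ Bin.toℕ x
    constᵇ-val Bin.zero = cong (_% M) zero-val
    constᵇ-val 2[1+ x ] = trans (addc-val d (eval {num ∷ []} zeroT (d , tt)) true)
        (trans (+-cong {val d + val (eval {num ∷ []} zeroT (d , tt))} {Bin.toℕ x + Bin.toℕ x + 1 + 0} {1} {1}
          (+-cong {val d} (trans (addc-val c c true) (+-cong {val c + val c} {Bin.toℕ x + Bin.toℕ x} {1} (+-cong {val c} (constᵇ-val x) (constᵇ-val x)) refl)) (cong (_% M) (val≡0 {N} _ (λ _ → refl)))) refl)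
          (cong (_% M) (r (Bin.toℕ x))))
      where
      c = eval (constᵇ x) γ
      d = eval double+1T (c , tt)
      r : ∀ x → x + x + 1 + 0 + 1 ≡ 2 * (1 + x)
      r = solve-∀
    constᵇ-val 1+[2 x ] = trans (addc-val c c true) (trans (+-cong {val c + val c} {Bin.toℕ x + Bin.toℕ x} {1} (+-cong {val c} (constᵇ-val x) (constᵇ-val x)) refl) (cong (_% M) (r (Bin.toℕ x))))
      where
      c = eval (constᵇ x) γ
      r : ∀ x → x + x + 1 ≡ 1 + 2 * x
      r = solve-∀

    const-val : ∀ n → val (eval (const n) γ) ≈ n
    const-val n = trans (constᵇ-val (Bin.fromℕ n)) (cong (_% M) (toℕ-fromℕ n))

  private
    cmp : ∀ {n} → (a b : Fin n → Bool) → Fin n → Bool → Bool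
    cmp a b i p = if a i then (if b i then p else false) else (if b i then true else p)

    -- `p` is the verdict brought along from lower bits. It matters only in a tie, where it decides
    -- between weak and strict inequality.
    cmp-⇒ : ∀ {n} (a b : Fin n → Bool) p → foldFin n (cmp a b) p ≡ true → val a < val b + [ p ]
    cmp-⇒ {zero} a b p h rewrite h = s≤s z≤n
    cmp-⇒ {suc n} a b p h with a zero | b zero | p | cmp-⇒ (a ∘ suc) (b ∘ suc) _ h
    ... | true | true | p | q = lower p q
      where
      lower : ∀ p → val (a ∘ suc) < val (b ∘ suc) + [ p ] → 1 + 2 * val (a ∘ suc) < 1 + 2 * val (b ∘ suc) + [ p ]
      lower true q = s≤s (≤-trans (≤-reflexive (+-comm 1 _)) (+-monoˡ-≤ 1 (*-monoʳ-≤ 2 (≤-pred (≤-trans q (≤-reflexive (+-comm _ 1)))))))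
      lower false q = s≤s (≤-trans (*-monoʳ-< 2 (≤-trans q (≤-reflexive (+-identityʳ _)))) (≤-reflexive (sym (+-identityʳ _))))
    ... | true | false | p | q = ≤-trans (≤-trans (≤-reflexive (sym (*-suc 2 (val (a ∘ suc))))) (*-monoʳ-≤ 2 (≤-trans q (≤-reflexive (+-identityʳ _))))) (m≤m+n _ [ p ])
    ... | false | true | p | q = s≤s (≤-trans (*-monoʳ-≤ 2 (≤-pred (≤-trans q (≤-reflexive (+-comm _ 1))))) (m≤m+n _ [ p ]))
    ... | false | false | true | q = ≤-trans (s≤s (*-monoʳ-≤ 2 (≤-pred (≤-trans q (≤-reflexive (+-comm _ 1)))))) (≤-reflexive (+-comm 1 _))
    ... | false | false | false | q = ≤-trans (*-monoʳ-< 2 (≤-trans q (≤-reflexive (+-identityʳ _)))) (≤-reflexive (sym (+-identityʳ _)))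

    cmp-⇐ : ∀ {n} (a b : Fin n → Bool) p → foldFin n (cmp a b) p ≡ false → val b + [ p ] ≤ val a
    cmp-⇐ {zero} a b p h rewrite h = z≤n
    cmp-⇐ {suc n} a b p h with a zero | b zero | p | cmp-⇐ (a ∘ suc) (b ∘ suc) _ h
    ... | true | true | true | q = s≤s (≤-trans (≤-trans (≤-trans (+-monoʳ-≤ (2 * val (b ∘ suc)) (n≤1+n 1)) (≤-reflexive (sym (*-distribˡ-+ 2 (val (b ∘ suc)) 1)))) (*-monoʳ-≤ 2 q)) ≤-refl)
    ... | true | true | false | q = s≤s (≤-trans (≤-reflexive (+-identityʳ _)) (*-monoʳ-≤ 2 (≤-trans (≤-reflexive (sym (+-identityʳ _))) q)))
    ... | true | false | p | q = ≤-trans (+-mono-≤ (*-monoʳ-≤ 2 (≤-trans (≤-reflexive (sym (+-identityʳ _))) q)) ([]≤1 p)) (≤-reflexive (+-comm _ 1))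
    ... | false | true | p | q = ≤-trans (s≤s (+-monoʳ-≤ (2 * val (b ∘ suc)) ([]≤1 p))) (≤-trans (≤-reflexive (r (val (b ∘ suc)))) (*-monoʳ-≤ 2 q))
      where
      r : ∀ x → suc (2 * x + 1) ≡ 2 * (x + 1)
      r = solve-∀
    ... | false | false | true | q = ≤-trans (≤-trans (+-monoʳ-≤ (2 * val (b ∘ suc)) (n≤1+n 1)) (≤-reflexive (sym (*-distribˡ-+ 2 (val (b ∘ suc)) 1)))) (*-monoʳ-≤ 2 q)
    ... | false | false | false | q = ≤-trans (≤-reflexive (+-identityʳ _)) (*-monoʳ-≤ 2 (≤-trans (≤-reflexive (sym (+-identityʳ _))) q))

  opaque
    unfolding leT

    le⇒≤ : ∀ {Γ} {γ : ⟦ Γ ⟧ᶜ} t u → eval (le t u) γ ≡ true → val (eval t γ) ≤ val (eval u γ)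
    le⇒≤ {γ = γ} t u h = ≤-pred (≤-trans (cmp-⇒ (eval t γ) (eval u γ) true h) (≤-reflexive (+-comm _ 1)))

    ≤⇒le : ∀ {Γ} {γ : ⟦ Γ ⟧ᶜ} t u → val (eval t γ) ≤ val (eval u γ) → eval (le t u) γ ≡ true
    ≤⇒le {γ = γ} t u h with eval (le t u) γ in eq
    ... | true = refl
    ... | false = contradiction (≤-trans (≤-reflexive (+-comm 1 _)) (≤-trans (cmp-⇐ (eval t γ) (eval u γ) true eq) h)) (n≮n _)

-- Partition functions of binary constraint networks

-- `q i j` is the factor of an ordered pair, and the factors of both directions multiply. The
-- diagonal holds the weights of single vertices, where only equal arguments matter.
Matrix : ℕ → Set
Matrix n = Fin n → Fin n → Bool → Bool → ℕ

module _ {n : ℕ} where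
  prod-one : {f : Fin n → ℕ} → (∀ i → f i ≡ 1) → prod f ≡ 1
  prod-one = go n
    where
    go : ∀ n {f : Fin n → ℕ} → (∀ i → f i ≡ 1) → prod f ≡ 1
    go zero p = refl
    go (suc n) p = cong₂ _*_ (p zero) (go n (p ∘ suc))

prod-pick : ∀ {n} (v : Fin n) (f : Fin n → ℕ) → prod (λ i → if v ≡ᶠ i then f i else 1) ≡ f v
prod-pick {suc n} zero f = trans (cong (f zero *_) (prod-one {n} (λ _ → refl))) (*-identityʳ _)
prod-pick (suc v) f = trans (*-identityˡ _) (prod-pick v (f ∘ suc))

prod-zero : ∀ {n} (f : Fin n → ℕ) v → f v ≡ 0 → prod f ≡ 0
prod-zero f zero p rewrite p = refl
prod-zero f (suc v) p rewrite prod-zero (f ∘ suc) v p = *-zeroʳ (f zero)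

weight : ∀ {n} → Matrix n → (Fin n → Bool) → ℕ
weight q ω = prod (λ i → prod (λ j → q i j (ω i) (ω j)))

cons : ∀ {n} → Bool → (Fin n → Bool) → Fin (suc n) → Bool
cons b ω zero = b
cons b ω (suc i) = ω i

sumω : ∀ {n} → ((Fin n → Bool) → ℕ) → ℕ
sumω {zero} f = f (λ ())
sumω {suc n} f = sumω (f ∘ cons false) + sumω (f ∘ cons true)

Z : ∀ {n} → Matrix n → ℕ
Z q = sumω (weight q)

-- Updated assignments agree with each other only pointwise, so a summand has to respect pointwise
-- equality.
Ext : ∀ {n} → ((Fin n → Bool) → ℕ) → Set
Ext f = ∀ {ω ω′} → (∀ i → ω i ≡ ω′ i) → f ω ≡ f ω′

weight-ext : ∀ {n} (q : Matrix n) → Ext (weight q)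
weight-ext q p = prod-cong (λ i → prod-cong (λ j → cong₂ (q i j) (p i) (p j)))

cons-cong : ∀ {n} b {ω ω′ : Fin n → Bool} → (∀ i → ω i ≡ ω′ i) → ∀ i → cons b ω i ≡ cons b ω′ i
cons-cong b p zero = refl
cons-cong b p (suc i) = p i

sumω-cong : ∀ {n} {f g : (Fin n → Bool) → ℕ} → (∀ ω → f ω ≡ g ω) → sumω f ≡ sumω g
sumω-cong {zero} p = p _
sumω-cong {suc n} p = cong₂ _+_ (sumω-cong (p ∘ cons false)) (sumω-cong (p ∘ cons true))

sumω-zero : ∀ {n} {f : (Fin n → Bool) → ℕ} → (∀ ω → f ω ≡ 0) → sumω f ≡ 0
sumω-zero {zero} p = p _
sumω-zero {suc n} p = cong₂ _+_ (sumω-zero (p ∘ cons false)) (sumω-zero (p ∘ cons true))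

sumω-+ : ∀ {n} (f g : (Fin n → Bool) → ℕ) → sumω (λ ω → f ω + g ω) ≡ sumω f + sumω g
sumω-+ {zero} f g = refl
sumω-+ {suc n} f g = trans (cong₂ _+_ (sumω-+ (f ∘ cons false) (g ∘ cons false)) (sumω-+ (f ∘ cons true) (g ∘ cons true)))
  (r (sumω (f ∘ cons false)) (sumω (g ∘ cons false)) (sumω (f ∘ cons true)) (sumω (g ∘ cons true)))
  where
  r : ∀ a b c d → a + b + (c + d) ≡ a + c + (b + d)
  r = solve-∀

sumω-* : ∀ {n} c (f : (Fin n → Bool) → ℕ) → sumω (λ ω → c * f ω) ≡ c * sumω f
sumω-* {zero} c f = refl
sumω-* {suc n} c f = trans (cong₂ _+_ (sumω-* c (f ∘ cons false)) (sumω-* c (f ∘ cons true))) (sym (*-distribˡ-+ c _ _))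

is : Bool → Bool → Bool
is true b = b
is false b = not b

update : ∀ {n} → (Fin n → Bool) → Fin n → Bool → Fin n → Bool
update ω v α i = if v ≡ᶠ i then α else ω i

-- An update at `v` matches the assignments with `v = false` with those with `v = α`. So a vertex
-- can be assigned while the vertex set stays the same.
sumω-update : ∀ {n} (v : Fin n) α (h : (Fin n → Bool) → ℕ) → Ext h →
              sumω (λ ω → [ not (ω v) ] * h (update ω v α)) ≡ sumω (λ ω → [ is α (ω v) ] * h ω)
sumω-update {suc n} zero α h ext = trans (cong₂ _+_ (sumω-cong (λ ω → trans (*-identityˡ _) (ext (e ω false)))) (sumω-zero {n} (λ _ → refl))) (c α)
  where
  e : ∀ ω b i → update (cons b ω) zero α i ≡ cons α ω i
  e ω b zero = refl
  e ω b (suc i) = refl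
  c : ∀ α → sumω (h ∘ cons α) + 0 ≡ sumω (λ ω → [ is α false ] * h (cons false ω)) + sumω (λ ω → [ is α true ] * h (cons true ω))
  c true = trans (+-identityʳ _) (sym (trans (cong (_+ sumω (λ ω → 1 * h (cons true ω))) (sumω-zero {n} (λ _ → refl))) (sumω-cong {n} (λ ω → *-identityˡ (h (cons true ω))))))
  c false = cong₂ _+_ (sumω-cong {n} (λ ω → sym (*-identityˡ (h (cons false ω))))) (sym (sumω-zero {n} (λ _ → refl)))
sumω-update {suc n} (suc v) α h ext = cong₂ _+_ (go false) (go true)
  where
  e : ∀ ω b i → update (cons b ω) (suc v) α i ≡ cons b (update ω v α) i
  e ω b zero = refl
  e ω b (suc i) = refl
  go : ∀ b → sumω (λ ω → [ not (ω v) ] * h (update (cons b ω) (suc v) α)) ≡ sumω (λ ω → [ is α (ω v) ] * h (cons b ω))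
  go b = trans (sumω-cong (λ ω → cong ([ not (ω v) ] *_) (ext (e ω b)))) (sumω-update v α (h ∘ cons b) (λ p → ext (cons-cong b p)))

sumω-split-value : ∀ {n} (v : Fin n) (h : (Fin n → Bool) → ℕ) → sumω h ≡ sumω (λ ω → [ is false (ω v) ] * h ω) + sumω (λ ω → [ is true (ω v) ] * h ω)
sumω-split-value v h = trans (sumω-cong (λ ω → c (ω v) (h ω))) (sumω-+ (λ ω → [ is false (ω v) ] * h ω) _)
  where
  c : ∀ b x → x ≡ [ not b ] * x + [ b ] * x
  c true x = sym (+-identityʳ x)
  c false x = sym (trans (+-identityʳ _) (+-identityʳ x))

-- Moves the factors of row and column v to the diagonal.
to-diagonal : ∀ {n} → Fin n → (Fin n → Fin n → ℕ) → Fin n → Fin n → ℕ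
to-diagonal v f i j =
  if v ≡ᶠ i then (if v ≡ᶠ j then f v v else 1)
  else if v ≡ᶠ j then 1
  else if i ≡ᶠ j then f i j * f v i * f i v else f i j

prod-to-diagonal : ∀ {n} (v : Fin n) (f : Fin n → Fin n → ℕ) →
                   prod (λ i → prod (λ j → f i j)) ≡ prod (λ i → prod (λ j → to-diagonal v f i j))
prod-to-diagonal {n} v f = begin
  prod (λ i → prod (λ j → f i j)) ≡⟨ prod-cong (λ i → prod-cong (λ j → split₁ i j)) ⟩
  prod (λ i → prod (λ j → A i j * (row i j * col i j))) ≡⟨ prod-cong (λ i → trans (prod-distrib (A i) _) (cong (prod (A i) *_) (prod-distrib (row i) (col i)))) ⟩
  prod (λ i → prod (A i) * (prod (row i) * prod (col i))) ≡⟨ trans (prod-distrib (λ i → prod (A i)) _) (cong (prod (λ i → prod (A i)) *_) (prod-distrib (λ i → prod (row i)) (λ i → prod (col i)))) ⟩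
  prod (λ i → prod (A i)) * (prod (λ i → prod (row i)) * prod (λ i → prod (col i))) ≡⟨ cong (prod (λ i → prod (A i)) *_) (cong₂ _*_ rows cols) ⟩
  prod (λ i → prod (A i)) * (prod (λ j → r j) * prod (λ i → c i)) ≡⟨ cong (prod (λ i → prod (A i)) *_) (prod-distrib r c) ⟨
  prod (λ i → prod (A i)) * prod (λ i → r i * c i) ≡⟨ cong (prod (λ i → prod (A i)) *_) (prod-cong (λ i → sym (prod-pick i (λ j → r j * c j)))) ⟩
  prod (λ i → prod (A i)) * prod (λ i → prod (λ j → if i ≡ᶠ j then r j * c j else 1)) ≡⟨ prod-distrib (λ i → prod (A i)) _ ⟨
  prod (λ i → prod (A i) * prod (λ j → if i ≡ᶠ j then r j * c j else 1)) ≡⟨ prod-cong (λ i → sym (prod-distrib (A i) _)) ⟩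
  prod (λ i → prod (λ j → A i j * (if i ≡ᶠ j then r j * c j else 1))) ≡⟨ prod-cong (λ i → prod-cong (λ j → split₂ i j)) ⟩
  prod (λ i → prod (λ j → to-diagonal v f i j)) ∎
  where
  open ≡-Reasoning
  A row col : Fin n → Fin n → ℕ
  A i j = if v ≡ᶠ i then (if v ≡ᶠ j then f v v else 1) else (if v ≡ᶠ j then 1 else f i j)
  r c : Fin n → ℕ
  r j = if v ≡ᶠ j then 1 else f v j
  c i = if v ≡ᶠ i then 1 else f i v
  row i j = if v ≡ᶠ i then r j else 1
  col i j = if v ≡ᶠ j then c i else 1
  split₁ : ∀ i j → f i j ≡ A i j * (row i j * col i j)
  split₁ i j with v ≡ᶠ i in ei | v ≡ᶠ j in ej
  ... | true | true rewrite sym (≡ᶠ⇒≡ v i ei) | sym (≡ᶠ⇒≡ v j ej) = sym (*-identityʳ _)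
  ... | true | false rewrite sym (≡ᶠ⇒≡ v i ei) = sym (trans (*-identityˡ _) (*-identityʳ _))
  ... | false | true rewrite sym (≡ᶠ⇒≡ v j ej) = sym (trans (*-identityˡ _) (*-identityˡ _))
  ... | false | false = sym (*-identityʳ _)
  rows : prod (λ i → prod (row i)) ≡ prod r
  rows = trans (prod-cong one) (prod-pick v (λ _ → prod r))
    where
    one : ∀ i → prod (row i) ≡ (if v ≡ᶠ i then prod r else 1)
    one i with v ≡ᶠ i
    ... | true = refl
    ... | false = prod-one {n} (λ _ → refl)
  cols : prod (λ i → prod (col i)) ≡ prod c
  cols = prod-cong (λ i → prod-pick v (λ _ → c i))
  split₂ : ∀ i j → A i j * (if i ≡ᶠ j then r j * c j else 1) ≡ to-diagonal v f i j
  split₂ i j with v ≡ᶠ i in ei | v ≡ᶠ j in ej | i ≡ᶠ j in eij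
  ... | true | true | true rewrite sym (≡ᶠ⇒≡ v j ej) = *-identityʳ _
  ... | true | true | false = *-identityʳ _
  ... | true | false | false = refl
  ... | false | true | false = refl
  ... | false | false | false = *-identityʳ _
  ... | false | false | true rewrite sym (≡ᶠ⇒≡ i j eij) = sym (*-assoc (f i i) (f v i) (f i v))
  ... | true | false | true with trans (sym ei) (trans (cong (v ≡ᶠ_) (≡ᶠ⇒≡ i j eij)) ej)
  ... | ()
  split₂ i j | false | true | true with trans (sym ej) (trans (cong (v ≡ᶠ_) (sym (≡ᶠ⇒≡ i j eij))) ei)
  ... | ()

-- `v` stays behind as an isolated vertex: its value `true` has weight 0, and `false` carries the
-- old weight of `α`. The factors between `v` and `i` move to the diagonal of `i`.
assignM : ∀ {n} → Matrix n → Fin n → Bool → Matrix n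
assignM q v α i j x y =
  if v ≡ᶠ i then (if v ≡ᶠ j then (if x then 0 else q v v α α) else 1)
  else if v ≡ᶠ j then 1
  else if i ≡ᶠ j then q i j x y * q v i α x * q i v x α else q i j x y

assignM-weight : ∀ {n} (q : Matrix n) v α ω → weight (assignM q v α) ω ≡ [ not (ω v) ] * weight q (update ω v α)
assignM-weight {n} q v α ω with ω v in ωv
... | true = prod-zero (λ i → prod (λ j → assignM q v α i j (ω i) (ω j))) v (prod-zero (λ j → assignM q v α v j (ω v) (ω j)) v vv)
  where
  vv : assignM q v α v v (ω v) (ω v) ≡ 0
  vv rewrite ≡ᶠ-refl v | ωv = refl
... | false = trans (prod-cong (λ i → prod-cong (λ j → e i j))) (trans (sym (prod-to-diagonal v (λ i j → q i j (update ω v α i) (update ω v α j)))) (sym (+-identityʳ _)))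
  where
  e : ∀ i j → assignM q v α i j (ω i) (ω j) ≡ to-diagonal v (λ i j → q i j (update ω v α i) (update ω v α j)) i j
  e i j with v ≡ᶠ i in ei
  ... | true with v ≡ᶠ j
  ... | true rewrite ≡ᶠ-refl v | sym (≡ᶠ⇒≡ v i ei) | ωv = refl
  ... | false = refl
  e i j | false with v ≡ᶠ j
  ... | true = refl
  ... | false rewrite ≡ᶠ-refl v = refl

assignM-Z : ∀ {n} (q : Matrix n) v α → Z (assignM q v α) ≡ sumω (λ ω → [ is α (ω v) ] * weight q ω)
assignM-Z q v α = trans (sumω-cong (assignM-weight q v α)) (sumω-update v α (weight q) (weight-ext q))

branch-Z : ∀ {n} (q : Matrix n) v → Z q ≡ Z (assignM q v false) + Z (assignM q v true)
branch-Z q v = trans (sumω-split-value v (weight q)) (sym (cong₂ _+_ (assignM-Z q v false) (assignM-Z q v true)))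

forced-Z : ∀ {n} (q : Matrix n) v α → q v v (not α) (not α) ≡ 0 → Z (assignM q v α) ≡ Z q
forced-Z q v α p = trans (assignM-Z q v α) (sumω-cong h)
  where
  h : ∀ ω → [ is α (ω v) ] * weight q ω ≡ weight q ω
  h ω with is α (ω v) in eq
  ... | true = +-identityʳ _
  ... | false = sym (prod-zero (λ i → prod (λ j → q i j (ω i) (ω j))) v (prod-zero (λ j → q v j (ω v) (ω j)) v
                  (subst (λ b → q v v b b ≡ 0) (flip α (ω v) eq) p)))
    where
    flip : ∀ α b → is α b ≡ false → not α ≡ b
    flip true false _ = refl
    flip false true _ = refl

leaf-Z : ∀ {n} (q : Matrix n) → (∀ i j x y → i ≢ j → q i j x y ≡ 1) → Z q ≡ prod (λ i → q i i false false + q i i true true)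
leaf-Z q p = trans (sumω-cong (λ ω → prod-cong (λ i → trans (prod-cong (λ j → e ω i j)) (prod-pick i (λ j → q j j (ω j) (ω j)))))) (sumω-prod (λ i b → q i i b b))
  where
  e : ∀ ω i j → q i j (ω i) (ω j) ≡ (if i ≡ᶠ j then q j j (ω j) (ω j) else 1)
  e ω i j with i ≡ᶠ j in eq
  ... | true rewrite ≡ᶠ⇒≡ i j eq = refl
  ... | false = p i j _ _ (≡ᶠ⇒≢ eq)
  sumω-prod : ∀ {n} (c : Fin n → Bool → ℕ) → sumω (λ ω → prod (λ i → c i (ω i))) ≡ prod (λ i → c i false + c i true)
  sumω-prod {zero} c = refl
  sumω-prod {suc n} c = trans (cong₂ _+_ (trans (sumω-* {n} (c zero false) (λ ω → prod (λ i → c (suc i) (ω i)))) (cong (c zero false *_) (sumω-prod (c ∘ suc)))) (trans (sumω-* {n} (c zero true) (λ ω → prod (λ i → c (suc i) (ω i)))) (cong (c zero true *_) (sumω-prod (c ∘ suc)))))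
    (sym (*-distribʳ-+ _ (c zero false) (c zero true)))

merge : ∀ {n} → (Fin n → Bool) → (ζ η : Fin n → Bool) → Fin n → Bool
merge X ζ η i = if X i then ζ i else η i

zeroOn : ∀ {n} → (Fin n → Bool) → (Fin n → Bool) → ℕ
zeroOn P ω = prod (λ i → if P i then [ not (ω i) ] else 1)

-- A double sum over the values off `X` and on `X`. Both range over total assignments whose
-- irrelevant part is fixed to `false`, which spares partial assignments.
sumω-merge : ∀ {n} (X : Fin n → Bool) (g : (Fin n → Bool) → ℕ) → Ext g →
             sumω g ≡ sumω (λ η → zeroOn X η * sumω (λ ζ → zeroOn (not ∘ X) ζ * g (merge X ζ η)))
sumω-merge {zero} X g ext = sym (trans (*-identityˡ _) (trans (*-identityˡ _) (ext (λ ()))))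
sumω-merge {suc n} X g ext = trans
  (trans (cong₂ _+_ (sumω-merge X′ (g ∘ cons false) (ext ∘ cons-cong false)) (sumω-merge X′ (g ∘ cons true) (ext ∘ cons-cong true))) (by-cases (X zero)))
  (cong₂ _+_ (sumω-cong (λ η → same-inner false η)) (sumω-cong (λ η → same-inner true η)))
  where
  X′ = X ∘ suc
  inner : Bool → (Fin n → Bool) → ℕ
  inner b η = sumω (λ ζ → zeroOn (not ∘ X′) ζ * g (cons b (merge X′ ζ η)))
  term : Bool → Bool → Bool → (Fin n → Bool) → ℕ
  term x b c η = sumω (λ ζ → (if not x then [ not c ] else 1) * zeroOn (not ∘ X′) ζ * g (cons (if x then c else b) (merge X′ ζ η)))
  expand : Bool → Bool → (Fin n → Bool) → ℕ
  expand x b η = (if x then [ not b ] else 1) * zeroOn X′ η * (term x b false η + term x b true η)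
  same-inner : ∀ b η → expand (X zero) b η ≡ zeroOn X (cons b η) * sumω (λ ζ → zeroOn (not ∘ X) ζ * g (merge X ζ (cons b η)))
  same-inner b η = cong (zeroOn X (cons b η) *_) (cong₂ _+_ (part false) (part true))
    where
    e : ∀ c ζ i → cons (if X zero then c else b) (merge X′ ζ η) i ≡ merge X (cons c ζ) (cons b η) i
    e c ζ zero = refl
    e c ζ (suc i) = refl
    part : ∀ c → term (X zero) b c η ≡ sumω (λ ζ → zeroOn (not ∘ X) (cons c ζ) * g (merge X (cons c ζ) (cons b η)))
    part c = sumω-cong (λ ζ → cong (zeroOn (not ∘ X) (cons c ζ) *_) (ext (e c ζ)))
  full : ∀ x b c η → (if not x then [ not c ] else 1) ≡ 1 → term x b c η ≡ inner (if x then c else b) η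
  full x b c η one = sumω-cong (λ ζ → cong (_* g (cons (if x then c else b) (merge X′ ζ η))) (trans (cong (_* zeroOn (not ∘ X′) ζ) one) (*-identityˡ _)))
  by-cases : ∀ x → sumω (λ η → zeroOn X′ η * inner false η) + sumω (λ η → zeroOn X′ η * inner true η) ≡ sumω (expand x false) + sumω (expand x true)
  by-cases true = begin
    sumω (λ η → zeroOn X′ η * inner false η) + sumω (λ η → zeroOn X′ η * inner true η) ≡⟨ sumω-+ (λ η → zeroOn X′ η * inner false η) _ ⟨
    sumω (λ η → zeroOn X′ η * inner false η + zeroOn X′ η * inner true η) ≡⟨ sumω-cong (λ η → trans (sym (*-distribˡ-+ (zeroOn X′ η) (inner false η) (inner true η)))
      (cong₂ _*_ (sym (*-identityˡ (zeroOn X′ η))) (cong₂ _+_ (sym (full true false false η refl)) (sym (full true false true η refl))))) ⟩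
    sumω (expand true false) ≡⟨ +-identityʳ _ ⟨
    sumω (expand true false) + 0 ≡⟨ cong (sumω (expand true false) +_) (sym (sumω-zero {n} (λ _ → refl))) ⟩
    sumω (expand true false) + sumω (expand true true) ∎
    where open ≡-Reasoning
  by-cases false = cong₂ _+_ (side false) (side true)
    where
    side : ∀ b → sumω (λ η → zeroOn X′ η * inner b η) ≡ sumω (expand false b)
    side b = sumω-cong (λ η → cong₂ _*_ (sym (*-identityˡ (zeroOn X′ η)))
      (sym (trans (cong₂ _+_ (full false b false η refl) (sumω-zero {n} (λ _ → refl))) (+-identityʳ _))))

sumω-pick : ∀ {n} (t : Fin n → Bool) (g : (Fin n → Bool) → ℕ) → Ext g → sumω (λ ω → prod (λ i → [ is (t i) (ω i) ]) * g ω) ≡ g t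
sumω-pick {zero} t g ext = trans (*-identityˡ _) (ext (λ ()))
sumω-pick {suc n} t g ext with t zero in t0
... | true = trans (cong₂ _+_ (sumω-zero {n} (λ _ → refl)) (trans (sumω-cong {n} (λ ω → cong (_* g (cons true ω)) (*-identityˡ (prod (λ i → [ is (t (suc i)) (ω i) ]))))) (sumω-pick (t ∘ suc) (g ∘ cons true) (ext ∘ cons-cong true)))) (ext e)
  where
  e : ∀ i → cons true (t ∘ suc) i ≡ t i
  e zero = sym t0
  e (suc i) = refl
... | false = trans (cong₂ _+_ (trans (sumω-cong {n} (λ ω → cong (_* g (cons false ω)) (*-identityˡ (prod (λ i → [ is (t (suc i)) (ω i) ]))))) (sumω-pick (t ∘ suc) (g ∘ cons false) (ext ∘ cons-cong false))) (sumω-zero {n} (λ _ → refl))) (trans (+-identityʳ _) (ext e))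
  where
  e : ∀ i → cons false (t ∘ suc) i ≡ t i
  e zero = sym t0
  e (suc i) = refl

-- Summing out a vertex set

module _ {n} (q : Matrix n) (X : Fin n → Bool) (a b : Fin n) where

  base : Bool → Bool → Fin n → Bool
  base x y i = if a ≡ᶠ i then x else (if b ≡ᶠ i then y else false)

  -- The factors that involve X, with a and b fixed to x and y.
  localM : Bool → Bool → Matrix n
  localM x y i j u w = if X i ∨ X j then q i j u w else (if i ≡ᶠ j then [ is (base x y i) u ] else 1)

  -- The vertices of `X` survive as isolated ones fixed to `false`. For `a ≡ b` the factor lands on
  -- the diagonal, so that one formula covers two, one or no neighbours.
  elimM : (Bool → Bool → ℕ) → Matrix n
  elimM F i j u w = if X i ∨ X j then (if i ≡ᶠ j then [ not u ] else 1) else (if (a ≡ᶠ i) ∧ (b ≡ᶠ j) then q i j u w * F u w else q i j u w)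

  Out In : (Fin n → Bool) → ℕ
  Out ω = prod (λ i → prod (λ j → if X i ∨ X j then 1 else q i j (ω i) (ω j)))
  In ω = prod (λ i → prod (λ j → if X i ∨ X j then q i j (ω i) (ω j) else 1))

  private
    prod² : ∀ (f g : Fin n → Fin n → ℕ) → prod (λ i → prod (λ j → f i j * g i j)) ≡ prod (λ i → prod (f i)) * prod (λ i → prod (g i))
    prod² f g = trans (prod-cong (λ i → prod-distrib (f i) (g i))) (prod-distrib (λ i → prod (f i)) _)

    diagonal : ∀ (c : Fin n → ℕ) → prod (λ i → prod (λ j → if i ≡ᶠ j then c j else 1)) ≡ prod c
    diagonal c = prod-cong (λ i → prod-pick i c)

  weight-split : ∀ ω → weight q ω ≡ Out ω * In ω
  weight-split ω = trans (prod-cong (λ i → prod-cong (λ j → h i j))) (prod² _ _)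
    where
    h : ∀ i j → q i j (ω i) (ω j) ≡ (if X i ∨ X j then 1 else q i j (ω i) (ω j)) * (if X i ∨ X j then q i j (ω i) (ω j) else 1)
    h i j with X i ∨ X j
    ... | true = sym (*-identityˡ _)
    ... | false = sym (*-identityʳ _)

  module _ (a∉X : X a ≡ false) (b∉X : X b ≡ false) where

    elimM-weight : ∀ F ω → weight (elimM F) ω ≡ zeroOn X ω * (Out ω * F (ω a) (ω b))
    elimM-weight F ω = begin
      weight (elimM F) ω ≡⟨ prod-cong (λ i → prod-cong (λ j → h i j)) ⟩
      prod (λ i → prod (λ j → zs i j * (os i j * fs i j))) ≡⟨ trans (prod² zs _) (cong (prod (λ i → prod (zs i)) *_) (prod² os fs)) ⟩
      prod (λ i → prod (zs i)) * (Out ω * prod (λ i → prod (fs i))) ≡⟨ cong₂ _*_ (diagonal (λ j → if X j then [ not (ω j) ] else 1)) (cong (Out ω *_) pick) ⟩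
      zeroOn X ω * (Out ω * F (ω a) (ω b)) ∎
      where
      open ≡-Reasoning
      zs os fs : Fin n → Fin n → ℕ
      zs i j = if i ≡ᶠ j then (if X j then [ not (ω j) ] else 1) else 1
      os i j = if X i ∨ X j then 1 else q i j (ω i) (ω j)
      fs i j = if a ≡ᶠ i then (if b ≡ᶠ j then F (ω i) (ω j) else 1) else 1
      pick : prod (λ i → prod (fs i)) ≡ F (ω a) (ω b)
      pick = trans (prod-cong pᵃ) (prod-pick a (λ i → F (ω i) (ω b)))
        where
        pᵃ : ∀ i → prod (fs i) ≡ (if a ≡ᶠ i then F (ω i) (ω b) else 1)
        pᵃ i with a ≡ᶠ i
        ... | true = prod-pick b (λ j → F (ω i) (ω j))
        ... | false = prod-one {n} (λ _ → refl)
      h : ∀ i j → elimM F i j (ω i) (ω j) ≡ zs i j * (os i j * fs i j)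
      h i j with i ≡ᶠ j in ij | X i in Xi | X j in Xj | a ≡ᶠ i in ai | b ≡ᶠ j in bj
      h i j | true | true | true | true | _ with trans (sym a∉X) (trans (cong X (≡ᶠ⇒≡ a i ai)) Xi)
      ... | ()
      h i j | true | true | true | false | _ rewrite ≡ᶠ⇒≡ i j ij = sym (trans (cong ([ not (ω j) ] *_) (*-identityˡ 1)) (*-identityʳ _))
      h i j | true | true | false | _ | _ with trans (sym Xi) (trans (cong X (≡ᶠ⇒≡ i j ij)) Xj)
      ... | ()
      h i j | true | false | true | _ | _ with trans (sym Xj) (trans (cong X (sym (≡ᶠ⇒≡ i j ij))) Xi)
      ... | ()
      h i j | true | false | false | true | true = sym (*-identityˡ _)
      h i j | true | false | false | true | false = sym (trans (*-identityˡ _) (*-identityʳ _))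
      h i j | true | false | false | false | _ = sym (trans (*-identityˡ _) (*-identityʳ _))
      h i j | false | true | _ | true | _ with trans (sym a∉X) (trans (cong X (≡ᶠ⇒≡ a i ai)) Xi)
      ... | ()
      h i j | false | true | _ | false | _ = refl
      h i j | false | false | true | _ | true with trans (sym b∉X) (trans (cong X (≡ᶠ⇒≡ b j bj)) Xj)
      ... | ()
      h i j | false | false | true | true | false = refl
      h i j | false | false | true | false | false = refl
      h i j | false | false | false | true | true = sym (*-identityˡ _)
      h i j | false | false | false | true | false = sym (trans (*-identityˡ _) (*-identityʳ _))
      h i j | false | false | false | false | _ = sym (trans (*-identityˡ _) (*-identityʳ _))

    -- The result of summing out `X`, as a function of the values outside.
    G : (Fin n → Bool) → ℕ
    G η = sumω (λ ζ → zeroOn (not ∘ X) ζ * In (merge X ζ η))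

    In-ext : Ext In
    In-ext p = prod-cong (λ i → prod-cong (λ j → cong₂ (λ u w → if X i ∨ X j then q i j u w else 1) (p i) (p j)))

    Out-ext : Ext Out
    Out-ext p = prod-cong (λ i → prod-cong (λ j → cong₂ (λ u w → if X i ∨ X j then 1 else q i j u w) (p i) (p j)))

    merge-cong : ∀ ζ {η η′ : Fin n → Bool} → (∀ i → η i ≡ η′ i) → ∀ i → merge X ζ η i ≡ merge X ζ η′ i
    merge-cong ζ p i = cong (λ u → if X i then ζ i else u) (p i)

    Z-split : Z q ≡ sumω (λ η → zeroOn X η * (Out η * G η))
    Z-split = trans (sumω-cong weight-split) (trans (sumω-merge X (λ ω → Out ω * In ω) (λ p → cong₂ _*_ (Out-ext p) (In-ext p)))
      (sumω-cong (λ η → cong (zeroOn X η *_) (trans (sumω-cong (λ ζ → trans (cong (zeroOn (not ∘ X) ζ *_) (cong (_* In (merge X ζ η)) (out ζ η))) (r (zeroOn (not ∘ X) ζ) (Out η) (In (merge X ζ η)))))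
        (sumω-* {n} (Out η) (λ ζ → zeroOn (not ∘ X) ζ * In (merge X ζ η)))))))
      where
      r : ∀ z o i → z * (o * i) ≡ o * (z * i)
      r = solve-∀
      out : ∀ ζ η → Out (merge X ζ η) ≡ Out η
      out ζ η = prod-cong (λ i → prod-cong (λ j → h i j))
        where
        h : ∀ i j → (if X i ∨ X j then 1 else q i j (merge X ζ η i) (merge X ζ η j)) ≡ (if X i ∨ X j then 1 else q i j (η i) (η j))
        h i j with X i | X j
        ... | true | _ = refl
        ... | false | true = refl
        ... | false | false = refl

    -- Outside of `X` the local network admits a single assignment, so the outer sum picks one value
    -- of `G`.
    localM-Z : ∀ x y → Z (localM x y) ≡ G (λ i → if X i then false else base x y i)
    localM-Z x y = begin
      Z (localM x y) ≡⟨ sumω-cong lw ⟩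
      sumω (λ ω → In ω * match ω) ≡⟨ sumω-merge X _ (λ p → cong₂ _*_ (In-ext p) (match-ext p)) ⟩
      sumω (λ η → zeroOn X η * sumω (λ ζ → zeroOn (not ∘ X) ζ * (In (merge X ζ η) * match (merge X ζ η))))
                                                                          ≡⟨ sumω-cong (λ η → trans (cong (zeroOn X η *_) (trans (sumω-cong (λ ζ → trans (cong (λ m → zeroOn (not ∘ X) ζ * (In (merge X ζ η) * m)) (mm ζ η)) (r (zeroOn (not ∘ X) ζ) (In (merge X ζ η)) (match η)))) (sumω-* {n} (match η) (λ ζ → zeroOn (not ∘ X) ζ * In (merge X ζ η)))))
                                                                                (trans (sym (*-assoc (zeroOn X η) (match η) (G η))) (cong (_* G η) (point η)))) ⟩
      sumω (λ η → prod (λ i → [ is (t i) (η i) ]) * G η) ≡⟨ sumω-pick t G (λ p → sumω-cong (λ ζ → cong (zeroOn (not ∘ X) ζ *_) (In-ext (merge-cong ζ p)))) ⟩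
      G t ∎
      where
      open ≡-Reasoning
      t : Fin n → Bool
      t i = if X i then false else base x y i
      match : (Fin n → Bool) → ℕ
      match ω = prod (λ i → if X i then 1 else [ is (base x y i) (ω i) ])
      match-ext : Ext match
      match-ext p = prod-cong (λ i → cong (λ u → if X i then 1 else [ is (base x y i) u ]) (p i))
      r : ∀ z i m → z * (i * m) ≡ m * (z * i)
      r = solve-∀
      mm : ∀ ζ η → match (merge X ζ η) ≡ match η
      mm ζ η = prod-cong h
        where
        h : ∀ i → (if X i then 1 else [ is (base x y i) (merge X ζ η i) ]) ≡ (if X i then 1 else [ is (base x y i) (η i) ])
        h i with X i
        ... | true = refl
        ... | false = refl
      point : ∀ η → zeroOn X η * match η ≡ prod (λ i → [ is (t i) (η i) ])
      point η = trans (sym (prod-distrib (λ i → if X i then [ not (η i) ] else 1) _)) (prod-cong h)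
        where
        h : ∀ i → (if X i then [ not (η i) ] else 1) * (if X i then 1 else [ is (base x y i) (η i) ]) ≡ [ is (t i) (η i) ]
        h i with X i
        ... | true = *-identityʳ _
        ... | false = *-identityˡ _
      lw : ∀ ω → weight (localM x y) ω ≡ In ω * match ω
      lw ω = trans (prod-cong (λ i → prod-cong (λ j → h i j))) (trans (prod² _ (λ i j → if i ≡ᶠ j then (if X j then 1 else [ is (base x y j) (ω j) ]) else 1)) (cong (In ω *_) (diagonal _)))
        where
        h : ∀ i j → localM x y i j (ω i) (ω j) ≡ (if X i ∨ X j then q i j (ω i) (ω j) else 1) * (if i ≡ᶠ j then (if X j then 1 else [ is (base x y j) (ω j) ]) else 1)
        h i j with i ≡ᶠ j in ij
        ... | true rewrite ≡ᶠ⇒≡ i j ij with X j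
        ... | true = sym (*-identityʳ _)
        ... | false = sym (*-identityˡ _)
        h i j | false with X i ∨ X j
        ... | true = sym (*-identityʳ _)
        ... | false = refl

    -- All factors between `X` and vertices other than `a` and `b` are 1. Hence `In` depends on the
    -- values outside `X` only through `a` and `b`, and the inner sum equals the tabulated factor.
    elimM-Z : ∀ F → (∀ x y → F x y ≡ Z (localM x y)) →
      (∀ i j → X i ≡ true → X j ≡ false → a ≢ j → b ≢ j → ∀ x y → q i j x y ≡ 1 × q j i x y ≡ 1) → Z (elimM F) ≡ Z q
    elimM-Z F F≡ apart = trans (sumω-cong (elimM-weight F)) (trans (sumω-cong (λ η → cong (λ f → zeroOn X η * (Out η * f)) (trans (F≡ (η a) (η b)) (trans (localM-Z (η a) (η b)) (sumω-cong (λ ζ → cong (zeroOn (not ∘ X) ζ *_) (agree ζ η))))))) (sym Z-split))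
      where
      agree : ∀ ζ η → In (merge X ζ (λ i → if X i then false else base (η a) (η b) i)) ≡ In (merge X ζ η)
      agree ζ η = prod-cong (λ i → prod-cong (λ j → h i j))
        where
        t : Fin n → Bool
        t i = if X i then false else base (η a) (η b) i
        same-ends : ∀ j → X j ≡ false → a ≡ j ⊎ b ≡ j → t j ≡ η j
        same-ends j Xj p rewrite Xj with a ≡ᶠ j in aj
        ... | true = cong η (≡ᶠ⇒≡ a j aj)
        ... | false with b ≡ᶠ j in bj
        ... | true = cong η (≡ᶠ⇒≡ b j bj)
        ... | false with p
        ... | inj₁ q = contradiction q (≡ᶠ⇒≢ aj)
        ... | inj₂ q = contradiction q (≡ᶠ⇒≢ bj)
        side : ∀ j → X j ≡ false → (t j ≡ η j) ⊎ (a ≢ j × b ≢ j)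
        side j Xj = go (a ≡ᶠ j) (b ≡ᶠ j) refl refl
          where
          go : ∀ p r → (a ≡ᶠ j) ≡ p → (b ≡ᶠ j) ≡ r → (t j ≡ η j) ⊎ (a ≢ j × b ≢ j)
          go true _ aj bj = inj₁ (same-ends j Xj (inj₁ (≡ᶠ⇒≡ a j aj)))
          go false true aj bj = inj₁ (same-ends j Xj (inj₂ (≡ᶠ⇒≡ b j bj)))
          go false false aj bj = inj₂ (≡ᶠ⇒≢ aj , ≡ᶠ⇒≢ bj)
        h : ∀ i j → (if X i ∨ X j then q i j (merge X ζ t i) (merge X ζ t j) else 1) ≡ (if X i ∨ X j then q i j (merge X ζ η i) (merge X ζ η j) else 1)
        h i j with X i in Xi | X j in Xj
        ... | false | false = refl
        ... | true | true = refl
        ... | true | false with side j Xj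
        ... | inj₁ e rewrite Xj = cong (q i j (ζ i)) e
        ... | inj₂ (na , nb) = trans (proj₁ (apart i j Xi Xj na nb _ _)) (sym (proj₁ (apart i j Xi Xj na nb _ _)))
        h i j | false | true with side i Xi
        ... | inj₁ e rewrite Xi = cong (λ u → q i j u (ζ j)) e
        ... | inj₂ (na , nb) = trans (proj₂ (apart j i Xj Xi na nb _ _)) (sym (proj₂ (apart j i Xj Xi na nb _ _)))

-- Operations on networks in the loop language

tbl state : Ty
tbl = (num ⊗ num) ⊗ (num ⊗ num)
state = arr (arr tbl)

andT orT : ∀ {Γ} → Tm Γ bool → Tm Γ bool → Tm Γ bool
andT a b = ite a b fls
orT a b = ite a tru b

notT : ∀ {Γ} → Tm Γ bool → Tm Γ bool
notT a = ite a fls tru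

lit : ∀ {Γ} → Bool → Tm Γ bool
lit true = tru
lit false = fls

get : ∀ {Γ} → Tm Γ tbl → Bool → Bool → Tm Γ num
get t false false = fst (fst t)
get t false true = snd (fst t)
get t true false = fst (snd t)
get t true true = snd (snd t)

tblOf : ∀ {Γ} → (Bool → Bool → Tm Γ num) → Tm Γ tbl
tblOf e = pr (pr (e false false) (e false true)) (pr (e true false) (e true true))

cell : ∀ {Γ} → Tm Γ state → Tm Γ idx → Tm Γ idx → Tm Γ tbl
cell q i j = at (at q i) j

oneT : ∀ {Γ} → Tm Γ num
oneT = const 1

ones : ∀ {Γ} → Tm Γ tbl
ones = tblOf (λ _ _ → oneT)

opaque
  assignT : Tm (state ∷ idx ∷ bool ∷ []) state
  assignT = tab (tab
    (ite (same x3 x1)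
      (ite (same x3 x0) (tblOf (λ x y → if x then zeroT else ite x4 (get (cell x2 x3 x3) true true) (get (cell x2 x3 x3) false false))) ones)
      (ite (same x3 x0) ones
        (ite (same x1 x0)
          (tblOf (λ x y → mul (mul (get (cell x2 x1 x0) x y) (ite x4 (get (cell x2 x3 x1) true x) (get (cell x2 x3 x1) false x)))
                              (ite x4 (get (cell x2 x1 x3) x true) (get (cell x2 x1 x3) x false))))
          (cell x2 x1 x0)))))

isOne : ∀ {Γ} → Tm Γ num → Tm Γ bool
isOne t = andT (le t oneT) (le oneT t)

trivial : ∀ {Γ} → Tm Γ tbl → Tm Γ bool
trivial t = andT (andT (isOne (get t false false)) (isOne (get t false true))) (andT (isOne (get t true false)) (isOne (get t true true)))

opaque
  edgeT : Tm (state ∷ idx ∷ idx ∷ []) bool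
  edgeT = andT (notT (same x1 x2)) (notT (andT (trivial (cell x0 x1 x2)) (trivial (cell x0 x2 x1))))

  zeroRow : Bool → Tm (state ∷ idx ∷ idx ∷ []) bool
  zeroRow α = orT (orT (isZero (get (cell x0 x1 x2) α false)) (isZero (get (cell x0 x1 x2) α true)))
                  (orT (isZero (get (cell x0 x2 x1) false α)) (isZero (get (cell x0 x2 x1) true α)))

softT : Tm (state ∷ idx ∷ idx ∷ []) bool
softT = andT edgeT (notT (orT (zeroRow false) (zeroRow true)))

-- At most one value counts as forcing, in agreement with `kindOf`, where a zero in the row of
-- `false` has priority.
forcedT : Bool → Tm (state ∷ idx ∷ idx ∷ []) bool
forcedT false = andT edgeT (zeroRow false)
forcedT true = andT edgeT (andT (notT (zeroRow false)) (zeroRow true))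

sumT : ∀ {Γ} → Tm (idx ∷ num ∷ Γ) num → Tm Γ num
sumT t = fold zeroT (add x1 t)

-- Networks as machine states, and their graphs

module Ops (N B : ℕ) (1≤N : 1 ≤ N) where
  open Semantics N B
  private
    M = 2 ^ N
    instance
      M≢0 : NonZero M
      M≢0 = m^n≢0 2 N
  open Modular M

  State Table : Set
  State = ⟦ state ⟧ᵗ
  Table = ⟦ tbl ⟧ᵗ

  entry : Table → Bool → Bool → Num N B
  entry t false false = proj₁ (proj₁ t)
  entry t false true = proj₂ (proj₁ t)
  entry t true false = proj₁ (proj₂ t)
  entry t true true = proj₂ (proj₂ t)

  matrix : State → Matrix N
  matrix q i j x y = val (entry (q i j) x y)

  get-eval : ∀ {Γ} (γ : ⟦ Γ ⟧ᶜ) t x y → eval (get t x y) γ ≡ entry (eval t γ) x y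
  get-eval γ t false false = refl
  get-eval γ t false true = refl
  get-eval γ t true false = refl
  get-eval γ t true true = refl

  tblOf-eval : ∀ {Γ} (γ : ⟦ Γ ⟧ᶜ) e x y → entry (eval (tblOf e) γ) x y ≡ eval (e x y) γ
  tblOf-eval γ e false false = refl
  tblOf-eval γ e false true = refl
  tblOf-eval γ e true false = refl
  tblOf-eval γ e true true = refl

  1<M : 1 < M
  1<M = ≤-trans (≤-reflexive refl) (^-monoʳ-≤ 2 1≤N)

  oneT-val : ∀ {Γ} (γ : ⟦ Γ ⟧ᶜ) → val (eval {Γ} oneT γ) ≡ 1
  oneT-val γ = ≈⇒≡ (val< (eval oneT γ)) 1<M (const-val N B γ 1)

  ones-val : ∀ {Γ} (γ : ⟦ Γ ⟧ᶜ) x y → val (entry (eval {Γ} ones γ) x y) ≡ 1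
  ones-val γ x y = trans (cong val (tblOf-eval γ (λ _ _ → oneT) x y)) (oneT-val γ)

  assign : State → Fin N → Bool → State
  assign q v α = eval assignT (q , v , α , tt)

  opaque
    unfolding assignT

    assign-matrix : ∀ q v α i j x y → matrix (assign q v α) i j x y ≈ assignM (matrix q) v α i j x y
    assign-matrix q v α i j x y = go (v ≡ᶠ i) (v ≡ᶠ j) (i ≡ᶠ j) α x y
      where
      Γ : Ctx
      Γ = idx ∷ idx ∷ state ∷ idx ∷ bool ∷ []
      γ : Bool → ⟦ Γ ⟧ᶜ
      γ α = j , i , q , v , α , tt
      diag : Bool → Bool → Tm Γ num
      diag x y = if x then zeroT else ite x4 (get (cell x2 x3 x3) true true) (get (cell x2 x3 x3) false false)
      prodT : Bool → Bool → Tm Γ num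
      prodT x y = mul (mul (get (cell x2 x1 x0) x y) (ite x4 (get (cell x2 x3 x1) true x) (get (cell x2 x3 x1) false x)))
                      (ite x4 (get (cell x2 x1 x3) x true) (get (cell x2 x1 x3) x false))
      pick₁ : ∀ α (t : Tm Γ tbl) x → eval (ite x4 (get t true x) (get t false x)) (γ α) ≡ entry (eval t (γ α)) α x
      pick₁ true t x = get-eval (γ true) t true x
      pick₁ false t x = get-eval (γ false) t false x
      pick₂ : ∀ α (t : Tm Γ tbl) x → eval (ite x4 (get t x true) (get t x false)) (γ α) ≡ entry (eval t (γ α)) x α
      pick₂ true t x = get-eval (γ true) t x true
      pick₂ false t x = get-eval (γ false) t x false
      mul-val : ∀ α x y → val (eval (prodT x y) (γ α)) ≈ matrix q i j x y * matrix q v i α x * matrix q i v x α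
      mul-val α x y = trans (mul-term N B (γ α) (mul (get (cell x2 x1 x0) x y) (ite x4 (get (cell x2 x3 x1) true x) (get (cell x2 x3 x1) false x))) (ite x4 (get (cell x2 x1 x3) x true) (get (cell x2 x1 x3) x false)))
        (trans (*-cong {val (eval (mul (get (cell x2 x1 x0) x y) (ite x4 (get (cell x2 x3 x1) true x) (get (cell x2 x3 x1) false x))) (γ α))} {matrix q i j x y * matrix q v i α x} {_} {matrix q i v x α}
          (trans (mul-term N B (γ α) (get (cell x2 x1 x0) x y) (ite x4 (get (cell x2 x3 x1) true x) (get (cell x2 x3 x1) false x)))
            (cong (_% M) (cong₂ _*_ (cong val (get-eval (γ α) (cell x2 x1 x0) x y)) (cong val (pick₁ α (cell x2 x3 x1) x)))))
          (cong (_% M) (cong val (pick₂ α (cell x2 x1 x3) x)))) refl)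
      go : ∀ p r c α x y → val (entry (if p then (if r then eval (tblOf diag) (γ α) else eval {Γ} ones (γ α)) else (if r then eval {Γ} ones (γ α) else (if c then eval (tblOf prodT) (γ α) else q i j))) x y)
                           ≈ (if p then (if r then (if x then 0 else matrix q v v α α) else 1) else (if r then 1 else (if c then matrix q i j x y * matrix q v i α x * matrix q i v x α else matrix q i j x y)))
      go true true c α true y = cong (_% M) (trans (cong val (tblOf-eval (γ α) diag true y)) (val≡0 {N} _ (λ _ → refl)))
      go true true c true false y = cong (_% M) (trans (cong val (tblOf-eval (γ true) diag false y)) refl)
      go true true c false false y = cong (_% M) (trans (cong val (tblOf-eval (γ false) diag false y)) refl)
      go true false c α x y = cong (_% M) (ones-val (γ α) x y)
      go false true c α x y = cong (_% M) (ones-val (γ α) x y)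
      go false false true α x y = trans (cong (_% M) (cong val (tblOf-eval (γ α) prodT x y))) (mul-val α x y)
      go false false false α x y = refl

  Z-cong : ∀ {p q : Matrix N} → (∀ i j x y → p i j x y ≈ q i j x y) → Z p ≈ Z q
  Z-cong {p} {q} h = sumω-≈ (λ ω → prod-≈ (λ i → prod-≈ (λ j → h i j (ω i) (ω j))))
    where
    prod-≈ : ∀ {n} {f g : Fin n → ℕ} → (∀ i → f i ≈ g i) → prod f ≈ prod g
    prod-≈ {zero} p = refl
    prod-≈ {suc n} {f} {g} p = *-cong {f zero} {g zero} (p zero) (prod-≈ (p ∘ suc))
    sumω-≈ : ∀ {n} {f g : (Fin n → Bool) → ℕ} → (∀ ω → f ω ≈ g ω) → sumω f ≈ sumω g
    sumω-≈ {zero} p = p _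
    sumω-≈ {suc n} {f} {g} p = +-cong {sumω (f ∘ cons false)} (sumω-≈ (p ∘ cons false)) (sumω-≈ (p ∘ cons true))

  assign-Z : ∀ q v α → Z (matrix (assign q v α)) ≈ Z (assignM (matrix q) v α)
  assign-Z q v α = Z-cong (assign-matrix q v α)

  isOne-sound : ∀ {Γ} (γ : ⟦ Γ ⟧ᶜ) t → eval (isOne t) γ ≡ true → val (eval t γ) ≡ 1
  isOne-sound γ t h with eval (le t oneT) γ in e₁ | eval (le oneT t) γ in e₂
  ... | true | true = ≤-antisym (≤-trans (le⇒≤ N B {γ = γ} t oneT e₁) (≤-reflexive (oneT-val γ))) (≤-trans (≤-reflexive (sym (oneT-val γ))) (le⇒≤ N B {γ = γ} oneT t e₂))

  isOne-complete : ∀ {Γ} (γ : ⟦ Γ ⟧ᶜ) t → val (eval t γ) ≡ 1 → eval (isOne t) γ ≡ true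
  isOne-complete γ t h rewrite ≤⇒le N B {γ = γ} t oneT (≤-reflexive (trans h (sym (oneT-val γ)))) = ≤⇒le N B {γ = γ} oneT t (≤-reflexive (trans (oneT-val γ) (sym h)))

  isZero-sound : ∀ {Γ} (γ : ⟦ Γ ⟧ᶜ) t → eval (isZero t) γ ≡ true → val (eval t γ) ≡ 0
  isZero-sound γ t h = n≤0⇒n≡0 (≤-trans (le⇒≤ N B {γ = γ} t zeroT h) (≤-reflexive (zero-val N B γ)))

  isZero-complete : ∀ {Γ} (γ : ⟦ Γ ⟧ᶜ) t → val (eval t γ) ≡ 0 → eval (isZero t) γ ≡ true
  isZero-complete γ t h = ≤⇒le N B {γ = γ} t zeroT (≤-trans (≤-reflexive h) z≤n)

  triv : Table → Bool
  triv t = eval trivial′ (t , tt)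
    where
    trivial′ : Tm (tbl ∷ []) bool
    trivial′ = trivial x0

  zeroAt : Table → Bool → Bool → Bool
  zeroAt t x y = eval (isZero {num ∷ []} x0) (entry t x y , tt)

  edge : State → Fin N → Fin N → Bool
  edge q i j = eval edgeT (q , i , j , tt)

  zrow : State → Bool → Fin N → Fin N → Bool
  zrow q α i j = eval (zeroRow α) (q , i , j , tt)

  kindOf : State → Fin N → Fin N → Kind
  kindOf q i j = if edge q i j then (if zrow q false i j then hard false else (if zrow q true i j then hard true else soft)) else none

  isEdge-kind : ∀ q i j → isEdge (kindOf q i j) ≡ edge q i j
  isEdge-kind q i j with edge q i j | zrow q false i j | zrow q true i j
  ... | true | true | _ = refl
  ... | true | false | true = refl
  ... | true | false | false = refl
  ... | false | _ | _ = refl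

  isSoft-kind : ∀ q i j → isSoft (kindOf q i j) ≡ eval softT (q , i , j , tt)
  isSoft-kind q i j with edge q i j | zrow q false i j | zrow q true i j
  ... | true | true | _ = refl
  ... | true | false | true = refl
  ... | true | false | false = refl
  ... | false | _ | _ = refl

  isHard-kind : ∀ q α i j → isHard α (kindOf q i j) ≡ eval (forcedT α) (q , i , j , tt)
  isHard-kind q false i j with edge q i j | zrow q false i j | zrow q true i j
  ... | true | true | _ = refl
  ... | true | false | true = refl
  ... | true | false | false = refl
  ... | false | _ | _ = refl
  isHard-kind q true i j with edge q i j | zrow q false i j | zrow q true i j
  ... | true | true | _ = refl
  ... | true | false | true = refl
  ... | true | false | false = refl
  ... | false | _ | _ = refl

  opaque
    unfolding edgeT zeroRow

    edge-irrefl : ∀ q i → edge q i i ≡ false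
    edge-irrefl q i rewrite ≡ᶠ-refl i = refl

    private
      if-∧ : ∀ a b → (if a then b else false) ≡ (if b then a else false)
      if-∧ true true = refl
      if-∧ true false = refl
      if-∧ false true = refl
      if-∧ false false = refl

    edge-symᵇ : ∀ q i j → edge q i j ≡ edge q j i
    edge-symᵇ q i j = cong₂ (λ a b → if (if a then false else true) then (if b then false else true) else false) (≡ᶠ-sym i j) (if-∧ (triv (q i j)) (triv (q j i)))

    -- The rows of the two values together cover both tables completely, from either end.
    zrow-sym : ∀ q i j → zrow q false i j ∨ zrow q true i j ≡ zrow q false j i ∨ zrow q true j i
    zrow-sym q i j = c (zeroAt (q i j) false false) (zeroAt (q i j) false true) (zeroAt (q i j) true false) (zeroAt (q i j) true true)
                       (zeroAt (q j i) false false) (zeroAt (q j i) false true) (zeroAt (q j i) true false) (zeroAt (q j i) true true)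
      where
      or : Bool → Bool → Bool
      or a b = if a then true else b
      c : ∀ a b c d e f g h → or (or a b) (or e g) ∨ or (or c d) (or f h) ≡ or (or e f) (or a c) ∨ or (or g h) (or b d)
      c true true _ _ true _ _ _ = refl
      c true true _ _ false true _ _ = refl
      c true true _ _ false false _ _ = refl
      c true false _ _ true _ _ _ = refl
      c true false _ _ false true _ _ = refl
      c true false _ _ false false _ _ = refl
      c false true c d true _ _ _ = refl
      c false true c d false true _ _ = refl
      c false true true d false false _ _ = refl
      c false true false d false false true _ = refl
      c false true false d false false false true = refl
      c false true false d false false false false = refl
      c false false _ _ true _ _ _ = refl
      c false false true d false true true _ = refl
      c false false true d false true false _ = refl
      c false false false d false true true _ = refl
      c false false false true false true false _ = refl
      c false false false false false true false _ = refl
      c false false true d false false true _ = refl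
      c false false true d false false false _ = refl
      c false false false d false false true _ = refl
      c false false false true false false false true = refl
      c false false false true false false false false = refl
      c false false false false false false false true = refl
      c false false false false false false false false = refl

  graphOf : State → Graph N
  graphOf q = record
    { kind = kindOf q
    ; irrefl = λ v → cong (λ b → if b then (if zrow q false v v then hard false else (if zrow q true v v then hard true else soft)) else none) (edge-irrefl q v)
    ; edge-sym = λ u v → trans (isEdge-kind q u v) (trans (edge-symᵇ q u v) (sym (isEdge-kind q v u)))
    ; soft-sym = λ u v → trans (soft-∨ u v) (trans (cong₂ (λ a b → if a then not b else false) (edge-symᵇ q u v) (zrow-sym q u v)) (sym (soft-∨ v u)))
    }
    where
    soft-∨ : ∀ u v → isSoft (kindOf q u v) ≡ (if edge q u v then not (zrow q false u v ∨ zrow q true u v) else false)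
    soft-∨ u v with edge q u v | zrow q false u v | zrow q true u v
    ... | true | true | _ = refl
    ... | true | false | true = refl
    ... | true | false | false = refl
    ... | false | _ | _ = refl

  triv⇒1 : ∀ t x y → triv t ≡ true → val (entry t x y) ≡ 1
  triv⇒1 t x y h with eval (isOne {tbl ∷ []} (get x0 false false)) (t , tt) in e₁ | eval (isOne {tbl ∷ []} (get x0 false true)) (t , tt) in e₂
                    | eval (isOne {tbl ∷ []} (get x0 true false)) (t , tt) in e₃ | eval (isOne {tbl ∷ []} (get x0 true true)) (t , tt) in e₄
  triv⇒1 t false false h | true | true | true | true = isOne-sound (t , tt) (get x0 false false) e₁
  triv⇒1 t false true h | true | true | true | true = isOne-sound (t , tt) (get x0 false true) e₂
  triv⇒1 t true false h | true | true | true | true = isOne-sound (t , tt) (get x0 true false) e₃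
  triv⇒1 t true true h | true | true | true | true = isOne-sound (t , tt) (get x0 true true) e₄

  1⇒triv : ∀ t → (∀ x y → val (entry t x y) ≡ 1) → triv t ≡ true
  1⇒triv t h rewrite isOne-complete {tbl ∷ []} (t , tt) (get x0 false false) (h false false) | isOne-complete {tbl ∷ []} (t , tt) (get x0 false true) (h false true)
                   | isOne-complete {tbl ∷ []} (t , tt) (get x0 true false) (h true false) = isOne-complete {tbl ∷ []} (t , tt) (get x0 true true) (h true true)

  opaque
    unfolding edgeT

    no-edge⇒1 : ∀ q i j → i ≢ j → edge q i j ≡ false → ∀ x y → matrix q i j x y ≡ 1
    no-edge⇒1 q i j i≢j e x y rewrite ≢⇒≡ᶠ i≢j with triv (q i j) in t₁ | triv (q j i)
    ... | true | true = triv⇒1 (q i j) x y t₁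

  opaque
    unfolding edgeT

    no-edge : ∀ q i j → triv (q i j) ≡ true → triv (q j i) ≡ true → edge q i j ≡ false
    no-edge q i j p r rewrite p | r with i ≡ᶠ j
    ... | true = refl
    ... | false = refl

anyT : ∀ {Γ} → Tm (idx ∷ bool ∷ Γ) bool → Tm Γ bool
anyT t = fold fls (ite x1 tru t)

opaque
  hasEdgeT : Tm (state ∷ idx ∷ []) bool
  hasEdgeT = anyT (call (x2 ∷ x3 ∷ x0 ∷ []) edgeT)

  leafT : Tm (state ∷ []) num
  leafT = fold oneT (mul x1 (add (get (cell x2 x0 x0) false false) (get (cell x2 x0 x0) true true)))

opaque
  -- Branches on the first vertex that is not isolated; exact for states with
  -- at most k such vertices.
  bruteT : ℕ → Tm (state ∷ []) num
  bruteT zero = leafT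
  bruteT (suc k) = snd (fold (pr fls (call (x0 ∷ []) leafT))
    (ite (fst x1) x1
      (ite (call (x2 ∷ x0 ∷ []) hasEdgeT)
        (pr tru (add (call (call (x2 ∷ x0 ∷ fls ∷ []) assignT ∷ []) (bruteT k)) (call (call (x2 ∷ x0 ∷ tru ∷ []) assignT ∷ []) (bruteT k))))
        x1)))

ind : ∀ {Γ} → Bool → Tm Γ tbl
ind b = tblOf (λ u _ → if is b u then oneT else zeroT)

opaque
  localT : Bool → Bool → Tm (state ∷ arr bool ∷ idx ∷ idx ∷ []) state
  localT x y = tab (tab (ite (orT (at x3 x1) (at x3 x0)) (cell x2 x1 x0)
    (ite (same x1 x0) (ite (same x4 x1) (ind x) (ite (same x5 x1) (ind y) (ind false))) ones)))

-- Nine vertices can be non-isolated: at most seven in `X`, and `a` and `b`.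
factorT : Bool → Bool → Tm (state ∷ arr bool ∷ idx ∷ idx ∷ []) num
factorT x y = call (localT x y ∷ []) (bruteT 9)

opaque
  elimT : Tm (state ∷ arr bool ∷ idx ∷ idx ∷ []) state
  elimT = tab (tab (ite (orT (at x3 x1) (at x3 x0)) (ite (same x1 x0) (ind false) ones)
    (ite (andT (same x4 x1) (same x5 x0))
      (tblOf (λ u w → mul (get (cell x2 x1 x0) u w) (call (x2 ∷ x3 ∷ x4 ∷ x5 ∷ []) (factorT u w))))
      (cell x2 x1 x0))))

  -- A single pass is enough: only zeros that are present at its start have to be resolved, while
  -- those that arise on the way may remain.
  propagateT : Tm (state ∷ []) state
  propagateT = fold x0
    (ite (isZero (get (cell x1 x0 x0) false false)) (call (x1 ∷ x0 ∷ tru ∷ []) assignT)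
      (ite (isZero (get (cell x1 x0 x0) true true)) (call (x1 ∷ x0 ∷ fls ∷ []) assignT) x1))

any-fold : ∀ {n} (e : Fin n → Bool) b → foldFin n (λ i a → if a then true else e i) b ≡ b ∨ any e
any-fold {zero} e true = refl
any-fold {zero} e false = refl
any-fold {suc n} e true = any-fold (e ∘ suc) true
any-fold {suc n} e false = any-fold (e ∘ suc) (e zero)

module Ops₂ (N B : ℕ) (1≤N : 1 ≤ N) where
  open Semantics N B
  open Ops N B 1≤N public
  private
    M = 2 ^ N
    instance
      M≢0 : NonZero M
      M≢0 = m^n≢0 2 N
  open Modular M

  -- `kindOf` as a function of the two tables only, so that unchanged tables have unchanged kinds.
  kindᵀ : Bool → Table → Table → Kind
  kindᵀ c a b = if (if (if c then false else true) then (if (if triv a then triv b else false) then false else true) else false)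
    then (if row false then hard false else (if row true then hard true else soft)) else none
    where
    row : Bool → Bool
    row α = if (if zeroAt a α false then true else zeroAt a α true) then true else (if zeroAt b false α then true else zeroAt b true α)

  opaque
    unfolding edgeT zeroRow

    kindOf-local : ∀ q i j → kindOf q i j ≡ kindᵀ (i ≡ᶠ j) (q i j) (q j i)
    kindOf-local q i j = helper (edge q i j) refl
      where
      ga : ∀ t α β → eval (isZero {num ∷ []} x0) (entry t α β , tt) ≡ zeroAt t α β
      ga t α β = refl
      z₁ : ∀ α β → eval (isZero (get (cell x0 x1 x2) α β)) (q , i , j , tt) ≡ zeroAt (q i j) α β
      z₁ false false = refl
      z₁ false true = refl
      z₁ true false = refl
      z₁ true true = refl
      z₂ : ∀ α β → eval (isZero (get (cell x0 x2 x1) α β)) (q , i , j , tt) ≡ zeroAt (q j i) α β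
      z₂ false false = refl
      z₂ false true = refl
      z₂ true false = refl
      z₂ true true = refl
      helper : ∀ e → edge q i j ≡ e → kindOf q i j ≡ kindᵀ (i ≡ᶠ j) (q i j) (q j i)
      helper e _ rewrite z₁ false false | z₁ false true | z₁ true false | z₁ true true | z₂ false false | z₂ true false | z₂ false true | z₂ true true = refl

  kindOf-cong : ∀ p q i j → p i j ≡ q i j → p j i ≡ q j i → kindOf p i j ≡ kindOf q i j
  kindOf-cong p q i j e₁ e₂ = trans (kindOf-local p i j) (trans (cong₂ (kindᵀ (i ≡ᶠ j)) e₁ e₂) (sym (kindOf-local q i j)))

  no-edge⇒none : ∀ q i j → edge q i j ≡ false → kindOf q i j ≡ none
  no-edge⇒none q i j e rewrite e = refl

  hasEdge : State → Fin N → Bool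
  hasEdge q v = eval hasEdgeT (q , v , tt)

  opaque
    unfolding hasEdgeT

    hasEdge-any : ∀ q v → hasEdge q v ≡ any (edge q v)
    hasEdge-any q v = any-fold (edge q v) false

  isolated : ∀ q v → hasEdge q v ≡ false → ∀ j → edge q v j ≡ false
  isolated q v h j with edge q v j in e
  ... | false = refl
  ... | true with trans (sym h) (trans (hasEdge-any q v) (any⁺ (edge q v) j e))
  ... | ()

  hasEdge⁺ : ∀ q v j → edge q v j ≡ true → hasEdge q v ≡ true
  hasEdge⁺ q v j e = trans (hasEdge-any q v) (any⁺ (edge q v) j e)

  hasEdge⁻ : ∀ q v → hasEdge q v ≡ true → ∃ λ j → edge q v j ≡ true
  hasEdge⁻ q v h = any⁻ (edge q v) (trans (sym (hasEdge-any q v)) h)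

  -- Every step lowers this number, so it bounds the depth of the recursion, which the measure does
  -- not: steps without branching need not decrease it.
  alive : State → ℕ
  alive q = count (hasEdge q)

  -- Off the diagonal, p has no other tables than q has.
  _⊑_ : State → State → Set
  p ⊑ q = ∀ i j → edge p i j ≡ true → kindOf p i j ≡ kindOf q i j

  ⊑-refl : ∀ {q} → q ⊑ q
  ⊑-refl i j _ = refl

  ⊑-edge : ∀ {p q} → p ⊑ q → ∀ i j → edge p i j ≡ true → edge q i j ≡ true
  ⊑-edge {p} {q} h i j e = trans (sym (isEdge-kind q i j)) (trans (cong isEdge (sym (h i j e))) (trans (isEdge-kind p i j) e))

  ⊑-trans : ∀ {p q r} → p ⊑ q → q ⊑ r → p ⊑ r
  ⊑-trans {p} {q} {r} h k i j e = trans (h i j e) (k i j (⊑-edge {p} {q} h i j e))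

  true≢false : ∀ {b} → b ≡ true → b ≡ false → ⊥
  true≢false refl ()

  edge⇒≢ : ∀ q i j → edge q i j ≡ true → i ≢ j
  edge⇒≢ q i .i e refl = true≢false e (edge-irrefl q i)

  onesᵛ : ∀ {Γ} (γ : ⟦ Γ ⟧ᶜ) → triv (eval {Γ} ones γ) ≡ true
  onesᵛ {Γ} γ = 1⇒triv (eval {Γ} ones γ) (ones-val γ)

  opaque
    unfolding assignT

    assign-row : ∀ q v α j → v ≢ j → triv (assign q v α v j) ≡ true × triv (assign q v α j v) ≡ true
    assign-row q v α j v≢j rewrite ≡ᶠ-refl v | ≢⇒≡ᶠ v≢j = onesᵛ (j , v , q , v , α , tt) , onesᵛ (v , j , q , v , α , tt)

    assign-off : ∀ q v α i j → v ≢ i → v ≢ j → i ≢ j → assign q v α i j ≡ q i j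
    assign-off q v α i j a b c rewrite ≢⇒≡ᶠ a | ≢⇒≡ᶠ b | ≢⇒≡ᶠ c = refl

  assign-isolates : ∀ q v α j → edge (assign q v α) v j ≡ false
  assign-isolates q v α j with v ≟ᶠ j
  ... | yes refl = edge-irrefl (assign q v α) v
  ... | no v≢j = no-edge (assign q v α) v j (proj₁ (assign-row q v α j v≢j)) (proj₂ (assign-row q v α j v≢j))

  assign-edge : ∀ q v α i j → edge (assign q v α) i j ≡ true → v ≢ i × v ≢ j × i ≢ j
  assign-edge q v α i j e = (λ { refl → true≢false e (assign-isolates q v α j) })
    , (λ { refl → true≢false e (trans (edge-symᵇ (assign q v α) i v) (assign-isolates q v α i)) }) , edge⇒≢ (assign q v α) i j e

  assign-⊑ : ∀ q v α → assign q v α ⊑ q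
  assign-⊑ q v α i j e with assign-edge q v α i j e
  ... | a , b , c = kindOf-cong (assign q v α) q i j (assign-off q v α i j a b c) (assign-off q v α j i b a (c ∘ sym))

  assign-kept : ∀ q v α i j → v ≢ i → v ≢ j → edge (assign q v α) i j ≡ edge q i j
  assign-kept q v α i j a b with i ≟ᶠ j
  ... | yes refl = trans (edge-irrefl (assign q v α) i) (sym (edge-irrefl q i))
  ... | no i≢j = trans (sym (isEdge-kind (assign q v α) i j)) (trans (cong isEdge (kindOf-cong (assign q v α) q i j (assign-off q v α i j a b i≢j) (assign-off q v α j i b a (i≢j ∘ sym)))) (isEdge-kind q i j))

  zero-exact : ∀ (a : Num N B) {x} → val a ≈ x → x ≡ 0 → val a ≡ 0
  zero-exact a p refl = ≈⇒≡ (val< a) (≤-trans (s≤s z≤n) (<⇒≤ 1<M)) p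

  -- A zero among the factors collected on the diagonal stays an exact zero modulo `2 ^ N`. About
  -- products of non-zero factors nothing is claimed.
  assign-zero : ∀ q v α u b → v ≢ u → (matrix q u u b b ≡ 0 ⊎ matrix q v u α b ≡ 0) ⊎ matrix q u v b α ≡ 0 → matrix (assign q v α) u u b b ≡ 0
  assign-zero q v α u b v≢u h = zero-exact (entry (assign q v α u u) b b) (assign-matrix q v α u u b b) (eq h)
    where
    eq : (matrix q u u b b ≡ 0 ⊎ matrix q v u α b ≡ 0) ⊎ matrix q u v b α ≡ 0 → assignM (matrix q) v α u u b b ≡ 0
    eq h rewrite ≢⇒≡ᶠ v≢u | ≡ᶠ-refl u with h
    ... | inj₁ (inj₁ e) rewrite e = refl
    ... | inj₁ (inj₂ e) rewrite e | *-zeroʳ (matrix q u u b b) = refl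
    ... | inj₂ e rewrite e = *-zeroʳ (matrix q u u b b * matrix q v u α b)

  propagate : State → State
  propagate q = eval propagateT (q , tt)

  settle : Fin N → State → State
  settle u q = if eval (isZero {state ∷ idx ∷ []} (get (cell x0 x1 x1) false false)) (q , u , tt) then assign q u true
    else (if eval (isZero {state ∷ idx ∷ []} (get (cell x0 x1 x1) true true)) (q , u , tt) then assign q u false else q)

  -- `zeros` makes the pass over all vertices work: a vertex with an impossible value keeps it until
  -- its turn comes, unless it has become isolated before.
  record _⇝_ (p q : State) : Set where
    field
      same-Z : Z (matrix q) ≈ Z (matrix p)
      shrinks : q ⊑ p
      zeros : ∀ u b → matrix p u u b b ≡ 0 → matrix q u u b b ≡ 0 ⊎ (∀ j → edge q u j ≡ false)
  open _⇝_

  ⊑-isolated : ∀ {p q} → p ⊑ q → ∀ u → (∀ j → edge q u j ≡ false) → ∀ j → edge p u j ≡ false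
  ⊑-isolated {p} {q} h u iso j with edge p u j in e
  ... | false = refl
  ... | true = ⊥-elim (true≢false (⊑-edge {p} {q} h u j e) (iso j))

  ⇝-trans : ∀ {p q r} → p ⇝ q → q ⇝ r → p ⇝ r
  ⇝-trans {p} {q} {r} f g = record
    { same-Z = trans (same-Z g) (same-Z f)
    ; shrinks = ⊑-trans {r} {q} {p} (shrinks g) (shrinks f)
    ; zeros = λ u b zp → h u b (zeros f u b zp) }
    where
    h : ∀ u b → matrix q u u b b ≡ 0 ⊎ (∀ j → edge q u j ≡ false) → matrix r u u b b ≡ 0 ⊎ (∀ j → edge r u j ≡ false)
    h u b (inj₁ zq) = zeros g u b zq
    h u b (inj₂ iso) = inj₂ (⊑-isolated {r} {q} (shrinks g) u iso)

  ⇝-refl : ∀ {q} → q ⇝ q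
  ⇝-refl {q} = record { same-Z = refl ; shrinks = ⊑-refl {q} ; zeros = λ _ _ zq → inj₁ zq }

  force-⇝ : ∀ q u α → matrix q u u (not α) (not α) ≡ 0 → q ⇝ assign q u α
  force-⇝ q u α zq = record
    { same-Z = trans (assign-Z q u α) (cong (_% M) (forced-Z (matrix q) u α zq))
    ; shrinks = assign-⊑ q u α
    ; zeros = h }
    where
    h : ∀ w b → matrix q w w b b ≡ 0 → matrix (assign q u α) w w b b ≡ 0 ⊎ (∀ j → edge (assign q u α) w j ≡ false)
    h w b zw with u ≟ᶠ w
    ... | yes refl = inj₂ (assign-isolates q u α)
    ... | no u≢w = inj₁ (assign-zero q u α w b u≢w (inj₁ (inj₁ zw)))

  settle-⇝ : ∀ u q → q ⇝ settle u q × (∀ b → matrix q u u b b ≡ 0 → ∀ j → edge (settle u q) u j ≡ false)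
  settle-⇝ u q with eval (isZero {state ∷ idx ∷ []} (get (cell x0 x1 x1) false false)) (q , u , tt) in e₀
  ... | true = force-⇝ q u true (isZero-sound {state ∷ idx ∷ []} (q , u , tt) (get (cell x0 x1 x1) false false) e₀) , λ _ _ → assign-isolates q u true
  ... | false with eval (isZero {state ∷ idx ∷ []} (get (cell x0 x1 x1) true true)) (q , u , tt) in e₁
  ... | true = force-⇝ q u false (isZero-sound {state ∷ idx ∷ []} (q , u , tt) (get (cell x0 x1 x1) true true) e₁) , λ _ _ → assign-isolates q u false
  ... | false = ⇝-refl , λ where
            false zq → ⊥-elim (true≢false (isZero-complete {state ∷ idx ∷ []} (q , u , tt) (get (cell x0 x1 x1) false false) zq) e₀)
            true zq → ⊥-elim (true≢false (isZero-complete {state ∷ idx ∷ []} (q , u , tt) (get (cell x0 x1 x1) true true) zq) e₁)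

  opaque
    unfolding propagateT

    propagate-⇝ : ∀ q → q ⇝ propagate q × (∀ u b → matrix q u u b b ≡ 0 → ∀ j → edge (propagate q) u j ≡ false)
    propagate-⇝ q = go N (λ i → i) q
      where
      go : ∀ n (h : Fin n → Fin N) p → p ⇝ foldFin n (λ i → settle (h i)) p × (∀ i b → matrix p (h i) (h i) b b ≡ 0 → ∀ j → edge (foldFin n (λ i → settle (h i)) p) (h i) j ≡ false)
      go zero h p = ⇝-refl , λ ()
      go (suc n) h p with settle-⇝ (h zero) p | go n (h ∘ suc) (settle (h zero) p)
      ... | s₁ , d₁ | s₂ , d₂ = ⇝-trans s₁ s₂ , k
        where
        r : State
        r = foldFin n (λ i → settle (h (suc i))) (settle (h zero) p)
        k : ∀ i b → matrix p (h i) (h i) b b ≡ 0 → ∀ j → edge r (h i) j ≡ false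
        k zero b zp = ⊑-isolated {r} {settle (h zero) p} (shrinks s₂) (h zero) (d₁ b zp)
        k (suc i) b zp with zeros s₁ (h (suc i)) b zp
        ... | inj₁ z₁ = d₂ i b z₁
        ... | inj₂ iso = ⊑-isolated {r} {settle (h zero) p} (shrinks s₂) (h (suc i)) iso

  branchChild : State → Fin N → Bool → State
  branchChild q v α = propagate (assign q v α)

  branchChild-Z : ∀ q v → Z (matrix q) ≈ Z (matrix (branchChild q v false)) + Z (matrix (branchChild q v true))
  branchChild-Z q v = trans (cong (_% M) (branch-Z (matrix q) v))
    (+-cong {Z (assignM (matrix q) v false)} (back false) (back true))
    where
    back : ∀ α → Z (assignM (matrix q) v α) ≈ Z (matrix (branchChild q v α))
    back α = trans (sym (assign-Z q v α)) (sym (same-Z (proj₁ (propagate-⇝ (assign q v α)))))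

  branchChild-⊑ : ∀ q v α → branchChild q v α ⊑ q
  branchChild-⊑ q v α = ⊑-trans {branchChild q v α} {assign q v α} {q} (shrinks (proj₁ (propagate-⇝ (assign q v α)))) (assign-⊑ q v α)

  private
    or⁻ : ∀ a {b} → (if a then true else b) ≡ true → a ≡ true ⊎ b ≡ true
    or⁻ true _ = inj₁ refl
    or⁻ false p = inj₂ p

  opaque
    unfolding zeroRow

    zrow-zero : ∀ q α v u → zrow q α v u ≡ true →
      (matrix q v u α false ≡ 0 ⊎ matrix q v u α true ≡ 0) ⊎ (matrix q u v false α ≡ 0 ⊎ matrix q u v true α ≡ 0)
    zrow-zero q α v u r with or⁻ (if eval (isZero (get (cell x0 x1 x2) α false)) γ then true else eval (isZero (get (cell x0 x1 x2) α true)) γ) r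
      where
      γ : ⟦ state ∷ idx ∷ idx ∷ [] ⟧ᶜ
      γ = q , v , u , tt
    ... | inj₁ p = inj₁ (h (or⁻ (eval (isZero (get (cell x0 x1 x2) α false)) (q , v , u , tt)) p))
      where
      h : eval (isZero (get (cell x0 x1 x2) α false)) (q , v , u , tt) ≡ true ⊎ eval (isZero (get (cell x0 x1 x2) α true)) (q , v , u , tt) ≡ true → matrix q v u α false ≡ 0 ⊎ matrix q v u α true ≡ 0
      h (inj₁ e) = inj₁ (trans (cong val (sym (get-eval (q , v , u , tt) (cell x0 x1 x2) α false))) (isZero-sound (q , v , u , tt) (get (cell x0 x1 x2) α false) e))
      h (inj₂ e) = inj₂ (trans (cong val (sym (get-eval (q , v , u , tt) (cell x0 x1 x2) α true))) (isZero-sound (q , v , u , tt) (get (cell x0 x1 x2) α true) e))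
    ... | inj₂ p = inj₂ (h (or⁻ (eval (isZero (get (cell x0 x2 x1) false α)) (q , v , u , tt)) p))
      where
      h : eval (isZero (get (cell x0 x2 x1) false α)) (q , v , u , tt) ≡ true ⊎ eval (isZero (get (cell x0 x2 x1) true α)) (q , v , u , tt) ≡ true → matrix q u v false α ≡ 0 ⊎ matrix q u v true α ≡ 0
      h (inj₁ e) = inj₁ (trans (cong val (sym (get-eval (q , v , u , tt) (cell x0 x2 x1) false α))) (isZero-sound (q , v , u , tt) (get (cell x0 x2 x1) false α) e))
      h (inj₂ e) = inj₂ (trans (cong val (sym (get-eval (q , v , u , tt) (cell x0 x2 x1) true α))) (isZero-sound (q , v , u , tt) (get (cell x0 x2 x1) true α) e))

  forced⇒zero : ∀ q v α u → isHard α (kindOf q v u) ≡ true → v ≢ u × ∃ λ b → matrix q v u α b ≡ 0 ⊎ matrix q u v b α ≡ 0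
  forced⇒zero q v α u h = edge⇒≢ q v u (proj₁ (parts α h)) , row α (proj₂ (parts α h))
    where
    parts : ∀ α → isHard α (kindOf q v u) ≡ true → edge q v u ≡ true × zrow q α v u ≡ true
    parts false h with edge q v u | zrow q false v u | zrow q true v u | trans (sym (isHard-kind q false v u)) h
    ... | true | true | _ | _ = refl , refl
    parts true h with edge q v u | zrow q false v u | zrow q true v u | trans (sym (isHard-kind q true v u)) h
    ... | true | false | true | _ = refl , refl
    row : ∀ α → zrow q α v u ≡ true → ∃ λ b → matrix q v u α b ≡ 0 ⊎ matrix q u v b α ≡ 0
    row α r with zrow-zero q α v u r
    ... | inj₁ (inj₁ e) = false , inj₁ e
    ... | inj₁ (inj₂ e) = true , inj₁ e
    ... | inj₂ (inj₁ e) = false , inj₂ e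
    ... | inj₂ (inj₂ e) = true , inj₂ e

  -- `v` is isolated by the assignment itself. A forced vertex has received a zero on its diagonal,
  -- which propagation resolves.
  branchChild-gone : ∀ q v α u → Graph.cluster (graphOf q) v α u ≡ true → ∀ j → edge (branchChild q v α) u j ≡ false
  branchChild-gone q v α u X with v ≟ᶠ u
  ... | yes refl = ⊑-isolated {branchChild q u α} {assign q u α} (shrinks (proj₁ (propagate-⇝ (assign q u α)))) u (assign-isolates q u α)
  ... | no v≢u′ with forced⇒zero q v α u (subst (λ b → b ∨ isHard α (kindOf q v u) ≡ true) (≢⇒≡ᶠ v≢u′) X)
  ... | v≢u , b , inj₁ z₁ = proj₂ (propagate-⇝ (assign q v α)) u b (assign-zero q v α u b v≢u (inj₁ (inj₂ z₁)))
  ... | v≢u , b , inj₂ z₂ = proj₂ (propagate-⇝ (assign q v α)) u b (assign-zero q v α u b v≢u (inj₂ z₂))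

  branchChild-Removes : ∀ q v α → Removes (Graph.cluster (graphOf q) v α) (graphOf q) (graphOf (branchChild q v α))
  branchChild-Removes q v α = record { edge⁻ = λ x y e → inj₁ (h x y (trans (sym (isEdge-kind p x y)) e)) ; soft⁻ = λ x y e → inj₁ (hs x y e) }
    where
    p = branchChild q v α
    X = Graph.cluster (graphOf q) v α
    out : ∀ x y → edge p x y ≡ true → X x ≡ false
    out x y e with X x in Xx
    ... | false = refl
    ... | true = ⊥-elim (true≢false e (branchChild-gone q v α x Xx y))
    h : ∀ x y → edge p x y ≡ true → isEdge (kindOf q x y) ≡ true × X x ≡ false × X y ≡ false
    h x y e = trans (isEdge-kind q x y) (⊑-edge {p} {q} (branchChild-⊑ q v α) x y e) , out x y e , out y x (trans (edge-symᵇ p y x) e)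
    hs : ∀ x y → isSoft (kindOf p x y) ≡ true → isSoft (kindOf q x y) ≡ true × X x ≡ false × X y ≡ false
    hs x y e = trans (cong isSoft (sym (branchChild-⊑ q v α x y ed))) e , proj₂ (h x y ed)
      where
      ed : edge p x y ≡ true
      ed with kindOf p x y in k
      ... | soft = trans (sym (isEdge-kind p x y)) (cong isEdge k)

  fold-prod : ∀ {n} (f : Fin n → Num N B → Num N B) (c : Fin n → ℕ) → (∀ i a → val (f i a) ≈ val a * c i) →
              ∀ a → val (foldFin n f a) ≈ val a * prod c
  fold-prod {zero} f c h a = cong (_% M) (sym (*-identityʳ (val a)))
  fold-prod {suc n} f c h a = trans (fold-prod (f ∘ suc) (c ∘ suc) (h ∘ suc) (f zero a))
    (trans (*-cong {val (f zero a)} {val a * c zero} {prod (c ∘ suc)} (h zero a) refl) (cong (_% M) (*-assoc (val a) (c zero) (prod (c ∘ suc)))))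

  leaf : State → Num N B
  leaf q = eval leafT (q , tt)

  opaque
    unfolding leafT

    leaf-val : ∀ q → val (leaf q) ≈ prod (λ i → matrix q i i false false + matrix q i i true true)
    leaf-val q = trans (fold-prod {N} (λ i a → eval step (i , a , q , tt)) _ h (eval {state ∷ []} oneT (q , tt)))
      (trans (*-cong {val (eval {state ∷ []} oneT (q , tt))} {1} {prod (λ i → matrix q i i false false + matrix q i i true true)} (cong (_% M) (oneT-val (q , tt))) refl) (cong (_% M) (*-identityˡ _)))
      where
      step : Tm (idx ∷ num ∷ state ∷ []) num
      step = mul x1 (add (get (cell x2 x0 x0) false false) (get (cell x2 x0 x0) true true))
      h : ∀ i a → val (eval step (i , a , q , tt)) ≈ val a * (matrix q i i false false + matrix q i i true true)
      h i a = trans (mul-term N B (i , a , q , tt) x1 (add (get (cell x2 x0 x0) false false) (get (cell x2 x0 x0) true true)))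
        (*-cong {val a} refl (add-term N B (i , a , q , tt) (get (cell x2 x0 x0) false false) (get (cell x2 x0 x0) true true)))

  leaf-correct : ∀ q → (∀ v → hasEdge q v ≡ false) → val (leaf q) ≈ Z (matrix q)
  leaf-correct q h = trans (leaf-val q) (cong (_% M) (sym (leaf-Z (matrix q) (λ i j x y i≢j → no-edge⇒1 q i j i≢j (isolated q i (h i) j) x y))))

  alive-drop : ∀ {p q} v → (∀ i → hasEdge p i ≡ true → hasEdge q i ≡ true) → hasEdge p v ≡ false → hasEdge q v ≡ true → suc (alive p) ≤ alive q
  alive-drop {p} {q} v sub iso ed = ≤-trans (s≤s (count-mono h)) (≤-reflexive (sym (count-∖ {P = hasEdge q} {v} ed)))
    where
    h : ∀ i → hasEdge p i ≡ true → (hasEdge q ∖ v) i ≡ true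
    h i pi = ∧⁺ (sub i pi) (cong not (≢⇒≡ᶠ {i = v} {i} (λ { refl → true≢false pi iso })))

  ⊑-hasEdge : ∀ {p q} → p ⊑ q → ∀ i → hasEdge p i ≡ true → hasEdge q i ≡ true
  ⊑-hasEdge {p} {q} h i e with hasEdge⁻ p i e
  ... | j , ej = hasEdge⁺ q i j (⊑-edge {p} {q} h i j ej)

  isolated⁺ : ∀ q v → (∀ j → edge q v j ≡ false) → hasEdge q v ≡ false
  isolated⁺ q v h with hasEdge q v in e
  ... | false = refl
  ... | true with hasEdge⁻ q v e
  ... | j , ej = ⊥-elim (true≢false ej (h j))

  assign-alive : ∀ q v α → hasEdge q v ≡ true → suc (alive (assign q v α)) ≤ alive q
  assign-alive q v α = alive-drop {assign q v α} {q} v (⊑-hasEdge {assign q v α} {q} (assign-⊑ q v α)) (isolated⁺ (assign q v α) v (assign-isolates q v α))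

  stay : ∀ {A : Set} n (e : Fin n → Bool) (R : Fin n → A) r → foldFin {Bool × A} n (λ v a → if proj₁ a then a else (if e v then (true , R v) else a)) (true , r) ≡ (true , r)
  stay zero e R r = refl
  stay (suc n) e R r = stay n (e ∘ suc) (R ∘ suc) r

  -- A loop cannot be left early; instead the flag freezes the result of the first hit.
  first-fold : ∀ {A : Set} {n} (P : A → Set) (e : Fin n → Bool) (R : Fin n → A) r →
    (∀ v → e v ≡ true → P (R v)) → ((∀ v → e v ≡ false) → P r) →
    P (proj₂ (foldFin {Bool × A} n (λ v a → if proj₁ a then a else (if e v then (true , R v) else a)) (false , r)))
  first-fold {n = zero} P e R r hit miss = miss (λ ())
  first-fold {A} {suc n} P e R r hit miss with e zero in e0
  ... | true = subst (λ (x : Bool × A) → P (proj₂ x)) (sym (stay n (e ∘ suc) (R ∘ suc) (R zero))) (hit zero e0)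
  ... | false = first-fold P (e ∘ suc) (R ∘ suc) r (hit ∘ suc) (λ h → miss λ { zero → e0 ; (suc i) → h i })

  brute : ℕ → State → Num N B
  brute k q = eval (bruteT k) (q , tt)

  no-alive : ∀ q → alive q ≤ 0 → ∀ v → hasEdge q v ≡ false
  no-alive q h = count≡0 (hasEdge q) (n≤0⇒n≡0 h)

  opaque
    unfolding bruteT

    brute-correct : ∀ k q → alive q ≤ k → val (brute k q) ≈ Z (matrix q)
    brute-correct zero q h = leaf-correct q (no-alive q h)
    brute-correct (suc k) q h = first-fold (λ a → val a ≈ Z (matrix q)) (hasEdge q) R (leaf q) hit (leaf-correct q)
      where
      R : Fin N → Num N B
      R v = eval addcT (brute k (assign q v false) , brute k (assign q v true) , false , tt)
      ih : ∀ v α → hasEdge q v ≡ true → val (brute k (assign q v α)) ≈ Z (assignM (matrix q) v α)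
      ih v α e = trans (brute-correct k (assign q v α) (≤-pred (≤-trans (assign-alive q v α e) h))) (assign-Z q v α)
      hit : ∀ v → hasEdge q v ≡ true → val (R v) ≈ Z (matrix q)
      hit v e = trans (addc-val N B (brute k (assign q v false)) (brute k (assign q v true)) false)
        (trans (cong (_% M) (+-identityʳ _)) (trans (+-cong {val (brute k (assign q v false))} (ih v false e) (ih v true e)) (cong (_% M) (sym (branch-Z (matrix q) v)))))

  Mask : Set
  Mask = Fin N → Bool

  ind-val : ∀ {Γ} (γ : ⟦ Γ ⟧ᶜ) b u w → val (entry (eval {Γ} (ind b) γ) u w) ≡ [ is b u ]
  ind-val {Γ} γ b u w = trans (cong val (tblOf-eval γ (λ u _ → if is b u then oneT else zeroT) u w)) (c (is b u))
    where
    c : ∀ e → val (eval {Γ} (if e then oneT else zeroT) γ) ≡ [ e ]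
    c true = oneT-val γ
    c false = zero-val N B γ

  local : State → Mask → Fin N → Fin N → Bool → Bool → State
  local q X a b x y = eval (localT x y) (q , X , a , b , tt)

  opaque
    unfolding localT

    local-matrix : ∀ q X a b x y i j u w → matrix (local q X a b x y) i j u w ≡ localM (matrix q) X a b x y i j u w
    local-matrix q X a b x y i j u w with X i | X j | i ≡ᶠ j
    ... | true | _ | _ = refl
    ... | false | true | _ = refl
    ... | false | false | false = ones-val (j , i , q , X , a , b , tt) u w
    ... | false | false | true with a ≡ᶠ i | b ≡ᶠ i
    ... | true | _ = ind-val (j , i , q , X , a , b , tt) x u w
    ... | false | true = ind-val (j , i , q , X , a , b , tt) y u w
    ... | false | false = ind-val (j , i , q , X , a , b , tt) false u w

    local-in : ∀ q X a b x y i j → X i ∨ X j ≡ true → local q X a b x y i j ≡ q i j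
    local-in q X a b x y i j h with X i | X j
    ... | true | _ = refl
    ... | false | true = refl

    local-out : ∀ q X a b x y i j → X i ≡ false → X j ≡ false → i ≢ j → triv (local q X a b x y i j) ≡ true
    local-out q X a b x y i j Xi Xj i≢j rewrite Xi | Xj | ≢⇒≡ᶠ i≢j = onesᵛ (j , i , q , X , a , b , tt)

  bd : State → Mask → Mask
  bd q X = Graph.boundary (graphOf q) X

  bd⁺ : ∀ q X x y → X y ≡ false → X x ≡ true → edge q y x ≡ true → bd q X y ≡ true
  bd⁺ q X x y Xy Xx e = ∧⁺ (cong not Xy) (any⁺ (λ x → X x ∧ isEdge (kindOf q y x)) x (∧⁺ Xx (trans (isEdge-kind q y x) e)))

  bd⁻ : ∀ q X y → bd q X y ≡ true → X y ≡ false × ∃ λ x → X x ≡ true × edge q y x ≡ true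
  bd⁻ q X y h with ∧⁻ {not (X y)} h
  ... | nX , an with any⁻ (λ x → X x ∧ isEdge (kindOf q y x)) an
  ... | x , p with ∧⁻ {X x} p
  ... | Xx , e = flip (X y) nX , x , Xx , trans (sym (isEdge-kind q y x)) e
    where
    flip : ∀ b → not b ≡ true → b ≡ false
    flip false _ = refl

  -- `both` ensures that `a` and `b` have edges into `X` to exchange for the new one.
  record Valid (q : State) (X : Mask) (a b : Fin N) : Set where
    field
      a∉X : X a ≡ false
      b∉X : X b ≡ false
      small : count X ≤ 7
      only : ∀ y → bd q X y ≡ true → y ≡ a ⊎ y ≡ b
      both : a ≡ b ⊎ (bd q X a ≡ true × bd q X b ≡ true)

  elim : State → Mask → Fin N → Fin N → State
  elim q X a b = eval elimT (q , X , a , b , tt)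

  factor : State → Mask → Fin N → Fin N → Bool → Bool → Num N B
  factor q X a b u w = brute 9 (local q X a b u w)

  opaque
    unfolding elimT

    elim-matrix : ∀ q X a b i j u w → matrix (elim q X a b) i j u w ≈ elimM (matrix q) X a b (λ u w → val (factor q X a b u w)) i j u w
    elim-matrix q X a b i j u w = go (X i) (X j) (i ≡ᶠ j) (a ≡ᶠ i) (b ≡ᶠ j)
      where
      Γ : Ctx
      Γ = idx ∷ idx ∷ state ∷ arr bool ∷ idx ∷ idx ∷ []
      γ : ⟦ Γ ⟧ᶜ
      γ = j , i , q , X , a , b , tt
      e : Bool → Bool → Tm Γ num
      e u w = mul (get (cell x2 x1 x0) u w) (call (x2 ∷ x3 ∷ x4 ∷ x5 ∷ []) (factorT u w))
      go : ∀ p r c d f → val (entry (if (if p then true else r) then (if c then eval {Γ} (ind false) γ else eval {Γ} ones γ) else (if (if d then f else false) then eval (tblOf e) γ else q i j)) u w)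
           ≈ (if p ∨ r then (if c then [ not u ] else 1) else (if d ∧ f then matrix q i j u w * val (factor q X a b u w) else matrix q i j u w))
      go true r true d f = cong (_% M) (ind-val γ false u w)
      go true r false d f = cong (_% M) (ones-val γ u w)
      go false true true d f = cong (_% M) (ind-val γ false u w)
      go false true false d f = cong (_% M) (ones-val γ u w)
      go false false c true true = trans (cong (_% M) (cong val (tblOf-eval γ e u w)))
        (trans (mul-term N B γ (get (cell x2 x1 x0) u w) (call (x2 ∷ x3 ∷ x4 ∷ x5 ∷ []) (factorT u w))) (cong (λ m → (m * val (factor q X a b u w)) % M) (cong val (get-eval γ (cell x2 x1 x0) u w))))
      go false false c true false = refl
      go false false c false f = refl

    elim-off : ∀ q X a b i j → X i ≡ false → X j ≡ false → ¬ (a ≡ i × b ≡ j) → elim q X a b i j ≡ q i j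
    elim-off q X a b i j Xi Xj nab rewrite Xi | Xj with a ≡ᶠ i in ai | b ≡ᶠ j in bj
    ... | true | true = ⊥-elim (nab (≡ᶠ⇒≡ a i ai , ≡ᶠ⇒≡ b j bj))
    ... | true | false = refl
    ... | false | _ = refl

    elim-in : ∀ q X a b i j → X i ∨ X j ≡ true → i ≢ j → triv (elim q X a b i j) ≡ true
    elim-in q X a b i j h i≢j with X i | X j
    ... | true | _ rewrite ≢⇒≡ᶠ i≢j = onesᵛ (j , i , q , X , a , b , tt)
    ... | false | true rewrite ≢⇒≡ᶠ i≢j = onesᵛ (j , i , q , X , a , b , tt)

  ∨-swap : ∀ {a b} → a ∨ b ≡ true → b ∨ a ≡ true
  ∨-swap {true} {true} _ = refl
  ∨-swap {true} {false} _ = refl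
  ∨-swap {false} {true} _ = refl

  ∨-true⁻ : ∀ a {b} → a ∨ b ≡ true → a ≡ true ⊎ b ≡ true
  ∨-true⁻ true _ = inj₁ refl
  ∨-true⁻ false p = inj₂ p

  elim-edge : ∀ q X a b i j → edge (elim q X a b) i j ≡ true → X i ≡ false × X j ≡ false × (kindOf (elim q X a b) i j ≡ kindOf q i j ⊎ Joins a b i j)
  elim-edge q X a b i j e with X i in Xi | X j in Xj
  ... | true | _ = ⊥-elim (true≢false e (no-edge p i j (elim-in q X a b i j (cong (_∨ X j) Xi) i≢j) (elim-in q X a b j i (∨-swap {X i} (cong (_∨ X j) Xi)) (i≢j ∘ sym))))
    where
    p = elim q X a b
    i≢j = edge⇒≢ p i j e
  ... | false | true = ⊥-elim (true≢false e (no-edge p i j (elim-in q X a b i j (trans (cong (_∨ X j) Xi) Xj) i≢j) (elim-in q X a b j i (cong (_∨ X i) Xj) (i≢j ∘ sym))))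
    where
    p = elim q X a b
    i≢j = edge⇒≢ p i j e
  ... | false | false = refl , refl , joins?
    where
    joins? : kindOf (elim q X a b) i j ≡ kindOf q i j ⊎ Joins a b i j
    joins? with a ≟ᶠ i | b ≟ᶠ j | a ≟ᶠ j | b ≟ᶠ i
    ... | yes ai | yes bj | _ | _ = inj₂ (inj₁ (sym ai , sym bj))
    ... | _ | _ | yes aj | yes bi = inj₂ (inj₂ (sym bi , sym aj))
    ... | yes _ | no nbj | no naj | _ = inj₁ (kindOf-cong (elim q X a b) q i j (elim-off q X a b i j Xi Xj (nbj ∘ proj₂)) (elim-off q X a b j i Xj Xi (naj ∘ proj₁)))
    ... | yes _ | no nbj | yes _ | no nbi = inj₁ (kindOf-cong (elim q X a b) q i j (elim-off q X a b i j Xi Xj (nbj ∘ proj₂)) (elim-off q X a b j i Xj Xi (nbi ∘ proj₂)))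
    ... | no nai | _ | no naj | _ = inj₁ (kindOf-cong (elim q X a b) q i j (elim-off q X a b i j Xi Xj (nai ∘ proj₁)) (elim-off q X a b j i Xj Xi (naj ∘ proj₁)))
    ... | no nai | _ | yes _ | no nbi = inj₁ (kindOf-cong (elim q X a b) q i j (elim-off q X a b i j Xi Xj (nai ∘ proj₁)) (elim-off q X a b j i Xj Xi (nbi ∘ proj₂)))

  module _ {q X a b} (ok : Valid q X a b) where
    open Valid ok

    local-edge : ∀ x y i j → edge (local q X a b x y) i j ≡ true → (X i ≡ true ⊎ X j ≡ true) × edge q i j ≡ true
    local-edge x y i j e with X i ∨ X j in Xij
    ... | true = ∨-true⁻ (X i) Xij , trans (sym (isEdge-kind q i j)) (trans (cong isEdge (sym (kindOf-cong p q i j (local-in q X a b x y i j Xij) (local-in q X a b x y j i (∨-swap {X i} Xij))))) (trans (isEdge-kind p i j) e))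
      where p = local q X a b x y
    ... | false = ⊥-elim (true≢false e (no-edge p i j (local-out q X a b x y i j (proj₁ (both-false Xij)) (proj₂ (both-false Xij)) i≢j) (local-out q X a b x y j i (proj₂ (both-false Xij)) (proj₁ (both-false Xij)) (i≢j ∘ sym))))
      where
      p = local q X a b x y
      i≢j = edge⇒≢ p i j e
      both-false : ∀ {c d} → c ∨ d ≡ false → c ≡ false × d ≡ false
      both-false {false} {false} _ = refl , refl

    local-alive : ∀ x y → alive (local q X a b x y) ≤ 9
    local-alive x y = ≤-trans (sum-mono h) (≤-trans (≤-reflexive (trans (∑-distrib-+ (λ i → [ X i ]) _) (cong (count X +_) (trans (∑-distrib-+ (λ i → [ a ≡ᶠ i ] * 1) _) (cong₂ _+_ (sum-pick a (λ _ → 1)) (sum-pick b (λ _ → 1))))))) (+-monoˡ-≤ 2 small))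
      where
      p = local q X a b x y
      h : ∀ i → [ hasEdge p i ] ≤ [ X i ] + ([ a ≡ᶠ i ] * 1 + [ b ≡ᶠ i ] * 1)
      h i with hasEdge p i in hi
      ... | false = z≤n
      ... | true with X i in Xi
      ... | true = s≤s z≤n
      ... | false with hasEdge⁻ p i hi
      ... | j , e with local-edge x y i j e
      ... | inj₁ Xi′ , _ = ⊥-elim (true≢false Xi′ Xi)
      ... | inj₂ Xj , eq with only i (bd⁺ q X j i Xi Xj eq)
      ... | inj₁ refl rewrite ≡ᶠ-refl i = s≤s z≤n
      ... | inj₂ refl rewrite ≡ᶠ-refl i = m≤n+m 1 _

    factor-correct : ∀ u w → val (factor q X a b u w) ≈ Z (localM (matrix q) X a b u w)
    factor-correct u w = trans (brute-correct 9 (local q X a b u w) (local-alive u w)) (Z-cong (λ i j x y → cong (_% M) (local-matrix q X a b u w i j x y)))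

    elim-Z : Z (matrix (elim q X a b)) ≈ Z (matrix q)
    elim-Z = trans (Z-cong (elim-matrix q X a b)) (trans (Z-cong exact) (cong (_% M) (elimM-Z (matrix q) X a b a∉X b∉X (λ u w → Z (localM (matrix q) X a b u w)) (λ _ _ → refl) apart)))
      where
      exact : ∀ i j u w → elimM (matrix q) X a b (λ u w → val (factor q X a b u w)) i j u w ≈ elimM (matrix q) X a b (λ u w → Z (localM (matrix q) X a b u w)) i j u w
      exact i j u w with X i ∨ X j | (a ≡ᶠ i) ∧ (b ≡ᶠ j)
      ... | true | _ = refl
      ... | false | true = *-cong {matrix q i j u w} refl (factor-correct u w)
      ... | false | false = refl
      apart : ∀ i j → X i ≡ true → X j ≡ false → a ≢ j → b ≢ j → ∀ x y → matrix q i j x y ≡ 1 × matrix q j i x y ≡ 1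
      apart i j Xi Xj a≢j b≢j x y = no-edge⇒1 q i j i≢j (trans (edge-symᵇ q i j) none-ji) x y , no-edge⇒1 q j i (i≢j ∘ sym) none-ji x y
        where
        i≢j : i ≢ j
        i≢j refl = true≢false Xi Xj
        none-ji : edge q j i ≡ false
        none-ji with edge q j i in e
        ... | false = refl
        ... | true with only j (bd⁺ q X i j Xj Xi e)
        ... | inj₁ p = ⊥-elim (a≢j (sym p))
        ... | inj₂ p = ⊥-elim (b≢j (sym p))

    elim-hasEdge : ∀ i → hasEdge (elim q X a b) i ≡ true → X i ≡ false × hasEdge q i ≡ true
    elim-hasEdge i h with hasEdge⁻ (elim q X a b) i h
    ... | j , e with elim-edge q X a b i j e
    ... | Xi , Xj , inj₁ k = Xi , hasEdge⁺ q i j (trans (sym (isEdge-kind q i j)) (trans (cong isEdge (sym k)) (trans (isEdge-kind (elim q X a b) i j) e)))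
    ... | Xi , Xj , inj₂ jn = Xi , joined jn
      where
      attached-edge : ∀ y → bd q X y ≡ true → hasEdge q y ≡ true
      attached-edge y p = let (_ , x , _ , e) = bd⁻ q X y p in hasEdge⁺ q y x e
      joined : Joins a b i j → hasEdge q i ≡ true
      joined jn with both
      joined (inj₁ (refl , refl)) | inj₁ refl = ⊥-elim (true≢false e (edge-irrefl (elim q X a b) i))
      joined (inj₂ (refl , refl)) | inj₁ refl = ⊥-elim (true≢false e (edge-irrefl (elim q X a b) i))
      joined (inj₁ (refl , refl)) | inj₂ (pa , pb) = attached-edge i pa
      joined (inj₂ (refl , refl)) | inj₂ (pa , pb) = attached-edge i pb

    -- Compares with the network `q₀` before a separator was assigned. The assigned vertices are
    -- isolated in `q`, so relative to `q₀` all of `Y` disappears.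
    elim-Deletes : ∀ {q₀} → q ⊑ q₀ → ∀ Y → (∀ i j → edge q i j ≡ true → X i ≡ false → Y i ≡ false) → Y a ≡ false → Y b ≡ false →
                   Deletes Y (Joins a b) (graphOf q₀) (graphOf (elim q X a b))
    elim-Deletes {q₀} sub Y avoid Ya Yb = record { edge⁻ = λ x y e → h x y (trans (sym (isEdge-kind p x y)) e) ; soft⁻ = hs }
      where
      p = elim q X a b
      keep : ∀ x y → edge p x y ≡ true → kindOf p x y ≡ kindOf q x y → X x ≡ false → X y ≡ false → edge q x y ≡ true × Y x ≡ false × Y y ≡ false
      keep x y e k Xx Xy = eq , avoid x y eq Xx , avoid y x (trans (edge-symᵇ q y x) eq) Xy
        where
        eq : edge q x y ≡ true
        eq = trans (sym (isEdge-kind q x y)) (trans (cong isEdge (sym k)) (trans (isEdge-kind p x y) e))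
      h : ∀ x y → edge p x y ≡ true → (isEdge (kindOf q₀ x y) ≡ true × Y x ≡ false × Y y ≡ false) ⊎ Joins a b x y
      h x y e with elim-edge q X a b x y e
      ... | _ , _ , inj₂ jn = inj₂ jn
      ... | Xx , Xy , inj₁ k with keep x y e k Xx Xy
      ... | eq , ys = inj₁ (trans (isEdge-kind q₀ x y) (⊑-edge {q} {q₀} sub x y eq) , ys)
      hs : ∀ x y → isSoft (kindOf p x y) ≡ true → (isSoft (kindOf q₀ x y) ≡ true × Y x ≡ false × Y y ≡ false) ⊎ Joins a b x y
      hs x y e with elim-edge q X a b x y ed
        where
        ed : edge p x y ≡ true
        ed with kindOf p x y in k
        ... | soft = trans (sym (isEdge-kind p x y)) (cong isEdge k)
      ... | _ , _ , inj₂ jn = inj₂ jn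
      ... | Xx , Xy , inj₁ k with keep x y (soft-edge (kindOf p x y) refl) k Xx Xy
        where
        soft-edge : ∀ κ → kindOf p x y ≡ κ → edge p x y ≡ true
        soft-edge soft eq = trans (sym (isEdge-kind p x y)) (cong isEdge eq)
        soft-edge none eq = ⊥-elim (true≢false e (cong isSoft eq))
        soft-edge (hard _) eq = ⊥-elim (true≢false e (cong isSoft eq))
      ... | eq , ys = inj₁ (trans (cong isSoft (trans (sym (sub x y eq)) (sym k))) e , ys)

-- The measure in the loop language

opaque
  degT : Tm (state ∷ idx ∷ []) num
  degT = sumT (ite (call (x2 ∷ x3 ∷ x0 ∷ []) edgeT) oneT zeroT)

  sdegT : ℕ → Tm (state ∷ idx ∷ []) num
  sdegT σ = sumT (ite (call (x2 ∷ x3 ∷ x0 ∷ []) softT) (const σ) zeroT)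

  wT : Weights → Tm (num ∷ []) num
  wT F = ite (le x0 (const 1)) zeroT (ite (le x0 (const 2)) (const (2 * σ)) (ite (le x0 (const 3)) (const (2 * w₃))
    (ite (le x0 (const 4)) (const (2 * w₄)) (ite (le x0 (const 5)) (const (2 * w₅)) (const (2 * w₆))))))
    where open Weights F

  measureT : Weights → Tm (state ∷ []) num
  measureT F = sumT (add (call (call (x2 ∷ x0 ∷ []) degT ∷ []) (wT F)) (call (x2 ∷ x0 ∷ []) (sdegT (Weights.σ F))))

  minT : Tm (num ∷ num ∷ []) num
  minT = ite (le x0 x1) x0 x1

leastT : List Weights → Tm (state ∷ []) num
leastT [] = zeroT
leastT (F ∷ []) = measureT F
leastT (F ∷ G ∷ Fs) = call (measureT F ∷ leastT (G ∷ Fs) ∷ []) minT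

drops? : ∀ {Γ} → Tm Γ num → Tm Γ num → ℕ → Tm Γ bool
drops? m m′ x = le (add m′ (const x)) m

exceedsT : List (ℕ × ℕ) → Tm (num ∷ num ∷ num ∷ []) bool
exceedsT [] = fls
exceedsT ((p , q) ∷ ts) = orT (andT (drops? x0 x1 p) (drops? x0 x2 q)) (orT (andT (drops? x0 x1 q) (drops? x0 x2 p)) (exceedsT ts))

-- This is the test of the program on actual measures, whereas `exceeds` concerns guaranteed
-- decreases.
accepted : List (ℕ × ℕ) → (m m₀ m₁ : ℕ) → Bool
accepted [] m m₀ m₁ = false
accepted ((p , q) ∷ ts) m m₀ m₁ = ((m₀ + p ≤ᵇ m) ∧ (m₁ + q ≤ᵇ m)) ∨ ((m₀ + q ≤ᵇ m) ∧ (m₁ + p ≤ᵇ m)) ∨ accepted ts m m₀ m₁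

exceeds⇒accepted : ∀ ts {x y m m₀ m₁} → exceeds ts x y ≡ true → m₀ + x ≤ m → m₁ + y ≤ m → accepted ts m m₀ m₁ ≡ true
exceeds⇒accepted ((p , q) ∷ ts) {x} {y} {m} {m₀} {m₁} e d₀ d₁ with ∨⁻ {(p ≤ᵇ x) ∧ (q ≤ᵇ y)} e
... | inj₁ h = let (a , b) = ∧⁻ {p ≤ᵇ x} h in
  ∨-left _ (∧⁺ (true-≤ᵇ (≤-trans (+-monoʳ-≤ m₀ (≤ᵇ-true p x a)) d₀)) (true-≤ᵇ (≤-trans (+-monoʳ-≤ m₁ (≤ᵇ-true q y b)) d₁)))
... | inj₂ h with ∨⁻ {(q ≤ᵇ x) ∧ (p ≤ᵇ y)} h
... | inj₁ h′ = let (a , b) = ∧⁻ {q ≤ᵇ x} h′ in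
  ∨-right ((m₀ + p ≤ᵇ m) ∧ (m₁ + q ≤ᵇ m)) (∨-left _ (∧⁺ (true-≤ᵇ (≤-trans (+-monoʳ-≤ m₀ (≤ᵇ-true q x a)) d₀)) (true-≤ᵇ (≤-trans (+-monoʳ-≤ m₁ (≤ᵇ-true p y b)) d₁))))
... | inj₂ h′ = ∨-right ((m₀ + p ≤ᵇ m) ∧ (m₁ + q ≤ᵇ m)) (∨-right ((m₀ + q ≤ᵇ m) ∧ (m₁ + p ≤ᵇ m)) (exceeds⇒accepted ts h′ d₀ d₁))

accepted-≤ : ∀ ts {m m₀ m₁} → accepted ts m m₀ m₁ ≡ true → m₀ ≤ m × m₁ ≤ m
accepted-≤ ((p , q) ∷ ts) {m} {m₀} {m₁} e with ∨⁻ {(m₀ + p ≤ᵇ m) ∧ (m₁ + q ≤ᵇ m)} e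
... | inj₁ h = let (a , b) = ∧⁻ {m₀ + p ≤ᵇ m} h in m+n≤o⇒m≤o m₀ (≤ᵇ-true (m₀ + p) m a) , m+n≤o⇒m≤o m₁ (≤ᵇ-true (m₁ + q) m b)
... | inj₂ h with ∨⁻ {(m₀ + q ≤ᵇ m) ∧ (m₁ + p ≤ᵇ m)} h
... | inj₁ h′ = let (a , b) = ∧⁻ {m₀ + q ≤ᵇ m} h′ in m+n≤o⇒m≤o m₀ (≤ᵇ-true (m₀ + q) m a) , m+n≤o⇒m≤o m₁ (≤ᵇ-true (m₁ + p) m b)
... | inj₂ h′ = accepted-≤ ts h′

-- Bounds on the numbers that occur, so that arithmetic modulo 2 ^ N is exact.
record Small (K₁ K₂ : ℕ) (F : Weights) : Set where
  field
    inc : Weights.Increasing F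
    σ≤ : Weights.σ F ≤ K₂
    w≤ : 2 * Weights.w₆ F ≤ K₁

-- `K₁ + K₂ * N` bounds the weight of a vertex and `K₃` the constants that are added, so `big`
-- excludes overflow when measures are compared.
module Ops₄ (N B : ℕ) (1≤N : 1 ≤ N) (K₁ K₂ K₃ : ℕ) (1≤K₁ : 1 ≤ K₁) (5≤K₃ : 5 ≤ K₃)
            (big : N * (K₁ + K₂ * N) + K₃ < 2 ^ N) where
  open Semantics N B
  open Ops₂ N B 1≤N public
  private
    M = 2 ^ N
    instance
      M≢0 : NonZero M
      M≢0 = m^n≢0 2 N
  open Modular M

  fold-sum : ∀ {n} (f : Fin n → Num N B → Num N B) (c : Fin n → ℕ) → (∀ i a → val (f i a) ≈ val a + c i) →
             ∀ a → val (foldFin n f a) ≈ val a + sum c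
  fold-sum {zero} f c h a = cong (_% M) (sym (+-identityʳ (val a)))
  fold-sum {suc n} f c h a = trans (fold-sum (f ∘ suc) (c ∘ suc) (h ∘ suc) (f zero a))
    (trans (+-cong {val (f zero a)} {val a + c zero} {sum (c ∘ suc)} (h zero a) refl) (cong (_% M) (+-assoc (val a) (c zero) (sum (c ∘ suc)))))

  sum-val : ∀ {Γ} (γ : ⟦ Γ ⟧ᶜ) (t : Tm (idx ∷ num ∷ Γ) num) (c : Fin N → ℕ) → (∀ i a → val (eval t (i , a , γ)) ≈ c i) → val (eval (sumT t) γ) ≈ sum c
  sum-val γ t c h = trans (fold-sum {N} (λ i a → eval (add x1 t) (i , a , γ)) c (λ i a → trans (add-term N B (i , a , γ) x1 t) (+-cong {val a} refl (h i a))) (eval zeroT γ))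
    (cong (λ x → (x + sum c) % M) (zero-val N B γ))

  small<M : ∀ {x} → x ≤ K₃ → x < M
  small<M x≤ = ≤-<-trans (≤-trans x≤ (m≤n+m K₃ (N * (K₁ + K₂ * N)))) big

  N<M : N < M
  N<M = ≤-<-trans (≤-trans (≤-trans (≤-reflexive (sym (*-identityʳ N))) (*-monoʳ-≤ N (≤-trans 1≤K₁ (m≤m+n K₁ (K₂ * N))))) (m≤m+n (N * (K₁ + K₂ * N)) K₃)) big

  count≤N : ∀ {n} (P : Fin n → Bool) → count P ≤ n
  count≤N {zero} P = z≤n
  count≤N {suc n} P = +-mono-≤ ([]≤1 (P zero)) (count≤N (P ∘ suc))

  const-exact : ∀ {Γ} (γ : ⟦ Γ ⟧ᶜ) n → n ≤ K₃ → val (eval {Γ} (const n) γ) ≡ n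
  const-exact γ n n≤ = ≈⇒≡ (val< (eval (const n) γ)) (small<M n≤) (const-val N B γ n)

  le-exact : ∀ {Γ} (γ : ⟦ Γ ⟧ᶜ) t u → eval (le t u) γ ≡ (val (eval t γ) ≤ᵇ val (eval u γ))
  le-exact γ t u with eval (le t u) γ in e
  ... | true = sym (true-≤ᵇ (le⇒≤ N B {γ = γ} t u e))
  ... | false with val (eval t γ) ≤ᵇ val (eval u γ) in e′
  ... | false = refl
  ... | true = trans (sym e) (≤⇒le N B {γ = γ} t u (≤ᵇ-true (val (eval t γ)) (val (eval u γ)) e′))

  opaque
    unfolding degT

    deg-val : ∀ q v → val (eval degT (q , v , tt)) ≡ Graph.deg (graphOf q) v
    deg-val q v = ≈⇒≡ (val< (eval degT (q , v , tt))) (≤-<-trans (count≤N _) N<M) (sum-val (q , v , tt) body (λ j → [ isEdge (kindOf q v j) ]) (λ j a → h j a (edge q v j) refl))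
      where
      body : Tm (idx ∷ num ∷ state ∷ idx ∷ []) num
      body = ite (call (x2 ∷ x3 ∷ x0 ∷ []) edgeT) oneT zeroT
      h : ∀ j a e → edge q v j ≡ e → val (eval body (j , a , q , v , tt)) ≈ [ isEdge (kindOf q v j) ]
      h j a true eq rewrite isEdge-kind q v j | eq = cong (_% M) (oneT-val {idx ∷ num ∷ state ∷ idx ∷ []} (j , a , q , v , tt))
      h j a false eq rewrite isEdge-kind q v j | eq = cong (_% M) (zero-val N B {idx ∷ num ∷ state ∷ idx ∷ []} (j , a , q , v , tt))

    sdeg-val : ∀ σ q v → val (eval (sdegT σ) (q , v , tt)) ≈ σ * Graph.sdeg (graphOf q) v
    sdeg-val σ q v = trans (sum-val (q , v , tt) body (λ j → σ * [ isSoft (kindOf q v j) ]) (λ j a → h j a (eval softT (q , v , j , tt)) refl))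
        (cong (_% M) (sym (*-distribˡ-sum σ (λ j → [ isSoft (kindOf q v j) ]))))
      where
      body : Tm (idx ∷ num ∷ state ∷ idx ∷ []) num
      body = ite (call (x2 ∷ x3 ∷ x0 ∷ []) softT) (const σ) zeroT
      h : ∀ j a e → eval softT (q , v , j , tt) ≡ e → val (eval body (j , a , q , v , tt)) ≈ σ * [ isSoft (kindOf q v j) ]
      h j a true eq rewrite isSoft-kind q v j | eq = trans (const-val N B {idx ∷ num ∷ state ∷ idx ∷ []} (j , a , q , v , tt) σ) (cong (_% M) (sym (*-identityʳ σ)))
      h j a false eq rewrite isSoft-kind q v j | eq = cong (_% M) (trans (zero-val N B {idx ∷ num ∷ state ∷ idx ∷ []} (j , a , q , v , tt)) (sym (*-zeroʳ σ)))

    w-val : ∀ F a → val (eval (wT F) (a , tt)) ≈ 2 * Weights.w F (val a)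
    w-val F a rewrite le-exact {num ∷ []} (a , tt) x0 (const 1) | const-exact {num ∷ []} (a , tt) 1 (≤-trans (m≤m+n 1 4) 5≤K₃)
                    | le-exact {num ∷ []} (a , tt) x0 (const 2) | const-exact {num ∷ []} (a , tt) 2 (≤-trans (m≤m+n 2 3) 5≤K₃)
                    | le-exact {num ∷ []} (a , tt) x0 (const 3) | const-exact {num ∷ []} (a , tt) 3 (≤-trans (m≤m+n 3 2) 5≤K₃)
                    | le-exact {num ∷ []} (a , tt) x0 (const 4) | const-exact {num ∷ []} (a , tt) 4 (≤-trans (m≤m+n 4 1) 5≤K₃)
                    | le-exact {num ∷ []} (a , tt) x0 (const 5) | const-exact {num ∷ []} (a , tt) 5 5≤K₃ = go (val a)
      where
      open Weights F
      k : ℕ → Num N B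
      k n = eval {num ∷ []} (const n) (a , tt)
      kv : ∀ n → val (k n) ≈ n
      kv = const-val N B {num ∷ []} (a , tt)
      go : ∀ d → val (if d ≤ᵇ 1 then eval {num ∷ []} zeroT (a , tt) else (if d ≤ᵇ 2 then k (2 * σ) else (if d ≤ᵇ 3 then k (2 * w₃) else (if d ≤ᵇ 4 then k (2 * w₄) else (if d ≤ᵇ 5 then k (2 * w₅) else k (2 * w₆)))))) ≈ 2 * w d
      go 0 = cong (_% M) (zero-val N B {num ∷ []} (a , tt))
      go 1 = cong (_% M) (zero-val N B {num ∷ []} (a , tt))
      go 2 = kv (2 * σ)
      go 3 = kv (2 * w₃)
      go 4 = kv (2 * w₄)
      go 5 = kv (2 * w₅)
      go (suc (suc (suc (suc (suc (suc d)))))) = kv (2 * w₆)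

    measure-≈ : ∀ F q → val (eval (measureT F) (q , tt)) ≈ measure F (graphOf q)
    measure-≈ F q = sum-val (q , tt) (add dt st) (λ v → W (Graph.deg (graphOf q) v) (Graph.sdeg (graphOf q) v)) h
      where
      open Weights F
      dt st : Tm (idx ∷ num ∷ state ∷ []) num
      dt = call (call (x2 ∷ x0 ∷ []) degT ∷ []) (wT F)
      st = call (x2 ∷ x0 ∷ []) (sdegT σ)
      h : ∀ v a → val (eval (add dt st) (v , a , q , tt)) ≈ W (Graph.deg (graphOf q) v) (Graph.sdeg (graphOf q) v)
      h v a = trans (add-term N B (v , a , q , tt) dt st)
        (+-cong {val (eval dt (v , a , q , tt))} {2 * w (Graph.deg (graphOf q) v)} (trans (w-val F (eval degT (q , v , tt))) (cong (λ d → (2 * w d) % M) (deg-val q v))) (sdeg-val σ q v))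

    minT-val : ∀ a b → val (eval minT (a , b , tt)) ≡ val a ⊓ val b
    minT-val a b rewrite le-exact {num ∷ num ∷ []} (a , b , tt) x0 x1 with val a ≤ᵇ val b in e
    ... | true = sym (m≤n⇒m⊓n≡m (≤ᵇ-true (val a) (val b) e))
    ... | false = sym (m≥n⇒m⊓n≡n (<⇒≤ (false-≤ᵇ {val a} {val b} e)))

  measure-bound : ∀ {F} → Small K₁ K₂ F → ∀ q → measure F (graphOf q) ≤ N * (K₁ + K₂ * N)
  measure-bound {F} sm q = ≤-trans (sum-mono h) (≤-reflexive (sum-const N (K₁ + K₂ * N)))
    where
    open Weights F
    open Small sm
    sum-const : ∀ n c → sum {n} (λ _ → c) ≡ n * c
    sum-const zero c = refl
    sum-const (suc n) c = cong (c +_) (sum-const n c)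
    w≤w₆ : ∀ d → w d ≤ w₆
    w≤w₆ d = ≤-trans (w-mono inc (m≤m+n d 6)) (≤-reflexive (top d))
      where
      top : ∀ d → w (d + 6) ≡ w₆
      top d rewrite +-comm d 6 = refl
    h : ∀ v → W (Graph.deg (graphOf q) v) (Graph.sdeg (graphOf q) v) ≤ K₁ + K₂ * N
    h v = +-mono-≤ (≤-trans (*-monoʳ-≤ 2 (w≤w₆ (Graph.deg (graphOf q) v))) w≤) (*-mono-≤ σ≤ (count≤N _))

  measure<M : ∀ {F} → Small K₁ K₂ F → ∀ q → measure F (graphOf q) < M
  measure<M sm q = ≤-<-trans (≤-trans (measure-bound sm q) (m≤m+n (N * (K₁ + K₂ * N)) K₃)) big

  measure-val : ∀ {F} → Small K₁ K₂ F → ∀ q → val (eval (measureT F) (q , tt)) ≡ measure F (graphOf q)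
  measure-val {F} sm q = ≈⇒≡ (val< (eval (measureT F) (q , tt))) (measure<M sm q) (measure-≈ F q)

  least-val : ∀ Fs → All (Small K₁ K₂) Fs → ∀ q → val (eval (leastT Fs) (q , tt)) ≡ least (graphOf q) Fs
  least-val [] _ q = zero-val N B (q , tt)
  least-val (F ∷ []) (sm ∷ _) q = measure-val sm q
  least-val (F ∷ G ∷ Fs) (sm ∷ sms) q = trans (minT-val (eval (measureT F) (q , tt)) (eval (leastT (G ∷ Fs)) (q , tt))) (cong₂ _⊓_ (measure-val sm q) (least-val (G ∷ Fs) sms q))

  least-bound : ∀ F Fs → All (Small K₁ K₂) (F ∷ Fs) → ∀ q → least (graphOf q) (F ∷ Fs) ≤ N * (K₁ + K₂ * N)
  least-bound F [] (sm ∷ _) q = measure-bound sm q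
  least-bound F (G ∷ Fs) (sm ∷ _) q = ≤-trans (m⊓n≤m _ _) (measure-bound sm q)

  drops-exact : ∀ {Γ} (γ : ⟦ Γ ⟧ᶜ) m m′ x → x ≤ K₃ → val (eval m′ γ) ≤ N * (K₁ + K₂ * N) →
                eval (drops? m m′ x) γ ≡ (val (eval m′ γ) + x ≤ᵇ val (eval m γ))
  drops-exact γ m m′ x x≤ m′≤ = trans (le-exact γ (add m′ (const x)) m) (cong (_≤ᵇ val (eval m γ)) exact)
    where
    exact : val (eval (add m′ (const x)) γ) ≡ val (eval m′ γ) + x
    exact = ≈⇒≡ (val< (eval (add m′ (const x)) γ)) (≤-<-trans (+-mono-≤ m′≤ x≤) big)
      (trans (add-term N B γ m′ (const x)) (+-cong {val (eval m′ γ)} refl (const-val N B γ x)))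

  exceeds-exact : ∀ ts → All (λ (p , q) → p ≤ K₃ × q ≤ K₃) ts → ∀ a b c → val b ≤ N * (K₁ + K₂ * N) → val c ≤ N * (K₁ + K₂ * N) →
                  eval (exceedsT ts) (a , b , c , tt) ≡ accepted ts (val a) (val b) (val c)
  exceeds-exact [] _ a b c b≤ c≤ = refl
  exceeds-exact ((p , q) ∷ ts) ((p≤ , q≤) ∷ h) a b c b≤ c≤
    rewrite drops-exact {num ∷ num ∷ num ∷ []} (a , b , c , tt) x0 x1 p p≤ b≤ | drops-exact {num ∷ num ∷ num ∷ []} (a , b , c , tt) x0 x2 q q≤ c≤
          | drops-exact {num ∷ num ∷ num ∷ []} (a , b , c , tt) x0 x1 q q≤ b≤ | drops-exact {num ∷ num ∷ num ∷ []} (a , b , c , tt) x0 x2 p p≤ c≤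
          | exceeds-exact ts h a b c b≤ c≤ = shape (val b + p ≤ᵇ val a) (val c + q ≤ᵇ val a) (val b + q ≤ᵇ val a) (val c + p ≤ᵇ val a) _
    where
    shape : ∀ a b c d e → (if (if a then b else false) then true else (if (if c then d else false) then true else e)) ≡ (a ∧ b) ∨ (c ∧ d) ∨ e
    shape true true _ _ _ = refl
    shape true false true true _ = refl
    shape true false true false _ = refl
    shape true false false _ _ = refl
    shape false _ true true _ = refl
    shape false _ true false _ = refl
    shape false _ false _ _ = refl

-- The search for a step

-- The sets that are summed out: a single vertex, which is meant for degrees one and two, or a
-- cluster.
data Shape : Set where
  single : Shape
  around : Bool → Shape

-- Four children suffice, as at most two vertices are assigned before a set is summed out. The flags
-- tell whether a child is present and whether a step has been found.
opt node outcome : Ty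
opt = bool ⊗ state
node = opt ⊗ (opt ⊗ (opt ⊗ opt))
outcome = bool ⊗ node

Region : Ctx
Region = state ∷ arr bool ∷ idx ∷ idx ∷ []

opaque
  maskT : Shape → Tm (state ∷ idx ∷ []) (arr bool)
  maskT single = tab (same x2 x0)
  maskT (around α) = tab (orT (same x2 x0) (call (x1 ∷ x2 ∷ x0 ∷ []) (forcedT α)))

  bdT : Tm (state ∷ arr bool ∷ idx ∷ []) bool
  bdT = andT (notT (at x1 x2)) (anyT (andT (at x3 x0) (call (x2 ∷ x4 ∷ x0 ∷ []) edgeT)))

  smallT onlyT bothT : Tm Region bool
  smallT = le (sumT (ite (at x3 x0) oneT zeroT)) (const 7)
  onlyT = notT (anyT (andT (call (x2 ∷ x3 ∷ x0 ∷ []) bdT) (notT (orT (same x0 x4) (same x0 x5)))))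
  bothT = orT (same x2 x3) (andT (call (x0 ∷ x1 ∷ x2 ∷ []) bdT) (call (x0 ∷ x1 ∷ x3 ∷ []) bdT))

validT : Tm Region bool
validT = andT (notT (at x1 x2)) (andT (notT (at x1 x3)) (andT smallT (andT onlyT bothT)))

orElse : ∀ {Γ} → Tm Γ outcome → Tm Γ outcome → Tm Γ outcome
orElse r r′ = ite (fst r) r r′

anyOf : ∀ {Γ} → Tm Γ outcome → List (Tm Γ outcome) → Tm Γ outcome
anyOf r [] = r
anyOf r (r′ ∷ rs) = orElse r (anyOf r′ rs)

-- Candidate steps are tried for all u₂, u₁, b, a, v (in the order of the
-- context).
Choice : Ctx
Choice = idx ∷ idx ∷ idx ∷ idx ∷ idx ∷ state ∷ []

module SearchTerms (F₀ : Weights) (Fs : List Weights) (ts : List (ℕ × ℕ)) (unit : ℕ) where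
  opaque
    μT : Tm (state ∷ []) num
    μT = leastT (F₀ ∷ Fs)

    -- The required decrease `d` depends on the number of siblings: 0 for an only child, `unit`
    -- after one assignment, and `2 * unit` after two.
    childT : ℕ → Tm (num ∷ Region) opt
    childT d = pr (andT (call (x1 ∷ x2 ∷ x3 ∷ x4 ∷ []) validT) (drops? x0 (call (call (x1 ∷ x2 ∷ x3 ∷ x4 ∷ []) elimT ∷ []) μT) d))
                  (call (x1 ∷ x2 ∷ x3 ∷ x4 ∷ []) elimT)

    splitT : Tm (num ∷ state ∷ state ∷ []) bool
    splitT = call (x0 ∷ call (x1 ∷ []) μT ∷ call (x2 ∷ []) μT ∷ []) (exceedsT ts)

  sepT : ℕ → Tm Choice state → Shape → Tm Choice opt
  sepT d p κ = call (call (x5 ∷ []) μT ∷ p ∷ call (x5 ∷ x4 ∷ []) (maskT κ) ∷ x3 ∷ x2 ∷ []) (childT d)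

  assigned₁ : Bool → Tm Choice state
  assigned₁ c = call (x5 ∷ x1 ∷ lit c ∷ []) assignT

  assigned₂ : Bool → Bool → Tm Choice state
  assigned₂ c d = call (assigned₁ c ∷ x0 ∷ lit d ∷ []) assignT

  absent : Tm Choice opt
  absent = pr fls x5

  branchT : Bool → Tm Choice state
  branchT α = call (call (x5 ∷ x4 ∷ lit α ∷ []) assignT ∷ []) propagateT

  candidate₀ : Shape → Tm Choice outcome
  candidate₀ κ = pr (andT (call (x5 ∷ x4 ∷ []) hasEdgeT) (fst (sepT 0 x5 κ))) (pr (sepT 0 x5 κ) (pr absent (pr absent absent)))

  candidateᵇ : Tm Choice outcome
  candidateᵇ = pr (andT (call (x5 ∷ x4 ∷ []) hasEdgeT) (call (call (x5 ∷ []) μT ∷ branchT false ∷ branchT true ∷ []) splitT))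
                  (pr (pr tru (branchT false)) (pr (pr tru (branchT true)) (pr absent absent)))

  candidate₁ : Shape → Tm Choice outcome
  candidate₁ κ = pr (andT (call (x5 ∷ x4 ∷ []) hasEdgeT) (andT (fst (c false)) (fst (c true)))) (pr (c false) (pr (c true) (pr absent absent)))
    where
    c : Bool → Tm Choice opt
    c b = sepT unit (assigned₁ b) κ

  candidate₂ : Shape → Tm Choice outcome
  candidate₂ κ = pr (andT (call (x5 ∷ x4 ∷ []) hasEdgeT) (andT (fst (c false false)) (andT (fst (c false true)) (andT (fst (c true false)) (fst (c true true))))))
                    (pr (c false false) (pr (c false true) (pr (c true false) (c true true))))
    where
    c : Bool → Bool → Tm Choice opt
    c b d = sepT (2 * unit) (assigned₂ b d) κ

  candidates : List (Tm Choice outcome)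
  candidates = candidate₀ (around false) ∷ candidate₀ (around true) ∷ candidateᵇ ∷ candidate₁ (around false) ∷ candidate₁ (around true)
             ∷ candidate₂ (around false) ∷ candidate₂ (around true) ∷ []

  opaque
    tryT : Tm Choice outcome
    tryT = anyOf (candidate₀ single) candidates

  loop₅ : Tm (outcome ∷ Choice) outcome
  loop₅ = orElse x0 (call (x1 ∷ x2 ∷ x3 ∷ x4 ∷ x5 ∷ x6 ∷ []) tryT)

  loop₄ : Tm (outcome ∷ idx ∷ idx ∷ idx ∷ idx ∷ state ∷ []) outcome
  loop₄ = fold x0 (call (x1 ∷ x0 ∷ x3 ∷ x4 ∷ x5 ∷ x6 ∷ x7 ∷ []) loop₅)

  loop₃ : Tm (outcome ∷ idx ∷ idx ∷ idx ∷ state ∷ []) outcome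
  loop₃ = fold x0 (call (x1 ∷ x0 ∷ x3 ∷ x4 ∷ x5 ∷ x6 ∷ []) loop₄)

  loop₂ : Tm (outcome ∷ idx ∷ idx ∷ state ∷ []) outcome
  loop₂ = fold x0 (call (x1 ∷ x0 ∷ x3 ∷ x4 ∷ x5 ∷ []) loop₃)

  loop₁ : Tm (outcome ∷ idx ∷ state ∷ []) outcome
  loop₁ = fold x0 (call (x1 ∷ x0 ∷ x3 ∷ x4 ∷ []) loop₂)

  opaque
    stepT : Tm (state ∷ []) outcome
    stepT = fold (pr fls (pr (pr fls x0) (pr (pr fls x0) (pr (pr fls x0) (pr fls x0))))) (call (x1 ∷ x0 ∷ x2 ∷ []) loop₁)

-- The charge of a problem of measure m is φ m, as long as m ≤ K.
record Charge (ts : List (ℕ × ℕ)) (unit K : ℕ) (φ : ℕ → ℕ) : Set where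
  field
    φ-mono : ∀ {m m₀} → m ≤ K → m₀ ≤ m → φ m₀ ≤ φ m
    φ-split : ∀ {m m₀ m₁} → m ≤ K → accepted ts m m₀ m₁ ≡ true → φ m₀ + φ m₁ ≤ φ m
    φ-half : ∀ {m m₀} → m ≤ K → m₀ + unit ≤ m → 2 * φ m₀ ≤ φ m
    φ-quarter : ∀ {m m₀} → m ≤ K → m₀ + 2 * unit ≤ m → 4 * φ m₀ ≤ φ m

count-true : ∀ n → count {n} (λ _ → true) ≡ n
count-true zero = refl
count-true (suc n) = cong suc (count-true n)

any-cong : ∀ {n} {P Q : Fin n → Bool} → (∀ i → P i ≡ Q i) → any P ≡ any Q
any-cong {zero} h = refl
any-cong {suc n} h = cong₂ _∨_ (h zero) (any-cong (h ∘ suc))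

fold-sound : ∀ {A : Set} (P : A → Set) n (f : Fin n → A → A) → (∀ i a → P a → P (f i a)) → ∀ a → P a → P (foldFin n f a)
fold-sound P zero f h a p = p
fold-sound P (suc n) f h a p = fold-sound P n (f ∘ suc) (h ∘ suc) (f zero a) (h zero a p)

-- One round establishes `P` whatever the accumulator is, and the later rounds preserve it.
fold-hit : ∀ {A : Set} (P : A → Set) n (f : Fin n → A → A) → (∀ i a → P a → P (f i a)) → ∀ i → (∀ a → P (f i a)) → ∀ a → P (foldFin n f a)
fold-hit P (suc n) f h zero hit a = fold-sound P n (f ∘ suc) (h ∘ suc) (f zero a) (hit a)
fold-hit P (suc n) f h (suc i) hit a = fold-hit P n (f ∘ suc) (h ∘ suc) i hit (f zero a)

-- Soundness and completeness of the search

module Ops₅ (F₀ : Weights) (Fs : List Weights) (ts : List (ℕ × ℕ)) (unit : ℕ)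
            (N B : ℕ) (1≤N : 1 ≤ N) (K₁ K₂ K₃ : ℕ) (1≤K₁ : 1 ≤ K₁) (7≤K₃ : 7 ≤ K₃) (big : N * (K₁ + K₂ * N) + K₃ < 2 ^ N)
            (small : All (Small K₁ K₂) (F₀ ∷ Fs)) (ts≤ : All (λ (p , q) → p ≤ K₃ × q ≤ K₃) ts) (unit≤ : 2 * unit ≤ K₃) where
  open Semantics N B
  open Ops₄ N B 1≤N K₁ K₂ K₃ 1≤K₁ (≤-trans (m≤m+n 5 2) 7≤K₃) big public
  open SearchTerms F₀ Fs ts unit
  private
    M = 2 ^ N
    instance
      M≢0 : NonZero M
      M≢0 = m^n≢0 2 N
  open Modular M

  module _ {Γ} (γ : ⟦ Γ ⟧ᶜ) where
    andT⁻ : ∀ c t → eval (andT c t) γ ≡ true → eval c γ ≡ true × eval t γ ≡ true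
    andT⁻ c t h with eval c γ
    ... | true = refl , h

    andT⁺ : ∀ c t → eval c γ ≡ true → eval t γ ≡ true → eval (andT c t) γ ≡ true
    andT⁺ c t h k rewrite h = k

    notT⁻ : ∀ c → eval (notT c) γ ≡ true → eval c γ ≡ false
    notT⁻ c h with eval c γ
    ... | false = refl

    notT⁺ : ∀ c → eval c γ ≡ false → eval (notT c) γ ≡ true
    notT⁺ c h rewrite h = refl

  μ : State → ℕ
  μ q = least (graphOf q) (F₀ ∷ Fs)

  opaque
    unfolding μT

    μ-val : ∀ q → val (eval μT (q , tt)) ≡ μ q
    μ-val = least-val (F₀ ∷ Fs) small

  μ≤ : ∀ q → val (eval μT (q , tt)) ≤ N * (K₁ + K₂ * N)
  μ≤ q = ≤-trans (≤-reflexive (μ-val q)) (least-bound F₀ Fs small q)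

  mask : Shape → State → Fin N → Mask
  mask κ q v = eval (maskT κ) (q , v , tt)

  opaque
    unfolding maskT

    mask-single : ∀ q v i → mask single q v i ≡ (v ≡ᶠ i)
    mask-single q v i = refl

    mask-around : ∀ q v α i → mask (around α) q v i ≡ Graph.cluster (graphOf q) v α i
    mask-around q v α i with v ≡ᶠ i
    ... | true = refl
    ... | false = sym (isHard-kind q α v i)

  mask-self : ∀ κ q v → mask κ q v v ≡ true
  mask-self single q v = trans (mask-single q v v) (≡ᶠ-refl v)
  mask-self (around α) q v = trans (mask-around q v α v) (cong (_∨ isHard α (kindOf q v v)) (≡ᶠ-refl v))

  bd-cong : ∀ q {X X′ : Mask} → (∀ i → X i ≡ X′ i) → ∀ y → bd q X y ≡ bd q X′ y
  bd-cong q h y = cong₂ (λ a b → not a ∧ b) (h y) (any-cong (λ x → cong (_∧ isEdge (kindOf q y x)) (h x)))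

  opaque
    unfolding bdT

    bd-eval : ∀ q X y → eval bdT (q , X , y , tt) ≡ bd q X y
    bd-eval q X y with X y
    ... | true = refl
    ... | false = trans (any-fold (λ x → if X x then edge q y x else false) false) (any-cong h)
      where
      h : ∀ x → (if X x then edge q y x else false) ≡ X x ∧ isEdge (kindOf q y x)
      h x with X x
      ... | true = sym (isEdge-kind q y x)
      ... | false = refl

    small-eval : ∀ q X a b → eval smallT (q , X , a , b , tt) ≡ (count X ≤ᵇ 7)
    small-eval q X a b = trans (le-exact (q , X , a , b , tt) (sumT body) (const 7))
      (cong₂ _≤ᵇ_ (≈⇒≡ (val< (eval (sumT body) (q , X , a , b , tt))) (≤-<-trans (count≤N X) N<M) (sum-val (q , X , a , b , tt) body (λ i → [ X i ]) h))
                  (const-exact {Region} (q , X , a , b , tt) 7 7≤K₃))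
      where
      body : Tm (idx ∷ num ∷ Region) num
      body = ite (at x3 x0) oneT zeroT
      h : ∀ i c → val (eval body (i , c , q , X , a , b , tt)) ≈ [ X i ]
      h i c with X i
      ... | true = cong (_% M) (oneT-val {idx ∷ num ∷ Region} (i , c , q , X , a , b , tt))
      ... | false = cong (_% M) (zero-val N B {idx ∷ num ∷ Region} (i , c , q , X , a , b , tt))

    private
      other : State → Mask → Fin N → Fin N → Fin N → Bool
      other q X a b y = if eval bdT (q , X , y , tt) then (if (if y ≡ᶠ a then true else (y ≡ᶠ b)) then false else true) else false

      only-any : ∀ q X a b → eval onlyT (q , X , a , b , tt) ≡ (if any (other q X a b) then false else true)
      only-any q X a b = cong (if_then false else true) (any-fold (other q X a b) false)

    only⁻ : ∀ q X a b → eval onlyT (q , X , a , b , tt) ≡ true → ∀ y → bd q X y ≡ true → y ≡ a ⊎ y ≡ b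
    only⁻ q X a b h y by with y ≡ᶠ a in ya | y ≡ᶠ b in yb
    ... | true | _ = inj₁ (≡ᶠ⇒≡ y a ya)
    ... | false | true = inj₂ (≡ᶠ⇒≡ y b yb)
    ... | false | false = ⊥-elim (absurd (trans (sym (only-any q X a b)) h) (any⁺ (other q X a b) y o))
      where
      absurd : ∀ {c} → (if c then false else true) ≡ true → c ≡ true → ⊥
      absurd {true} () _
      o : other q X a b y ≡ true
      o rewrite trans (bd-eval q X y) by | ya | yb = refl

    only⁺ : ∀ q X a b → (∀ y → bd q X y ≡ true → y ≡ a ⊎ y ≡ b) → eval onlyT (q , X , a , b , tt) ≡ true
    only⁺ q X a b h with any (other q X a b) in e
    ... | false = trans (only-any q X a b) (cong (if_then false else true) e)
    ... | true with any⁻ (other q X a b) e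
    ... | y , o = ⊥-elim (none-other (eval bdT (q , X , y , tt)) refl o)
      where
      none-other : ∀ c → eval bdT (q , X , y , tt) ≡ c → (if c then (if (if y ≡ᶠ a then true else (y ≡ᶠ b)) then false else true) else false) ≡ true → ⊥
      none-other true eq o′ with h y (trans (sym (bd-eval q X y)) eq)
      ... | inj₁ refl rewrite ≡ᶠ-refl y with o′
      ... | ()
      none-other true eq o′ | inj₂ refl rewrite ≡ᶠ-refl y with y ≡ᶠ a
      ... | true with o′
      ... | ()
      none-other true eq o′ | inj₂ refl | false with o′
      ... | ()

    both⁻ : ∀ q X a b → eval bothT (q , X , a , b , tt) ≡ true → a ≡ b ⊎ (bd q X a ≡ true × bd q X b ≡ true)
    both⁻ q X a b h with a ≡ᶠ b in ab
    ... | true = inj₁ (≡ᶠ⇒≡ a b ab)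
    ... | false = let (p , r) = andT⁻ (q , X , a , b , tt) (call (x0 ∷ x1 ∷ x2 ∷ []) bdT) (call (x0 ∷ x1 ∷ x3 ∷ []) bdT) h in
                  inj₂ (trans (sym (bd-eval q X a)) p , trans (sym (bd-eval q X b)) r)

    both⁺ : ∀ q X a b → a ≡ b ⊎ (bd q X a ≡ true × bd q X b ≡ true) → eval bothT (q , X , a , b , tt) ≡ true
    both⁺ q X a .a (inj₁ refl) rewrite ≡ᶠ-refl a = refl
    both⁺ q X a b (inj₂ (p , r)) with a ≡ᶠ b
    ... | true = refl
    ... | false = andT⁺ (q , X , a , b , tt) (call (x0 ∷ x1 ∷ x2 ∷ []) bdT) (call (x0 ∷ x1 ∷ x3 ∷ []) bdT) (trans (bd-eval q X a) p) (trans (bd-eval q X b) r)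

  valid⁻ : ∀ q X a b → eval validT (q , X , a , b , tt) ≡ true → Valid q X a b
  valid⁻ q X a b h =
    let γ = q , X , a , b , tt
        (h₁ , r₁) = andT⁻ γ (notT (at x1 x2)) (andT (notT (at x1 x3)) (andT smallT (andT onlyT bothT))) h
        (h₂ , r₂) = andT⁻ γ (notT (at x1 x3)) (andT smallT (andT onlyT bothT)) r₁
        (h₃ , r₃) = andT⁻ γ smallT (andT onlyT bothT) r₂
        (h₄ , h₅) = andT⁻ γ onlyT bothT r₃
    in record { a∉X = notT⁻ γ (at x1 x2) h₁ ; b∉X = notT⁻ γ (at x1 x3) h₂ ; small = ≤ᵇ-true (count X) 7 (trans (sym (small-eval q X a b)) h₃)
              ; only = only⁻ q X a b h₄ ; both = both⁻ q X a b h₅ }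

  valid⁺ : ∀ q X a b → Valid q X a b → eval validT (q , X , a , b , tt) ≡ true
  valid⁺ q X a b ok =
    let γ = q , X , a , b , tt in
    andT⁺ γ (notT (at x1 x2)) (andT (notT (at x1 x3)) (andT smallT (andT onlyT bothT))) (notT⁺ γ (at x1 x2) a∉X)
      (andT⁺ γ (notT (at x1 x3)) (andT smallT (andT onlyT bothT)) (notT⁺ γ (at x1 x3) b∉X)
        (andT⁺ γ smallT (andT onlyT bothT) (trans (small-eval q X a b) (true-≤ᵇ (Valid.small ok))) (andT⁺ γ onlyT bothT (only⁺ q X a b only) (both⁺ q X a b both))))
    where open Valid ok hiding (small)

  Opt : Set
  Opt = ⟦ opt ⟧ᵗ

  child : ℕ → State → State → Mask → Fin N → Fin N → Opt
  child d q p X a b = eval (childT d) (eval μT (q , tt) , p , X , a , b , tt)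

  opaque
    unfolding childT

    child-state : ∀ d q p X a b → proj₂ (child d q p X a b) ≡ elim p X a b
    child-state d q p X a b = refl

    child⁻ : ∀ d q p X a b → d ≤ K₃ → proj₁ (child d q p X a b) ≡ true → Valid p X a b × μ (elim p X a b) + d ≤ μ q
    child⁻ d q p X a b d≤ h =
      let γ = eval μT (q , tt) , p , X , a , b , tt
          eT = call (call (x1 ∷ x2 ∷ x3 ∷ x4 ∷ []) elimT ∷ []) μT
          (h₁ , h₂) = andT⁻ {num ∷ Region} γ (call (x1 ∷ x2 ∷ x3 ∷ x4 ∷ []) validT) (drops? x0 eT d) h
          h₃ = trans (sym (drops-exact {num ∷ Region} γ x0 eT d d≤ (μ≤ (elim p X a b)))) h₂
      in valid⁻ p X a b h₁ , subst₂ (λ m n → m + d ≤ n) (μ-val (elim p X a b)) (μ-val q) (≤ᵇ-true (val (eval μT (elim p X a b , tt)) + d) (val (eval μT (q , tt))) h₃)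

    child⁺ : ∀ d q p X a b → d ≤ K₃ → Valid p X a b → μ (elim p X a b) + d ≤ μ q → proj₁ (child d q p X a b) ≡ true
    child⁺ d q p X a b d≤ ok le =
      let γ = eval μT (q , tt) , p , X , a , b , tt
          eT = call (call (x1 ∷ x2 ∷ x3 ∷ x4 ∷ []) elimT ∷ []) μT
      in andT⁺ {num ∷ Region} γ (call (x1 ∷ x2 ∷ x3 ∷ x4 ∷ []) validT) (drops? x0 eT d) (valid⁺ p X a b ok)
           (trans (drops-exact {num ∷ Region} γ x0 eT d d≤ (μ≤ (elim p X a b))) (true-≤ᵇ (subst₂ (λ m n → m + d ≤ n) (sym (μ-val (elim p X a b))) (sym (μ-val q)) le)))

    split-eval : ∀ q p₀ p₁ → eval splitT (eval μT (q , tt) , p₀ , p₁ , tt) ≡ accepted ts (μ q) (μ p₀) (μ p₁)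
    split-eval q p₀ p₁ = trans (exceeds-exact ts ts≤ (eval μT (q , tt)) (eval μT (p₀ , tt)) (eval μT (p₁ , tt)) (μ≤ p₀) (μ≤ p₁))
      (trans (cong (λ m → accepted ts m (val (eval μT (p₀ , tt))) (val (eval μT (p₁ , tt)))) (μ-val q)) (cong₂ (accepted ts (μ q)) (μ-val p₀) (μ-val p₁)))

  -- The assigned vertices form S; in p they are isolated and the rest is as
  -- in q.
  module Separation (q p : State) (X S Y : Mask) (a b : Fin N) (Y≡ : ∀ y → Y y ≡ X y ∨ S y) (sub : p ⊑ q)
    (dead : ∀ i j → edge p i j ≡ true → S i ≡ false) (kept : ∀ i j → S i ≡ false → S j ≡ false → edge p i j ≡ edge q i j)
    (X∩S : ∀ x → X x ≡ true → S x ≡ false) (X≤7 : count X ≤ 7) (a∉X : X a ≡ false) (b∉X : X b ≡ false) (a∉S : S a ≡ false) (b∉S : S b ≡ false)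
    (both : a ≡ b ⊎ (bd q X a ≡ true × bd q X b ≡ true))
    (only : ∀ y → bd q X y ≡ true → S y ≡ false → y ≡ a ⊎ y ≡ b) where

    private
      in-p : ∀ y → bd q X y ≡ true → S y ≡ false → bd p X y ≡ true
      in-p y by Sy = let (Xy , x , Xx , e) = bd⁻ q X y by in bd⁺ p X x y Xy Xx (trans (kept y x Sy (X∩S x Xx)) e)

      both-p : a ≡ b ⊎ (bd q X a ≡ true × bd q X b ≡ true) → a ≡ b ⊎ (bd p X a ≡ true × bd p X b ≡ true)
      both-p (inj₁ e) = inj₁ e
      both-p (inj₂ (e , f)) = inj₂ (in-p a e a∉S , in-p b f b∉S)

      linked : ∀ y → bd q X y ≡ true → 1 ≤ Graph.links (graphOf q) Y y
      linked y by = let (_ , x , Xx , e) = bd⁻ q X y by in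
        ∃⇒count (λ x → Y x ∧ isEdge (kindOf q y x)) {x} (∧⁺ (trans (Y≡ x) (cong (_∨ S x) Xx)) (trans (isEdge-kind q y x) e))

      attach : a ≡ b ⊎ (bd q X a ≡ true × bd q X b ≡ true) → a ≡ b ⊎ (1 ≤ Graph.links (graphOf q) Y a × 1 ≤ Graph.links (graphOf q) Y b)
      attach (inj₁ e) = inj₁ e
      attach (inj₂ (e , f)) = inj₂ (linked a e , linked b f)

      ∉Y : ∀ y → X y ≡ false → S y ≡ false → Y y ≡ false
      ∉Y y Xy Sy = trans (Y≡ y) (cong₂ _∨_ Xy Sy)

    valid : Valid p X a b
    valid = record
      { a∉X = a∉X ; b∉X = b∉X ; small = X≤7 ; both = both-p both
      ; only = λ y by → let (Xy , x , Xx , e) = bd⁻ p X y by in only y (bd⁺ q X x y Xy Xx (⊑-edge {p} {q} sub y x e)) (dead y x e) }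

    eliminates : Eliminates Y a b (graphOf q) (graphOf (elim p X a b))
    eliminates = record
      { deletes = elim-Deletes {p} {X} {a} {b} valid {q} sub Y (λ i j e Xi → ∉Y i Xi (dead i j e)) (∉Y a a∉X a∉S) (∉Y b b∉X b∉S)
      ; a∉X = ∉Y a a∉X a∉S
      ; b∉X = ∉Y b b∉X b∉S
      ; attached = attach both }

  Outcome Node : Set
  Outcome = ⟦ outcome ⟧ᵗ
  Node = ⟦ node ⟧ᵗ

  flag : Outcome → Bool
  flag = proj₁

  value : Opt → ℕ
  value o = if proj₁ o then Z (matrix (proj₂ o)) else 0

  module _ {Γ} (γ : ⟦ Γ ⟧ᶜ) where
    orElse-elim : ∀ (P : Outcome → Set) r r′ → P (eval r γ) → P (eval r′ γ) → P (eval (orElse r r′) γ)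
    orElse-elim P r r′ p p′ = c (flag (eval r γ))
      where
      c : ∀ f → P (if f then eval r γ else eval r′ γ)
      c true = p
      c false = p′

    orElse-flag : ∀ r r′ → flag (eval r γ) ≡ true ⊎ flag (eval r′ γ) ≡ true → flag (eval (orElse r r′) γ) ≡ true
    orElse-flag r r′ h = c (flag (eval r γ)) refl h
      where
      c : ∀ f → flag (eval r γ) ≡ f → flag (eval r γ) ≡ true ⊎ flag (eval r′ γ) ≡ true → flag (if f then eval r γ else eval r′ γ) ≡ true
      c true e _ = e
      c false e (inj₁ p) = ⊥-elim (true≢false p e)
      c false e (inj₂ p) = p

    anyOf-elim : ∀ (P : Outcome → Set) r rs → P (eval r γ) → All (λ r → P (eval r γ)) rs → P (eval (anyOf r rs) γ)
    anyOf-elim P r [] p _ = p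
    anyOf-elim P r (r′ ∷ rs) p (p′ ∷ ps) = orElse-elim P r (anyOf r′ rs) p (anyOf-elim P r′ rs p′ ps)

    anyOf-flag : ∀ r rs {c} → c ∈ r ∷ rs → flag (eval c γ) ≡ true → flag (eval (anyOf r rs) γ) ≡ true
    anyOf-flag r [] (here refl) f = f
    anyOf-flag r (r′ ∷ rs) (here refl) f = orElse-flag r (anyOf r′ rs) (inj₁ f)
    anyOf-flag r (r′ ∷ rs) (there c∈) f = orElse-flag r (anyOf r′ rs) (inj₂ (anyOf-flag r′ rs c∈ f))

  step : State → Outcome
  step q = eval stepT (q , tt)

  private
    ξ : (u₂ u₁ b a v : Fin N) → State → ⟦ Choice ⟧ᶜ
    ξ u₂ u₁ b a v q = u₂ , u₁ , b , a , v , q , tt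

  module _ (P : Outcome → Set) (q : State) (pres : ∀ r u₂ u₁ b a v → P r → P (eval loop₅ (r , ξ u₂ u₁ b a v q))) where
    pres₄ : ∀ r u₁ b a v → P r → P (eval loop₄ (r , u₁ , b , a , v , q , tt))
    pres₄ r u₁ b a v = fold-sound P N (λ u₂ r → eval loop₅ (r , ξ u₂ u₁ b a v q)) (λ u₂ r → pres r u₂ u₁ b a v) r
    pres₃ : ∀ r b a v → P r → P (eval loop₃ (r , b , a , v , q , tt))
    pres₃ r b a v = fold-sound P N (λ u₁ r → eval loop₄ (r , u₁ , b , a , v , q , tt)) (λ u₁ r → pres₄ r u₁ b a v) r
    pres₂ : ∀ r a v → P r → P (eval loop₂ (r , a , v , q , tt))
    pres₂ r a v = fold-sound P N (λ b r → eval loop₃ (r , b , a , v , q , tt)) (λ b r → pres₃ r b a v) r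
    pres₁ : ∀ r v → P r → P (eval loop₁ (r , v , q , tt))
    pres₁ r v = fold-sound P N (λ a r → eval loop₂ (r , a , v , q , tt)) (λ a r → pres₂ r a v) r

    opaque
      unfolding stepT

      step-preserves : P (false , (false , q) , (false , q) , (false , q) , (false , q)) → P (step q)
      step-preserves = fold-sound P N (λ v r → eval loop₁ (r , v , q , tt)) (λ v r → pres₁ r v) _

      step-hits : ∀ u₂ u₁ b a v → (∀ r → P (eval loop₅ (r , ξ u₂ u₁ b a v q))) → P (step q)
      step-hits u₂ u₁ b a v h =
        fold-hit P N (λ v r → eval loop₁ (r , v , q , tt)) (λ v r → pres₁ r v) v
          (fold-hit P N (λ a r → eval loop₂ (r , a , v , q , tt)) (λ a r → pres₂ r a v) a
            (fold-hit P N (λ b r → eval loop₃ (r , b , a , v , q , tt)) (λ b r → pres₃ r b a v) b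
              (fold-hit P N (λ u₁ r → eval loop₄ (r , u₁ , b , a , v , q , tt)) (λ u₁ r → pres₄ r u₁ b a v) u₁
                (fold-hit P N (λ u₂ r → eval loop₅ (r , ξ u₂ u₁ b a v q)) (λ u₂ r → pres r u₂ u₁ b a v) u₂ h)))) _

  loop₅-elim : ∀ (P : Outcome → Set) r ω → P r → P (eval tryT ω) → P (eval loop₅ (r , ω))
  loop₅-elim P r ω = orElse-elim {outcome ∷ Choice} (r , ω) P x0 (call (x1 ∷ x2 ∷ x3 ∷ x4 ∷ x5 ∷ x6 ∷ []) tryT)

  loop₅-flag : ∀ r ω → flag r ≡ true ⊎ flag (eval tryT ω) ≡ true → flag (eval loop₅ (r , ω)) ≡ true
  loop₅-flag r ω = orElse-flag {outcome ∷ Choice} (r , ω) x0 (call (x1 ∷ x2 ∷ x3 ∷ x4 ∷ x5 ∷ x6 ∷ []) tryT)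

  step-flag : ∀ q u₂ u₁ b a v → flag (eval tryT (ξ u₂ u₁ b a v q)) ≡ true → flag (step q) ≡ true
  step-flag q u₂ u₁ b a v h = step-hits (λ r → flag r ≡ true) q (λ r u₂ u₁ b a v f → loop₅-flag r (ξ u₂ u₁ b a v q) (inj₁ f)) u₂ u₁ b a v
    (λ r → loop₅-flag r (ξ u₂ u₁ b a v q) (inj₂ h))

  Smaller : State → Opt → Set
  Smaller q o = proj₁ o ≡ true → suc (alive (proj₂ o)) ≤ alive q × μ (proj₂ o) ≤ μ q

  module Soundness {K φ} (charge : Charge ts unit K φ) where
    open Charge charge

    Φ : Opt → ℕ
    Φ o = if proj₁ o then φ (μ (proj₂ o)) else 0

    -- Absent children have value and charge 0, so every step has this form with four children.
    record Sound (q : State) (n : Node) : Set where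
      private
        o₁ = proj₁ n
        o₂ = proj₁ (proj₂ n)
        o₃ = proj₁ (proj₂ (proj₂ n))
        o₄ = proj₂ (proj₂ (proj₂ n))
      field
        sums-up : value o₁ + (value o₂ + (value o₃ + value o₄)) ≈ Z (matrix q)
        smaller : Smaller q o₁ × Smaller q o₂ × Smaller q o₃ × Smaller q o₄
        charged : Φ o₁ + (Φ o₂ + (Φ o₃ + Φ o₄)) ≤ φ (μ q)

    record Part (q p : State) (d : ℕ) (o : Opt) : Set where
      field
        same-Z : value o ≈ Z (matrix p)
        fewer : Smaller q o
        charged : ∃ λ m → Φ o ≡ φ m × m + d ≤ μ q

    -- `v` witnesses the progress: it has an edge in `q`, belongs to `X`, and is isolated
    -- afterwards.
    part : ∀ d q p X a b v → d ≤ K₃ → p ⊑ q → hasEdge q v ≡ true → X v ≡ true → proj₁ (child d q p X a b) ≡ true → Part q p d (child d q p X a b)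
    part d q p X a b v d≤ sub ev Xv f = record
      { same-Z = trans (cong (_% M) (cong₂ (λ f p → if f then Z (matrix p) else 0) f st)) (elim-Z ok)
      ; fewer = λ _ → subst (λ p → suc (alive p) ≤ alive q × μ p ≤ μ q) (sym st)
                    (alive-drop {r} {q} v (λ i h → ⊑-hasEdge {p} {q} sub i (proj₂ (elim-hasEdge ok i h))) (gone (hasEdge r v) refl) ev
                    , m+n≤o⇒m≤o (μ r) (proj₂ (child⁻ d q p X a b d≤ f)))
      ; charged = μ r , cong₂ (λ f p → if f then φ (μ p) else 0) f st , proj₂ (child⁻ d q p X a b d≤ f) }
      where
      r = elim p X a b
      ok = proj₁ (child⁻ d q p X a b d≤ f)
      st = child-state d q p X a b
      gone : ∀ c → hasEdge r v ≡ c → hasEdge r v ≡ false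
      gone false e = e
      gone true e = ⊥-elim (true≢false Xv (proj₁ (elim-hasEdge ok v e)))

    branch-assign : ∀ q u → Z (matrix (assign q u false)) + Z (matrix (assign q u true)) ≈ Z (matrix q)
    branch-assign q u = trans (+-cong {Z (matrix (assign q u false))} (assign-Z q u false) (assign-Z q u true)) (cong (_% M) (sym (branch-Z (matrix q) u)))

    private
      none-smaller : ∀ q → Smaller q (false , q)
      none-smaller q ()

      OK : State → Outcome → Set
      OK q r = flag r ≡ true → Sound q (proj₂ r)

    module _ (q : State) (μ≤K : μ q ≤ K) (u₂ u₁ b a v : Fin N) where
      private
        ω = ξ u₂ u₁ b a v q
        hT : Tm Choice bool
        hT = call (x5 ∷ x4 ∷ []) hasEdgeT
        0≤ : 0 ≤ K₃
        0≤ = z≤n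
        1≤u : unit ≤ K₃
        1≤u = ≤-trans (m≤m+n unit _) unit≤

      sound₀ : ∀ κ → OK q (eval (candidate₀ κ) ω)
      sound₀ κ f = record
        { sums-up = trans (cong (_% M) (+-identityʳ _)) (Part.same-Z pt)
        ; smaller = Part.fewer pt , none-smaller q , none-smaller q , none-smaller q
        ; charged = let (m , e , le) = Part.charged pt in ≤-trans (≤-reflexive (trans (+-identityʳ _) e)) (φ-mono μ≤K (≤-trans (≤-reflexive (sym (+-identityʳ m))) le)) }
        where
        fs = andT⁻ {Choice} ω hT (fst (sepT 0 x5 κ)) f
        pt = part 0 q q (mask κ q v) a b v 0≤ (⊑-refl {q}) (proj₁ fs) (mask-self κ q v) (proj₂ fs)

      soundᵇ : OK q (eval candidateᵇ ω)
      soundᵇ f = record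
        { sums-up = trans (cong (λ m → (Z (matrix (c false)) + m) % M) (+-identityʳ _)) (sym (branchChild-Z q v))
        ; smaller = (λ _ → fewer false , proj₁ (accepted-≤ ts acc)) , (λ _ → fewer true , proj₂ (accepted-≤ ts acc)) , none-smaller q , none-smaller q
        ; charged = ≤-trans (≤-reflexive (cong (φ (μ (c false)) +_) (+-identityʳ _))) (φ-split μ≤K acc) }
        where
        fs = andT⁻ {Choice} ω hT (call (call (x5 ∷ []) μT ∷ branchT false ∷ branchT true ∷ []) splitT) f
        c : Bool → State
        c α = branchChild q v α
        acc : accepted ts (μ q) (μ (c false)) (μ (c true)) ≡ true
        acc = trans (sym (split-eval q (c false) (c true))) (proj₂ fs)
        fewer : ∀ α → suc (alive (c α)) ≤ alive q
        fewer α = alive-drop {c α} {q} v (⊑-hasEdge {c α} {q} (branchChild-⊑ q v α))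
          (isolated⁺ (c α) v (branchChild-gone q v α v (cong (_∨ isHard α (kindOf q v v)) (≡ᶠ-refl v)))) (proj₁ fs)

      -- Two children, each of at most half the charge; they are the two values of the separating
      -- vertex.
      sound₁ : ∀ κ → OK q (eval (candidate₁ κ) ω)
      sound₁ κ f = record
        { sums-up = trans (cong (λ m → (value (c false) + m) % M) (+-identityʳ _))
                      (trans (+-cong {value (c false)} (Part.same-Z pf) (Part.same-Z pt)) (branch-assign q u₁))
        ; smaller = Part.fewer pf , Part.fewer pt , none-smaller q , none-smaller q
        ; charged = let (m , e , le) = Part.charged pf ; (n , e′ , le′) = Part.charged pt in
            ≤-trans (≤-reflexive (cong₂ _+_ e (trans (+-identityʳ _) e′))) (halves (φ m) (φ n) (φ-half μ≤K le) (φ-half μ≤K le′)) }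
        where
        cT : Bool → Tm Choice opt
        cT d = sepT unit (assigned₁ d) κ
        fs = andT⁻ {Choice} ω hT (andT (fst (cT false)) (fst (cT true))) f
        gs = andT⁻ {Choice} ω (fst (cT false)) (fst (cT true)) (proj₂ fs)
        c : Bool → Opt
        c d = child unit q (assign q u₁ d) (mask κ q v) a b
        pf = part unit q (assign q u₁ false) (mask κ q v) a b v 1≤u (assign-⊑ q u₁ false) (proj₁ fs) (mask-self κ q v) (proj₁ gs)
        pt = part unit q (assign q u₁ true) (mask κ q v) a b v 1≤u (assign-⊑ q u₁ true) (proj₁ fs) (mask-self κ q v) (proj₂ gs)
        halves : ∀ m n {k} → 2 * m ≤ k → 2 * n ≤ k → m + n ≤ k
        halves m n {k} p q = *-cancelˡ-≤ 2 (≤-trans (≤-reflexive (*-distribˡ-+ 2 m n)) (≤-trans (+-mono-≤ p q) (≤-reflexive (cong (k +_) (sym (+-identityʳ k))))))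

      sound₂ : ∀ κ → OK q (eval (candidate₂ κ) ω)
      sound₂ κ f = record
        { sums-up = trans (+-cong {value (c false false)} (Part.same-Z part₀) (+-cong {value (c false true)} (Part.same-Z part₁) (+-cong {value (c true false)} (Part.same-Z part₂) (Part.same-Z part₃))))
                      (trans (cong (_% M) (sym (+-assoc (Z (matrix (leaf₂ false false))) _ _)))
                        (trans (+-cong {Z (matrix (leaf₂ false false)) + Z (matrix (leaf₂ false true))} (branch-assign (assign q u₁ false) u₂) (branch-assign (assign q u₁ true) u₂)) (branch-assign q u₁)))
        ; smaller = Part.fewer part₀ , Part.fewer part₁ , Part.fewer part₂ , Part.fewer part₃
        ; charged = let (m₀ , e₀ , l₀) = Part.charged part₀ ; (m₁ , e₁ , l₁) = Part.charged part₁ ; (m₂ , e₂ , l₂) = Part.charged part₂ ; (m₃ , e₃ , l₃) = Part.charged part₃ in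
            ≤-trans (≤-reflexive (cong₂ _+_ e₀ (cong₂ _+_ e₁ (cong₂ _+_ e₂ e₃))))
              (quarters (φ m₀) (φ m₁) (φ m₂) (φ m₃) (φ-quarter μ≤K l₀) (φ-quarter μ≤K l₁) (φ-quarter μ≤K l₂) (φ-quarter μ≤K l₃)) }
        where
        cT : Bool → Bool → Tm Choice opt
        cT d e = sepT (2 * unit) (assigned₂ d e) κ
        fs = andT⁻ {Choice} ω hT (andT (fst (cT false false)) (andT (fst (cT false true)) (andT (fst (cT true false)) (fst (cT true true))))) f
        gs = andT⁻ {Choice} ω (fst (cT false false)) (andT (fst (cT false true)) (andT (fst (cT true false)) (fst (cT true true)))) (proj₂ fs)
        hs = andT⁻ {Choice} ω (fst (cT false true)) (andT (fst (cT true false)) (fst (cT true true))) (proj₂ gs)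
        is′ = andT⁻ {Choice} ω (fst (cT true false)) (fst (cT true true)) (proj₂ hs)
        leaf₂ : Bool → Bool → State
        leaf₂ d e = assign (assign q u₁ d) u₂ e
        c : Bool → Bool → Opt
        c d e = child (2 * unit) q (leaf₂ d e) (mask κ q v) a b
        pt : ∀ d e → proj₁ (c d e) ≡ true → Part q (leaf₂ d e) (2 * unit) (c d e)
        pt d e = part (2 * unit) q (leaf₂ d e) (mask κ q v) a b v unit≤ (⊑-trans {leaf₂ d e} {assign q u₁ d} {q} (assign-⊑ (assign q u₁ d) u₂ e) (assign-⊑ q u₁ d)) (proj₁ fs) (mask-self κ q v)
        part₀ = pt false false (proj₁ gs)
        part₁ = pt false true (proj₁ hs)
        part₂ = pt true false (proj₁ is′)
        part₃ = pt true true (proj₂ is′)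
        quarters : ∀ m n o p {k} → 4 * m ≤ k → 4 * n ≤ k → 4 * o ≤ k → 4 * p ≤ k → m + (n + (o + p)) ≤ k
        quarters m n o p {k} h i j l = *-cancelˡ-≤ 4 (≤-trans (≤-reflexive (r m n o p)) (≤-trans (+-mono-≤ h (+-mono-≤ i (+-mono-≤ j l))) (≤-reflexive (r′ k))))
          where
          r : ∀ m n o p → 4 * (m + (n + (o + p))) ≡ 4 * m + (4 * n + (4 * o + 4 * p))
          r = solve-∀
          r′ : ∀ k → k + (k + (k + k)) ≡ 4 * k
          r′ = solve-∀

      opaque
        unfolding tryT

        try-sound : OK q (eval tryT ω)
        try-sound = anyOf-elim {Choice} ω (OK q) (candidate₀ single) candidates (sound₀ single)
          (sound₀ (around false) ∷ sound₀ (around true) ∷ soundᵇ ∷ sound₁ (around false) ∷ sound₁ (around true) ∷ sound₂ (around false) ∷ sound₂ (around true) ∷ [])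

    step-sound : ∀ q → μ q ≤ K → flag (step q) ≡ true → Sound q (proj₂ (step q))
    step-sound q μ≤K = step-preserves (OK q) q (λ r u₂ u₁ b a v ok → loop₅-elim (OK q) r (ξ u₂ u₁ b a v q) ok (try-sound q μ≤K u₂ u₁ b a v)) (λ ())

  opaque
    unfolding tryT

    try-hits : ∀ ω {c} → c ∈ candidate₀ single ∷ candidates → flag (eval c ω) ≡ true → flag (eval tryT ω) ≡ true
    try-hits ω = anyOf-flag {Choice} ω (candidate₀ single) candidates

  private
    hT : Tm Choice bool
    hT = call (x5 ∷ x4 ∷ []) hasEdgeT

    ∈₀ : ∀ κ → candidate₀ κ ∈ candidate₀ single ∷ candidates
    ∈₀ single = here refl
    ∈₀ (around false) = there (here refl)
    ∈₀ (around true) = there (there (here refl))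

    ∈₁ : ∀ α → candidate₁ (around α) ∈ candidate₀ single ∷ candidates
    ∈₁ false = there (there (there (there (here refl))))
    ∈₁ true = there (there (there (there (there (here refl)))))

    ∈₂ : ∀ α → candidate₂ (around α) ∈ candidate₀ single ∷ candidates
    ∈₂ false = there (there (there (there (there (there (here refl))))))
    ∈₂ true = there (there (there (there (there (there (there (here refl)))))))

  module _ (q : State) where
    private
      g = graphOf q
      open Graph g

    deg⇒hasEdge : ∀ v → 1 ≤ deg v → hasEdge q v ≡ true
    deg⇒hasEdge v h with count⇒∃ (adj v) h
    ... | u , e = hasEdge⁺ q v u (trans (sym (isEdge-kind q v u)) e)

    hasEdge⇒deg : ∀ v → hasEdge q v ≡ true → 1 ≤ deg v
    hasEdge⇒deg v h with hasEdge⁻ q v h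
    ... | u , e = ∃⇒count (adj v) {u} (trans (isEdge-kind q v u) e)

    record Ends (X : Mask) (v a b : Fin N) : Set where
      field
        a∉X : X a ≡ false
        b∉X : X b ≡ false
        both : a ≡ b ⊎ (bd q X a ≡ true × bd q X b ≡ true)
        only : ∀ y → bd q X y ≡ true → y ≡ a ⊎ y ≡ b
        paid : a ≡ b ⊎ 2 ≤ deg v

    bd∉ : ∀ X y → bd q X y ≡ true → X y ≡ false
    bd∉ X y p = proj₁ (bd⁻ q X y p)

    outside : ∀ (X : Mask) → count X ≤ 7 → 8 ≤ N → ∃ λ o → X o ≡ false
    outside X c 8≤N with find (not ∘ X)
    ... | inj₁ (o , p) = o , flip (X o) p
      where
      flip : ∀ b → not b ≡ true → b ≡ false
      flip false _ = refl
    ... | inj₂ all = contradiction (≤-trans 8≤N (≤-trans (≤-reflexive (sym (count-true N))) (≤-trans (count-mono {N} {λ _ → true} {X} (λ i _ → flip (X i) (all i))) c))) (n≮n 7)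
      where
      flip : ∀ b → not b ≡ false → b ≡ true
      flip true _ = refl

    -- With fewer than two boundary vertices the two ends coincide. With none, any vertex outside
    -- `X` will do, and `8 ≤ N` provides one.
    find-ends : ∀ (X : Mask) v → 8 ≤ N → count X ≤ 7 → ∀ c → count (bd q X) ≡ c → c ≤ 2 → 2 ≤ deg v ⊎ c ≤ 1 → ∃₂ λ a b → Ends X v a b
    find-ends X v 8≤N X≤7 0 c _ _ with outside X X≤7 8≤N
    ... | o , Xo = o , o , record { a∉X = Xo ; b∉X = Xo ; both = inj₁ refl ; paid = inj₁ refl
                                  ; only = λ y by → ⊥-elim (true≢false by (count≡0 (bd q X) c y)) }
    find-ends X v 8≤N X≤7 1 c _ _ with count⇒∃ (bd q X) (≤-reflexive (sym c))
    ... | a , ba = a , a , record { a∉X = bd∉ X a ba ; b∉X = bd∉ X a ba ; both = inj₁ refl ; paid = inj₁ refl ; only = λ y by → inj₁ (o y by) }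
      where
      o : ∀ y → bd q X y ≡ true → y ≡ a
      o y by with a ≟ᶠ y
      ... | yes refl = refl
      ... | no a≢y = ⊥-elim (true≢false (∧⁺ by (cong not (≢⇒≡ᶠ a≢y))) (count≡0 (bd q X ∖ a) (suc-injective (trans (sym (count-∖ {P = bd q X} {a} ba)) c)) y))
    find-ends X v 8≤N X≤7 2 c _ (inj₂ (s≤s ()))
    find-ends X v 8≤N X≤7 2 c _ (inj₁ 2≤d) with pair (bd q X) c
    ... | a , b , pr′ = a , b , record { a∉X = bd∉ X a (Pair.a∈ pr′) ; b∉X = bd∉ X b (Pair.b∈ pr′) ; both = inj₂ (Pair.a∈ pr′ , Pair.b∈ pr′) ; only = Pair.only pr′ ; paid = inj₂ 2≤d }
    find-ends X v 8≤N X≤7 (suc (suc (suc c))) _ (s≤s (s≤s ())) _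

    Hit : Set
    Hit = flag (step q) ≡ true

    -- A set with at most two neighbours is summed out without branching. A new edge costs `2 * σ`,
    -- which the weight of `v` covers when its degree is at least two; if the ends coincide, there
    -- is no new edge.
    unary-hit : ∀ κ v → 8 ≤ N → 1 ≤ deg v → count (mask κ q v) ≤ 7 → count (bd q (mask κ q v)) ≤ 2 → 2 ≤ deg v ⊎ count (bd q (mask κ q v)) ≤ 1 → Hit
    unary-hit κ v 8≤N 1≤d X≤7 bd≤2 or1 with find-ends (mask κ q v) v 8≤N X≤7 (count (bd q (mask κ q v))) refl bd≤2 or1
    ... | a , b , en = step-flag q v v b a v (try-hits (ξ v v b a v q) (∈₀ κ)
      (andT⁺ {Choice} (ξ v v b a v q) hT (fst (sepT 0 x5 κ)) (deg⇒hasEdge v 1≤d)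
        (child⁺ 0 q q X a b z≤n Sep.valid (≤-trans (≤-reflexive (+-identityʳ _)) (≤-trans (least≤ g′ F∈) (≤-trans (drop (Ends.paid en)) (≤-reflexive (sym Fmin))))))))
      where
      X = mask κ q v
      module Sep = Separation q q X (λ _ → false) X a b (λ y → sym (∨-identityʳ (X y))) (⊑-refl {q}) (λ _ _ _ → refl) (λ _ _ _ _ → refl) (λ _ _ → refl) X≤7
                              (Ends.a∉X en) (Ends.b∉X en) refl refl (Ends.both en) (λ y by _ → Ends.only en y by)
      g′ = graphOf (elim q X a b)
      attained = least-attained g F₀ Fs
      F = proj₁ attained
      F∈ = proj₁ (proj₂ attained)
      Fmin = proj₂ (proj₂ attained)
      inc = Small.inc (All.lookup small F∈)
      open Weights F
      drop : a ≡ b ⊎ 2 ≤ deg v → measure F g′ ≤ measure F g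
      drop (inj₁ a≡b) = elim-same-drop Sep.eliminates F inc a≡b
      drop (inj₂ 2≤d) = +-cancelʳ-≤ (2 * σ) _ _ (≤-trans (+-monoʳ-≤ (measure F g′) enough) (elim-drop₀ Sep.eliminates F inc c c≤))
        where
        c : Fin N → ℕ
        c y = [ v ≡ᶠ y ] * W (deg v) (sdeg v)
        enough : 2 * σ ≤ sum c
        enough = ≤-trans (≤-trans (*-monoʳ-≤ 2 (w-mono inc 2≤d)) (m≤m+n (2 * w (deg v)) (σ * sdeg v))) (≤-reflexive (sym (sum-pick v (λ _ → W (deg v) (sdeg v)))))
        c≤ : ∀ y → c y ≤ [ X y ] * W (deg y) (sdeg y)
        c≤ y with v ≟ᶠ y
        ... | yes refl rewrite ≡ᶠ-refl v | mask-self κ q v = ≤-refl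
        ... | no v≢y rewrite ≢⇒≡ᶠ v≢y = z≤n

    -- The minimum is attained by `F` at the parent and is at most `F` at the child, so a decrease
    -- of `F` is a decrease of the minimum.
    minimal-drop : ∀ {F p d} → F ∈ F₀ ∷ Fs → least g (F₀ ∷ Fs) ≡ measure F g → measure F (graphOf p) + d ≤ measure F g → μ p + d ≤ μ q
    minimal-drop {F} {p} {d} F∈ m h = ≤-trans (+-monoˡ-≤ d (least≤ (graphOf p) F∈)) (≤-trans h (≤-reflexive (sym m)))

    good-hit : ∀ F → F ∈ F₀ ∷ Fs → least g (F₀ ∷ Fs) ≡ measure F g → Good unit ts g F → Hit
    good-hit F F∈ m (branch v x y 1≤d ex d₀ d₁) = step-flag q v v v v v (try-hits (ξ v v v v v q) (there (there (there (here refl))))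
      (andT⁺ {Choice} (ξ v v v v v q) hT (call (call (x5 ∷ []) μT ∷ branchT false ∷ branchT true ∷ []) splitT) (deg⇒hasEdge v 1≤d)
        (trans (split-eval q (branchChild q v false) (branchChild q v true))
          (exceeds⇒accepted ts ex (minimal-drop {p = branchChild q v false} F∈ m (d₀ (branchChild-Removes q v false))) (minimal-drop {p = branchChild q v true} F∈ m (d₁ (branchChild-Removes q v true)))))))
    good-hit F F∈ m (separate₁ v α u a b 1≤d X≤7 bu pr′ dr) = step-flag q u u b a v (try-hits (ξ u u b a v q) (∈₁ α)
      (andT⁺ {Choice} (ξ u u b a v q) hT (andT (fst (cT false)) (fst (cT true))) (deg⇒hasEdge v 1≤d)
        (andT⁺ {Choice} (ξ u u b a v q) (fst (cT false)) (fst (cT true)) (ok false) (ok true))))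
      where
      cT : Bool → Tm Choice opt
      cT d = sepT unit (assigned₁ d) (around α)
      X = mask (around α) q v
      C = cluster v α
      bdX : ∀ y → bd q X y ≡ bd q C y
      bdX = bd-cong q (mask-around q v α)
      a∈ = ∖-true {P = bd q C} {u} {a} (Pair.a∈ pr′)
      b∈ = ∖-true {P = bd q C} {u} {b} (Pair.b∈ pr′)
      ba = trans (bdX a) (proj₁ a∈)
      bb = trans (bdX b) (proj₁ b∈)
      X∩S : ∀ x → X x ≡ true → (u ≡ᶠ x) ≡ false
      X∩S x Xx = ≢⇒≡ᶠ {i = u} {x} (λ { refl → true≢false Xx (bd∉ X u (trans (bdX u) bu)) })
      module Sep (d : Bool) = Separation q (assign q u d) X (u ≡ᶠ_) (with₁ C u) a b
        (λ y → cong (_∨ (u ≡ᶠ y)) (sym (mask-around q v α y))) (assign-⊑ q u d)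
        (λ i j e → ≢⇒≡ᶠ (proj₁ (assign-edge q u d i j e)))
        (λ i j Si Sj → assign-kept q u d i j (≡ᶠ⇒≢ Si) (≡ᶠ⇒≢ Sj))
        X∩S
        (≤-trans (≤-reflexive (count-cong (mask-around q v α))) X≤7)
        (bd∉ X a ba) (bd∉ X b bb) (≢⇒≡ᶠ (proj₂ a∈)) (≢⇒≡ᶠ (proj₂ b∈)) (inj₂ (ba , bb))
        (λ y by Sy → Pair.only pr′ y (∧⁺ (trans (sym (bdX y)) by) (cong not Sy)))
      ok : ∀ d → proj₁ (child unit q (assign q u d) X a b) ≡ true
      ok d = child⁺ unit q (assign q u d) X a b (≤-trans (m≤m+n unit _) unit≤) (Sep.valid d) (minimal-drop {p = elim (assign q u d) X a b} F∈ m (dr (Sep.eliminates d)))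
    good-hit F F∈ m (separate₂ v α u₁ u₂ a b 1≤d X≤7 bu₁ bu₂ pr′ dr) = step-flag q u₂ u₁ b a v (try-hits (ξ u₂ u₁ b a v q) (∈₂ α)
      (andT⁺ {Choice} ω hT (andT (fst (cT false false)) (andT (fst (cT false true)) (andT (fst (cT true false)) (fst (cT true true))))) (deg⇒hasEdge v 1≤d)
        (andT⁺ {Choice} ω (fst (cT false false)) (andT (fst (cT false true)) (andT (fst (cT true false)) (fst (cT true true)))) (ok false false)
          (andT⁺ {Choice} ω (fst (cT false true)) (andT (fst (cT true false)) (fst (cT true true))) (ok false true)
            (andT⁺ {Choice} ω (fst (cT true false)) (fst (cT true true)) (ok true false) (ok true true))))))
      where
      ω = ξ u₂ u₁ b a v q
      cT : Bool → Bool → Tm Choice opt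
      cT d e = sepT (2 * unit) (assigned₂ d e) (around α)
      X = mask (around α) q v
      C = cluster v α
      bdX : ∀ y → bd q X y ≡ bd q C y
      bdX = bd-cong q (mask-around q v α)
      S : Mask
      S y = (u₁ ≡ᶠ y) ∨ (u₂ ≡ᶠ y)
      ∉S : ∀ {y} → u₁ ≢ y → u₂ ≢ y → S y ≡ false
      ∉S n₁ n₂ rewrite ≢⇒≡ᶠ n₁ | ≢⇒≡ᶠ n₂ = refl
      S⁻ : ∀ y → S y ≡ false → (u₁ ≡ᶠ y) ≡ false × (u₂ ≡ᶠ y) ≡ false
      S⁻ y h with u₁ ≡ᶠ y | u₂ ≡ᶠ y
      ... | false | false = refl , refl
      inside : ∀ y → ((bd q C ∖ u₁) ∖ u₂) y ≡ true → bd q X y ≡ true × S y ≡ false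
      inside y h = let (h₁ , n₂) = ∖-true {P = bd q C ∖ u₁} {u₂} {y} h ; (h₂ , n₁) = ∖-true {P = bd q C} {u₁} {y} h₁ in trans (bdX y) h₂ , ∉S n₁ n₂
      a∈ = inside a (Pair.a∈ pr′)
      b∈ = inside b (Pair.b∈ pr′)
      p : Bool → Bool → State
      p d e = assign (assign q u₁ d) u₂ e
      X∩S : ∀ x → X x ≡ true → S x ≡ false
      X∩S x Xx = ∉S {x} (λ { refl → true≢false Xx (bd∉ X u₁ (trans (bdX u₁) bu₁)) }) (λ { refl → true≢false Xx (bd∉ X u₂ (trans (bdX u₂) (proj₁ (∖-true {P = bd q C} {u₁} {u₂} bu₂)))) })
      module Sep (d e : Bool) = Separation q (p d e) X S (with₁ (with₁ C u₁) u₂) a b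
        (λ y → trans (∨-assoc (C y) (u₁ ≡ᶠ y) (u₂ ≡ᶠ y)) (cong (_∨ S y) (sym (mask-around q v α y))))
        (⊑-trans {p d e} {assign q u₁ d} {q} (assign-⊑ (assign q u₁ d) u₂ e) (assign-⊑ q u₁ d))
        (λ i j ed → ∉S (proj₁ (assign-edge q u₁ d i j (⊑-edge {p d e} {assign q u₁ d} (assign-⊑ (assign q u₁ d) u₂ e) i j ed))) (proj₁ (assign-edge (assign q u₁ d) u₂ e i j ed)))
        (λ i j Si Sj → trans (assign-kept (assign q u₁ d) u₂ e i j (≡ᶠ⇒≢ (proj₂ (S⁻ i Si))) (≡ᶠ⇒≢ (proj₂ (S⁻ j Sj)))) (assign-kept q u₁ d i j (≡ᶠ⇒≢ (proj₁ (S⁻ i Si))) (≡ᶠ⇒≢ (proj₁ (S⁻ j Sj)))))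
        X∩S
        (≤-trans (≤-reflexive (count-cong (mask-around q v α))) X≤7)
        (bd∉ X a (proj₁ a∈)) (bd∉ X b (proj₁ b∈)) (proj₂ a∈) (proj₂ b∈) (inj₂ (proj₁ a∈ , proj₁ b∈))
        (λ y by Sy → Pair.only pr′ y (∧⁺ (∧⁺ (trans (sym (bdX y)) by) (cong not (proj₁ (S⁻ y Sy)))) (cong not (proj₂ (S⁻ y Sy)))))
      ok : ∀ d e → proj₁ (child (2 * unit) q (p d e) X a b) ≡ true
      ok d e = child⁺ (2 * unit) q (p d e) X a b unit≤ (Sep.valid d e) (minimal-drop {p = elim (p d e) X a b} F∈ m (dr (Sep.eliminates d e)))

    module _ (8≤N : 8 ≤ N) (progress : Reduced g → ∀ v → 1 ≤ deg v → ∃ λ F → F ∈ F₀ ∷ Fs × least g (F₀ ∷ Fs) ≡ measure F g × Good unit ts g F) where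
      private
        low : Fin N → Bool
        low v = (1 ≤ᵇ deg v) ∧ (deg v ≤ᵇ 2)

        thin : Bool → Fin N → Bool
        thin α v = ((1 ≤ᵇ deg v) ∧ (deg v ≤ᵇ 6)) ∧ (count (boundary (cluster v α)) ≤ᵇ 2)

        degree : (∀ v → low v ≡ false) → ∀ v → deg v ≡ 0 ⊎ 3 ≤ deg v
        degree h v = c (deg v) (h v)
          where
          c : ∀ d → (1 ≤ᵇ d) ∧ (d ≤ᵇ 2) ≡ false → d ≡ 0 ⊎ 3 ≤ d
          c 0 _ = inj₁ refl
          c (suc (suc (suc d))) _ = inj₂ (s≤s (s≤s (s≤s z≤n)))

        thin-hit : (∀ v → deg v ≡ 0 ⊎ 3 ≤ deg v) → ∀ α v → thin α v ≡ true → Hit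
        thin-hit degs α v h = unary-hit (around α) v 8≤N 1≤d
            (≤-trans (≤-reflexive (trans (count-cong (mask-around q v α)) (count-cluster g v α))) (s≤s (≤-trans (count-mono (forced⇒adj g v α)) (≤ᵇ-true (deg v) 6 (proj₂ h₂)))))
            (≤-trans (≤-reflexive (count-cong (bd-cong q (mask-around q v α)))) (≤ᵇ-true _ 2 (proj₂ h₁)))
            (inj₁ (2≤ (degs v)))
          where
          h₁ = ∧⁻ {(1 ≤ᵇ deg v) ∧ (deg v ≤ᵇ 6)} h
          h₂ = ∧⁻ {1 ≤ᵇ deg v} (proj₁ h₁)
          1≤d = ≤ᵇ-true 1 (deg v) (proj₁ h₂)
          2≤ : deg v ≡ 0 ⊎ 3 ≤ deg v → 2 ≤ deg v
          2≤ (inj₁ e) = contradiction (≤-trans 1≤d (≤-reflexive e)) λ ()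
          2≤ (inj₂ p) = ≤-trans (n≤1+n 2) p

        low-hit : ∀ v → low v ≡ true → Hit
        low-hit v h = unary-hit single v 8≤N 1≤d
            (≤-trans (≤-reflexive (trans (sum-cong-≗ (λ i → trans (cong [_] (mask-single q v i)) (sym (*-identityʳ _)))) (sum-pick v (λ _ → 1)))) (s≤s z≤n))
            (≤-trans bd≤d d≤2) (c (deg v) refl)
          where
          h₁ = ∧⁻ {1 ≤ᵇ deg v} h
          1≤d = ≤ᵇ-true 1 (deg v) (proj₁ h₁)
          d≤2 = ≤ᵇ-true (deg v) 2 (proj₂ h₁)
          bd≤d : count (bd q (mask single q v)) ≤ deg v
          bd≤d = count-mono nb
            where
            nb : ∀ y → bd q (mask single q v) y ≡ true → adj v y ≡ true
            nb y by with bd⁻ q (mask single q v) y by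
            ... | _ , x , Xx , e with ≡ᶠ⇒≡ v x (trans (sym (mask-single q v x)) Xx)
            ... | refl = trans (edge-sym v y) (trans (isEdge-kind q y v) e)
          c : ∀ d → deg v ≡ d → 2 ≤ deg v ⊎ count (bd q (mask single q v)) ≤ 1
          c 0 e = inj₂ (≤-trans bd≤d (≤-trans (≤-reflexive e) z≤n))
          c 1 e = inj₂ (≤-trans bd≤d (≤-reflexive e))
          c (suc (suc d)) e = inj₁ (≤-trans (s≤s (s≤s z≤n)) (≤-reflexive (sym e)))

      -- A vertex of degree one or two, or a cluster with at most two boundary vertices, can be
      -- summed out. If there is neither, the graph is reduced and `progress` applies.
      step-complete : ∀ v → hasEdge q v ≡ true → Hit
      step-complete v ev with find low
      ... | inj₁ (u , p) = low-hit u p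
      ... | inj₂ noLow with find (thin false) | find (thin true)
      ... | inj₁ (u , p) | _ = thin-hit (degree noLow) false u p
      ... | inj₂ _ | inj₁ (u , p) = thin-hit (degree noLow) true u p
      ... | inj₂ n₀ | inj₂ n₁ = let (F , F∈ , m , good) = progress red v (hasEdge⇒deg v ev) in good-hit F F∈ m good
        where
        never : ∀ α v → thin α v ≡ false
        never false = n₀
        never true = n₁
        red : Reduced g
        red = record { degrees = degree noLow ; wide = λ v α 1≤ ≤6 → wide v α 1≤ ≤6 (never α v) }
          where
          wide : ∀ v α → 1 ≤ deg v → deg v ≤ 6 → thin α v ≡ false → 3 ≤ count (boundary (cluster v α))
          wide v α 1≤ ≤6 h rewrite true-≤ᵇ 1≤ | true-≤ᵇ ≤6 = false-≤ᵇ {count (boundary (cluster v α))} {2} h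

-- The network of a formula

literal : Ty
literal = bool ⊗ idx

pattern x8 = var (s (s (s (s (s (s (s (s z))))))))

bit : Bool → Bool → Tm (idx ∷ idx ∷ bool ∷ bool ∷ bool ∷ bool ∷ state ∷ idx ∷ idx ∷ []) bool
bit false false = x2
bit false true = x3
bit true false = x4
bit true true = x5

opaque
  restrictT : Tm (bool ∷ bool ∷ bool ∷ bool ∷ state ∷ idx ∷ idx ∷ []) state
  restrictT = tab (tab (ite (andT (same x7 x1) (same x8 x0)) (tblOf (λ x y → ite (bit x y) (get (cell x6 x1 x0) x y) zeroT)) (cell x6 x1 x0)))

  -- `tab tru` is the numeral with all bits set, which is -1 modulo `2 ^ N`.
  activateT : Tm (state ∷ idx ∷ []) state
  activateT = tab (tab (ite (andT (same x3 x1) (same x3 x0)) (tblOf (λ x _ → if x then tab tru else oneT)) (cell x2 x1 x0)))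

  -- The flag tells whether the first index has been met; the second one is smaller if it comes up
  -- before that.
  lessT : Tm (idx ∷ idx ∷ []) bool
  lessT = snd (fold (pr fls fls) (pr (orT (fst x1) (same x0 x2)) (ite (same x0 x3) (notT (orT (fst x1) (same x0 x2))) (snd x1))))

  -- The flag tells whether the previous round met the given index; then the current one is its
  -- successor.
  succT : Tm (idx ∷ []) idx
  succT = snd (fold (pr fls x0) (pr (same x0 x2) (ite (fst x1) x0 (snd x1))))

  -- Fixes the vertices that no clause has claimed to `false`, as otherwise each of them would
  -- double the count.
  killT : Tm ((state ⊗ idx) ∷ []) state
  killT = tab (tab (ite (andT (same x1 x0) (notT (call (snd x2 ∷ x1 ∷ []) lessT)))
    (tblOf (λ x y → if x then zeroT else get (cell (fst x2) x1 x0) x y)) (cell (fst x2) x1 x0)))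

truthT : ∀ {Γ} → Tm Γ bool → Bool → Tm Γ bool
truthT b x = if x then notT b else b

flags : Ty
flags = bool ⊗ (bool ⊗ bool)

-- Whether a clause has at least one, two, three literals, its first and its
-- last literal.
summaryT : Tm (list literal ∷ idx ∷ []) (flags ⊗ (literal ⊗ literal))
summaryT = foldL x0 (pr (pr fls (pr fls fls)) (pr (pr fls x1) (pr fls x1)))
  (pr (pr tru (pr (fst (fst x1)) (fst (snd (fst x1))))) (pr (ite (fst (fst x1)) (fst (snd x1)) x0) x0))

-- An empty clause zeroes the table of the auxiliary vertex `x2`. A unit clause restricts a diagonal
-- table, its first literal being also its last, and a clause of width two restricts the table of
-- its two variables.
wideT narrowT : Tm (list literal ∷ (state ⊗ idx) ∷ idx ∷ []) state
wideT = foldL x0 (call (fst x1 ∷ snd x1 ∷ []) activateT)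
  (call (tru ∷ tru ∷ notT (truthT (fst x0) false) ∷ notT (truthT (fst x0) true) ∷ x1 ∷ snd x3 ∷ snd x0 ∷ []) restrictT)
narrowT = ite (fst (fst (call (x0 ∷ x2 ∷ []) summaryT)))
  (call (e false false ∷ e false true ∷ e true false ∷ e true true ∷ fst x1 ∷ snd l₁ ∷ snd l₂ ∷ []) restrictT)
  (call (fls ∷ fls ∷ fls ∷ fls ∷ fst x1 ∷ x2 ∷ x2 ∷ []) restrictT)
  where
  l₁ l₂ : Tm (list literal ∷ (state ⊗ idx) ∷ idx ∷ []) literal
  l₁ = fst (snd (call (x0 ∷ x2 ∷ []) summaryT))
  l₂ = snd (snd (call (x0 ∷ x2 ∷ []) summaryT))
  e : Bool → Bool → Tm (list literal ∷ (state ⊗ idx) ∷ idx ∷ []) bool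
  e x y = orT (truthT (fst l₁) x) (truthT (fst l₂) y)

opaque
  clauseT : Tm (list literal ∷ (state ⊗ idx) ∷ idx ∷ []) (state ⊗ idx)
  clauseT = ite (snd (snd (fst (call (x0 ∷ x2 ∷ []) summaryT)))) (pr wideT (call (snd x1 ∷ []) succT)) (pr narrowT (snd x1))

  -- The vertex after the `n` variables is fixed to `false`. It provides a table for empty clauses
  -- even if there are no variables. The clause vertices follow it, so the number of vertices in use
  -- is that of the variables and wide clauses plus one.
  initT : Tm (list (list literal) ∷ idx ∷ []) state
  initT = call (foldL x0 (pr (call (tru ∷ tru ∷ fls ∷ fls ∷ tab (tab ones) ∷ x1 ∷ x1 ∷ []) restrictT) (call (x1 ∷ []) succT)) (call (x0 ∷ x1 ∷ x3 ∷ []) clauseT) ∷ []) killT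

less-fold : ∀ m (n i : Fin m) r →
  proj₂ (foldFin {Bool × Bool} m (λ j a → (if proj₁ a then true else (j ≡ᶠ n)) , (if j ≡ᶠ i then (if (if proj₁ a then true else (j ≡ᶠ n)) then false else true) else proj₂ a)) (false , r))
  ≡ (toℕ i <ᵇ toℕ n)
less-fold (suc m) n i r = c n i
  where
  -- After i has been passed, and after n has been passed.
  past-i : ∀ m (n : Fin m → Bool) b r → proj₂ (foldFin {Bool × Bool} m (λ j a → (if proj₁ a then true else n j) , proj₂ a) (b , r)) ≡ r
  past-i zero n b r = refl
  past-i (suc m) n b r = past-i m (n ∘ suc) _ r
  past-n : ∀ m (n i : Fin m → Bool) → proj₂ (foldFin {Bool × Bool} m (λ j a → (if proj₁ a then true else n j) , (if i j then (if (if proj₁ a then true else n j) then false else true) else proj₂ a)) (true , false)) ≡ false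
  past-n zero n i = refl
  past-n (suc m) n i with i zero
  ... | true = past-n m (n ∘ suc) (i ∘ suc)
  ... | false = past-n m (n ∘ suc) (i ∘ suc)
  skip : ∀ m (i : Fin m) r → proj₂ (foldFin {Bool × Bool} m (λ j a → (if proj₁ a then true else false) , (if j ≡ᶠ i then (if (if proj₁ a then true else false) then false else true) else proj₂ a)) (true , r)) ≡ false
  skip (suc m) zero r = past-i m (λ _ → false) true false
  skip (suc m) (suc i) r = skip m i r
  c : ∀ n i → proj₂ (foldFin {Bool × Bool} (suc m) (λ j a → (if proj₁ a then true else (j ≡ᶠ n)) , (if j ≡ᶠ i then (if (if proj₁ a then true else (j ≡ᶠ n)) then false else true) else proj₂ a)) (false , r))
      ≡ (toℕ i <ᵇ toℕ n)
  c zero zero = past-i m (λ _ → false) true false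
  c zero (suc i) = skip m i r
  c (suc n) zero = past-i m (_≡ᶠ n) false true
  c (suc n) (suc i) = less-fold m n i r

succ-fold : ∀ {A : Set} m (i : Fin m) (h : Fin m → A) d → suc (toℕ i) < m →
  ∃ λ k → toℕ k ≡ suc (toℕ i) × proj₂ (foldFin {Bool × A} m (λ j a → (j ≡ᶠ i) , (if proj₁ a then h j else proj₂ a)) (false , d)) ≡ h k
succ-fold (suc (suc m)) zero h d lt = suc zero , refl , quiet m (λ j → h (suc (suc j))) (h (suc zero))
  where
  quiet : ∀ {A : Set} m (h : Fin m → A) d → proj₂ (foldFin {Bool × A} m (λ j a → false , (if proj₁ a then h j else proj₂ a)) (false , d)) ≡ d
  quiet zero h d = refl
  quiet (suc m) h d = quiet m (h ∘ suc) d
succ-fold (suc m) (suc i) h d (s≤s lt) = let (k , e , f) = succ-fold m i (h ∘ suc) d lt in suc k , cong suc e , f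

module _ {n} {p p′ : Matrix n} where
  weight-* : ∀ ω (c : Fin n → Fin n → ℕ) → (∀ i j → p′ i j (ω i) (ω j) ≡ p i j (ω i) (ω j) * c i j) → weight p′ ω ≡ weight p ω * prod (λ i → prod (c i))
  weight-* ω c h = trans (prod-cong (λ i → trans (prod-cong (h i)) (prod-distrib (λ j → p i j (ω i) (ω j)) (c i)))) (prod-distrib (λ i → prod (λ j → p i j (ω i) (ω j))) (λ i → prod (c i)))

prod-point : ∀ {n} (I J : Fin n) (c : Fin n → Fin n → ℕ) → prod (λ i → prod (λ j → if I ≡ᶠ i then (if J ≡ᶠ j then c i j else 1) else 1)) ≡ c I J
prod-point {n} I J c = trans (prod-cong h) (trans (prod-pick I (λ i → prod (λ j → if J ≡ᶠ j then c i j else 1))) (prod-pick J (c I)))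
  where
  h : ∀ i → prod (λ j → if I ≡ᶠ i then (if J ≡ᶠ j then c i j else 1) else 1) ≡ (if I ≡ᶠ i then prod (λ j → if J ≡ᶠ j then c i j else 1) else 1)
  h i with I ≡ᶠ i
  ... | true = refl
  ... | false = prod-one {n} (λ _ → refl)

sumω-pair : ∀ {n} (v : Fin n) (h : (Fin n → Bool) → ℕ) → Ext h → sumω h ≡ sumω (λ ω → [ not (ω v) ] * (h (update ω v false) + h (update ω v true)))
sumω-pair v h ext = trans (sumω-split-value v h) (sym (trans (sumω-cong (λ ω → *-distribˡ-+ [ not (ω v) ] (h (update ω v false)) _))
  (trans (sumω-+ (λ ω → [ not (ω v) ] * h (update ω v false)) _) (cong₂ _+_ (sumω-update v false h ext) (sumω-update v true h ext)))))

-- The vertices from `k` on are not yet in use; fixing them makes a partial network count every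
-- assignment once.
tail-zero : ∀ {n} → ℕ → (Fin n → Bool) → ℕ
tail-zero k ω = prod (λ i → if toℕ i <ᵇ k then 1 else [ not (ω i) ])

tail-zero-ext : ∀ {n} k → Ext {n} (tail-zero k)
tail-zero-ext k h = prod-cong (λ i → cong (λ b → if toℕ i <ᵇ k then 1 else [ not b ]) (h i))

<ᵇ-suc : ∀ a k → a ≢ k → (a <ᵇ suc k) ≡ (a <ᵇ k)
<ᵇ-suc zero zero n = ⊥-elim (n refl)
<ᵇ-suc zero (suc k) n = refl
<ᵇ-suc (suc a) zero n = refl
<ᵇ-suc (suc a) (suc k) n = <ᵇ-suc a k (n ∘ cong suc)

<ᵇ-self : ∀ k → (k <ᵇ k) ≡ false × (k <ᵇ suc k) ≡ true
<ᵇ-self zero = refl , refl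
<ᵇ-self (suc k) = <ᵇ-self k

tail-zero-step : ∀ {n} (v : Fin n) ω → tail-zero (toℕ v) ω ≡ [ not (ω v) ] * tail-zero (suc (toℕ v)) ω
tail-zero-step v ω = trans (prod-cong h) (trans (prod-distrib (λ i → if v ≡ᶠ i then [ not (ω i) ] else 1) (λ i → if toℕ i <ᵇ suc (toℕ v) then 1 else [ not (ω i) ])) (cong (_* tail-zero (suc (toℕ v)) ω) (prod-pick v (λ i → [ not (ω i) ]))))
  where
  h : ∀ i → (if toℕ i <ᵇ toℕ v then 1 else [ not (ω i) ]) ≡ (if v ≡ᶠ i then [ not (ω i) ] else 1) * (if toℕ i <ᵇ suc (toℕ v) then 1 else [ not (ω i) ])
  h i with v ≟ᶠ i
  ... | yes refl rewrite ≡ᶠ-refl v | proj₁ (<ᵇ-self (toℕ v)) | proj₂ (<ᵇ-self (toℕ v)) = sym (*-identityʳ _)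
  ... | no v≢i rewrite ≢⇒≡ᶠ v≢i | <ᵇ-suc (toℕ i) (toℕ v) (λ e → v≢i (toℕ-injective (sym e))) = sym (*-identityˡ _)

tail-zero-update : ∀ {n} (v : Fin n) ω b → tail-zero (suc (toℕ v)) (update ω v b) ≡ tail-zero (suc (toℕ v)) ω
tail-zero-update v ω b = prod-cong h
  where
  h : ∀ i → (if toℕ i <ᵇ suc (toℕ v) then 1 else [ not (update ω v b i) ]) ≡ (if toℕ i <ᵇ suc (toℕ v) then 1 else [ not (ω i) ])
  h i with v ≟ᶠ i
  ... | yes refl rewrite proj₂ (<ᵇ-self (toℕ v)) = refl
  ... | no v≢i rewrite ≢⇒≡ᶠ v≢i = refl

restrict-to : ∀ {n N} → n ≤ N → (Fin N → Bool) → Vec Bool n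
restrict-to z≤n ω = []
restrict-to (s≤s p) ω = ω zero ∷ restrict-to p (ω ∘ suc)

sumL : ∀ {A : Set} → (A → ℕ) → List A → ℕ
sumL f [] = 0
sumL f (x ∷ xs) = f x + sumL f xs

sumL-++ : ∀ {A : Set} (f : A → ℕ) xs ys → sumL f (xs ++ ys) ≡ sumL f xs + sumL f ys
sumL-++ f [] ys = refl
sumL-++ f (x ∷ xs) ys = trans (cong (f x +_) (sumL-++ f xs ys)) (sym (+-assoc (f x) _ _))

sumL-map : ∀ {A B : Set} (f : B → ℕ) (h : A → B) xs → sumL f (map h xs) ≡ sumL (f ∘ h) xs
sumL-map f h [] = refl
sumL-map f h (x ∷ xs) = cong (f (h x) +_) (sumL-map f h xs)

sumL-filter : ∀ {A : Set} (P : A → Bool) xs → length (filterᵇ P xs) ≡ sumL (λ x → [ P x ]) xs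
sumL-filter P [] = refl
sumL-filter P (x ∷ xs) with P x
... | true = cong suc (sumL-filter P xs)
... | false = sumL-filter P xs

sumω-assignments : ∀ {n N} (p : n ≤ N) (h : Vec Bool n → ℕ) → sumω {N} (λ ω → tail-zero n ω * h (restrict-to p ω)) ≡ sumL h (assignments n)
sumω-assignments {N = N} z≤n h = trans (zeros N (h [])) (sym (+-identityʳ _))
  where
  zeros : ∀ N c → sumω {N} (λ ω → tail-zero 0 ω * c) ≡ c
  zeros zero c = *-identityˡ c
  zeros (suc N) c = trans (cong₂ _+_ (trans (sumω-cong {N} (λ ω → cong (_* c) (*-identityˡ (tail-zero 0 ω)))) (zeros N c)) (sumω-zero {N} (λ _ → refl))) (+-identityʳ c)
sumω-assignments {suc n} {suc N} (s≤s p) h = trans (cong₂ _+_ (side false) (side true))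
  (sym (trans (sumL-++ h (map (false Vec.∷_) (assignments n)) _) (cong₂ _+_ (sumL-map h (false Vec.∷_) (assignments n)) (sumL-map h (true Vec.∷_) (assignments n)))))
  where
  side : ∀ b → sumω {N} (λ ω → tail-zero (suc n) (cons b ω) * h (b ∷ restrict-to p ω)) ≡ sumL (h ∘ (b Vec.∷_)) (assignments n)
  side b = trans (sumω-cong {N} (λ ω → cong (_* h (b ∷ restrict-to p ω)) (*-identityˡ (tail-zero n ω)))) (sumω-assignments p (h ∘ (b Vec.∷_)))

length-assignments : ∀ n → length (assignments n) ≡ 2 ^ n
length-assignments zero = refl
length-assignments (suc n) = trans (length-++ (map (false Vec.∷_) (assignments n)))
  (trans (cong₂ _+_ (trans (length-map _ (assignments n)) (length-assignments n)) (trans (length-map _ (assignments n)) (length-assignments n))) (cong (2 ^ n +_) (sym (+-identityʳ (2 ^ n)))))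

val-ones : ∀ n → val {n} (λ _ → true) + 1 ≡ 2 ^ n
val-ones zero = refl
val-ones (suc n) = trans (r (val {n} (λ _ → true))) (cong (2 *_) (val-ones n))
  where
  r : ∀ x → 1 + 2 * x + 1 ≡ 2 * (x + 1)
  r = solve-∀

-- Correctness of the initial network

module Ops₇ (N B : ℕ) (1≤N : 1 ≤ N) where
  open Semantics N B
  open Ops₂ N B 1≤N
  private
    M = 2 ^ N
    instance
      M≢0 : NonZero M
      M≢0 = m^n≢0 2 N
  open Modular M

  truth : Bool → Bool → Bool
  truth b x = if x then (if b then false else true) else b

  Lit : Set
  Lit = Bool × Fin N

  holds : (Fin N → Bool) → Lit → Bool
  holds ω l = truth (proj₁ l) (ω (proj₂ l))

  satisfied : (Fin N → Bool) → List Lit → Bool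
  satisfied ω = ListB.any (holds ω)

  restrict : State → Fin N → Fin N → (Bool → Bool → Bool) → State
  restrict q I J t = eval restrictT (t false false , t false true , t true false , t true true , q , I , J , tt)

  activate : State → Fin N → State
  activate q y = eval activateT (q , y , tt)

  before : Fin N → Fin N → Bool
  before n i = eval lessT (n , i , tt)

  next : Fin N → Fin N
  next i = eval succT (i , tt)

  kill : State → Fin N → State
  kill q y = eval killT ((q , y) , tt)

  minus-one : ℕ
  minus-one = val {N} (λ _ → true)

  sign : Bool → ℕ
  sign x = if x then minus-one else 1

  opaque
    unfolding restrictT activateT lessT succT killT

    restrict-cell : ∀ q I J t i j x y → matrix (restrict q I J t) i j x y ≡ (if (if I ≡ᶠ i then (J ≡ᶠ j) else false) then (if t x y then matrix q i j x y else 0) else matrix q i j x y)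
    restrict-cell q I J t i j x y with if I ≡ᶠ i then (J ≡ᶠ j) else false
    ... | false = refl
    ... | true = c x y
      where
      zr : ∀ {Γ} (γ : ⟦ Γ ⟧ᶜ) → val (eval {Γ} zeroT γ) ≡ 0
      zr γ = zero-val N B γ
      γ : ⟦ idx ∷ idx ∷ bool ∷ bool ∷ bool ∷ bool ∷ state ∷ idx ∷ idx ∷ [] ⟧ᶜ
      γ = j , i , t false false , t false true , t true false , t true true , q , I , J , tt
      d : ∀ b (e : Num N B) → val (if b then e else eval {idx ∷ idx ∷ bool ∷ bool ∷ bool ∷ bool ∷ state ∷ idx ∷ idx ∷ []} zeroT γ) ≡ (if b then val e else 0)
      d true e = refl
      d false e = zr {idx ∷ idx ∷ bool ∷ bool ∷ bool ∷ bool ∷ state ∷ idx ∷ idx ∷ []} γ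
      c : ∀ x y → val (entry (eval (tblOf (λ x y → ite (bit x y) (get (cell x6 x1 x0) x y) zeroT)) γ) x y) ≡ (if t x y then matrix q i j x y else 0)
      c false false = d (t false false) (entry (q i j) false false)
      c false true = d (t false true) (entry (q i j) false true)
      c true false = d (t true false) (entry (q i j) true false)
      c true true = d (t true true) (entry (q i j) true true)

    activate-cell : ∀ q v i j x y → matrix (activate q v) i j x y ≡ (if (if v ≡ᶠ i then (v ≡ᶠ j) else false) then sign x else matrix q i j x y)
    activate-cell q v i j x y with if v ≡ᶠ i then (v ≡ᶠ j) else false
    ... | false = refl
    ... | true = c x y
      where
      Γ : Ctx
      Γ = idx ∷ idx ∷ state ∷ idx ∷ []
      e : Bool → Bool → Tm Γ num
      e x _ = if x then tab tru else oneT
      c : ∀ x y → val (entry (eval (tblOf e) (j , i , q , v , tt)) x y) ≡ sign x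
      c true y = cong val (tblOf-eval (j , i , q , v , tt) e true y)
      c false y = trans (cong val (tblOf-eval (j , i , q , v , tt) e false y)) (oneT-val {Γ} (j , i , q , v , tt))

    less-eval : ∀ n i → before n i ≡ (toℕ i <ᵇ toℕ n)
    less-eval n i = less-fold N n i false

    next-toℕ : ∀ i → suc (toℕ i) < N → toℕ (next i) ≡ suc (toℕ i)
    next-toℕ i lt = let (k , e , f) = succ-fold N i (λ j → j) i lt in trans (cong toℕ f) e

    kill-cell : ∀ q v i j x y → matrix (kill q v) i j x y ≡ (if (if i ≡ᶠ j then (if before v i then false else true) else false) then (if x then 0 else matrix q i j x y) else matrix q i j x y)
    kill-cell q v i j x y with if i ≡ᶠ j then (if before v i then false else true) else false
    ... | false = refl
    ... | true = c x y
      where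
      Γ : Ctx
      Γ = idx ∷ idx ∷ (state ⊗ idx) ∷ []
      e : Bool → Bool → Tm Γ num
      e x y = if x then zeroT else get (cell (fst x2) x1 x0) x y
      c : ∀ x y → val (entry (eval (tblOf e) (j , i , (q , v) , tt)) x y) ≡ (if x then 0 else matrix q i j x y)
      c true y = trans (cong val (tblOf-eval (j , i , (q , v) , tt) e true y)) (zero-val N B {Γ} (j , i , (q , v) , tt))
      c false y = trans (cong val (tblOf-eval (j , i , (q , v) , tt) e false y)) (cong val (get-eval (j , i , (q , v) , tt) (cell (fst x2) x1 x0) false y))

  restrict-weight : ∀ q I J t ω → weight (matrix (restrict q I J t)) ω ≡ weight (matrix q) ω * [ t (ω I) (ω J) ]
  restrict-weight q I J t ω = trans (weight-* {p = matrix q} {matrix (restrict q I J t)} ω (λ i j → if I ≡ᶠ i then (if J ≡ᶠ j then [ t (ω i) (ω j) ] else 1) else 1) h) (cong (weight (matrix q) ω *_) (prod-point I J (λ i j → [ t (ω i) (ω j) ])))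
    where
    h : ∀ i j → matrix (restrict q I J t) i j (ω i) (ω j) ≡ matrix q i j (ω i) (ω j) * (if I ≡ᶠ i then (if J ≡ᶠ j then [ t (ω i) (ω j) ] else 1) else 1)
    h i j rewrite restrict-cell q I J t i j (ω i) (ω j) with I ≡ᶠ i | J ≡ᶠ j | t (ω i) (ω j)
    ... | false | _ | _ = sym (*-identityʳ _)
    ... | true | false | _ = sym (*-identityʳ _)
    ... | true | true | true = sym (*-identityʳ _)
    ... | true | true | false = sym (*-zeroʳ (matrix q i j (ω i) (ω j)))

  activate-weight : ∀ q v ω → (∀ x y → matrix q v v x y ≡ 1) → weight (matrix (activate q v)) ω ≡ weight (matrix q) ω * sign (ω v)
  activate-weight q v ω one = trans (weight-* {p = matrix q} {matrix (activate q v)} ω (λ i j → if v ≡ᶠ i then (if v ≡ᶠ j then sign (ω i) else 1) else 1) h) (cong (weight (matrix q) ω *_) (prod-point v v (λ i j → sign (ω i))))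
    where
    h : ∀ i j → matrix (activate q v) i j (ω i) (ω j) ≡ matrix q i j (ω i) (ω j) * (if v ≡ᶠ i then (if v ≡ᶠ j then sign (ω i) else 1) else 1)
    h i j rewrite activate-cell q v i j (ω i) (ω j) with v ≡ᶠ i in vi | v ≡ᶠ j in vj
    ... | false | _ = sym (*-identityʳ _)
    ... | true | false = sym (*-identityʳ _)
    ... | true | true rewrite sym (≡ᶠ⇒≡ v i vi) | sym (≡ᶠ⇒≡ v j vj) | one (ω v) (ω v) = sym (*-identityˡ _)

  kill-weight : ∀ q v ω → weight (matrix (kill q v)) ω ≡ weight (matrix q) ω * tail-zero (toℕ v) ω
  kill-weight q v ω = trans (weight-* {p = matrix q} {matrix (kill q v)} ω c h) (cong (weight (matrix q) ω *_) (prod-cong (λ i → prod-pick i (λ j → if toℕ j <ᵇ toℕ v then 1 else [ not (ω j) ]))))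
    where
    c : Fin N → Fin N → ℕ
    c i j = if i ≡ᶠ j then (if toℕ j <ᵇ toℕ v then 1 else [ not (ω j) ]) else 1
    h : ∀ i j → matrix (kill q v) i j (ω i) (ω j) ≡ matrix q i j (ω i) (ω j) * c i j
    h i j rewrite kill-cell q v i j (ω i) (ω j) | less-eval v i with i ≟ᶠ j
    ... | no i≢j rewrite ≢⇒≡ᶠ i≢j = sym (*-identityʳ _)
    ... | yes refl rewrite ≡ᶠ-refl i with toℕ i <ᵇ toℕ v | ω i
    ... | true | _ = sym (*-identityʳ _)
    ... | false | false = sym (*-identityʳ _)
    ... | false | true = sym (*-zeroʳ (matrix q i i true true))

  Lits : Set
  Lits = List≤ B Lit

  forbid either : Lit → Lit → Bool → Bool → Bool
  forbid _ l x y = if x then (if truth (proj₁ l) y then false else true) else true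
  either l m x y = if truth (proj₁ l) x then true else truth (proj₁ m) y

  clause : State × Fin N → Fin N → Lits → State × Fin N
  clause a n c = eval clauseT (c , a , n , tt)

  wide-state : State → Fin N → List Lit → State
  wide-state q y = foldl (λ p l → restrict p y (proj₂ l) (forbid l l)) q

  wide? : Lits → Bool
  wide? c = 3 ≤ᵇ length (elements c)

  opaque
    unfolding clauseT

    clause-0 : ∀ q y n b → clause (q , y) n (list≤ [] b) ≡ (restrict q n n (λ _ _ → false) , y)
    clause-0 q y n b = refl

    clause-1 : ∀ q y n l b → clause (q , y) n (list≤ (l ∷ []) b) ≡ (restrict q (proj₂ l) (proj₂ l) (either l l) , y)
    clause-1 q y n l b = refl

    clause-2 : ∀ q y n l m b → clause (q , y) n (list≤ (l ∷ m ∷ []) b) ≡ (restrict q (proj₂ l) (proj₂ m) (either l m) , y)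
    clause-2 q y n l m b = refl

    clause-3 : ∀ q y n l m o ls b → clause (q , y) n (list≤ (l ∷ m ∷ o ∷ ls) b) ≡ (wide-state (activate q y) y (l ∷ m ∷ o ∷ ls) , next y)
    clause-3 q y n l m o ls b = cong (if_then (wide-state (activate q y) y (l ∷ m ∷ o ∷ ls) , next y) else (eval narrowT (list≤ (l ∷ m ∷ o ∷ ls) b , (q , y) , n , tt) , y)) (third ls (l , o))
      where
      Summary : Set
      Summary = (Bool × Bool × Bool) × (Lit × Lit)
      add-literal : Summary → Lit → Summary
      add-literal a l = (true , proj₁ (proj₁ a) , proj₁ (proj₂ (proj₁ a))) , ((if proj₁ (proj₁ a) then proj₁ (proj₂ a) else l) , l)
      third : ∀ ls e → proj₂ (proj₂ (proj₁ (foldl add-literal ((true , true , true) , e) ls))) ≡ true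
      third [] e = refl
      third (l ∷ ls) e = third ls (proj₁ e , l)

  -- `cells` is the reason why all initial edges are hard: an off-diagonal table that is not
  -- constantly 1 contains a zero. `free` leaves the vertices from `k` on to later clauses.
  record Inv (k : ℕ) (q : State) : Set where
    field
      cells : ∀ i j → i ≢ j → (∀ x y → matrix q i j x y ≡ 1) ⊎ (∃₂ λ x y → matrix q i j x y ≡ 0)
      free : ∀ i → k ≤ toℕ i → ∀ j x y → matrix q i j x y ≡ 1 × matrix q j i x y ≡ 1
  open Inv

  restrict-Inv : ∀ {k q} I J t → Inv k q → toℕ I < k → toℕ J < k → (∃₂ λ x y → t x y ≡ false) → Inv k (restrict q I J t)
  restrict-Inv {k} {q} I J t inv I< J< (x₀ , y₀ , t₀) = record { cells = cl ; free = λ i k≤ j x y → row i k≤ j x y , col i k≤ j x y }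
    where
    off : ∀ i j x y → (if I ≡ᶠ i then (J ≡ᶠ j) else false) ≡ false → matrix (restrict q I J t) i j x y ≡ matrix q i j x y
    off i j x y e = trans (restrict-cell q I J t i j x y) (cong (λ c → if c then (if t x y then matrix q i j x y else 0) else matrix q i j x y) e)
    cl : ∀ i j → i ≢ j → (∀ x y → matrix (restrict q I J t) i j x y ≡ 1) ⊎ (∃₂ λ x y → matrix (restrict q I J t) i j x y ≡ 0)
    cl i j i≢j = c (if I ≡ᶠ i then (J ≡ᶠ j) else false) refl
      where
      c : ∀ b → (if I ≡ᶠ i then (J ≡ᶠ j) else false) ≡ b → (∀ x y → matrix (restrict q I J t) i j x y ≡ 1) ⊎ (∃₂ λ x y → matrix (restrict q I J t) i j x y ≡ 0)
      c true e = inj₂ (x₀ , y₀ , trans (restrict-cell q I J t i j x₀ y₀) (cong₂ (λ c d → if c then (if d then matrix q i j x₀ y₀ else 0) else matrix q i j x₀ y₀) e t₀))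
      c false e with cells inv i j i≢j
      ... | inj₁ ones = inj₁ (λ x y → trans (off i j x y e) (ones x y))
      ... | inj₂ (x , y , zr) = inj₂ (x , y , trans (off i j x y e) zr)
    far : ∀ {I i : Fin N} → toℕ I < k → k ≤ toℕ i → (I ≡ᶠ i) ≡ false
    far {I} {i} I< k≤ = ≢⇒≡ᶠ {i = I} {i} (λ { refl → n≮n _ (≤-trans I< k≤) })
    row : ∀ i → k ≤ toℕ i → ∀ j x y → matrix (restrict q I J t) i j x y ≡ 1
    row i k≤ j x y = trans (off i j x y (cong (if_then (J ≡ᶠ j) else false) (far I< k≤))) (proj₁ (free inv i k≤ j x y))
    col : ∀ i → k ≤ toℕ i → ∀ j x y → matrix (restrict q I J t) j i x y ≡ 1
    col i k≤ j x y = trans (off j i x y (both (I ≡ᶠ j) (far J< k≤))) (proj₂ (free inv i k≤ j x y))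
      where
      both : ∀ a {b} → b ≡ false → (if a then b else false) ≡ false
      both true e = e
      both false e = refl

  activate-Inv : ∀ {q} v → Inv (toℕ v) q → Inv (suc (toℕ v)) (activate q v)
  activate-Inv {q} v inv = record { cells = cl ; free = λ i k≤ j x y → trans (off i j x y (row i k≤ j)) (proj₁ (free inv i (<⇒≤ k≤) j x y)) , trans (off j i x y (col i k≤ j)) (proj₂ (free inv i (<⇒≤ k≤) j x y)) }
    where
    off : ∀ i j x y → (if v ≡ᶠ i then (v ≡ᶠ j) else false) ≡ false → matrix (activate q v) i j x y ≡ matrix q i j x y
    off i j x y e = trans (activate-cell q v i j x y) (cong (λ c → if c then sign x else matrix q i j x y) e)
    far : ∀ {i} → suc (toℕ v) ≤ toℕ i → (v ≡ᶠ i) ≡ false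
    far {i} k≤ = ≢⇒≡ᶠ {i = v} {i} (λ { refl → n≮n _ k≤ })
    row : ∀ i → suc (toℕ v) ≤ toℕ i → ∀ j → (if v ≡ᶠ i then (v ≡ᶠ j) else false) ≡ false
    row i k≤ j = cong (if_then (v ≡ᶠ j) else false) (far k≤)
    col : ∀ i → suc (toℕ v) ≤ toℕ i → ∀ j → (if v ≡ᶠ j then (v ≡ᶠ i) else false) ≡ false
    col i k≤ j with v ≡ᶠ j
    ... | true = far k≤
    ... | false = refl
    distinct : ∀ i j → i ≢ j → (if v ≡ᶠ i then (v ≡ᶠ j) else false) ≡ false
    distinct i j i≢j with v ≡ᶠ i in vi
    ... | false = refl
    ... | true = ≢⇒≡ᶠ {i = v} {j} (λ { refl → i≢j (sym (≡ᶠ⇒≡ v i vi)) })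
    cl : ∀ i j → i ≢ j → (∀ x y → matrix (activate q v) i j x y ≡ 1) ⊎ (∃₂ λ x y → matrix (activate q v) i j x y ≡ 0)
    cl i j i≢j with cells inv i j i≢j
    ... | inj₁ ones = inj₁ (λ x y → trans (off i j x y (distinct i j i≢j)) (ones x y))
    ... | inj₂ (x , y , zr) = inj₂ (x , y , trans (off i j x y (distinct i j i≢j)) zr)

  Below : ℕ → List Lit → Set
  Below n = All (λ l → toℕ (proj₂ l) < n)

  falsifiable : ∀ b → ∃ λ x → truth b x ≡ false
  falsifiable true = true , refl
  falsifiable false = false , refl

  forbid-some : ∀ l → ∃₂ λ x y → forbid l l x y ≡ false
  forbid-some (true , i) = true , false , refl
  forbid-some (false , i) = true , true , refl

  either-some : ∀ l m → ∃₂ λ x y → either l m x y ≡ false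
  either-some l m with falsifiable (proj₁ l) | falsifiable (proj₁ m)
  ... | x , e | y , f = x , y , trans (cong (if_then true else truth (proj₁ m) y) e) f

  wide-Inv : ∀ {k q} y ls → Inv k q → toℕ y < k → Below k ls → Inv k (wide-state q y ls)
  wide-Inv y [] inv y< _ = inv
  wide-Inv {k} {q} y (l ∷ ls) inv y< (l< ∷ b) = wide-Inv y ls (restrict-Inv {k} {q} y (proj₂ l) (forbid l l) inv y< l< (forbid-some l)) y< b

  wide-weight : ∀ ω q y ls → weight (matrix (wide-state q y ls)) ω ≡ weight (matrix q) ω * [ if ω y then not (satisfied ω ls) else true ]
  wide-weight ω q y [] = sym (trans (cong (λ b → weight (matrix q) ω * [ b ]) (c (ω y))) (*-identityʳ _))
    where
    c : ∀ b → (if b then true else true) ≡ true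
    c true = refl
    c false = refl
  wide-weight ω q y (l ∷ ls) = trans (wide-weight ω (restrict q y (proj₂ l) (forbid l l)) y ls)
    (trans (cong (_* [ if ω y then not (satisfied ω ls) else true ]) (restrict-weight q y (proj₂ l) (forbid l l) ω))
      (trans (*-assoc (weight (matrix q) ω) _ _) (cong (weight (matrix q) ω *_) (c (ω y) (holds ω l) (satisfied ω ls)))))
    where
    c : ∀ a h r → [ if a then (if h then false else true) else true ] * [ if a then not r else true ] ≡ [ if a then not (h ∨ r) else true ]
    c false h r = refl
    c true true r = refl
    c true false true = refl
    c true false false = refl

  satisfied-cong : ∀ {ω ω′} ls → All (λ l → ω (proj₂ l) ≡ ω′ (proj₂ l)) ls → satisfied ω ls ≡ satisfied ω′ ls
  satisfied-cong [] _ = refl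
  satisfied-cong (l ∷ ls) (e ∷ es) = cong₂ (λ x r → truth (proj₁ l) x ∨ r) e (satisfied-cong ls es)

  Indep : ℕ → ((Fin N → Bool) → ℕ) → Set
  Indep n S = ∀ i ω b → n ≤ toℕ i → S (update ω i b) ≡ S ω

  free-weight : ∀ {q} y → Inv (toℕ y) q → ∀ ω b → weight (matrix q) (update ω y b) ≡ weight (matrix q) ω
  free-weight {q} y inv ω b = prod-cong (λ i → prod-cong (h i))
    where
    h : ∀ i j → matrix q i j (update ω y b i) (update ω y b j) ≡ matrix q i j (ω i) (ω j)
    h i j with y ≟ᶠ i | y ≟ᶠ j
    ... | yes refl | _ = trans (proj₁ (free inv y ≤-refl j (update ω y b y) (update ω y b j))) (sym (proj₁ (free inv y ≤-refl j (ω y) (ω j))))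
    ... | no _ | yes refl = trans (proj₂ (free inv y ≤-refl i (update ω y b i) (update ω y b y))) (sym (proj₂ (free inv y ≤-refl i (ω i) (ω y))))
    ... | no a | no c rewrite ≢⇒≡ᶠ a | ≢⇒≡ᶠ c = refl

  sumω-≈ : ∀ {n} {f g : (Fin n → Bool) → ℕ} → (∀ ω → f ω ≈ g ω) → sumω f ≈ sumω g
  sumω-≈ {zero} p = p _
  sumω-≈ {suc n} {f} {g} p = +-cong {sumω (f ∘ cons false)} (sumω-≈ (p ∘ cons false)) (sumω-≈ (p ∘ cons true))

  update-at : ∀ (ω : Fin N → Bool) v b → update ω v b v ≡ b
  update-at ω v b rewrite ≡ᶠ-refl v = refl

  update-off : ∀ (ω : Fin N → Bool) v b i → v ≢ i → update ω v b i ≡ ω i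
  update-off ω v b i v≢i rewrite ≢⇒≡ᶠ v≢i = refl

  -- `S` stands for the clauses still to come. It depends on the variables only, so that summing
  -- over a new clause vertex does not interfere with it.
  record Done (n : ℕ) (a a′ : State × Fin N) (c : Lits) : Set where
    field
      inv : Inv (toℕ (proj₂ a′)) (proj₁ a′)
      pointer : toℕ (proj₂ a′) ≡ [ wide? c ] + toℕ (proj₂ a)
      sums : ∀ S → Ext S → Indep n S → sumω (λ ω → weight (matrix (proj₁ a′)) ω * (tail-zero (toℕ (proj₂ a′)) ω * S ω))
                                  ≈ sumω (λ ω → weight (matrix (proj₁ a)) ω * (tail-zero (toℕ (proj₂ a)) ω * ([ satisfied ω (elements c) ] * S ω)))

  narrow-done : ∀ n q y I J t c → Inv (toℕ y) q → toℕ I < toℕ y → toℕ J < toℕ y → (∃₂ λ x z → t x z ≡ false) → wide? c ≡ false →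
                (∀ ω → [ t (ω I) (ω J) ] ≡ [ satisfied ω (elements c) ]) → Done n (q , y) (restrict q I J t , y) c
  narrow-done n q y I J t c inv I< J< some nw sem = record
    { inv = restrict-Inv {toℕ y} {q} I J t inv I< J< some
    ; pointer = cong (λ b → [ b ] + toℕ y) (sym nw)
    ; sums = λ S _ _ → cong (_% M) (sumω-cong (λ ω → trans (cong (_* (tail-zero (toℕ y) ω * S ω)) (trans (restrict-weight q I J t ω) (cong (weight (matrix q) ω *_) (sem ω))))
                                               (r (weight (matrix q) ω) [ satisfied ω (elements c) ] (tail-zero (toℕ y) ω) (S ω)))) }
    where
    r : ∀ w b t s → w * b * (t * s) ≡ w * (t * (b * s))
    r = solve-∀

  -- The new vertex y has weights 1 and -1, and y = 1 excludes all literals: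
  -- the two values of y contribute 1 - 1 if the clause is false, and 1 if not.
  wide-done : ∀ n q y c → n ≤ toℕ y → Inv (toℕ y) q → suc (toℕ y) < N → Below n (elements c) → wide? c ≡ true →
              Done n (q , y) (wide-state (activate q y) y (elements c) , next y) c
  wide-done n q y c n≤y inv y<N below w = record
    { inv = subst (λ k → Inv k p) (sym (next-toℕ y y<N)) (wide-Inv y ls (activate-Inv y inv) (n<1+n _) (All.map (λ l< → ≤-trans l< (≤-trans n≤y (n≤1+n _))) below))
    ; pointer = trans (next-toℕ y y<N) (cong (λ b → [ b ] + toℕ y) (sym w))
    ; sums = λ S ext ind → subst (λ k → sumω (λ ω → weight (matrix p) ω * (tail-zero k ω * S ω)) ≈ sumω (f S)) (sym (next-toℕ y y<N))
        (trans (cong (_% M) (sumω-pair y (f′ S) (f′-ext S ext))) (trans (sumω-≈ (λ ω → *-cong {[ not (ω y) ]} refl (paired S ind ω))) (cong (_% M) (sym (sumω-pair y (f S) (f-ext S ext)))))) }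
    where
    ls = elements c
    p = wide-state (activate q y) y ls
    k = toℕ y
    f f′ : ((Fin N → Bool) → ℕ) → (Fin N → Bool) → ℕ
    f S ω = weight (matrix q) ω * (tail-zero k ω * ([ satisfied ω ls ] * S ω))
    f′ S ω = weight (matrix p) ω * (tail-zero (suc k) ω * S ω)
    f′-ext : ∀ S → Ext S → Ext (f′ S)
    f′-ext S ext h = cong₂ _*_ (weight-ext (matrix p) h) (cong₂ _*_ (tail-zero-ext (suc k) h) (ext h))
    f-ext : ∀ S → Ext S → Ext (f S)
    f-ext S ext {ω} {ω′} h = cong₂ _*_ (weight-ext (matrix q) h) (cong₂ _*_ (tail-zero-ext k h) (cong₂ _*_ (cong [_] (satisfied-cong {ω} {ω′} ls (All.map (λ {l} _ → h (proj₂ l)) below))) (ext h)))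
    sat-update : ∀ ω b → satisfied (update ω y b) ls ≡ satisfied ω ls
    sat-update ω b = satisfied-cong ls (All.map (λ {l} l< → update-off ω y b (proj₂ l) (λ { refl → n≮n _ (≤-trans l< n≤y) })) below)
    weight-p : ∀ ω b → weight (matrix p) (update ω y b) ≡ weight (matrix q) ω * sign b * [ if b then not (satisfied ω ls) else true ]
    weight-p ω b = trans (wide-weight (update ω y b) (activate q y) y ls)
      (cong₂ _*_ (trans (activate-weight q y (update ω y b) (λ x z → proj₁ (free inv y ≤-refl y x z))) (cong₂ _*_ (free-weight y inv ω b) (cong sign (update-at ω y b))))
                 (cong₂ (λ a r → [ if a then not r else true ]) (update-at ω y b) (sat-update ω b)))
    f′-at : ∀ S → Indep n S → ∀ ω b → f′ S (update ω y b) ≡ weight (matrix q) ω * sign b * [ if b then not (satisfied ω ls) else true ] * (tail-zero (suc k) ω * S ω)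
    f′-at S ind ω b = cong₂ _*_ (weight-p ω b) (cong₂ _*_ (tail-zero-update y ω b) (ind y ω b n≤y))
    f-at : ∀ S → Indep n S → ∀ ω b → f S (update ω y b) ≡ weight (matrix q) ω * ([ not b ] * tail-zero (suc k) ω * ([ satisfied ω ls ] * S ω))
    f-at S ind ω b = cong₂ _*_ (free-weight y inv ω b) (cong₂ _*_ (trans (tail-zero-step y (update ω y b)) (cong₂ (λ a t → [ not a ] * t) (update-at ω y b) (tail-zero-update y ω b)))
      (cong₂ (λ a m → [ a ] * m) (sat-update ω b) (ind y ω b n≤y)))
    paired : ∀ S → Indep n S → ∀ ω → f′ S (update ω y false) + f′ S (update ω y true) ≈ f S (update ω y false) + f S (update ω y true)
    paired S ind ω = trans (cong (_% M) (cong₂ _+_ (f′-at S ind ω false) (f′-at S ind ω true)))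
      (trans (balance (satisfied ω ls) (weight (matrix q) ω) (tail-zero (suc k) ω) (S ω)) (cong (_% M) (sym (cong₂ _+_ (f-at S ind ω false) (f-at S ind ω true)))))
      where
      balance : ∀ b w t s → w * 1 * 1 * (t * s) + w * minus-one * [ not b ] * (t * s) ≈ w * (1 * t * ([ b ] * s)) + w * (0 * t * ([ b ] * s))
      balance true w t u = cong (_% M) (r w t u minus-one)
        where
        r : ∀ w t s m → w * 1 * 1 * (t * s) + w * m * 0 * (t * s) ≡ w * (1 * t * (1 * s)) + w * (0 * t * (1 * s))
        r = solve-∀
      -- The two contributions add up to `w * (t * u)` times `minus-one + 1`, which is a multiple of
      -- `2 ^ N`.
      balance false w t u = trans (cong (_% M) (trans (r w t u minus-one) (cong (λ m → 0 + m * (w * (t * u))) (val-ones N)))) (trans (multiple≈ 0 (w * (t * u))) (cong (_% M) (sym (r′ w t u))))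
        where
        r : ∀ w t s m → w * 1 * 1 * (t * s) + w * m * 1 * (t * s) ≡ 0 + (m + 1) * (w * (t * s))
        r = solve-∀
        r′ : ∀ w t s → w * (1 * t * (0 * s)) + w * (0 * t * (0 * s)) ≡ 0
        r′ = solve-∀

  clause-done : ∀ (nᶠ : Fin N) q y c → toℕ nᶠ < toℕ y → Inv (toℕ y) q → [ wide? c ] + toℕ y < N → Below (toℕ nᶠ) (elements c) → Done (toℕ nᶠ) (q , y) (clause (q , y) nᶠ c) c
  clause-done nᶠ q y c@(list≤ [] b) n<y inv lt _ rewrite clause-0 q y nᶠ b =
    narrow-done (toℕ nᶠ) q y nᶠ nᶠ (λ _ _ → false) c inv n<y n<y (true , true , refl) refl (λ ω → refl)
  clause-done nᶠ q y c@(list≤ (l ∷ []) b) n<y inv lt (l< ∷ _) rewrite clause-1 q y nᶠ l b =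
    narrow-done (toℕ nᶠ) q y (proj₂ l) (proj₂ l) (either l l) c inv (<-trans l< n<y) (<-trans l< n<y) (either-some l l) refl (λ ω → e (holds ω l))
    where
    e : ∀ h → [ if h then true else h ] ≡ [ h ∨ false ]
    e true = refl
    e false = refl
  clause-done nᶠ q y c@(list≤ (l ∷ m ∷ []) b) n<y inv lt (l< ∷ m< ∷ _) rewrite clause-2 q y nᶠ l m b =
    narrow-done (toℕ nᶠ) q y (proj₂ l) (proj₂ m) (either l m) c inv (<-trans l< n<y) (<-trans m< n<y) (either-some l m) refl (λ ω → e (holds ω l) (holds ω m))
    where
    e : ∀ h g → [ if h then true else g ] ≡ [ h ∨ (g ∨ false) ]
    e true _ = refl
    e false true = refl
    e false false = refl
  clause-done nᶠ q y c@(list≤ (l ∷ m ∷ o ∷ ls) b) n<y inv lt below rewrite clause-3 q y nᶠ l m o ls b =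
    wide-done (toℕ nᶠ) q y c (<⇒≤ n<y) inv lt below refl

  wides : List Lits → ℕ
  wides [] = 0
  wides (c ∷ cs) = [ wide? c ] + wides cs

  all-satisfied : (Fin N → Bool) → List Lits → Bool
  all-satisfied ω [] = true
  all-satisfied ω (c ∷ cs) = satisfied ω (elements c) ∧ all-satisfied ω cs

  all-satisfied-cong : ∀ {ω ω′} n cs → All (Below n ∘ elements) cs → (∀ i → toℕ i < n → ω i ≡ ω′ i) → all-satisfied ω cs ≡ all-satisfied ω′ cs
  all-satisfied-cong n [] _ h = refl
  all-satisfied-cong n (c ∷ cs) (b ∷ bs) h = cong₂ _∧_ (satisfied-cong (elements c) (All.map (h _) b)) (all-satisfied-cong n cs bs h)

  process : Fin N → State × Fin N → List Lits → State × Fin N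
  process nᶠ = foldl (λ a c → clause a nᶠ c)

  process-done : ∀ nᶠ cs a → toℕ nᶠ < toℕ (proj₂ a) → Inv (toℕ (proj₂ a)) (proj₁ a) → wides cs + toℕ (proj₂ a) < N → All (Below (toℕ nᶠ) ∘ elements) cs →
    let a′ = process nᶠ a cs in
    Inv (toℕ (proj₂ a′)) (proj₁ a′) × toℕ (proj₂ a′) ≡ wides cs + toℕ (proj₂ a) ×
    sumω (λ ω → weight (matrix (proj₁ a′)) ω * tail-zero (toℕ (proj₂ a′)) ω) ≈ sumω (λ ω → weight (matrix (proj₁ a)) ω * (tail-zero (toℕ (proj₂ a)) ω * [ all-satisfied ω cs ]))
  process-done nᶠ [] a n<y inv lt _ = inv , refl , cong (_% M) (sumω-cong (λ ω → cong (weight (matrix (proj₁ a)) ω *_) (sym (*-identityʳ _))))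
  process-done nᶠ (c ∷ cs) a n<y inv lt (b ∷ bs) =
    let d = clause-done nᶠ (proj₁ a) (proj₂ a) c n<y inv (≤-trans (s≤s (+-monoˡ-≤ (toℕ (proj₂ a)) (m≤m+n [ wide? c ] (wides cs)))) lt) b
        a₁ = clause a nᶠ c
        ptr = trans (+-comm (wides cs) (toℕ (proj₂ a₁))) (trans (cong (_+ wides cs) (Done.pointer d)) (r [ wide? c ] (toℕ (proj₂ a)) (wides cs)))
        (inv′ , ptr′ , sums′) = process-done nᶠ cs a₁ (≤-trans n<y (≤-trans (m≤n+m _ [ wide? c ]) (≤-reflexive (sym (Done.pointer d))))) (Done.inv d) (subst (_< N) (sym ptr) lt) bs
        S = λ ω → [ all-satisfied ω cs ]
    in inv′ , trans ptr′ ptr , trans sums′ (trans (Done.sums d S (λ h → cong [_] (all-satisfied-cong (toℕ nᶠ) cs bs (λ i _ → h i)))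
         (λ i ω b n≤ → cong [_] (all-satisfied-cong (toℕ nᶠ) cs bs (λ j j< → update-off ω i b j (λ { refl → n≮n _ (≤-trans j< n≤) })))))
         (cong (_% M) (sumω-cong (λ ω → cong (λ m → weight (matrix (proj₁ a)) ω * (tail-zero (toℕ (proj₂ a)) ω * m)) (e (satisfied ω (elements c)) (all-satisfied ω cs))))))
    where
    r : ∀ a b c → a + b + c ≡ a + c + b
    r = solve-∀
    e : ∀ a b → [ a ] * [ b ] ≡ [ a ∧ b ]
    e true b = +-identityʳ _
    e false b = refl

  Short : ∀ {n} → Clause n → Set
  Short c = length c ≤ B

  module _ {n} (n≤N : n ≤ N) where
    convert : Literal n → Lit
    convert (pos i) = false , inject≤ i n≤N
    convert (neg i) = true , inject≤ i n≤N

    convertᶜ : (c : Clause n) → Short c → Lits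
    convertᶜ c short = list≤ (map convert c) (≤-trans (≤-reflexive (length-map convert c)) short)

    convertᶠ : (φ : CNF n) → All Short φ → List Lits
    convertᶠ [] [] = []
    convertᶠ (c ∷ φ) (p ∷ ps) = convertᶜ c p ∷ convertᶠ φ ps

    length-convert : ∀ φ ps → length (convertᶠ φ ps) ≡ length φ
    length-convert [] [] = refl
    length-convert (c ∷ φ) (p ∷ ps) = cong suc (length-convert φ ps)

    convert-below : ∀ φ ps → All (Below n ∘ elements) (convertᶠ φ ps)
    convert-below [] [] = []
    convert-below (c ∷ φ) (p ∷ ps) = go c ∷ convert-below φ ps
      where
      lt : ∀ l → toℕ (proj₂ (convert l)) < n
      lt (pos i) = subst (_< n) (sym (toℕ-inject≤ i n≤N)) (toℕ<n i)
      lt (neg i) = subst (_< n) (sym (toℕ-inject≤ i n≤N)) (toℕ<n i)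
      go : ∀ c → Below n (map convert c)
      go [] = []
      go (l ∷ c) = lt l ∷ go c

    wides-convert : ∀ φ ps → wides (convertᶠ φ ps) ≡ #clauses≥3 φ
    wides-convert [] [] = refl
    wides-convert (c ∷ φ) (p ∷ ps) rewrite length-map convert c with 3 ≤ᵇ length c
    ... | true = cong suc (wides-convert φ ps)
    ... | false = wides-convert φ ps

    restrict-lookup : ∀ {n N} (p : n ≤ N) (ω : Fin N → Bool) i → Vec.lookup (restrict-to p ω) i ≡ ω (inject≤ i p)
    restrict-lookup (s≤s p) ω zero = refl
    restrict-lookup (s≤s p) ω (suc i) = restrict-lookup p (ω ∘ suc) i

    holds-convert : ∀ ω l → holds ω (convert l) ≡ evalLiteral l (restrict-to n≤N ω)
    holds-convert ω (pos i) rewrite restrict-lookup n≤N ω i with ω (inject≤ i n≤N)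
    ... | true = refl
    ... | false = refl
    holds-convert ω (neg i) rewrite restrict-lookup n≤N ω i with ω (inject≤ i n≤N)
    ... | true = refl
    ... | false = refl

    satisfied-convert : ∀ ω φ ps → all-satisfied ω (convertᶠ φ ps) ≡ ⟦ φ ⟧ (restrict-to n≤N ω)
    satisfied-convert ω [] [] = refl
    satisfied-convert ω (c ∷ φ) (p ∷ ps) = cong₂ _∧_ (go c) (satisfied-convert ω φ ps)
      where
      go : ∀ c → satisfied ω (map convert c) ≡ evalClause c (restrict-to n≤N ω)
      go [] = refl
      go (l ∷ c) = cong₂ _∨_ (holds-convert ω l) (go c)

  opaque
    unfolding zeroRow

    zrow-complete : ∀ q α i j → (∃ λ x → matrix q i j α x ≡ 0) ⊎ (∃ λ x → matrix q j i x α ≡ 0) → zrow q α i j ≡ true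
    zrow-complete q α i j h = c h
      where
      γ : ⟦ state ∷ idx ∷ idx ∷ [] ⟧ᶜ
      γ = q , i , j , tt
      zero₁ : ∀ x → matrix q i j α x ≡ 0 → eval (isZero (get (cell x0 x1 x2) α x)) γ ≡ true
      zero₁ x e = isZero-complete γ (get (cell x0 x1 x2) α x) (trans (cong val (get-eval γ (cell x0 x1 x2) α x)) e)
      zero₂ : ∀ x → matrix q j i x α ≡ 0 → eval (isZero (get (cell x0 x2 x1) x α)) γ ≡ true
      zero₂ x e = isZero-complete γ (get (cell x0 x2 x1) x α) (trans (cong val (get-eval γ (cell x0 x2 x1) x α)) e)
      zeroA zeroB : Bool → Tm (state ∷ idx ∷ idx ∷ []) bool
      zeroA x = isZero (get (cell x0 x1 x2) α x)
      zeroB x = isZero (get (cell x0 x2 x1) x α)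
      or₁ : ∀ a b → eval a γ ≡ true → eval (orT a b) γ ≡ true
      or₁ a b e = cong (if_then true else eval b γ) e
      or₂ : ∀ a b → eval b γ ≡ true → eval (orT a b) γ ≡ true
      or₂ a b e with eval a γ
      ... | true = refl
      ... | false = e
      c : (∃ λ x → matrix q i j α x ≡ 0) ⊎ (∃ λ x → matrix q j i x α ≡ 0) → zrow q α i j ≡ true
      c (inj₁ (false , e)) = or₁ (orT (zeroA false) (zeroA true)) (orT (zeroB false) (zeroB true)) (or₁ (zeroA false) (zeroA true) (zero₁ false e))
      c (inj₁ (true , e)) = or₁ (orT (zeroA false) (zeroA true)) (orT (zeroB false) (zeroB true)) (or₂ (zeroA false) (zeroA true) (zero₁ true e))
      c (inj₂ (false , e)) = or₂ (orT (zeroA false) (zeroA true)) (orT (zeroB false) (zeroB true)) (or₁ (zeroB false) (zeroB true) (zero₂ false e))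
      c (inj₂ (true , e)) = or₂ (orT (zeroA false) (zeroA true)) (orT (zeroB false) (zeroB true)) (or₂ (zeroB false) (zeroB true) (zero₂ true e))

  private
    blank : State
    blank = eval {[]} (tab (tab ones)) tt

    blank-matrix : ∀ i j x y → matrix blank i j x y ≡ 1
    blank-matrix i j x y = ones-val {idx ∷ idx ∷ []} (j , i , tt) x y

    low : Bool → Bool → Bool
    low x y = if x then false else true

  start : Fin N → State × Fin N
  start nᶠ = restrict blank nᶠ nᶠ low , next nᶠ

  init : List≤ B Lits → Fin N → State
  init cs nᶠ = eval initT (cs , nᶠ , tt)

  opaque
    unfolding initT

    init-kill : ∀ cs nᶠ → init cs nᶠ ≡ kill (proj₁ (process nᶠ (start nᶠ) (elements cs))) (proj₂ (process nᶠ (start nᶠ) (elements cs)))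
    init-kill cs nᶠ = refl

  module _ {n} (n<N : n < N) (φ : CNF n) (ps : All Short φ) (b : length (convertᶠ (<⇒≤ n<N) φ ps) ≤ B) (room : #clauses≥3 φ + suc n < N)
           (nᶠ : Fin N) (nᶠ≡ : toℕ nᶠ ≡ n) where
    private
      cs = convertᶠ (<⇒≤ n<N) φ ps
      a = process nᶠ (start nᶠ) cs

      ptr : toℕ (next nᶠ) ≡ suc n
      ptr = trans (next-toℕ nᶠ (subst (λ k → suc k < N) (sym nᶠ≡) (≤-trans (s≤s (m≤n+m (suc n) (#clauses≥3 φ))) room))) (cong suc nᶠ≡)

      n<ptr : toℕ nᶠ < toℕ (next nᶠ)
      n<ptr = ≤-reflexive (trans (cong suc nᶠ≡) (sym ptr))

      done = process-done nᶠ cs (start nᶠ) n<ptr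
        (restrict-Inv {toℕ (next nᶠ)} {blank} nᶠ nᶠ low (record { cells = λ i j _ → inj₁ (blank-matrix i j) ; free = λ i _ j x y → blank-matrix i j x y , blank-matrix j i x y }) n<ptr n<ptr (true , true , refl))
        (subst₂ (λ m k → m + k < N) (sym (wides-convert (<⇒≤ n<N) φ ps)) (sym ptr) room)
        (subst (λ k → All (Below k ∘ elements) cs) (sym nᶠ≡) (convert-below (<⇒≤ n<N) φ ps))

      inv = proj₁ done

      last-ptr : toℕ (proj₂ a) ≡ #clauses≥3 φ + suc n
      last-ptr = trans (proj₁ (proj₂ done)) (cong₂ _+_ (wides-convert (<⇒≤ n<N) φ ps) ptr)

    initial : State
    initial = init (list≤ cs b) nᶠ

    init-Z : Z (matrix initial) ≈ #sat φ
    init-Z = begin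
      Z (matrix initial) % M ≡⟨ cong (λ q → Z (matrix q) % M) (init-kill (list≤ cs b) nᶠ) ⟩
      Z (matrix (kill (proj₁ a) (proj₂ a))) % M ≡⟨ cong (_% M) (sumω-cong (kill-weight (proj₁ a) (proj₂ a))) ⟩
      sumω (λ ω → weight (matrix (proj₁ a)) ω * tail-zero (toℕ (proj₂ a)) ω) % M ≡⟨ proj₂ (proj₂ done) ⟩
      sumω (λ ω → weight (matrix (proj₁ (start nᶠ))) ω * (tail-zero (toℕ (next nᶠ)) ω * [ all-satisfied ω cs ])) % M ≡⟨ cong (_% M) (sumω-cong h) ⟩
      sumω (λ ω → tail-zero n ω * [ ⟦ φ ⟧ (restrict-to (<⇒≤ n<N) ω) ]) % M ≡⟨ cong (_% M) (sumω-assignments (<⇒≤ n<N) (λ x → [ ⟦ φ ⟧ x ])) ⟩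
      sumL (λ x → [ ⟦ φ ⟧ x ]) (assignments n) % M ≡⟨ cong (_% M) (sumL-filter ⟦ φ ⟧ (assignments n)) ⟨
      #sat φ % M ∎
      where
      open ≡-Reasoning
      h : ∀ ω → weight (matrix (proj₁ (start nᶠ))) ω * (tail-zero (toℕ (next nᶠ)) ω * [ all-satisfied ω cs ]) ≡ tail-zero n ω * [ ⟦ φ ⟧ (restrict-to (<⇒≤ n<N) ω) ]
      h ω = trans (cong (_* (tail-zero (toℕ (next nᶠ)) ω * [ all-satisfied ω cs ])) (trans (restrict-weight blank nᶠ nᶠ low ω)
                    (trans (cong (_* [ low (ω nᶠ) (ω nᶠ) ]) (prod-one {N} (λ i → prod-one {N} (λ j → blank-matrix i j (ω i) (ω j))))) (trans (*-identityˡ _) (cong [_] (lw (ω nᶠ)))))))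
        (trans (sym (*-assoc [ not (ω nᶠ) ] _ _))
          (cong₂ _*_ (trans (cong (λ k → [ not (ω nᶠ) ] * tail-zero k ω) (trans ptr (cong suc (sym nᶠ≡)))) (trans (sym (tail-zero-step nᶠ ω)) (cong (λ k → tail-zero k ω) nᶠ≡)))
                     (cong [_] (satisfied-convert (<⇒≤ n<N) ω φ ps))))
        where
        lw : ∀ x → (if x then false else true) ≡ not x
        lw true = refl
        lw false = refl

    private
      off : ∀ i j → i ≢ j → ∀ x y → matrix initial i j x y ≡ matrix (proj₁ a) i j x y
      off i j i≢j x y rewrite init-kill (list≤ cs b) nᶠ | kill-cell (proj₁ a) (proj₂ a) i j x y | ≢⇒≡ᶠ i≢j = refl

      zero-row₁ : ∀ q i j α x → matrix q i j α x ≡ 0 → zrow q α i j ≡ true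
      zero-row₁ q i j α x e = zrow-complete q α i j (inj₁ (x , e))

      zero-row₂ : ∀ q i j α x → matrix q j i x α ≡ 0 → zrow q α i j ≡ true
      zero-row₂ q i j α x e = zrow-complete q α i j (inj₂ (x , e))

      not-soft : ∀ i j → isSoft (kindOf initial i j) ≡ false
      not-soft i j with i ≟ᶠ j
      ... | yes refl = cong isSoft (Graph.irrefl (graphOf initial) i)
      ... | no i≢j = c (Inv.cells inv i j i≢j) (Inv.cells inv j i (i≢j ∘ sym))
        where
        hardᵏ : ∀ α → zrow initial α i j ≡ true → isSoft (kindOf initial i j) ≡ false
        hardᵏ false e rewrite e with edge initial i j
        ... | true = refl
        ... | false = refl
        hardᵏ true e rewrite e with edge initial i j | zrow initial false i j
        ... | true | true = refl
        ... | true | false = refl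
        ... | false | _ = refl
        c : _ → _ → isSoft (kindOf initial i j) ≡ false
        c (inj₂ (x , y , e)) _ = hardᵏ x (zero-row₁ initial i j x y (trans (off i j i≢j x y) e))
        c (inj₁ _) (inj₂ (x , y , e)) = hardᵏ y (zero-row₂ initial i j y x (trans (off j i (i≢j ∘ sym) x y) e))
        c (inj₁ o) (inj₁ o′) = cong isSoft (no-edge⇒none initial i j (no-edge initial i j (1⇒triv (initial i j) (λ x y → trans (off i j i≢j x y) (o x y))) (1⇒triv (initial j i) (λ x y → trans (off j i (i≢j ∘ sym) x y) (o′ x y)))))

      dead : ∀ i → toℕ (proj₂ a) ≤ toℕ i → Graph.deg (graphOf initial) i ≡ 0
      dead i k≤ = sum-zero (λ j → cong [_] (trans (isEdge-kind initial i j) (d j)))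
        where
        d : ∀ j → edge initial i j ≡ false
        d j with i ≟ᶠ j
        ... | yes refl = edge-irrefl initial i
        ... | no i≢j = no-edge initial i j (1⇒triv (initial i j) (λ x y → trans (off i j i≢j x y) (proj₁ (Inv.free inv i k≤ j x y))))
                                           (1⇒triv (initial j i) (λ x y → trans (off j i (i≢j ∘ sym) x y) (proj₂ (Inv.free inv i k≤ j x y))))

    -- No edge of the initial network is soft, so a vertex in use weighs at most `2 * w₆`, and all
    -- others are isolated.
    init-measure : ∀ F → Weights.Increasing F → measure F (graphOf initial) ≤ (#clauses≥3 φ + suc n) * (2 * Weights.w₆ F)
    init-measure F inc = ≤-trans (sum-mono h) (≤-trans (≤-reflexive (sym (*-distribʳ-sum {N} (2 * w₆) (λ i → [ toℕ i <ᵇ k ])))) (*-monoˡ-≤ (2 * w₆) (≤-trans (count-below N k) (≤-reflexive last-ptr))))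
      where
      open Weights F
      k = toℕ (proj₂ a)
      count-below : ∀ N k → sum {N} (λ i → [ toℕ i <ᵇ k ]) ≤ k
      count-below zero k = z≤n
      count-below (suc N) zero = ≤-reflexive (sum-zero {suc N} (λ _ → refl))
      count-below (suc N) (suc k) = s≤s (count-below N k)
      w≤w₆ : ∀ d → w d ≤ w₆
      w≤w₆ d = ≤-trans (w-mono inc (m≤m+n d 6)) (≤-reflexive (top d))
        where
        top : ∀ d → w (d + 6) ≡ w₆
        top d rewrite +-comm d 6 = refl
      h : ∀ i → W (Graph.deg (graphOf initial) i) (Graph.sdeg (graphOf initial) i) ≤ [ toℕ i <ᵇ k ] * (2 * w₆)
      h i = subst (λ t → 2 * w (Graph.deg (graphOf initial) i) + σ * t ≤ [ toℕ i <ᵇ k ] * (2 * w₆)) (sym (sum-zero {N} {λ j → [ isSoft (kindOf initial i j) ]} (λ j → cong [_] (not-soft i j))))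
        (≤-trans (≤-reflexive (trans (cong (2 * w (Graph.deg (graphOf initial) i) +_) (*-zeroʳ σ)) (+-identityʳ _))) (c (toℕ i <ᵇ k) refl))
        where
        c : ∀ e → (toℕ i <ᵇ k) ≡ e → 2 * w (Graph.deg (graphOf initial) i) ≤ [ e ] * (2 * w₆)
        c true _ = ≤-trans (*-monoʳ-≤ 2 (w≤w₆ (Graph.deg (graphOf initial) i))) (≤-reflexive (sym (+-identityʳ (2 * w₆))))
        c false e rewrite dead i (≮⇒≥ (λ lt → subst (λ b → b ≡ false → ⊥) (sym (Equivalence.to T-≡ (<⇒<ᵇ lt))) (λ ()) e)) = z≤n

    -- There are only `2 ^ n` assignments and `n < N`, so the residue that is computed determines
    -- the count.
    #sat< : #sat φ < M
    #sat< = ≤-trans (s≤s (≤-trans (length-filter {P = λ x → T (⟦ φ ⟧ x)} (λ x → T? (⟦ φ ⟧ x)) (assignments n)) (≤-reflexive (length-assignments n)))) (^-monoʳ-< 2 (s≤s (s≤s z≤n)) n<N)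

-- The recursive algorithm

opaque
  sum₄T : Tm (num ∷ num ∷ num ∷ num ∷ []) num
  sum₄T = add x0 (add x1 (add x2 x3))

  valueT : Tm (opt ∷ []) num
  valueT = ite (fst x0) (call (snd x0 ∷ []) leafT) zeroT

module SolveTerms (F₀ : Weights) (Fs : List Weights) (ts : List (ℕ × ℕ)) (unit : ℕ) where
  open SearchTerms F₀ Fs ts unit

  opaque
    solveStepT : Tm (opt ∷ []) outcome
    solveStepT = ite (fst x0) (call (snd x0 ∷ []) stepT) (pr fls (pr x0 (pr x0 (pr x0 x0))))

  module _ {f} (L E S : Fin f) (ι₁ : Fin (size solveStepT) → Fin f) (ι₂ : Fin (size valueT) → Fin f) (ι₃ : Fin (size sum₄T) → Fin f) where
    open Compile L E

    -- The cases unpack the four children from the node and the unary `N` from the argument. The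
    -- four results followed by `N` form the environment of `sum₄T`.
    children : Expr f 6
    children = case v3 nil (case v1 nil (case v1 nil (case (var (suc (suc (suc (suc (suc (suc (suc (suc (suc (suc (suc zero)))))))))))) nil
      (call S (var (suc (suc (suc (suc (suc (suc zero)))))) ∙ v1) ∙ (call S (var (suc (suc (suc (suc zero)))) ∙ v1) ∙ (call S (v2 ∙ v1) ∙ (call S (v3 ∙ v1) ∙ v1)))))))

    solveBody : Expr f 1
    solveBody = let′ (comp solveStepT ι₁ zero) (case v0 nil (case v0 (comp valueT ι₂ (suc (suc (suc zero)))) (let′ children (comp sum₄T ι₃ zero))))

  -- `ownCost` bounds a call without recursion. `totalCost` charges a node with children for its own
  -- work and for up to four calls of that kind.
  ownCost restCost totalCost : ℕ → ℕ
  ownCost B = suc (cost solveStepT B + suc (1 + suc (1 + cost valueT B)))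
  restCost B = 35 + (cost solveStepT B + cost sum₄T B)
  totalCost B = restCost B + 4 * ownCost B

module Ops₁₀ (F₀ : Weights) (Fs : List Weights) (ts : List (ℕ × ℕ)) (unit : ℕ)
            (N B : ℕ) (1≤N : 1 ≤ N) (K₁ K₂ K₃ : ℕ) (1≤K₁ : 1 ≤ K₁) (7≤K₃ : 7 ≤ K₃) (big : N * (K₁ + K₂ * N) + K₃ < 2 ^ N)
            (small : All (Small K₁ K₂) (F₀ ∷ Fs)) (ts≤ : All (λ (p , q) → p ≤ K₃ × q ≤ K₃) ts) (unit≤ : 2 * unit ≤ K₃)
            (8≤N : 8 ≤ N) (progress : (g : Graph N) → Reduced g → ∀ v → 1 ≤ Graph.deg g v → ∃ λ F → F ∈ F₀ ∷ Fs × least g (F₀ ∷ Fs) ≡ measure F g × Good unit ts g F)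
            {K : ℕ} {φ : ℕ → ℕ} (charge : Charge ts unit K φ) (Q : ℕ) (Q≤φ : ∀ {m} → m ≤ K → Q ≤ φ m)
            {f : ℕ} (fs : Vec (Expr f 1) f) (L E S : Fin f)
            (linkL : lookup fs L ≡ lookupBody L) (linkE : lookup fs E ≡ sameBody E)
            (ι₁ : Fin (size (SolveTerms.solveStepT F₀ Fs ts unit)) → Fin f) (ι₂ : Fin (size valueT) → Fin f) (ι₃ : Fin (size sum₄T) → Fin f)
            (linkS : lookup fs S ≡ SolveTerms.solveBody F₀ Fs ts unit L E S ι₁ ι₂ ι₃) (N≤B : N ≤ B) where
  open Semantics N B
  open Ops₅ F₀ Fs ts unit N B 1≤N K₁ K₂ K₃ 1≤K₁ 7≤K₃ big small ts≤ unit≤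
  open SearchTerms F₀ Fs ts unit
  open SolveTerms F₀ Fs ts unit
  open Soundness charge
  open Correct fs L E linkL linkE N B N≤B
  open Compile L E
  private
    M = 2 ^ N
    instance
      M≢0 : NonZero M
      M≢0 = m^n≢0 2 N
  open Modular M

  opaque
    unfolding sum₄T solveStepT

    sum₄-val : ∀ a b c d → val (eval sum₄T (a , b , c , d , tt)) ≈ val a + (val b + (val c + val d))
    sum₄-val a b c d = trans (add-term N B {num ∷ num ∷ num ∷ num ∷ []} (a , b , c , d , tt) x0 (add x1 (add x2 x3)))
      (+-cong {val a} refl (trans (add-term N B {num ∷ num ∷ num ∷ num ∷ []} (a , b , c , d , tt) x1 (add x2 x3))
        (+-cong {val b} refl (add-term N B {num ∷ num ∷ num ∷ num ∷ []} (a , b , c , d , tt) x2 x3))))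

    value-absent : ∀ q → val (eval valueT ((false , q) , tt)) ≡ 0
    value-absent q = zero-val N B {opt ∷ []} ((false , q) , tt)

    value-present : ∀ q → eval valueT ((true , q) , tt) ≡ leaf q
    value-present q = refl

    step-absent : ∀ q → eval solveStepT ((false , q) , tt) ≡ (false , (false , q) , (false , q) , (false , q) , (false , q))
    step-absent q = refl

    step-present : ∀ q → eval solveStepT ((true , q) , tt) ≡ step q
    step-present q = refl

  module _ (linked₁ : Linked solveStepT ι₁) (linked₂ : Linked valueT ι₂) (linked₃ : Linked sum₄T ι₃) where
    private
      body = solveBody L E S ι₁ ι₂ ι₃
      A = ownCost B
      P = totalCost B

      env : Opt → Tree
      env o = encEnv (opt ∷ []) (o , tt)

      -- At each of at most `k` levels of the recursion the charges of the nodes add up to at most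
      -- `Φ o`, and each present node has charge at least `Q`; multiplying by `Q` replaces a
      -- division. Absent nodes have no charge, so `A` is paid for them by the parent as a part of
      -- `P`.
      Solves : ℕ → Opt → Set
      Solves k o = ∃₂ λ (r : Num N B) t → (env o ∷ [] ⊢ body ⇓ enc num r ≤ t) × val r ≈ value o × t * Q ≤ A * Q + P * (k * Φ o)

      at-once : ∀ o n → eval solveStepT (o , tt) ≡ (false , n) → env o ∷ [] ⊢ body ⇓ enc num (eval valueT (o , tt)) ≤ A
      at-once o n e = evLet (subst (λ u → env o ∷ [] ⊢ comp solveStepT ι₁ zero ⇓ enc outcome u ≤ cost solveStepT B) e (comp-correct solveStepT ι₁ linked₁ (o , tt) zero refl))
        (evCase (evVar refl) (evCaseNil (evVar refl) (comp-correct valueT ι₂ linked₂ (o , tt) (suc (suc (suc zero))) refl)))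

      cheap : ∀ {k o} → A * Q ≤ A * Q + P * (k * Φ o)
      cheap = m≤m+n _ _

      combine : ∀ q o₁ o₂ o₃ o₄ {r₁ r₂ r₃ r₄ t₁ t₂ t₃ t₄} → eval solveStepT ((true , q) , tt) ≡ (true , o₁ , o₂ , o₃ , o₄) →
        env o₁ ∷ [] ⊢ body ⇓ enc num r₁ ≤ t₁ → env o₂ ∷ [] ⊢ body ⇓ enc num r₂ ≤ t₂ → env o₃ ∷ [] ⊢ body ⇓ enc num r₃ ≤ t₃ → env o₄ ∷ [] ⊢ body ⇓ enc num r₄ ≤ t₄ →
        env (true , q) ∷ [] ⊢ body ⇓ enc num (eval sum₄T (r₁ , r₂ , r₃ , r₄ , tt)) ≤ restCost B + (t₁ + (t₂ + (t₃ + t₄)))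
      combine q o₁ o₂ o₃ o₄ {r₁} {r₂} {r₃} {r₄} {t₁} {t₂} {t₃} {t₄} e p₁ p₂ p₃ p₄ = atMost (≤-reflexive (r (cost solveStepT B) (cost sum₄T B) t₁ t₂ t₃ t₄))
        (evLet (subst (λ u → env (true , q) ∷ [] ⊢ comp solveStepT ι₁ zero ⇓ enc outcome u ≤ cost solveStepT B) e (comp-correct solveStepT ι₁ linked₁ ((true , q) , tt) zero refl))
          (evCase (evVar refl) (evCase (evVar refl) (evLet
            (evCase (evVar refl) (evCase (evVar refl) (evCase (evVar refl) (evCase (evVar refl)
              (evCons (evCall linkS (evCons (evVar refl) (evVar refl)) p₁) (evCons (evCall linkS (evCons (evVar refl) (evVar refl)) p₂)
                (evCons (evCall linkS (evCons (evVar refl) (evVar refl)) p₃) (evCons (evCall linkS (evCons (evVar refl) (evVar refl)) p₄) (evVar refl)))))))))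
            (comp-correct sum₄T ι₃ linked₃ (r₁ , r₂ , r₃ , r₄ , tt) zero refl)))))
        where
        r : ∀ c d t₁ t₂ t₃ t₄ → suc (c + suc (1 + suc (1 + suc (suc (1 + suc (1 + suc (1 + suc (1 + suc (suc (suc (1 + 1) + t₁) + suc (suc (suc (1 + 1) + t₂) + suc (suc (suc (1 + 1) + t₃) + suc (suc (suc (1 + 1) + t₄) + 1)))))))) + d))))
            ≡ 35 + (c + d) + (t₁ + (t₂ + (t₃ + t₄)))
        r = solve-∀

      account : ∀ k {t₁ t₂ t₃ t₄ a₁ a₂ a₃ a₄ φq} → t₁ * Q ≤ A * Q + P * (k * a₁) → t₂ * Q ≤ A * Q + P * (k * a₂) → t₃ * Q ≤ A * Q + P * (k * a₃) → t₄ * Q ≤ A * Q + P * (k * a₄) →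
        a₁ + (a₂ + (a₃ + a₄)) ≤ φq → Q ≤ φq → (restCost B + (t₁ + (t₂ + (t₃ + t₄)))) * Q ≤ A * Q + P * (suc k * φq)
      account k {t₁} {t₂} {t₃} {t₄} {a₁} {a₂} {a₃} {a₄} {φq} h₁ h₂ h₃ h₄ ha hQ = begin
        (R + (t₁ + (t₂ + (t₃ + t₄)))) * Q ≡⟨ r₁ R t₁ t₂ t₃ t₄ Q ⟩
        R * Q + (t₁ * Q + (t₂ * Q + (t₃ * Q + t₄ * Q))) ≤⟨ +-monoʳ-≤ (R * Q) (+-mono-≤ h₁ (+-mono-≤ h₂ (+-mono-≤ h₃ h₄))) ⟩
        R * Q + (A * Q + P * (k * a₁) + (A * Q + P * (k * a₂) + (A * Q + P * (k * a₃) + (A * Q + P * (k * a₄))))) ≡⟨ r₂ R A Q P k a₁ a₂ a₃ a₄ ⟩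
        (R + 4 * A) * Q + P * (k * (a₁ + (a₂ + (a₃ + a₄)))) ≤⟨ +-mono-≤ (*-monoʳ-≤ P hQ) (*-monoʳ-≤ P (*-monoʳ-≤ k ha)) ⟩
        P * φq + P * (k * φq) ≡⟨ *-distribˡ-+ P φq (k * φq) ⟨
        P * (suc k * φq) ≤⟨ m≤n+m _ (A * Q) ⟩
        A * Q + P * (suc k * φq) ∎
        where
        open ≤-Reasoning
        R = restCost B
        r₁ : ∀ R a b c d Q → (R + (a + (b + (c + d)))) * Q ≡ R * Q + (a * Q + (b * Q + (c * Q + d * Q)))
        r₁ = solve-∀
        r₂ : ∀ R A Q P k a b c d → R * Q + (A * Q + P * (k * a) + (A * Q + P * (k * b) + (A * Q + P * (k * c) + (A * Q + P * (k * d))))) ≡ (R + 4 * A) * Q + P * (k * (a + (b + (c + d))))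
        r₂ = solve-∀

    -- `k` exceeds the number of non-isolated vertices, which drops with every recursive call on a
    -- present child.
    solve-correct : ∀ k o → (proj₁ o ≡ true → suc (alive (proj₂ o)) ≤ k × μ (proj₂ o) ≤ K) → Solves k o
    solve-correct k (false , q) _ = eval valueT ((false , q) , tt) , A , at-once (false , q) _ (step-absent q) , cong (_% M) (value-absent q) , cheap {k} {false , q}
    solve-correct zero (true , q) h with proj₁ (h refl)
    ... | ()
    solve-correct (suc k) (true , q) h = go (step q) refl
      where
      μ≤K = proj₂ (h refl)
      go : ∀ out → step q ≡ out → Solves (suc k) (true , q)
      go (false , n) e = eval valueT ((true , q) , tt) , A , at-once (true , q) n (trans (step-present q) e)
        , trans (cong (λ a → val a % M) (value-present q)) (leaf-correct q edgeless) , cheap {suc k} {true , q}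
        where
        -- The search is complete, so its failure means that no vertex has an edge.
        edgeless : ∀ v → hasEdge q v ≡ false
        edgeless v with hasEdge q v in ev
        ... | false = refl
        ... | true = ⊥-elim (true≢false (step-complete q 8≤N (progress (graphOf q)) v ev) (cong proj₁ e))
      go (true , o₁ , o₂ , o₃ , o₄) e =
        let (r₁ , t₁ , p₁ , v₁ , b₁) = rec o₁ s₁ ; (r₂ , t₂ , p₂ , v₂ , b₂) = rec o₂ s₂ ; (r₃ , t₃ , p₃ , v₃ , b₃) = rec o₃ s₃ ; (r₄ , t₄ , p₄ , v₄ , b₄) = rec o₄ s₄ in
        eval sum₄T (r₁ , r₂ , r₃ , r₄ , tt) , restCost B + (t₁ + (t₂ + (t₃ + t₄))) , combine q o₁ o₂ o₃ o₄ (trans (step-present q) e) p₁ p₂ p₃ p₄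
        , trans (sum₄-val r₁ r₂ r₃ r₄) (trans (+-cong {val r₁} v₁ (+-cong {val r₂} v₂ (+-cong {val r₃} v₃ v₄))) (Sound.sums-up snd′))
        , account k {t₁} {t₂} {t₃} {t₄} {Φ o₁} {Φ o₂} {Φ o₃} {Φ o₄} {φ (μ q)} b₁ b₂ b₃ b₄ (Sound.charged snd′) (Q≤φ μ≤K)
        where
        snd′ : Sound q (o₁ , o₂ , o₃ , o₄)
        snd′ = subst (λ u → Sound q (proj₂ u)) e (step-sound q μ≤K (cong proj₁ e))
        s₁ = proj₁ (Sound.smaller snd′)
        s₂ = proj₁ (proj₂ (Sound.smaller snd′))
        s₃ = proj₁ (proj₂ (proj₂ (Sound.smaller snd′)))
        s₄ = proj₂ (proj₂ (proj₂ (Sound.smaller snd′)))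
        rec : ∀ o → Smaller q o → Solves k o
        rec o sm = solve-correct k o (λ f → ≤-pred (≤-trans (s≤s (proj₁ (sm f))) (proj₁ (h refl))) , ≤-trans (proj₂ (sm f)) μ≤K)

-- The base of the running time

square : ℕ → ℕ
square y = y * y

powᵇ : ℕ → ℕᵇ → ℕ
powᵇ b Bin.zero = 1
powᵇ b 2[1+ x ] = square (b * powᵇ b x)
powᵇ b 1+[2 x ] = b * square (powᵇ b x)

-- Powers by repeated squaring, to compute with large exponents.
pow : ℕ → ℕ → ℕ
pow b n = powᵇ b (Bin.fromℕ n)

powᵇ-^ : ∀ b x → powᵇ b x ≡ b ^ Bin.toℕ x
powᵇ-^ b Bin.zero = refl
powᵇ-^ b 2[1+ x ] = trans (cong (λ y → square (b * y)) (powᵇ-^ b x)) (trans (cong (b ^ suc (Bin.toℕ x) *_) (sym (*-identityʳ _))) (^-*-assoc′ (suc (Bin.toℕ x))))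
  where
  ^-*-assoc′ : ∀ n → b ^ n * (b ^ n * 1) ≡ b ^ (2 * n)
  ^-*-assoc′ n = trans (^-*-assoc b n 2) (cong (b ^_) (*-comm n 2))
powᵇ-^ b 1+[2 x ] = cong (b *_) (trans (cong square (powᵇ-^ b x)) (trans (cong (b ^ Bin.toℕ x *_) (sym (*-identityʳ _))) (trans (^-*-assoc b (Bin.toℕ x) 2) (cong (b ^_) (*-comm (Bin.toℕ x) 2)))))

pow-^ : ∀ b n → pow b n ≡ b ^ n
pow-^ b n = trans (powᵇ-^ b (Bin.fromℕ n)) (cong (b ^_) (toℕ-fromℕ n))

pow-product-≤ : ∀ u v a c x y → (pow u x * pow c y ≤ᵇ pow v x * pow a y) ≡ true → u ^ x * c ^ y ≤ v ^ x * a ^ y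
pow-product-≤ u v a c x y h = subst₂ _≤_ (cong₂ _*_ (pow-^ u x) (pow-^ c y)) (cong₂ _*_ (pow-^ v x) (pow-^ a y)) (≤ᵇ-true (pow u x * pow c y) (pow v x * pow a y) h)

splits? : ℕ → ℕ → List (ℕ × ℕ) → Bool
splits? p q [] = true
splits? p q ((x , y) ∷ ts) = (pow q x * pow p y + pow q y * pow p x ≤ᵇ pow p x * pow p y) ∧ splits? p q ts

-- φ m is (p / q) ^ m, scaled by q ^ K to be integral.
module Exponential (p q : ℕ) (1≤q : 1 ≤ q) (q≤p : q ≤ p) (K : ℕ) where
  φ : ℕ → ℕ
  φ m = p ^ m * q ^ (K ∸ m)

  private
    instance
      p≢0 : NonZero p
      p≢0 = >-nonZero (≤-trans 1≤q q≤p)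

    cancel : ∀ x {a b} → a * p ^ x ≤ b * p ^ x → a ≤ b
    cancel x {a} {b} h = *-cancelʳ-≤ a b (p ^ x) {{m^n≢0 p x}} h

  -- Integral form of the fact that lowering the measure by `x` divides the charge by the power `x`
  -- of `p / q`.
  shift : ∀ {m} x → x ≤ m → m ≤ K → φ (m ∸ x) * p ^ x ≡ φ m * q ^ x
  shift {m} x x≤m m≤K = begin
    p ^ (m ∸ x) * q ^ (K ∸ (m ∸ x)) * p ^ x ≡⟨ r (p ^ (m ∸ x)) (q ^ (K ∸ (m ∸ x))) (p ^ x) ⟩
    p ^ (m ∸ x) * p ^ x * q ^ (K ∸ (m ∸ x)) ≡⟨ cong₂ _*_ (sym (^-distribˡ-+-* p (m ∸ x) x)) (cong (q ^_) K∸) ⟩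
    p ^ (m ∸ x + x) * q ^ (K ∸ m + x) ≡⟨ cong₂ _*_ (cong (p ^_) (m∸n+n≡m x≤m)) (^-distribˡ-+-* q (K ∸ m) x) ⟩
    p ^ m * (q ^ (K ∸ m) * q ^ x) ≡⟨ *-assoc (p ^ m) _ _ ⟨
    p ^ m * q ^ (K ∸ m) * q ^ x ∎
    where
    open ≡-Reasoning
    r : ∀ a b c → a * b * c ≡ a * c * b
    r = solve-∀
    K∸ : K ∸ (m ∸ x) ≡ K ∸ m + x
    K∸ = +-cancelʳ-≡ (m ∸ x) _ _ (trans (m∸n+n≡m (≤-trans (m∸n≤m m x) m≤K)) (sym (trans (+-assoc (K ∸ m) x (m ∸ x)) (trans (cong (K ∸ m +_) (m+[n∸m]≡n x≤m)) (m∸n+n≡m m≤K)))))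

  φ-mono : ∀ {m m₀} → m ≤ K → m₀ ≤ m → φ m₀ ≤ φ m
  φ-mono {m} {m₀} m≤K m₀≤m = cancel x (begin
    φ m₀ * p ^ x ≡⟨ cong (λ k → φ k * p ^ x) (m∸[m∸n]≡n m₀≤m) ⟨
    φ (m ∸ x) * p ^ x ≡⟨ shift x (m∸n≤m m m₀) m≤K ⟩
    φ m * q ^ x ≤⟨ *-monoʳ-≤ (φ m) (^-monoˡ-≤ x q≤p) ⟩
    φ m * p ^ x ∎)
    where
    open ≤-Reasoning
    x = m ∸ m₀

  below′ : ∀ {m m₀} x → m ≤ K → m₀ + x ≤ m → φ m₀ ≤ φ (m ∸ x) × x ≤ m
  below′ {m} {m₀} x m≤K h = φ-mono (≤-trans (m∸n≤m m x) m≤K) (m+n≤o⇒m≤o∸n m₀ h) , m+n≤o⇒n≤o m₀ h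

  scaled : ∀ c x → c * q ^ x ≤ p ^ x → ∀ {m m₀} → m ≤ K → m₀ + x ≤ m → c * φ m₀ ≤ φ m
  scaled c x h {m} {m₀} m≤K d = let (le , x≤m) = below′ x m≤K d in ≤-trans (*-monoʳ-≤ c le) (cancel x (begin
    c * φ (m ∸ x) * p ^ x ≡⟨ *-assoc c _ _ ⟩
    c * (φ (m ∸ x) * p ^ x) ≡⟨ cong (c *_) (shift x x≤m m≤K) ⟩
    c * (φ m * q ^ x) ≡⟨ r c (φ m) (q ^ x) ⟩
    φ m * (c * q ^ x) ≤⟨ *-monoʳ-≤ (φ m) h ⟩
    φ m * p ^ x ∎))
    where
    open ≤-Reasoning
    r : ∀ a b c → a * (b * c) ≡ b * (a * c)
    r = solve-∀

  -- The hypothesis is the condition `(q / p) ^ x + (q / p) ^ y ≤ 1` on the branching number,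
  -- cleared of denominators.
  split-pair : ∀ x y → q ^ x * p ^ y + q ^ y * p ^ x ≤ p ^ x * p ^ y → ∀ {m m₀ m₁} → m ≤ K → m₀ + x ≤ m → m₁ + y ≤ m → φ m₀ + φ m₁ ≤ φ m
  split-pair x y h {m} {m₀} {m₁} m≤K d₀ d₁ =
    let (le₀ , x≤m) = below′ x m≤K d₀ ; (le₁ , y≤m) = below′ y m≤K d₁ in
    ≤-trans (+-mono-≤ le₀ le₁) (cancel x (cancel y (begin
      (φ (m ∸ x) + φ (m ∸ y)) * p ^ x * p ^ y ≡⟨ r (φ (m ∸ x)) (φ (m ∸ y)) (p ^ x) (p ^ y) ⟩
      φ (m ∸ x) * p ^ x * p ^ y + φ (m ∸ y) * p ^ y * p ^ x ≡⟨ cong₂ (λ a b → a * p ^ y + b * p ^ x) (shift x x≤m m≤K) (shift y y≤m m≤K) ⟩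
      φ m * q ^ x * p ^ y + φ m * q ^ y * p ^ x ≡⟨ r′ (φ m) (q ^ x) (p ^ y) (q ^ y) (p ^ x) ⟩
      φ m * (q ^ x * p ^ y + q ^ y * p ^ x) ≤⟨ *-monoʳ-≤ (φ m) h ⟩
      φ m * (p ^ x * p ^ y) ≡⟨ *-assoc (φ m) _ _ ⟨
      φ m * p ^ x * p ^ y ∎)))
    where
    open ≤-Reasoning
    r : ∀ a b c d → (a + b) * c * d ≡ a * c * d + b * d * c
    r = solve-∀
    r′ : ∀ f a b c d → f * a * b + f * c * d ≡ f * (a * b + c * d)
    r′ = solve-∀

  split-all : ∀ ts → splits? p q ts ≡ true → ∀ {m m₀ m₁} → m ≤ K → accepted ts m m₀ m₁ ≡ true → φ m₀ + φ m₁ ≤ φ m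
  split-all ((x , y) ∷ ts) ok {m} {m₀} {m₁} m≤K acc with ∧⁻ {pow q x * pow p y + pow q y * pow p x ≤ᵇ pow p x * pow p y} ok | ∨⁻ {(m₀ + x ≤ᵇ m) ∧ (m₁ + y ≤ᵇ m)} acc
  ... | h , _ | inj₁ e = let (a , b) = ∧⁻ {m₀ + x ≤ᵇ m} e in split-pair x y (exact x y h) m≤K (≤ᵇ-true (m₀ + x) m a) (≤ᵇ-true (m₁ + y) m b)
    where
    exact : ∀ x y → (pow q x * pow p y + pow q y * pow p x ≤ᵇ pow p x * pow p y) ≡ true → q ^ x * p ^ y + q ^ y * p ^ x ≤ p ^ x * p ^ y
    exact x y h = subst₂ _≤_ (cong₂ _+_ (cong₂ _*_ (pow-^ q x) (pow-^ p y)) (cong₂ _*_ (pow-^ q y) (pow-^ p x))) (cong₂ _*_ (pow-^ p x) (pow-^ p y)) (≤ᵇ-true (pow q x * pow p y + pow q y * pow p x) (pow p x * pow p y) h)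
  ... | h , rest | inj₂ e with ∨⁻ {(m₀ + y ≤ᵇ m) ∧ (m₁ + x ≤ᵇ m)} e
  ... | inj₂ e′ = split-all ts rest m≤K e′
  ... | inj₁ e′ = let (a , b) = ∧⁻ {m₀ + y ≤ᵇ m} e′ in
    ≤-trans (≤-reflexive (+-comm (φ m₀) (φ m₁))) (split-pair x y exact m≤K (≤ᵇ-true (m₁ + x) m b) (≤ᵇ-true (m₀ + y) m a))
    where
    exact : q ^ x * p ^ y + q ^ y * p ^ x ≤ p ^ x * p ^ y
    exact = subst₂ _≤_ (cong₂ _+_ (cong₂ _*_ (pow-^ q x) (pow-^ p y)) (cong₂ _*_ (pow-^ q y) (pow-^ p x))) (cong₂ _*_ (pow-^ p x) (pow-^ p y)) (≤ᵇ-true (pow q x * pow p y + pow q y * pow p x) (pow p x * pow p y) h)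

  charge : ∀ ts unit → splits? p q ts ≡ true → (2 * pow q unit ≤ᵇ pow p unit) ≡ true → (4 * pow q (2 * unit) ≤ᵇ pow p (2 * unit)) ≡ true → Charge ts unit K φ
  charge ts unit ok half quarter = record
    { φ-mono = φ-mono
    ; φ-split = split-all ts ok
    ; φ-half = λ {m} {m₀} → scaled 2 unit (subst₂ (λ a b → 2 * a ≤ b) (pow-^ q unit) (pow-^ p unit) (≤ᵇ-true (2 * pow q unit) (pow p unit) half)) {m} {m₀}
    ; φ-quarter = λ {m} {m₀} → scaled 4 (2 * unit) (subst₂ (λ a b → 4 * a ≤ b) (pow-^ q (2 * unit)) (pow-^ p (2 * unit)) (≤ᵇ-true (4 * pow q (2 * unit)) (pow p (2 * unit)) quarter)) {m} {m₀}
    }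

  φ-least : ∀ {m} → m ≤ K → q ^ K ≤ φ m
  φ-least {m} m≤K = ≤-trans (≤-reflexive (trans (cong (q ^_) (sym (m+[n∸m]≡n m≤K))) (^-distribˡ-+-* q m (K ∸ m)))) (*-monoˡ-≤ (q ^ (K ∸ m)) (^-monoˡ-≤ m q≤p))

  φ-greatest : ∀ {m} → m ≤ K → φ m ≤ p ^ K
  φ-greatest m≤K = ≤-trans (φ-mono ≤-refl m≤K) (≤-reflexive (trans (cong (λ k → p ^ K * q ^ k) (n∸n≡0 K)) (*-identityʳ (p ^ K))))

opaque
  -- The 6152th power of their quotient is just below 1.2377.
  base-num base-den : ℕ
  base-num = 980853
  base-den = 980819

  1≤den : 1 ≤ base-den
  1≤den = ≤ᵇ-true 1 base-den refl

  den≤num : base-den ≤ base-num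
  den≤num = ≤ᵇ-true base-den base-num refl

  -- The quotient slightly exceeds the 20000th root of 2, at which the first pair of thresholds
  -- would just fail.
  base-splits : splits? base-num base-den thresholds ≡ true
  base-splits = refl

  base-half : (2 * pow base-den unit ≤ᵇ pow base-num unit) ≡ true
  base-half = refl

  base-quarter : (4 * pow base-den (2 * unit) ≤ᵇ pow base-num (2 * unit)) ≡ true
  base-quarter = refl

  base-root : (pow base-num 6152 * 10000 ≤ᵇ 12377 * pow base-den 6152) ≡ true
  base-root = refl

-- The inequality between 1.2377 to the power 1 + 2.2503 and 1.999995, raised to the power 10000 to
-- make the exponents integral, and cleared of denominators.
density-root : (pow 12377 (10000 + 22503) * pow 1000000 10000 ≤ᵇ pow 10000 (10000 + 22503) * pow 1999995 10000) ≡ true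
density-root = refl

-- Rational bounds

infixl 7 _÷_
_÷_ : ℕ → (d : ℕ) → .{{NonZero d}} → ℚ
a ÷ b = ℤ.+ a ℚ./ b

÷-* : ∀ a b c d .{{_ : NonZero b}} .{{_ : NonZero d}} .{{_ : NonZero (b * d)}} → (a ÷ b) ℚ.* (c ÷ d) ≡ (a * c) ÷ (b * d)
÷-* a (suc b) c (suc d) = ℚ.toℚᵘ-injective (ℚᵘ.≃-trans (ℚ.toℚᵘ-homo-* (a ÷ suc b) (c ÷ suc d))
  (ℚᵘ.≃-trans (ℚᵘ.*-cong (ℚ.toℚᵘ-fromℚᵘ (mkℚᵘ (ℤ.+ a) b)) (ℚ.toℚᵘ-fromℚᵘ (mkℚᵘ (ℤ.+ c) d)))
    (ℚᵘ.≃-trans (ℚᵘ.≃-reflexive (cong (λ i → mkℚᵘ i (d + b * suc d)) (sym (ℤ.pos-* a c)))) (ℚᵘ.≃-sym (ℚ.toℚᵘ-fromℚᵘ (mkℚᵘ (ℤ.+ (a * c)) (d + b * suc d)))))))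

÷-≤ : ∀ a b c d .{{_ : NonZero b}} .{{_ : NonZero d}} → a * d ≤ c * b → a ÷ b ℚ.≤ c ÷ d
÷-≤ a (suc b) c (suc d) h = ℚ.toℚᵘ-cancel-≤ (ℚᵘ.≤-respˡ-≃ (ℚᵘ.≃-sym (ℚ.toℚᵘ-fromℚᵘ (mkℚᵘ (ℤ.+ a) b))) (ℚᵘ.≤-respʳ-≃ (ℚᵘ.≃-sym (ℚ.toℚᵘ-fromℚᵘ (mkℚᵘ (ℤ.+ c) d)))
  (ℚᵘ.*≤* (subst₂ ℤ._≤_ (ℤ.pos-* a (suc d)) (ℤ.pos-* c (suc b)) (ℤ.+≤+ h)))))

÷-< : ∀ a b c d .{{_ : NonZero b}} .{{_ : NonZero d}} → a * d < c * b → a ÷ b ℚ.< c ÷ d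
÷-< a (suc b) c (suc d) h = ℚ.toℚᵘ-cancel-< (ℚᵘ.<-respˡ-≃ (ℚᵘ.≃-sym (ℚ.toℚᵘ-fromℚᵘ (mkℚᵘ (ℤ.+ a) b))) (ℚᵘ.<-respʳ-≃ (ℚᵘ.≃-sym (ℚ.toℚᵘ-fromℚᵘ (mkℚᵘ (ℤ.+ c) d)))
  (ℚᵘ.*<* (subst₂ ℤ._<_ (ℤ.pos-* a (suc d)) (ℤ.pos-* c (suc b)) (ℤ.+<+ h)))))

÷-<⁻ : ∀ a b c d .{{_ : NonZero b}} .{{_ : NonZero d}} → a ÷ b ℚ.< c ÷ d → a * d < c * b
÷-<⁻ a (suc b) c (suc d) h with ℚᵘ.<-respˡ-≃ (ℚ.toℚᵘ-fromℚᵘ (mkℚᵘ (ℤ.+ a) b)) (ℚᵘ.<-respʳ-≃ (ℚ.toℚᵘ-fromℚᵘ (mkℚᵘ (ℤ.+ c) d)) (ℚ.toℚᵘ-mono-< h))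
... | ℚᵘ.*<* lt = ℤ.drop‿+<+ (subst₂ ℤ._<_ (sym (ℤ.pos-* a (suc d))) (sym (ℤ.pos-* c (suc b))) lt)

÷-^ : ∀ a b .{{b≢0 : NonZero b}} k → (a ÷ b) ℚExp.^ k ≡ _÷_ (a ^ k) (b ^ k) {{m^n≢0 b k}}
÷-^ a b zero = refl
÷-^ a b {{b≢0}} (suc k) = trans (cong ((a ÷ b) ℚ.*_) (÷-^ a b k)) (÷-* a b (a ^ k) (b ^ k) {{b≢0}} {{m^n≢0 b k}} {{m^n≢0 b (suc k)}})

power-bound : ∀ a b .{{_ : NonZero b}} k t c → t * b ^ k ≤ c * a ^ k → fromℕ t ℚ.≤ fromℕ c ℚ.* (a ÷ b) ℚExp.^ k
power-bound a b k t c h = subst (fromℕ t ℚ.≤_) (sym (trans (cong (fromℕ c ℚ.*_) (÷-^ a b k)) (÷-* c 1 (a ^ k) (b ^ k) {{_}} {{m^n≢0 b k}} {{1*b}})))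
  (÷-≤ t 1 (c * a ^ k) (1 * b ^ k) {{_}} {{1*b}} (subst₂ _≤_ (cong (t *_) (sym (*-identityˡ (b ^ k)))) (sym (*-identityʳ (c * a ^ k))) h))
  where
  1*b : NonZero (1 * b ^ k)
  1*b = subst NonZero (sym (*-identityˡ (b ^ k))) (m^n≢0 b k)

-- The program

pad : ∀ {f v} → ℕ → Expr f v → Expr f v
pad zero x = x
pad (suc k) x = nil ∙ pad k x

-- Computes `N` in unary, as 40 plus the numbers of variables and of wide clauses. The padding makes
-- room for the auxiliary vertex and lets `2 ^ N` exceed all measures.
countBody : ∀ {f} → Fin f → Expr f 1
countBody Ct = case v0 nil (case v1 (pad 40 v0)
  (case v0 (call Ct (v2 ∙ v1))
    (case v1 (call Ct (var (suc (suc (suc (suc zero)))) ∙ v3))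
      (case v1 (call Ct (var (suc (suc (suc (suc (suc (suc zero)))))) ∙ var (suc (suc (suc (suc (suc zero)))))))
        (call Ct ((nil ∙ var (suc (suc (suc (suc (suc (suc (suc (suc zero))))))))) ∙ var (suc (suc (suc (suc (suc (suc (suc zero)))))))))))))

encodeClauses : ∀ {n} → CNF n → Tree
encodeClauses = encodeList (encodeList encodeLiteral)

module Counting {f} (fs : Vec (Expr f 1) f) (Ct : Fin f) (linkU : lookup fs Ct ≡ countBody Ct) where
  open Evaluation fs

  as-unary : ∀ {v} {ρ : Vec Tree v} {e m n t} → m ≡ n → ρ ⊢ e ⇓ encodeUnary m ≤ t → ρ ⊢ e ⇓ encodeUnary n ≤ t
  as-unary refl p = p

  pad-correct : ∀ {v} {ρ : Vec Tree v} k {x n} → ρ ⊢ x ⇓ encodeUnary n ≤ 1 → ρ ⊢ pad k x ⇓ encodeUnary (k + n) ≤ 1 + 2 * k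
  pad-correct zero p = p
  pad-correct (suc k) p = atMost (≤-reflexive (r k)) (evCons evNil (pad-correct k p))
    where
    r : ∀ k → suc (1 + (1 + 2 * k)) ≡ 1 + 2 * suc k
    r = solve-∀

  count-correct : ∀ {n} k (φ : CNF n) → (encodeUnary k ∙ encodeClauses φ) ∷ [] ⊢ countBody Ct ⇓ encodeUnary (40 + (k + #clauses≥3 φ)) ≤ suc (length φ) * 100
  count-correct k [] = atMost (m≤m+n 85 15) (evCase (evVar refl) (evCaseNil (evVar refl)
    (as-unary (cong (40 +_) (sym (+-identityʳ k))) (pad-correct 40 {n = k} (evVar refl)))))
  count-correct k ([] ∷ φ) = atMost (+-monoˡ-≤ (suc (length φ) * 100) (m≤m+n 10 90))
    (evCase (evVar refl) (evCase (evVar refl) (evCaseNil (evVar refl) (evCall linkU (evCons (evVar refl) (evVar refl)) (count-correct k φ)))))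
  count-correct k ((_ ∷ []) ∷ φ) = atMost (+-monoˡ-≤ (suc (length φ) * 100) (m≤m+n 12 88))
    (evCase (evVar refl) (evCase (evVar refl) (evCase (evVar refl) (evCaseNil (evVar refl) (evCall linkU (evCons (evVar refl) (evVar refl)) (count-correct k φ))))))
  count-correct k ((_ ∷ _ ∷ []) ∷ φ) = atMost (+-monoˡ-≤ (suc (length φ) * 100) (m≤m+n 14 86))
    (evCase (evVar refl) (evCase (evVar refl) (evCase (evVar refl) (evCase (evVar refl) (evCaseNil (evVar refl) (evCall linkU (evCons (evVar refl) (evVar refl)) (count-correct k φ)))))))
  count-correct k ((_ ∷ _ ∷ _ ∷ _) ∷ φ) = atMost (+-monoˡ-≤ (suc (length φ) * 100) (m≤m+n 16 84))
    (evCase (evVar refl) (evCase (evVar refl) (evCase (evVar refl) (evCase (evVar refl) (evCase (evVar refl) (evCall linkU (evCons (evCons evNil (evVar refl)) (evVar refl))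
      (as-unary (cong (40 +_) (sym (+-suc k (#clauses≥3 φ)))) (count-correct (suc k) φ))))))))

module Machine (F₀ : Weights) (Fs : List Weights) (ts : List (ℕ × ℕ)) (unit : ℕ) where
  open SolveTerms F₀ Fs ts unit
  private
    s₁ = size solveStepT
    s₂ = size valueT
    s₃ = size sum₄T
    s₄ = size initT

  #functions : ℕ
  #functions = 4 + (s₁ + (s₂ + (s₃ + s₄)))

  L E S Ct : Fin #functions
  L = zero
  E = suc zero
  S = suc (suc zero)
  Ct = suc (suc (suc zero))

  ι₁ : Fin s₁ → Fin #functions
  ι₁ j = 4 ↑ʳ (j ↑ˡ (s₂ + (s₃ + s₄)))
  ι₂ : Fin s₂ → Fin #functions
  ι₂ j = 4 ↑ʳ (s₁ ↑ʳ (j ↑ˡ (s₃ + s₄)))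
  ι₃ : Fin s₃ → Fin #functions
  ι₃ j = 4 ↑ʳ (s₁ ↑ʳ (s₂ ↑ʳ (j ↑ˡ s₄)))
  ι₄ : Fin s₄ → Fin #functions
  ι₄ j = 4 ↑ʳ (s₁ ↑ʳ (s₂ ↑ʳ (s₃ ↑ʳ j)))

  open Compile L E

  functions : Vec (Expr #functions 1) #functions
  functions = lookupBody L ∷ sameBody E ∷ solveBody L E S ι₁ ι₂ ι₃ ∷ countBody Ct ∷ (code solveStepT ι₁ Vec.++ (code valueT ι₂ Vec.++ (code sum₄T ι₃ Vec.++ code initT ι₄)))

  program : Program
  program = record
    { #funs = #functions
    ; bodies = functions
    -- The environment of `initT` consists of the clauses, `n` as the index of the auxiliary vertex,
    -- and `N`. The flag `nil ∙ nil` presents the initial state to the solver as a present child.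
    ; main = case v0 nil (let′ (call Ct (v0 ∙ v1)) (let′ (v2 ∙ (v1 ∙ v0)) (let′ (comp initT ι₄ zero) (call S (((nil ∙ nil) ∙ v0) ∙ v2))))) }

  linked₁ : ∀ j → lookup functions (ι₁ j) ≡ lookup (code solveStepT ι₁) j
  linked₁ j = lookup-++ˡ (code solveStepT ι₁) _ j

  linked₂ : ∀ j → lookup functions (ι₂ j) ≡ lookup (code valueT ι₂) j
  linked₂ j = trans (lookup-++ʳ (code solveStepT ι₁) _ (j ↑ˡ (s₃ + s₄))) (lookup-++ˡ (code valueT ι₂) _ j)

  linked₃ : ∀ j → lookup functions (ι₃ j) ≡ lookup (code sum₄T ι₃) j
  linked₃ j = trans (lookup-++ʳ (code solveStepT ι₁) _ (s₂ ↑ʳ (j ↑ˡ s₄))) (trans (lookup-++ʳ (code valueT ι₂) _ (j ↑ˡ s₄)) (lookup-++ˡ (code sum₄T ι₃) _ j))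

  linked₄ : ∀ j → lookup functions (ι₄ j) ≡ lookup (code initT ι₄) j
  linked₄ j = trans (lookup-++ʳ (code solveStepT ι₁) _ (s₂ ↑ʳ (s₃ ↑ʳ j))) (trans (lookup-++ʳ (code valueT ι₂) _ (s₃ ↑ʳ j)) (lookup-++ʳ (code sum₄T ι₃) _ j))

  runCost : ℕ → ℕ
  runCost B = 22 + suc B * 100 + cost initT B + ownCost B + totalCost B * suc B

  opaque
    runCost-poly : Polynomial runCost
    runCost-poly = poly-+ (poly-+ (poly-+ (poly-+ (poly-const 22) (poly-* poly-suc (poly-const 100))) (cost-poly initT)) own) (poly-* all poly-suc)
      where
      own : Polynomial ownCost
      own = poly-1+ (poly-+ (cost-poly solveStepT) (poly-1+ (poly-1+ (poly-1+ (poly-1+ (cost-poly valueT))))))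
      all : Polynomial totalCost
      all = poly-+ (poly-+ (poly-const 35) (poly-+ (cost-poly solveStepT) (cost-poly sum₄T))) (poly-* (poly-const 4) own)

^-distribʳ-* : ∀ k a b → (a * b) ^ k ≡ a ^ k * b ^ k
^-distribʳ-* zero a b = refl
^-distribʳ-* (suc k) a b = trans (cong (a * b *_) (^-distribʳ-* k a b)) (r a b (a ^ k) (b ^ k))
  where
  r : ∀ a b c d → a * b * (c * d) ≡ a * c * (b * d)
  r = solve-∀

exchange : ∀ t c g P Q Ct V → t * Q ≤ c * P → c ≤ g → P * V ≤ Ct * Q → t * V * Q ≤ g * Ct * Q
exchange t c g P Q Ct V h c≤g PV≤UQ = begin
  t * V * Q ≡⟨ r t V Q ⟩
  t * Q * V ≤⟨ *-monoˡ-≤ V (≤-trans h (*-monoˡ-≤ P c≤g)) ⟩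
  g * P * V ≡⟨ *-assoc g P V ⟩
  g * (P * V) ≤⟨ *-monoʳ-≤ g PV≤UQ ⟩
  g * (Ct * Q) ≡⟨ *-assoc g Ct Q ⟨
  g * Ct * Q ∎
  where
  open ≤-Reasoning
  r : ∀ a b c → a * b * c ≡ a * c * b
  r = solve-∀

unary≤size : ∀ n → n ≤ treeSize (encodeUnary n)
unary≤size zero = z≤n
unary≤size (suc n) = s≤s (≤-trans (unary≤size n) (n≤1+n _))

list≤size : ∀ {A : Set} (e : A → Tree) xs → length xs ≤ treeSize (encodeList e xs)
list≤size e [] = z≤n
list≤size e (x ∷ xs) = s≤s (≤-trans (list≤size e xs) (m≤n+m _ (treeSize (e x))))

clause≤size : ∀ {n} (φ : CNF n) → All (λ c → length c ≤ treeSize (encodeClauses φ)) φ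
clause≤size [] = []
clause≤size (c ∷ φ) = ≤-trans (list≤size encodeLiteral c) (m≤n⇒m≤1+n (m≤m+n _ _)) ∷ All.map (λ h → m≤n⇒m≤1+n (≤-trans h (m≤n+m _ (treeSize (encodeList encodeLiteral c))))) (clause≤size φ)

wide≤length : ∀ {n} (φ : CNF n) → #clauses≥3 φ ≤ length φ
wide≤length φ = length-filter (λ c → 3 ≤? width c) φ

bits : ∀ {n} → (Fin n → Bool) → List Bit
bits {zero} a = []
bits {suc n} a = (if a zero then suc zero else zero) ∷ bits (a ∘ suc)

fromDigits-bits : ∀ {n} (a : Fin n → Bool) → fromDigits (bits a) ≡ val a
fromDigits-bits {zero} a = refl
fromDigits-bits {suc n} a with a zero
... | true = cong suc (trans (*-comm (fromDigits (bits (a ∘ suc))) 2) (cong (2 *_) (fromDigits-bits (a ∘ suc))))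
... | false = trans (*-comm (fromDigits (bits (a ∘ suc))) 2) (cong (2 *_) (fromDigits-bits (a ∘ suc)))

-- The running time of the program

module Correctness (F₀ : Weights) (Fs : List Weights) (ts : List (ℕ × ℕ)) (unit : ℕ)
    (K₁ K₂ K₃ : ℕ) (1≤K₁ : 1 ≤ K₁) (7≤K₃ : 7 ≤ K₃) (big : ∀ N → 40 ≤ N → N * (K₁ + K₂ * N) + K₃ < 2 ^ N)
    (small : All (Small K₁ K₂) (F₀ ∷ Fs)) (ts≤ : All (λ (p , q) → p ≤ K₃ × q ≤ K₃) ts) (unit≤ : 2 * unit ≤ K₃)
    (progress : ∀ {N} (g : Graph N) → Reduced g → ∀ v → 1 ≤ Graph.deg g v → ∃ λ F → F ∈ F₀ ∷ Fs × least g (F₀ ∷ Fs) ≡ measure F g × Good unit ts g F)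
    (p q : ℕ) (1≤q : 1 ≤ q) (q≤p : q ≤ p) (splits : splits? p q ts ≡ true)
    (half : (2 * pow q unit ≤ᵇ pow p unit) ≡ true) (quarter : (4 * pow q (2 * unit) ≤ᵇ pow p (2 * unit)) ≡ true) where

  open Machine F₀ Fs ts unit public
  open SolveTerms F₀ Fs ts unit

  module Run {n} (φ : CNF n) (N B : ℕ) (N≡ : N ≡ 40 + (n + #clauses≥3 φ)) (B≡ : B ≡ 40 + inputSize (n , φ)) where
    -- Bounds the initial measure; the additional vertex is the auxiliary one.
    K : ℕ
    K = (#clauses≥3 φ + suc n) * (2 * Weights.w₆ F₀)

    private
      size≥ : n + treeSize (encodeClauses φ) ≤ inputSize (n , φ)
      size≥ = m≤n⇒m≤1+n (+-monoˡ-≤ _ (unary≤size n))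

      length≤ : length φ ≤ inputSize (n , φ)
      length≤ = ≤-trans (list≤size (encodeList encodeLiteral) φ) (≤-trans (m≤n+m _ n) size≥)

      size≤B : inputSize (n , φ) ≤ B
      size≤B = ≤-trans (m≤n+m _ 40) (≤-reflexive (sym B≡))

      N≤B : N ≤ B
      N≤B = ≤-trans (≤-reflexive N≡) (≤-trans (+-monoʳ-≤ 40 (≤-trans (+-monoʳ-≤ n (≤-trans (wide≤length φ) (list≤size (encodeList encodeLiteral) φ))) size≥)) (≤-reflexive (sym B≡)))

      40≤N : 40 ≤ N
      40≤N = ≤-trans (m≤m+n 40 _) (≤-reflexive (sym N≡))

      8≤N : 8 ≤ N
      8≤N = ≤-trans (m≤m+n 8 32) 40≤N

      1≤N : 1 ≤ N
      1≤N = ≤-trans (m≤m+n 1 39) 40≤N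

      n<N : n < N
      n<N = ≤-trans (+-mono-≤ (m≤m+n 1 39) (m≤m+n n (#clauses≥3 φ))) (≤-reflexive (sym N≡))

      room : #clauses≥3 φ + suc n < N
      room = ≤-trans (≤-reflexive (r (#clauses≥3 φ) n)) (≤-trans (+-monoˡ-≤ (n + #clauses≥3 φ) (m≤m+n 2 38)) (≤-reflexive (sym N≡)))
        where
        r : ∀ m n → suc (m + suc n) ≡ 2 + (n + m)
        r = solve-∀

      short : All (λ c → length c ≤ B) φ
      short = All.map (λ h → ≤-trans h (≤-trans (m≤n+m _ n) (≤-trans size≥ size≤B))) (clause≤size φ)

      instance
        M≢0 : NonZero (2 ^ N)
        M≢0 = m^n≢0 2 N

      open Semantics N B
      module I = Ops₇ N B 1≤N
      module O = Ops₂ N B 1≤N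

      cs = I.convertᶠ (<⇒≤ n<N) φ short

      csb : length cs ≤ B
      csb = ≤-trans (≤-reflexive (I.length-convert (<⇒≤ n<N) φ short)) (≤-trans length≤ size≤B)

      nᶠ : Fin N
      nᶠ = fromℕ< n<N

      nᶠ≡ : toℕ nᶠ ≡ n
      nᶠ≡ = toℕ-fromℕ< n<N

      q₀ : O.State
      q₀ = I.initial n<N φ short csb room nᶠ nᶠ≡

      literal-enc : ∀ l → enc literal (I.convert (<⇒≤ n<N) l) ≡ encodeLiteral l
      literal-enc (pos i) = cong (λ k → nil ∙ encodeUnary k) (toℕ-inject≤ i (<⇒≤ n<N))
      literal-enc (neg i) = cong (λ k → (nil ∙ nil) ∙ encodeUnary k) (toℕ-inject≤ i (<⇒≤ n<N))

      clause-enc : ∀ c → encodeList (enc literal) (map (I.convert (<⇒≤ n<N)) c) ≡ encodeList encodeLiteral c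
      clause-enc [] = refl
      clause-enc (l ∷ c) = cong₂ _∙_ (literal-enc l) (clause-enc c)

      clauses-enc : ∀ φ ps → encodeList (enc (list literal)) (I.convertᶠ (<⇒≤ n<N) φ ps) ≡ encodeClauses φ
      clauses-enc [] [] = refl
      clauses-enc (c ∷ φ) (p ∷ ps) = cong₂ _∙_ (clause-enc c) (clauses-enc φ ps)

      open Exponential p q 1≤q q≤p K renaming (φ to Φ)
      open Ops₁₀ F₀ Fs ts unit N B 1≤N K₁ K₂ K₃ 1≤K₁ 7≤K₃ (big N 40≤N) small ts≤ unit≤ 8≤N progress (charge ts unit splits half quarter) (q ^ K) φ-least
                 functions L E S refl refl ι₁ ι₂ ι₃ refl N≤B
      open Correct functions L E refl refl N B N≤B
      open Counting functions Ct refl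
      module T = Ops₅ F₀ Fs ts unit N B 1≤N K₁ K₂ K₃ 1≤K₁ 7≤K₃ (big N 40≤N) small ts≤ unit≤

      μ≤K : T.μ q₀ ≤ K
      μ≤K = ≤-trans (least≤ (O.graphOf q₀) {F₀ ∷ Fs} (here refl)) (I.init-measure n<N φ short csb room nᶠ nᶠ≡ F₀ (Small.inc (All.head small)))

      solved = solve-correct linked₁ linked₂ linked₃ (suc N) (true , q₀) (λ _ → s≤s (T.count≤N (T.hasEdge q₀)) , μ≤K)

      r = proj₁ solved
      t = proj₁ (proj₂ solved)

      exact : val r ≡ #sat φ
      exact = Modular.≈⇒≡ (2 ^ N) (val< r) (I.#sat< n<N φ short csb room nᶠ nᶠ≡) (trans (proj₁ (proj₂ (proj₂ (proj₂ solved)))) (I.init-Z n<N φ short csb room nᶠ nᶠ≡))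

      table-bits : ∀ {n} (a : Fin n → Bool) → encodeTable n (enc bool ∘ a) ≡ encodeList encodeBit (bits a)
      table-bits {zero} a = refl
      table-bits {suc n} a = cong₂ _∙_ (h (a zero)) (table-bits (a ∘ suc))
        where
        h : ∀ b → enc bool b ≡ encodeBit (if b then suc zero else zero)
        h true = refl
        h false = refl

      time : ℕ
      time = 22 + suc (length φ) * 100 + cost initT B + t

      main-run : encodeCNF φ ∷ [] ⊢ Program.main program ⇓ enc num r ≤ time
      main-run = atMost (≤-reflexive (e (suc (length φ) * 100) (cost initT B) t))
        (evCase (evVar refl) (evLet (evCall refl (evCons (evVar refl) (evVar refl)) (as-unary (sym N≡) (count-correct n φ)))
          (evLet (evCons (evVar refl) (evCons (evVar refl) (evVar refl)))
            (evLet (comp-correct initT ι₄ linked₄ (list≤ cs csb , nᶠ , tt) zero (sym (cong₂ (λ a b → a ∙ (encodeUnary b ∙ encodeUnary N)) (clauses-enc φ short) nᶠ≡)))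
              (evCall refl (evCons (evCons (evCons evNil evNil) (evVar refl)) (evVar refl)) (proj₁ (proj₂ (proj₂ solved))))))))
        where
        e : ∀ a b c → suc (1 + suc (suc (suc (1 + 1) + a) + suc (suc (1 + suc (1 + 1)) + suc (b + suc (suc (suc (suc (1 + 1) + 1) + 1) + c))))) ≡ 22 + a + b + c
        e = solve-∀

    output : Tree
    output = enc num r

    steps : ℕ
    steps = proj₁ main-run

    runs : Runs program (encodeCNF φ) output steps
    runs = proj₁ (proj₂ main-run)

    binary : IsBinary output (#sat φ)
    binary = bits r , trans (fromDigits-bits r) exact , table-bits r

    steps-bound : steps * q ^ K ≤ runCost B * p ^ K
    steps-bound = begin
      steps * Q ≤⟨ *-monoˡ-≤ Q (proj₂ (proj₂ main-run)) ⟩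
      (R + t) * Q ≡⟨ *-distribʳ-+ Q R t ⟩
      R * Q + t * Q ≤⟨ +-mono-≤ (*-mono-≤ R≤ (^-monoˡ-≤ K q≤p)) (≤-trans (proj₂ (proj₂ (proj₂ (proj₂ solved)))) (+-mono-≤ (*-monoʳ-≤ (ownCost B) (^-monoˡ-≤ K q≤p)) (*-monoʳ-≤ (totalCost B) (*-mono-≤ (s≤s N≤B) (φ-greatest μ≤K))))) ⟩
      (22 + suc B * 100 + cost initT B) * P + (ownCost B * P + totalCost B * (suc B * P)) ≡⟨ e (22 + suc B * 100 + cost initT B) (ownCost B) (totalCost B) (suc B) P ⟩
      runCost B * P ∎
      where
      open ≤-Reasoning
      Q = q ^ K
      P = p ^ K
      R = 22 + suc (length φ) * 100 + cost initT B
      R≤ : R ≤ 22 + suc B * 100 + cost initT B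
      R≤ = +-monoˡ-≤ (cost initT B) (+-monoʳ-≤ 22 (*-monoˡ-≤ 100 (s≤s (≤-trans length≤ size≤B))))
      e : ∀ a o t b P → a * P + (o * P + t * (b * P)) ≡ (a + o + t * b) * P
      e = solve-∀

  record Bounded (t c K : ℕ) : Set where
    constructor bounded-by
    field bound : t * q ^ K ≤ c * p ^ K

  rescale : ∀ {t c K} g Ct V → Bounded t c K → c ≤ g → p ^ K * V ≤ Ct * q ^ K → t * V * q ^ K ≤ g * Ct * q ^ K
  rescale {t} {c} {K} g Ct V (bounded-by h) = exchange t c g (p ^ K) (q ^ K) Ct V h

  run-at : ∀ {n} (φ : CNF n) N B → N ≡ 40 + (n + #clauses≥3 φ) → B ≡ 40 + inputSize (n , φ) →
    ∃ λ t → (∃ λ out → Runs program (encodeCNF φ) out t × IsBinary out (#sat φ))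
          × Bounded t (runCost B) ((#clauses≥3 φ + suc n) * (2 * Weights.w₆ F₀))
  run-at φ N B N≡ B≡ = steps , (output , runs , binary) , bounded-by steps-bound
    where open Run φ N B N≡ B≡

  opaque
    run : ∀ {n} (φ : CNF n) →
      ∃ λ t → (∃ λ out → Runs program (encodeCNF φ) out t × IsBinary out (#sat φ))
            × Bounded t (runCost (40 + inputSize (n , φ))) ((#clauses≥3 φ + suc n) * (2 * Weights.w₆ F₀))
    run φ = run-at φ _ _ refl refl

  time : Instance → ℕ
  time (n , φ) = proj₁ (run φ)

  module _ (u v : ℕ) .{{_ : NonZero v}} (root : p ^ (2 * Weights.w₆ F₀) * v ≤ u * q ^ (2 * Weights.w₆ F₀)) (u≤2v : u ≤ 2 * v) where
    private
      C₀ = proj₁ runCost-poly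
      d₀ = proj₁ (proj₂ runCost-poly)
      e = 2 * Weights.w₆ F₀

    -- The factor 2 absorbs the auxiliary vertex, since `u ≤ 2 * v`. For an input of size `len`, the
    -- 42 comes from `41 + len ≤ 42 * len`.
    coefficient degree : ℕ
    coefficient = 2 * (C₀ * 42 ^ d₀)
    degree = d₀

    time-bound : ∀ {n} (φ : CNF n) → time (n , φ) * v ^ (n + #clauses≥3 φ) ≤ coefficient * inputSize (n , φ) ^ degree * u ^ (n + #clauses≥3 φ)
    time-bound {n} φ = *-cancelʳ-≤ (t * v ^ k) (coefficient * len ^ d₀ * u ^ k) v (begin
      t * v ^ k * v ≡⟨ r₁ t (v ^ k) v ⟩
      t * v ^ suc k ≤⟨ *-cancelʳ-≤ (t * v ^ suc k) (G′ * u ^ suc k) (q ^ K) {{m^n≢0 q K {{>-nonZero 1≤q}}}} scaled-bound ⟩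
      G′ * (u * u ^ k) ≤⟨ *-monoʳ-≤ G′ (*-monoˡ-≤ (u ^ k) u≤2v) ⟩
      G′ * (2 * v * u ^ k) ≡⟨ r₂ G′ v (u ^ k) ⟩
      2 * G′ * u ^ k * v ≡⟨ cong (λ g → g * u ^ k * v) (r₃ C₀ (42 ^ d₀) (len ^ d₀)) ⟩
      coefficient * len ^ d₀ * u ^ k * v ∎)
      where
      open ≤-Reasoning
      len = inputSize (n , φ)
      k = n + #clauses≥3 φ
      t = time (n , φ)
      K = (#clauses≥3 φ + suc n) * e
      G′ = C₀ * (42 ^ d₀ * len ^ d₀)
      K≡ : K ≡ e * suc k
      K≡ = trans (*-comm (#clauses≥3 φ + suc n) e) (cong (e *_) (r₄ (#clauses≥3 φ) n))
        where
        r₄ : ∀ m n → m + suc n ≡ suc (n + m)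
        r₄ = solve-∀
      power : ∀ b → b ^ K ≡ (b ^ e) ^ suc k
      power b = trans (cong (b ^_) K≡) (sym (^-*-assoc b e (suc k)))
      cost≤G : runCost (40 + len) ≤ G′
      cost≤G = ≤-trans (proj₂ (proj₂ runCost-poly) (40 + len)) (*-monoʳ-≤ C₀ (≤-trans (^-monoˡ-≤ d₀ (≤-trans (+-monoˡ-≤ len (*-monoʳ-≤ 41 (1≤len (encodeUnary n) (encodeClauses φ)))) (≤-reflexive (r₅ len)))) (≤-reflexive (^-distribʳ-* d₀ 42 len))))
        where
        1≤len : ∀ a b → 1 ≤ treeSize (a ∙ b)
        1≤len a b = s≤s z≤n
        r₅ : ∀ l → 41 * l + l ≡ 42 * l
        r₅ = solve-∀
      r₁ : ∀ a b c → a * b * c ≡ a * (c * b)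
      r₁ = solve-∀
      r₂ : ∀ g v u → g * (2 * v * u) ≡ 2 * g * u * v
      r₂ = solve-∀
      r₃ : ∀ a b c → 2 * (a * (b * c)) ≡ 2 * (a * b) * c
      r₃ = solve-∀
      powers : p ^ K * v ^ suc k ≤ u ^ suc k * q ^ K
      powers = begin
        p ^ K * v ^ suc k ≡⟨ cong (_* v ^ suc k) (power p) ⟩
        (p ^ e) ^ suc k * v ^ suc k ≡⟨ ^-distribʳ-* (suc k) (p ^ e) v ⟨
        (p ^ e * v) ^ suc k ≤⟨ ^-monoˡ-≤ (suc k) root ⟩
        (u * q ^ e) ^ suc k ≡⟨ ^-distribʳ-* (suc k) u (q ^ e) ⟩
        u ^ suc k * (q ^ e) ^ suc k ≡⟨ cong (u ^ suc k *_) (power q) ⟨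
        u ^ suc k * q ^ K ∎
      scaled-bound : t * v ^ suc k * q ^ K ≤ G′ * u ^ suc k * q ^ K
      scaled-bound = rescale {t} {runCost (40 + len)} {K} G′ (u ^ suc k) (v ^ suc k) (proj₂ (proj₂ (run φ))) cost≤G powers

    module _ (x y a c : ℕ) (v≤u : v ≤ u) (density-bound : u ^ (y + x) * c ^ y ≤ v ^ (y + x) * a ^ y) .{{_ : NonZero y}} where
      private
        X = y + x

      -- `density-bound` covers only the exponents `y + x` and `y`. Raising the claim to the power
      -- `y` reduces it to the power `n` of that bound; the missing exponent `D` may be filled up
      -- because `v ≤ u`.
      ratio : ∀ k n → y * k ≤ X * n → u ^ k * c ^ n ≤ v ^ k * a ^ n
      ratio k n h with u ^ k * c ^ n ≤? v ^ k * a ^ n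
      ... | yes le = le
      ... | no gt = contradiction (^-monoˡ-< y (≰⇒> gt)) (≤⇒≯ (*-cancelʳ-≤ _ _ (v ^ D) {{m^n≢0 v D}} (begin
        (u ^ k * c ^ n) ^ y * v ^ D ≤⟨ *-monoʳ-≤ ((u ^ k * c ^ n) ^ y) (^-monoˡ-≤ D v≤u) ⟩
        (u ^ k * c ^ n) ^ y * u ^ D ≡⟨ collect u c ⟩
        (u ^ X * c ^ y) ^ n ≤⟨ ^-monoˡ-≤ n density-bound ⟩
        (v ^ X * a ^ y) ^ n ≡⟨ collect v a ⟨
        (v ^ k * a ^ n) ^ y * v ^ D ∎)))
        where
        open ≤-Reasoning
        D = X * n ∸ y * k
        collect : ∀ u c → (u ^ k * c ^ n) ^ y * u ^ D ≡ (u ^ X * c ^ y) ^ n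
        collect u c = trans (cong (_* u ^ D) (trans (^-distribʳ-* y (u ^ k) (c ^ n)) (cong₂ _*_ (^-*-assoc u k y) (^-*-assoc c n y))))
          (trans (r (u ^ (k * y)) (c ^ (n * y)) (u ^ D)) (trans (cong₂ _*_ (trans (sym (^-distribˡ-+-* u (k * y) D)) (cong (u ^_) exponents)) (cong (c ^_) (*-comm n y)))
            (sym (trans (^-distribʳ-* n (u ^ X) (c ^ y)) (cong₂ _*_ (^-*-assoc u X n) (^-*-assoc c y n))))))
          where
          r : ∀ a b c → a * b * c ≡ a * c * b
          r = solve-∀
          exponents : k * y + D ≡ X * n
          exponents = trans (cong (_+ D) (*-comm k y)) (m+[n∸m]≡n h)

      -- There are no more wide clauses than clauses, so the exponent of the first bound is at most
      -- `(1 + x / y) * n`.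
      dense-bound : ∀ {n} (φ : CNF n) → #clauses φ * y < x * n → time (n , φ) * c ^ n ≤ coefficient * inputSize (n , φ) ^ degree * a ^ n
      dense-bound {n} φ h = *-cancelʳ-≤ _ _ (v ^ k) {{m^n≢0 v k}} (begin
        t * c ^ n * v ^ k ≡⟨ r t (c ^ n) (v ^ k) ⟩
        t * v ^ k * c ^ n ≤⟨ *-monoˡ-≤ (c ^ n) (time-bound φ) ⟩
        G′ * u ^ k * c ^ n ≡⟨ *-assoc G′ (u ^ k) (c ^ n) ⟩
        G′ * (u ^ k * c ^ n) ≤⟨ *-monoʳ-≤ G′ (ratio k n few) ⟩
        G′ * (v ^ k * a ^ n) ≡⟨ r′ G′ (v ^ k) (a ^ n) ⟩
        G′ * a ^ n * v ^ k ∎)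
        where
        open ≤-Reasoning
        k = n + #clauses≥3 φ
        t = time (n , φ)
        G′ = coefficient * inputSize (n , φ) ^ degree
        r : ∀ a b c → a * b * c ≡ a * c * b
        r = solve-∀
        r′ : ∀ a b c → a * (b * c) ≡ a * c * b
        r′ = solve-∀
        few : y * k ≤ X * n
        few = begin
          y * (n + #clauses≥3 φ) ≡⟨ *-distribˡ-+ y n (#clauses≥3 φ) ⟩
          y * n + y * #clauses≥3 φ ≤⟨ +-monoʳ-≤ (y * n) (*-monoʳ-≤ y (wide≤length φ)) ⟩
          y * n + y * #clauses φ ≡⟨ cong (y * n +_) (*-comm y (#clauses φ)) ⟩
          y * n + #clauses φ * y ≤⟨ +-monoʳ-≤ (y * n) (<⇒≤ h) ⟩
          y * n + x * n ≡⟨ *-distribʳ-+ n y x ⟨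
          (y + x) * n ∎

-- Instantiation of the constants

opaque
  -- Bounds for `2 * w₆` and for `σ` over the ten functionals, and for the thresholds together with
  -- `2 * unit`.
  capacity₁ capacity₂ capacity₃ : ℕ
  capacity₁ = 20000
  capacity₂ = 2000
  capacity₃ = 60000

small? : ℕ → ℕ → List Weights → Bool
small? K₁ K₂ [] = true
small? K₁ K₂ (F ∷ Fs) = (increasing? F ∧ (Weights.σ F ≤ᵇ K₂) ∧ (2 * Weights.w₆ F ≤ᵇ K₁)) ∧ small? K₁ K₂ Fs

small?-sound : ∀ K₁ K₂ Fs → small? K₁ K₂ Fs ≡ true → All (Small K₁ K₂) Fs
small?-sound K₁ K₂ [] _ = []
small?-sound K₁ K₂ (F ∷ Fs) h =
  let (h₁ , h₂) = ∧⁻ {increasing? F ∧ (Weights.σ F ≤ᵇ K₂) ∧ (2 * Weights.w₆ F ≤ᵇ K₁)} h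
      (h₃ , h₄) = ∧⁻ {increasing? F} h₁
      (h₅ , h₆) = ∧⁻ {Weights.σ F ≤ᵇ K₂} h₄
  in record { inc = increasing F h₃ ; σ≤ = ≤ᵇ-true (Weights.σ F) K₂ h₅ ; w≤ = ≤ᵇ-true (2 * Weights.w₆ F) K₁ h₆ } ∷ small?-sound K₁ K₂ Fs h₂

bounded? : ℕ → List (ℕ × ℕ) → Bool
bounded? K [] = true
bounded? K ((x , y) ∷ ts) = ((x ≤ᵇ K) ∧ (y ≤ᵇ K)) ∧ bounded? K ts

bounded?-sound : ∀ K ts → bounded? K ts ≡ true → All (λ (x , y) → x ≤ K × y ≤ K) ts
bounded?-sound K [] _ = []
bounded?-sound K ((x , y) ∷ ts) h =
  let (h₁ , h₂) = ∧⁻ {(x ≤ᵇ K) ∧ (y ≤ᵇ K)} h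
      (h₃ , h₄) = ∧⁻ {x ≤ᵇ K} h₁
  in (≤ᵇ-true x K h₃ , ≤ᵇ-true y K h₄) ∷ bounded?-sound K ts h₂

-- A quadratic polynomial at most doubles from one argument to the next.
quadratic<2^ : ∀ a b c {N₀ N} → 3 ≤ N₀ → N₀ * (a + b * N₀) + c < 2 ^ N₀ → N₀ ≤ N → N * (a + b * N) + c < 2 ^ N
quadratic<2^ a b c {N₀} 3≤N₀ base N₀≤N = go (≤⇒≤′ N₀≤N)
  where
  f : ℕ → ℕ
  f N = N * (a + b * N) + c
  doubles : ∀ N → 3 ≤ N → f (suc N) ≤ 2 * f N
  doubles (suc (suc (suc k))) _ = m+n≤o⇒m≤o (f (4 + k)) (≤-reflexive (r a b c k))
    where
    r : ∀ a b c k → (4 + k) * (a + b * (4 + k)) + c + ((2 + k) * a + b * (k * k + 4 * k + 2) + c) ≡ 2 * ((3 + k) * (a + b * (3 + k)) + c)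
    r = solve-∀
  doubles (suc (suc zero)) (s≤s (s≤s ()))
  doubles (suc zero) (s≤s ())
  go : ∀ {N} → N₀ ≤′ N → f N < 2 ^ N
  go ≤′-refl = base
  go {suc N} (≤′-step le) = ≤-<-trans (doubles N (≤-trans 3≤N₀ (≤′⇒≤ le))) (*-monoʳ-< 2 (go le))

opaque
  unfolding capacity₁

  capacity-large : 40 * (capacity₁ + capacity₂ * 40) + capacity₃ < 2 ^ 40
  -- The successor of 40 * (20000 + 2000 * 40) + 60000, and 2 to the power 40.
  capacity-large = ≤ᵇ-true 4060001 1099511627776 refl

  all-small : small? capacity₁ capacity₂ all-weights ≡ true
  all-small = refl

  thresholds-bounded : bounded? capacity₃ thresholds ≡ true
  thresholds-bounded = refl

  unit-bounded : (2 * unit ≤ᵇ capacity₃) ≡ true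
  unit-bounded = refl

  1≤capacity₁ : (1 ≤ᵇ capacity₁) ≡ true
  1≤capacity₁ = refl

  7≤capacity₃ : (7 ≤ᵇ capacity₃) ≡ true
  7≤capacity₃ = refl

module Algorithm = Correctness f₁ (f₂ ∷ f₃ ∷ f₄ ∷ f₅ ∷ f₆ ∷ p₀ ∷ p₁ ∷ p₂ ∷ p₃ ∷ []) thresholds unit
  capacity₁ capacity₂ capacity₃ (≤ᵇ-true 1 capacity₁ 1≤capacity₁) (≤ᵇ-true 7 capacity₃ 7≤capacity₃)
  (λ N → quadratic<2^ capacity₁ capacity₂ capacity₃ {40} {N} (m≤m+n 3 37) capacity-large)
  (small?-sound capacity₁ capacity₂ all-weights all-small) (bounded?-sound capacity₃ thresholds thresholds-bounded) (≤ᵇ-true (2 * unit) capacity₃ unit-bounded)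
  (λ g red v 1≤ → progress g red v 1≤)
  base-num base-den 1≤den den≤num base-splits base-half base-quarter

rate-root : base-num ^ (2 * Weights.w₆ f₁) * 10000 ≤ 12377 * base-den ^ (2 * Weights.w₆ f₁)
rate-root = subst₂ (λ a b → a * 10000 ≤ 12377 * b) (pow-^ base-num 6152) (pow-^ base-den 6152) (≤ᵇ-true (pow base-num 6152 * 10000) (12377 * pow base-den 6152) base-root)

open Algorithm using (program; time; run)
open Algorithm using (coefficient; degree; time-bound; dense-bound)

rate≤2 : 12377 ≤ 2 * 10000
rate≤2 = ≤ᵇ-true 12377 20000 refl

theorem1 : Σ[ p ∈ Program ] Σ[ T ∈ (Instance → ℕ) ]
    ( Computes#SATInTime p T
    × O*-on U T (λ (n , φ) → (ℤ.+ 12377 ℚ./ 10000) ℚExp.^ (n + #clauses≥3 φ))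
    × Σ[ c ∈ ℚ ] ( c ℚ.< ℤ.+ 2 ℚ./ 1
    × O*-on (DensityBelow (ℤ.+ 22503 ℚ./ 10000)) T (λ (n , φ) → c ℚExp.^ n) ) )
theorem1 = program , time , (λ φ → proj₁ (proj₂ (run φ)))
  , (C , d , λ (n , φ) _ → power-bound 12377 10000 (n + #clauses≥3 φ) (time (n , φ)) (C * inputSize (n , φ) ^ d) (time-bound 12377 10000 rate-root rate≤2 φ))
  -- This base is what `density-root` allows for the density bound 2.2503.
  , (1999995 ÷ 1000000) , ÷-< 1999995 1000000 2 1 (≤ᵇ-true 1999996 2000000 refl)
  , (C , d , λ (n , φ) (n≢0 , sparse) → power-bound 1999995 1000000 n (time (n , φ)) (C * inputSize (n , φ) ^ d)
      (dense-bound 12377 10000 rate-root rate≤2 22503 10000 1999995 1000000 (≤ᵇ-true 10000 12377 refl) (pow-product-≤ 12377 10000 1999995 1000000 (10000 + 22503) 10000 density-root) φ (÷-<⁻ (#clauses φ) n 22503 10000 {{n≢0}} sparse)))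
  where
  C = coefficient 12377 10000 rate-root rate≤2
  d = degree 12377 10000 rate-root rate≤2
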